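{- Let $\lambda\ge 0$, $\eta$ and $\alpha_1,\dots,\alpha_\lambda$ be integers with $0<\alpha_1<\cdots<\alpha_\lambda<\eta$ and $\alpha_i=\eta-\alpha_{\lambda+1-i}$ for $1\le i\le\lambda$, and let $k,r$ be integers with $k\ge r\ge\lambda\ge0$ and $k-1>\lambda$. Then for every $n\ge0$, \[ \overline{A}_0(\alpha_1,\ldots,\alpha_\lambda;\eta,k,r;n)=\overline{B}_0(\alpha_1,\ldots,\alpha_\lambda;\eta,k,r;n). \]
   Context: Overpartitions: an overpartition of $n$ is a partition of $n$ in which the first occurrence of a part size may be overlined. Parts are totally ordered by $1<\bar1<2<\bar2<3<\cdots$; an overpartition is written $\pi=(\pi_1,\dots,\pi_s)$ with $\pi_1\ge\cdots\ge\pi_s$ in this order, and all inequalities between parts (and expressions $x\pm\eta$) are taken in this order, where $x\pm\eta$ denotes the part of size $|x|\pm\eta$ which is overlined iff $x$ is. $[x/\eta]=\lfloor|x|/\eta\rfloor$. $\overline{V}_\pi(N)$ is the number of overlined parts of $\pi$ that are $\le N$. $\overline{B}_0(\alpha_1,\ldots,\alpha_\lambda;\eta,k,r;n)$ is the number of overpartitions $\pi=(\pi_1,\dots,\pi_s)$ of $n$ such that: (1) every part has size $\equiv 0,\alpha_1,\ldots,\alpha_\lambda\pmod\eta$; (2) only parts whose size is a multiple of $\eta$ may be non-overlined; (3) $\pi_i\ge\pi_{i+k-1}+\eta$ whenever $i+k-1\le s$, with strict inequality if $\pi_i$ is non-overlined; (4) at most $r-1$ of the parts satisfy $\pi_i\le\eta$;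 (5) whenever $i+k-2\le s$ and $\pi_i\le\pi_{i+k-2}+\eta$ with strict inequality if $\pi_i$ is overlined, then $[\pi_i/\eta]+\cdots+[\pi_{i+k-2}/\eta]\equiv r-1+\overline{V}_\pi(\pi_i)\pmod{2}$. $\overline{A}_0(\alpha_1,\ldots,\alpha_\lambda;\eta,k,r;n)$ is the number of overpartitions of $n$ all of whose parts have size $\equiv0,\alpha_1,\ldots,\alpha_\lambda\pmod\eta$ and such that: if $\lambda$ is even, only multiples of $\eta$ may be non-overlined and no non-overlined part is $\equiv 0,\pm\eta(r-\lambda/2)\pmod{\eta(2k-\lambda-1)}$; if $\lambda$ is odd (so $\eta$ is even), only multiples of $\eta/2$ may be non-overlined, no non-overlined part is $\equiv\eta\pmod{2\eta}$, no non-overlined part is $\equiv0,\pm\eta(2r-\lambda)/2\pmod{\eta(2k-\lambda-1)}$, and no overlined part is $\equiv\eta/2\pmod\eta$.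
   Formalization: The formal theorem assumes η ≥ 1 and r ≥ 1; the latter only excludes λ = r = 0, where the claim fails as written (at n = 0 the first count is 1, while "at most r−1 = −1 parts" makes the second count 0). -}

module Defs where

open import Data.Nat.Base
open import Data.Bool.Base using (Bool; true; false; _∧_; _∨_; not; if_then_else_)
open import Data.List.Base using (List; []; _∷_; map; length; filterᵇ; concatMap; upTo; take; drop; tabulate)
open import Data.Bool.ListAction using (all; any)
open import Data.Nat.ListAction using (sum)
open import Data.Fin.Base using (Fin)
open import Data.Product.Base using (_×_; _,_; proj₁; proj₂)

-- Arithmetic helpers: modulus / quotient with an arbitrary (possibly
-- zero) divisor.  Under the hypotheses of the theorem every divisor used
-- below is nonzero, so the zero clause is never relevant.

_mod_ : ℕ → ℕ → ℕ
n mod zero  = n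
n mod suc m = n % suc m

_div_ : ℕ → ℕ → ℕ
n div zero  = zero
n div suc m = n / suc m

-- Parts of overpartitions: (size , overlined?)

Part : Set
Part = ℕ × Bool

size : Part → ℕ
size = proj₁

ov : Part → Bool
ov = proj₂

-- The total order 1 < 1̄ < 2 < 2̄ < ... is realised by the key
-- 2·|x| + [x overlined];  x ≤ y  iff  key x ≤ key y.
-- Note key (x ± η) = key x ± 2η.
key : Part → ℕ
key p = 2 * size p + (if ov p then 1 else 0)

nonincreasing : List Part → Bool
nonincreasing (p ∷ q ∷ ps) = (key q ≤ᵇ key p) ∧ nonincreasing (q ∷ ps)
nonincreasing _            = true

-- each part size is overlined at most once (only its first occurrence)
overlinesDistinct : List Part → Bool
overlinesDistinct (p ∷ q ∷ ps) = (not (ov q) ∨ (key q <ᵇ key p)) ∧ overlinesDistinct (q ∷ ps)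
overlinesDistinct _            = true

IsOverpartitionOf : ℕ → List Part → Bool
IsOverpartitionOf n π =
  all (λ p → 1 ≤ᵇ size p) π ∧ nonincreasing π ∧ overlinesDistinct π
  ∧ (sum (map size π) ≡ᵇ n)

-- A finite, duplicate-free superset of the overpartitions of n:
-- all lists of length ≤ n of parts of size 1..n.

alphabet : ℕ → List Part
alphabet n = concatMap (λ m → (suc m , false) ∷ (suc m , true) ∷ []) (upTo n)

listsOfLength : ℕ → List Part → List (List Part)
listsOfLength zero    as = [] ∷ []
listsOfLength (suc L) as = concatMap (λ a → map (a ∷_) (listsOfLength L as)) as

candidates : ℕ → List (List Part)
candidates n = concatMap (λ L → listsOfLength L (alphabet n)) (upTo (suc n))

countOverpartitions : (List Part → Bool) → ℕ → ℕ
countOverpartitions P n =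
  length (filterᵇ (λ π → IsOverpartitionOf n π ∧ P π) (candidates n))

windows : ℕ → List Part → List (List Part)
windows m π = filterᵇ (λ w → length w ≡ᵇ m) (map (λ i → take m (drop i π)) (upTo (length π)))

lastOr : Part → List Part → Part
lastOr a []       = a
lastOr _ (b ∷ bs) = lastOr b bs

Vbar : List Part → Part → ℕ
Vbar π N = length (filterᵇ (λ p → ov p ∧ (key p ≤ᵇ key N)) π)

-- Parameters: lam (= λ), η, α : Fin lam → ℕ  (α i = α_{i+1}), k, r.

residueOK : (lam η : ℕ) → (Fin lam → ℕ) → Part → Bool
residueOK lam η α p =
  (size p mod η ≡ᵇ 0) ∨ any (λ a → size p mod η ≡ᵇ a mod η) (tabulate α)

B-cond3 : (η : ℕ) → List Part → Bool
B-cond3 η []      = true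
B-cond3 η (a ∷ w) =
  if ov a then key (lastOr a w) + 2 * η ≤ᵇ key a
          else key (lastOr a w) + 2 * η <ᵇ key a

B-cond5 : (η r : ℕ) → List Part → List Part → Bool
B-cond5 η r π []      = true
B-cond5 η r π (a ∷ w) =
  not (if ov a then key a <ᵇ key (lastOr a w) + 2 * η
               else key a ≤ᵇ key (lastOr a w) + 2 * η)
  ∨ ((sum (map (λ p → size p div η) (a ∷ w)) mod 2) ≡ᵇ ((r ∸ 1 + Vbar π a) mod 2))

B-prop : (lam η : ℕ) → (Fin lam → ℕ) → (k r : ℕ) → List Part → Bool
B-prop lam η α k r π =
  all (residueOK lam η α) π
  ∧ all (λ p → ov p ∨ (size p mod η ≡ᵇ 0)) π
  ∧ all (B-cond3 η) (windows k π)
  ∧ (length (filterᵇ (λ p → key p ≤ᵇ key (η , false)) π) <ᵇ r)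
  ∧ all (B-cond5 η r π) (windows (k ∸ 1) π)

B̄₀ : (lam η : ℕ) → (Fin lam → ℕ) → (k r n : ℕ) → ℕ
B̄₀ lam η α k r n = countOverpartitions (B-prop lam η α k r) n

forbidden : (M x t : ℕ) → Bool
forbidden M x t = (x mod M ≡ᵇ 0) ∨ (x mod M ≡ᵇ t mod M) ∨ ((x + t) mod M ≡ᵇ 0)

A-part : (lam η : ℕ) → (Fin lam → ℕ) → (k r : ℕ) → Part → Bool
A-part lam η α k r p =
  residueOK lam η α p ∧
  (if lam mod 2 ≡ᵇ 0
   then (ov p ∨ ((size p mod η ≡ᵇ 0) ∧ not (forbidden M (size p) (η * (r ∸ (lam div 2))))))
   else ((ov p ∨ ((size p mod (η div 2) ≡ᵇ 0)
                  ∧ not (size p mod (2 * η) ≡ᵇ η)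
                  ∧ not (forbidden M (size p) ((η * (2 * r ∸ lam)) div 2))))
         ∧ (not (ov p) ∨ not (size p mod η ≡ᵇ η div 2))))
  where
  M : ℕ
  M = η * (2 * k ∸ lam ∸ 1)

Ā₀ : (lam η : ℕ) → (Fin lam → ℕ) → (k r n : ℕ) → ℕ
Ā₀ lam η α k r n = countOverpartitions (λ π → all (A-part lam η α k r) π) n

{-# OPTIONS --safe #-}
module Submission where

-- Read an overpartition counted by B̄₀ from its smallest part upwards: "columns"
-- of overlined parts (one per period of length η, at most one part in each of the
-- lam + 1 residue classes) alternate with the multiplicities f of the multiples
-- of η.  Conditions (3), (4) and (5) then only involve the previous column and a
-- slack c: partial sums of the new column exceed those of the old one by at most
-- c, then f ≤ c, and the next slack is k − 1 − |column| − f, minus 1 if c − f is odd.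
--
-- The generating function of what follows a given column has a closed form: it
-- is the sum over the admissible next columns e of b^e G(c′), c′ being the slack
-- left over, where G is an explicit alternating sum of exponentials in c′ such that
-- G(−1 − i) = − x^i G(−1 + i) for a monomial x.  Dropping admissibility turns the
-- recursion into an identity between exponentials.  The error made in doing so is
-- a sum over pairs of consecutive columns whose partial sums cross; behind the
-- crossing both columns are free, and exchanging their remainders changes the
-- sign of the term, by the antisymmetry of G.  Hence the error vanishes.
--
-- For the first column the symmetry α_i = η − α_{lam+1−i} makes the coefficients
-- of G constant up to sign and a power of q, and the triple product identity
-- gives the product on the side of Ā₀.  All identities are proved modulo a high
-- power of q, after multiplication by (q^η; q^η)_L.

-- The inequality between partial sums is condition (3): the window of an overlined part of residue
-- j in period m holds the parts of residue at most j of that period, the f copies of m η, and the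
-- parts of residue above j of the period before. The unit of slack lost when c - f is odd is
-- condition (5). Modulo 2 every free place of a window counts alike: an overlined part of period m
-- adds m to the floors and 1 to the number of overlined parts, a part (m + 1) η adds m + 1 to the
-- floors. Whether a window of k - 1 parts is allowed is thus known before it is filled. Condition
-- (4) becomes the same statement by means of virtual parts 0.
--
-- The restriction on partial sums is the obstacle: for unrestricted columns the sums factor. The
-- error term of a single pair of columns does not vanish; it cancels only after summing over the
-- earlier column of the pair, which is itself restricted by the column before it. The hypothesis
-- lam < k - 1 makes that older restriction void behind a crossing, so that the two remainders can
-- be exchanged.

open import Defs
open import Algebra.Bundles using (CommutativeRing)
open import Algebra.Structures using (IsCommutativeRing)
open import Data.Bool.Base using (Bool; true; false; _∧_; _∨_; not; if_then_else_; T)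
open import Data.Bool.ListAction using (all; any)
open import Data.Bool.Properties using (T?; T-∧; T-∨; T-≡; ∧-identityʳ)
open import Data.Fin.Base using (Fin; opposite; fromℕ<) renaming (_<_ to _<ᶠ_)
import Data.Fin.Properties as Finₚ
open import Data.Integer.Base as ℤ using (ℤ; +_; -[1+_]; 0ℤ; 1ℤ)
import Data.Integer.Properties as ℤₚ
import Data.Integer.Tactic.RingSolver as ℤ-Solver
open import Data.List.Base using (List; []; _∷_; _++_; map; length; concatMap; upTo; applyUpTo; filterᵇ; replicate; take; drop; tabulate)
open import Data.List.Membership.Propositional using (_∈_; find; lose)
open import Data.List.Membership.Propositional.Properties using (∈-map⁺; ∈-map⁻; ∈-++⁺ˡ; ∈-++⁺ʳ; ∈-concatMap⁺; ∈-concatMap⁻; ∈-upTo⁺; ∈-upTo⁻; ∈-filter⁺; ∈-filter⁻; ∈-tabulate⁺; ∈-tabulate⁻)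
open import Data.List.Membership.Propositional.Properties.WithK using (unique∧set⇒bag)
import Data.List.Properties as Listₚ
open import Data.List.Relation.Binary.BagAndSetEquality using (∼bag⇒↭)
open import Data.List.Relation.Binary.Permutation.Propositional using (_↭_)
open import Data.List.Relation.Binary.Permutation.Propositional.Properties using (↭-length)
open import Data.List.Relation.Binary.Pointwise as Pointwise using (Pointwise; []; _∷_)
open import Data.List.Relation.Unary.All as All using (All; []; _∷_)
import Data.List.Relation.Unary.All.Properties as Allₚ
open import Data.List.Relation.Unary.AllPairs as AllPairs using (AllPairs; []; _∷_)
import Data.List.Relation.Unary.AllPairs.Properties as AllPairsₚ
open import Data.List.Relation.Unary.Any using (here; there)
open import Data.List.Relation.Unary.Any.Properties using (any⁺; any⁻; tabulate⁺; tabulate⁻)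
open import Data.List.Relation.Unary.Linked using (Linked; []; [-]; _∷_)
import Data.List.Relation.Unary.Linked.Properties as Linkedₚ
open import Data.List.Relation.Unary.Unique.Propositional using (Unique)
import Data.List.Relation.Unary.Unique.Propositional.Properties as Uniqueₚ
open import Data.Maybe.Base using (Maybe; just; nothing)
open import Data.Nat.Base using (ℕ; zero; suc; _+_; _*_; _∸_; _≤_; _<_; z≤n; s≤s; _≡ᵇ_; _≤ᵇ_; _<ᵇ_)
import Data.Nat.DivMod as DM
open import Data.Nat.ListAction using (sum)
open import Data.Nat.ListAction.Properties using (sum-++; sum-↭)
import Data.Nat.Properties as ℕₚ
import Data.Nat.Tactic.RingSolver as ℕ-Solver
open import Data.Product.Base using (_×_; _,_; proj₁; proj₂; ∃; ∃₂)
open import Data.Sum.Base using (_⊎_; inj₁; inj₂)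
open import Data.Unit.Base using (tt)
open import Function.Base using (_∘_)
open import Function.Bundles using (mk⇔; Equivalence)
open import Level using (0ℓ)
open import Relation.Binary.Definitions using (tri<; tri≈; tri>)
open import Relation.Binary.PropositionalEquality using (_≡_; _≢_; refl; cong; cong₂; sym; trans; subst; subst₂)
open import Relation.Nullary using (Dec; yes; no; ¬_; contradiction)
import Tactic.RingSolver as Solver
open import Tactic.RingSolver.Core.AlmostCommutativeRing using (AlmostCommutativeRing; fromCommutativeRing)

-- The ring of Laurent polynomials

Series : Set
Series = ℤ → ℤ

infixl 6 _⊕_
infixl 7 _⊗_
infix 8 ⊖_
infix 4 _≈_

-- Laurent polynomials in q, as formal expressions; two of them are identified
-- when they act in the same way on all two-sided sequences (shift j moves it by j places).
data Laurent : Set where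
  con     : ℤ → Laurent
  shift   : ℤ → Laurent
  add mul : Laurent → Laurent → Laurent
  neg     : Laurent → Laurent

-- Constants are combined eagerly, which lets the ring solver compare coefficients.
_⊕_ : Laurent → Laurent → Laurent
con a ⊕ con b = con (a ℤ.+ b)
con a ⊕ r     = add (con a) r
p     ⊕ r     = add p r

_⊗_ : Laurent → Laurent → Laurent
con a ⊗ con b = con (a ℤ.* b)
con a ⊗ r     = mul (con a) r
p     ⊗ r     = mul p r

⊖_ : Laurent → Laurent
⊖ con a = con (ℤ.- a)
⊖ p     = neg p

𝟎 𝟏 : Laurent
𝟎 = con 0ℤ
𝟏 = con 1ℤ

act : Laurent → Series → Series
act (con a)   f n = a ℤ.* f n
act (shift j)   f n = f (n ℤ.- j)
act (add p r) f n = act p f n ℤ.+ act r f n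
act (mul p r) f n = act p (act r f) n
act (neg p)   f n = ℤ.- act p f n

record _≈_ (p r : Laurent) : Set where
  constructor mk≈
  field at : ∀ f n → act p f n ≡ act r f n
open _≈_

act-cong : ∀ p {f g : Series} → (∀ n → f n ≡ g n) → ∀ n → act p f n ≡ act p g n
act-cong (con a)   e n = cong (a ℤ.*_) (e n)
act-cong (shift j)   e n = e _
act-cong (add p r) e n = cong₂ ℤ._+_ (act-cong p e n) (act-cong r e n)
act-cong (mul p r) e n = act-cong p (act-cong r e) n
act-cong (neg p)   e n = cong ℤ.-_ (act-cong p e n)

act-+ : ∀ p f g n → act p (λ i → f i ℤ.+ g i) n ≡ act p f n ℤ.+ act p g n
act-+ (con a)   f g n = ℤₚ.*-distribˡ-+ a (f n) (g n)
act-+ (shift j)   f g n = refl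
act-+ (add p r) f g n rewrite act-+ p f g n | act-+ r f g n =
  interchange (act p f n) (act p g n) (act r f n) (act r g n)
  where
  interchange : ∀ a b c d → (a ℤ.+ b) ℤ.+ (c ℤ.+ d) ≡ (a ℤ.+ c) ℤ.+ (b ℤ.+ d)
  interchange = ℤ-Solver.solve-∀
act-+ (mul p r) f g n = trans (act-cong p (act-+ r f g) n) (act-+ p (act r f) (act r g) n)
act-+ (neg p)   f g n rewrite act-+ p f g n = ℤₚ.neg-distrib-+ (act p f n) (act p g n)

act-scale : ∀ p a f n → act p (λ i → a ℤ.* f i) n ≡ a ℤ.* act p f n
act-scale (con b)   a f n = swap b a (f n)
  where
  swap : ∀ a b c → a ℤ.* (b ℤ.* c) ≡ b ℤ.* (a ℤ.* c)
  swap = ℤ-Solver.solve-∀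
act-scale (shift j)   a f n = refl
act-scale (add p r) a f n rewrite act-scale p a f n | act-scale r a f n =
  sym (ℤₚ.*-distribˡ-+ a (act p f n) (act r f n))
act-scale (mul p r) a f n = trans (act-cong p (act-scale r a f) n) (act-scale p a (act r f) n)
act-scale (neg p)   a f n rewrite act-scale p a f n = ℤₚ.neg-distribʳ-* a (act p f n)

act-neg : ∀ p f n → act p (λ i → ℤ.- f i) n ≡ ℤ.- act p f n
act-neg (con a)   f n = sym (ℤₚ.neg-distribʳ-* a (f n))
act-neg (shift j)   f n = refl
act-neg (add p r) f n rewrite act-neg p f n | act-neg r f n = sym (ℤₚ.neg-distrib-+ (act p f n) (act r f n))
act-neg (mul p r) f n = trans (act-cong p (act-neg r f) n) (act-neg p (act r f) n)
act-neg (neg p)   f n = cong ℤ.-_ (act-neg p f n)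

act-shift : ∀ p j f n → act p (λ i → f (i ℤ.- j)) n ≡ act p f (n ℤ.- j)
act-shift (con a)   j f n = refl
act-shift (shift i)   j f n = cong f (swap n i j)
  where
  swap : ∀ n i j → n ℤ.- i ℤ.- j ≡ n ℤ.- j ℤ.- i
  swap = ℤ-Solver.solve-∀
act-shift (add p r) j f n = cong₂ ℤ._+_ (act-shift p j f n) (act-shift r j f n)
act-shift (mul p r) j f n = trans (act-cong p (act-shift r j f) n) (act-shift p j (act r f) n)
act-shift (neg p)   j f n = cong ℤ.-_ (act-shift p j f n)

-- Multiplication is composition of operators, so commutativity needs an argument: operators are
-- built from scalars, shifts, sums and composites, and each of these commutes with any `act r` by
-- the lemmas above.
act-comm : ∀ p r f n → act p (act r f) n ≡ act r (act p f) n
act-comm (con a)   r f n = sym (act-scale r a f n)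
act-comm (shift j)   r f n = sym (act-shift r j f n)
act-comm (add p s) r f n = trans (cong₂ ℤ._+_ (act-comm p r f n) (act-comm s r f n))
                                 (sym (act-+ r (act p f) (act s f) n))
act-comm (mul p s) r f n = trans (act-cong p (act-comm s r f) n) (act-comm p r (act s f) n)
act-comm (neg p)   r f n = trans (cong ℤ.-_ (act-comm p r f n)) (sym (act-neg r (act p f) n))

act-⊕ : ∀ p r f n → act (p ⊕ r) f n ≡ act p f n ℤ.+ act r f n
act-⊕ (con a)   (con b)   f n = ℤₚ.*-distribʳ-+ (f n) a b
act-⊕ (con a)   (shift j)   f n = refl
act-⊕ (con a)   (add r s) f n = refl
act-⊕ (con a)   (mul r s) f n = refl
act-⊕ (con a)   (neg r)   f n = refl
act-⊕ (shift j)   r         f n = refl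
act-⊕ (add p s) r         f n = refl
act-⊕ (mul p s) r         f n = refl
act-⊕ (neg p)   r         f n = refl

act-⊗ : ∀ p r f n → act (p ⊗ r) f n ≡ act p (act r f) n
act-⊗ (con a)   (con b)   f n = ℤₚ.*-assoc a b (f n)
act-⊗ (con a)   (shift j)   f n = refl
act-⊗ (con a)   (add r s) f n = refl
act-⊗ (con a)   (mul r s) f n = refl
act-⊗ (con a)   (neg r)   f n = refl
act-⊗ (shift j)   r         f n = refl
act-⊗ (add p s) r         f n = refl
act-⊗ (mul p s) r         f n = refl
act-⊗ (neg p)   r         f n = refl

act-⊖ : ∀ p f n → act (⊖ p) f n ≡ ℤ.- act p f n
act-⊖ (con a)   f n = sym (ℤₚ.neg-distribˡ-* a (f n))
act-⊖ (shift j)   f n = refl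
act-⊖ (add p s) f n = refl
act-⊖ (mul p s) f n = refl
act-⊖ (neg p)   f n = refl

private
  module L {p r s t : Laurent} {f : Series} {n : ℤ} where
    ⊕-cong′ : p ≈ s → r ≈ t → act (p ⊕ r) f n ≡ act (s ⊕ t) f n
    ⊕-cong′ e e′ = trans (act-⊕ p r f n) (trans (cong₂ ℤ._+_ (at e f n) (at e′ f n)) (sym (act-⊕ s t f n)))

    ⊕-assoc′ : act ((p ⊕ r) ⊕ s) f n ≡ act (p ⊕ (r ⊕ s)) f n
    ⊕-assoc′ rewrite act-⊕ (p ⊕ r) s f n | act-⊕ p r f n | act-⊕ p (r ⊕ s) f n | act-⊕ r s f n =
      ℤₚ.+-assoc (act p f n) (act r f n) (act s f n)

    ⊗-cong′ : p ≈ s → r ≈ t → act (p ⊗ r) f n ≡ act (s ⊗ t) f n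
    ⊗-cong′ e e′ = trans (act-⊗ p r f n)
      (trans (trans (act-cong p (at e′ f) n) (at e (act t f) n)) (sym (act-⊗ s t f n)))

    ⊗-assoc′ : act ((p ⊗ r) ⊗ s) f n ≡ act (p ⊗ (r ⊗ s)) f n
    ⊗-assoc′ = trans (act-⊗ (p ⊗ r) s f n) (trans (act-⊗ p r (act s f) n)
      (sym (trans (act-⊗ p (r ⊗ s) f n) (act-cong p (act-⊗ r s f) n))))

    distribˡ′ : act (p ⊗ (r ⊕ s)) f n ≡ act (p ⊗ r ⊕ p ⊗ s) f n
    distribˡ′ = trans (act-⊗ p (r ⊕ s) f n) (trans (act-cong p (act-⊕ r s f) n)
      (trans (act-+ p (act r f) (act s f) n)
        (sym (trans (act-⊕ (p ⊗ r) (p ⊗ s) f n) (cong₂ ℤ._+_ (act-⊗ p r f n) (act-⊗ p s f n))))))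

    distribʳ′ : act ((r ⊕ s) ⊗ p) f n ≡ act (r ⊗ p ⊕ s ⊗ p) f n
    distribʳ′ = trans (act-⊗ (r ⊕ s) p f n) (trans (act-⊕ r s (act p f) n)
        (sym (trans (act-⊕ (r ⊗ p) (s ⊗ p) f n) (cong₂ ℤ._+_ (act-⊗ r p f n) (act-⊗ s p f n)))))

laurentIsCommutativeRing : IsCommutativeRing _≈_ _⊕_ _⊗_ ⊖_ 𝟎 𝟏
laurentIsCommutativeRing = record
  { isRing = record
    { +-isAbelianGroup = record
      { isGroup = record
        { isMonoid = record
          { isSemigroup = record
            { isMagma = record
              { isEquivalence = record
                { refl  = mk≈ λ f n → refl
                ; sym   = λ e → mk≈ λ f n → sym (at e f n)
                ; trans = λ e e′ → mk≈ λ f n → trans (at e f n) (at e′ f n) }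
              ; ∙-cong = λ {p} {s} {r} {t} e e′ → mk≈ λ f n → L.⊕-cong′ {p} {r} {s} {t} e e′ }
            ; assoc = λ p r s → mk≈ λ f n → L.⊕-assoc′ {p} {r} {s} {𝟎} {f} {n} }
          ; identity = (λ p → mk≈ λ f n → trans (act-⊕ 𝟎 p f n) (ℤₚ.+-identityˡ (act p f n)))
                     , (λ p → mk≈ λ f n → trans (act-⊕ p 𝟎 f n) (ℤₚ.+-identityʳ (act p f n))) }
        ; inverse = (λ p → mk≈ λ f n → trans (act-⊕ (⊖ p) p f n)
                      (trans (cong (ℤ._+ act p f n) (act-⊖ p f n)) (ℤₚ.+-inverseˡ (act p f n))))
                  , (λ p → mk≈ λ f n → trans (act-⊕ p (⊖ p) f n)
                      (trans (cong (λ z → act p f n ℤ.+ z) (act-⊖ p f n)) (ℤₚ.+-inverseʳ (act p f n))))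
        ; ⁻¹-cong = λ {p} {r} e → mk≈ λ f n →
            trans (act-⊖ p f n) (trans (cong ℤ.-_ (at e f n)) (sym (act-⊖ r f n))) }
      ; comm = λ p r → mk≈ λ f n →
          trans (act-⊕ p r f n) (trans (ℤₚ.+-comm (act p f n) (act r f n)) (sym (act-⊕ r p f n))) }
    ; *-cong = λ {p} {s} {r} {t} e e′ → mk≈ λ f n → L.⊗-cong′ {p} {r} {s} {t} e e′
    ; *-assoc = λ p r s → mk≈ λ f n → L.⊗-assoc′ {p} {r} {s} {𝟎} {f} {n}
    ; *-identity = (λ p → mk≈ λ f n → trans (act-⊗ 𝟏 p f n) (ℤₚ.*-identityˡ (act p f n)))
                 , (λ p → mk≈ λ f n → trans (act-⊗ p 𝟏 f n) (act-cong p (λ i → ℤₚ.*-identityˡ (f i)) n))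
    ; distrib = (λ p r s → mk≈ λ f n → L.distribˡ′ {p} {r} {s} {𝟎} {f} {n})
              , (λ p r s → mk≈ λ f n → L.distribʳ′ {p} {r} {s} {𝟎} {f} {n}) }
  ; *-comm = λ p r → mk≈ λ f n →
      trans (act-⊗ p r f n) (trans (act-comm p r f n) (sym (act-⊗ r p f n))) }

laurent : CommutativeRing 0ℓ 0ℓ
laurent = record { isCommutativeRing = laurentIsCommutativeRing }

open CommutativeRing laurent public
  using () renaming
  ( refl to ≈-refl; sym to ≈-sym; trans to ≈-trans; reflexive to ≈-reflexive; setoid to laurentSetoid
  ; +-cong to ⊕-cong; *-cong to ⊗-cong; -‿cong to ⊖-cong
  ; +-identityˡ to ⊕-identityˡ; +-identityʳ to ⊕-identityʳ; *-identityˡ to ⊗-identityˡ; *-identityʳ to ⊗-identityʳ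
  ; zeroˡ to ⊗-zeroˡ; zeroʳ to ⊗-zeroʳ; *-comm to ⊗-comm; *-assoc to ⊗-assoc; +-comm to ⊕-comm; +-assoc to ⊕-assoc
  ; distribˡ to ⊗-distribˡ; -‿inverseʳ to ⊖-inverseʳ)

laurentRing : AlmostCommutativeRing 0ℓ 0ℓ
laurentRing = fromCommutativeRing laurent isZero
  where
  isZero : ∀ p → Maybe (𝟎 ≈ p)
  isZero (con (+ 0)) = just ≈-refl
  isZero _           = nothing

open import Relation.Binary.Reasoning.Setoid laurentSetoid

-- Opaque, so that a product of monomials keeps the shape in which it is written; exponents are
-- combined only through `mon-+` and `mon-0`.
abstract
  mon : ℤ → Laurent
  mon = shift

  act-mon : ∀ j f n → act (mon j) f n ≡ f (n ℤ.- j)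
  act-mon j f n = refl

mon-+ : ∀ i j → mon (i ℤ.+ j) ≈ mon i ⊗ mon j
mon-+ i j = mk≈ λ f n → trans (act-mon (i ℤ.+ j) f n) (trans (cong f (assoc n i j))
  (sym (trans (act-⊗ (mon i) (mon j) f n) (trans (act-mon i _ n) (act-mon j f _)))))
  where
  assoc : ∀ n i j → n ℤ.- (i ℤ.+ j) ≡ n ℤ.- i ℤ.- j
  assoc = ℤ-Solver.solve-∀

mon-0 : mon 0ℤ ≈ 𝟏
mon-0 = mk≈ λ f n → trans (trans (act-mon 0ℤ f n) (cong f (ℤₚ.+-identityʳ n))) (sym (ℤₚ.*-identityˡ (f n)))

mon-≡ : ∀ {i j} → i ≡ j → mon i ≈ mon j
mon-≡ refl = ≈-refl

-- The order of vanishing at q = 0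

-- Divisibility by q^j among power series, stated through the action because the expressions have no
-- normal form from which a lowest exponent could be read.
record Ord (j : ℤ) (p : Laurent) : Set where
  constructor mkOrd
  field
    vanish : ∀ i f → (∀ n → n ℤ.< i → f n ≡ 0ℤ) → ∀ n → n ℤ.< i ℤ.+ j → act p f n ≡ 0ℤ
open Ord

ord-≈ : ∀ {j p r} → p ≈ r → Ord j p → Ord j r
ord-≈ e o = mkOrd λ i f z n n< → trans (sym (at e f n)) (vanish o i f z n n<)

ord-weaken : ∀ {i j p} → i ℤ.≤ j → Ord j p → Ord i p
ord-weaken i≤j o = mkOrd λ a f z n n< → vanish o a f z n (ℤₚ.<-≤-trans n< (ℤₚ.+-monoʳ-≤ a i≤j))

ord-mon : ∀ {j} → Ord j (mon j)
ord-mon {j} = mkOrd λ i f z n n< → trans (act-mon j f n) (z _ (subst (n ℤ.- j ℤ.<_) (cancel i j) (ℤₚ.+-monoˡ-< (ℤ.- j) n<)))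
  where
  cancel : ∀ i j → i ℤ.+ j ℤ.- j ≡ i
  cancel = ℤ-Solver.solve-∀

ord-con : ∀ a → Ord 0ℤ (con a)
ord-con a = mkOrd λ i f z n n< →
  trans (cong (a ℤ.*_) (z n (subst (n ℤ.<_) (ℤₚ.+-identityʳ i) n<))) (ℤₚ.*-zeroʳ a)

ord-⊕ : ∀ {j p r} → Ord j p → Ord j r → Ord j (p ⊕ r)
ord-⊕ {p = p} {r} o o′ = mkOrd λ i f z n n< →
  trans (act-⊕ p r f n) (cong₂ ℤ._+_ (vanish o i f z n n<) (vanish o′ i f z n n<))

ord-⊖ : ∀ {j p} → Ord j p → Ord j (⊖ p)
ord-⊖ {p = p} o = mkOrd λ i f z n n< → trans (act-⊖ p f n) (cong ℤ.-_ (vanish o i f z n n<))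

ord-⊗ : ∀ {i j p r} → Ord i p → Ord j r → Ord (i ℤ.+ j) (p ⊗ r)
ord-⊗ {i} {j} {p} {r} o o′ = mkOrd λ a f z n n< → trans (act-⊗ p r f n)
  (vanish o (a ℤ.+ j) (act r f) (vanish o′ a f z) n (subst (n ℤ.<_) (rearrange a i j) n<))
  where
  rearrange : ∀ a i j → a ℤ.+ (i ℤ.+ j) ≡ a ℤ.+ j ℤ.+ i
  rearrange = ℤ-Solver.solve-∀

ord-𝟎 : ∀ {j} → Ord j 𝟎
ord-𝟎 = mkOrd λ _ _ _ _ _ → refl

ord-⊗ˡ : ∀ {j p r} → Ord j p → Ord 0ℤ r → Ord j (p ⊗ r)
ord-⊗ˡ {j} o o′ = subst (λ i → Ord i _) (ℤₚ.+-identityʳ j) (ord-⊗ o o′)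

ord-⊗ʳ : ∀ {j p r} → Ord 0ℤ p → Ord j r → Ord j (p ⊗ r)
ord-⊗ʳ {j} o o′ = subst (λ i → Ord i _) (ℤₚ.+-identityˡ j) (ord-⊗ o o′)

infix 4 _≃[_]_

record _≃[_]_ (p : Laurent) (J : ℤ) (r : Laurent) : Set where
  constructor mk≃
  field ord : Ord J (p ⊕ ⊖ r)
open _≃[_]_

≈⇒≃ : ∀ {J p r} → p ≈ r → p ≃[ J ] r
≈⇒≃ {p = p} {r} e = mk≃ (ord-≈ (≈-sym (≈-trans (⊕-cong e ≈-refl) (⊖-inverseʳ r))) ord-𝟎)

≃-refl : ∀ {J p} → p ≃[ J ] p
≃-refl = ≈⇒≃ ≈-refl

≃-sym : ∀ {J p r} → p ≃[ J ] r → r ≃[ J ] p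
≃-sym {p = p} {r} e = mk≃ (ord-≈ (lemma p r) (ord-⊖ (ord e)))
  where
  lemma : ∀ p r → ⊖ (p ⊕ ⊖ r) ≈ r ⊕ ⊖ p
  lemma = Solver.solve-∀ laurentRing

≃-trans : ∀ {J p r s} → p ≃[ J ] r → r ≃[ J ] s → p ≃[ J ] s
≃-trans {p = p} {r} {s} e e′ = mk≃ (ord-≈ (lemma p r s) (ord-⊕ (ord e) (ord e′)))
  where
  lemma : ∀ p r s → (p ⊕ ⊖ r) ⊕ (r ⊕ ⊖ s) ≈ p ⊕ ⊖ s
  lemma = Solver.solve-∀ laurentRing

≃-⊕ : ∀ {J p r s t} → p ≃[ J ] r → s ≃[ J ] t → p ⊕ s ≃[ J ] r ⊕ t
≃-⊕ {p = p} {r} {s} {t} e e′ = mk≃ (ord-≈ (lemma p r s t) (ord-⊕ (ord e) (ord e′)))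
  where
  lemma : ∀ p r s t → (p ⊕ ⊖ r) ⊕ (s ⊕ ⊖ t) ≈ p ⊕ s ⊕ ⊖ (r ⊕ t)
  lemma = Solver.solve-∀ laurentRing

≃-⊗ : ∀ {J p r s t} → Ord 0ℤ p → Ord 0ℤ t → p ≃[ J ] r → s ≃[ J ] t → p ⊗ s ≃[ J ] r ⊗ t
≃-⊗ {p = p} {r} {s} {t} o o′ e e′ =
  mk≃ (ord-≈ (lemma p r s t) (ord-⊕ (ord-⊗ˡ (ord e) o′) (ord-⊗ʳ o (ord e′))))
  where
  lemma : ∀ p r s t → (p ⊕ ⊖ r) ⊗ t ⊕ p ⊗ (s ⊕ ⊖ t) ≈ p ⊗ s ⊕ ⊖ (r ⊗ t)
  lemma = Solver.solve-∀ laurentRing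

≃-⊗ʳ : ∀ {J p s t} → Ord 0ℤ p → s ≃[ J ] t → p ⊗ s ≃[ J ] p ⊗ t
≃-⊗ʳ {p = p} {s} {t} o e = mk≃ (ord-≈ (lemma p s t) (ord-⊗ʳ o (ord e)))
  where
  lemma : ∀ p s t → p ⊗ (s ⊕ ⊖ t) ≈ p ⊗ s ⊕ ⊖ (p ⊗ t)
  lemma = Solver.solve-∀ laurentRing

≃𝟎 : ∀ {J p} → Ord J p → p ≃[ J ] 𝟎
≃𝟎 {p = p} o = mk≃ (ord-≈ (lemma p) o)
  where
  lemma : ∀ p → p ≈ p ⊕ ⊖ 𝟎
  lemma = Solver.solve-∀ laurentRing

-- Division by p = 1 + O(q) without an inverse: r = p r - (p - 1) r, where the last term has order
-- one higher than what is already known of r.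
ord-cancel : ∀ {p r} J → Ord 1ℤ (p ⊕ ⊖ 𝟏) → Ord 0ℤ r → Ord (+ J) (p ⊗ r) → Ord (+ J) r
ord-cancel zero    m o h = o
ord-cancel {p} {r} (suc J) m o h = ord-≈ (lemma p r)
  (ord-⊕ h (ord-⊖ (ord-⊗ m (ord-cancel J m o (ord-weaken (ℤ.+≤+ (ℕₚ.n≤1+n J)) h)))))
  where
  lemma : ∀ p r → p ⊗ r ⊕ ⊖ ((p ⊕ ⊖ 𝟏) ⊗ r) ≈ r
  lemma = Solver.solve-∀ laurentRing

≃-cancel : ∀ {p r s} J → Ord 1ℤ (p ⊕ ⊖ 𝟏) → Ord 0ℤ r → Ord 0ℤ s → p ⊗ r ≃[ + J ] p ⊗ s → r ≃[ + J ] s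
≃-cancel {p} {r} {s} J m o o′ h =
  mk≃ (ord-cancel J m (ord-⊕ o (ord-⊖ o′)) (ord-≈ (lemma p r s) (ord h)))
  where
  lemma : ∀ p r s → p ⊗ r ⊕ ⊖ (p ⊗ s) ≈ p ⊗ (r ⊕ ⊖ s)
  lemma = Solver.solve-∀ laurentRing

-- Acting on this sequence reads off the coefficients of a Laurent polynomial.
δ : Series
δ (+ 0) = 1ℤ
δ _     = 0ℤ

coeff : ℕ → Laurent → ℤ
coeff n p = act p δ (+ n)

coeff-≃ : ∀ {J p r} n → + n ℤ.< J → p ≃[ J ] r → coeff n p ≡ coeff n r
coeff-≃ {J} {p} {r} n n< e = ℤₚ.i-j≡0⇒i≡j _ _ (trans
  (sym (trans (act-⊕ p (⊖ r) δ (+ n)) (cong (λ z → act p δ (+ n) ℤ.+ z) (act-⊖ r δ (+ n)))))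
  (vanish (ord e) 0ℤ δ δ-neg (+ n) (subst (+ n ℤ.<_) (sym (ℤₚ.+-identityˡ J)) n<)))
  where
  δ-neg : ∀ n → n ℤ.< 0ℤ → δ n ≡ 0ℤ
  δ-neg (+ n)      (ℤ.+<+ ())
  δ-neg (-[1+ n ]) _ = refl

-- Finite sums and products

∑ : ℕ → (ℕ → Laurent) → Laurent
∑ zero    g = 𝟎
∑ (suc n) g = ∑ n g ⊕ g n

∏ : ℕ → (ℕ → Laurent) → Laurent
∏ zero    g = 𝟏
∏ (suc n) g = ∏ n g ⊗ g n

∏ₗ : {A : Set} → List A → (A → Laurent) → Laurent
∏ₗ []       g = 𝟏
∏ₗ (x ∷ xs) g = g x ⊗ ∏ₗ xs g

∑-cong : ∀ n {g h} → (∀ i → i < n → g i ≈ h i) → ∑ n g ≈ ∑ n h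
∑-cong zero    e = ≈-refl
∑-cong (suc n) e = ⊕-cong (∑-cong n (λ i i< → e i (ℕₚ.m<n⇒m<1+n i<))) (e n (ℕₚ.n<1+n n))

∑-≃ : ∀ {J} n {g h} → (∀ i → i < n → g i ≃[ J ] h i) → ∑ n g ≃[ J ] ∑ n h
∑-≃ zero    e = ≃-refl
∑-≃ (suc n) e = ≃-⊕ (∑-≃ n (λ i i< → e i (ℕₚ.m<n⇒m<1+n i<))) (e n (ℕₚ.n<1+n n))

∑-⊕ : ∀ n g h → ∑ n (λ i → g i ⊕ h i) ≈ ∑ n g ⊕ ∑ n h
∑-⊕ zero    g h = ≈-refl
∑-⊕ (suc n) g h = ≈-trans (⊕-cong (∑-⊕ n g h) ≈-refl) (lemma (∑ n g) (∑ n h) (g n) (h n))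
  where
  lemma : ∀ a b c d → (a ⊕ b) ⊕ (c ⊕ d) ≈ (a ⊕ c) ⊕ (b ⊕ d)
  lemma = Solver.solve-∀ laurentRing

∑-⊖ : ∀ n g → ∑ n (λ i → ⊖ g i) ≈ ⊖ ∑ n g
∑-⊖ zero    g = ≈-refl
∑-⊖ (suc n) g = ≈-trans (⊕-cong (∑-⊖ n g) ≈-refl) (lemma (∑ n g) (g n))
  where
  lemma : ∀ a b → ⊖ a ⊕ ⊖ b ≈ ⊖ (a ⊕ b)
  lemma = Solver.solve-∀ laurentRing

∑-⊗ : ∀ n p g → p ⊗ ∑ n g ≈ ∑ n (λ i → p ⊗ g i)
∑-⊗ zero    p g = ⊗-zeroʳ p
∑-⊗ (suc n) p g = ≈-trans (⊗-distribˡ p (∑ n g) (g n)) (⊕-cong (∑-⊗ n p g) ≈-refl)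

∑-zero : ∀ n {g} → (∀ i → i < n → g i ≈ 𝟎) → ∑ n g ≈ 𝟎
∑-zero zero    e = ≈-refl
∑-zero (suc n) e = ≈-trans (⊕-cong (∑-zero n (λ i i< → e i (ℕₚ.m<n⇒m<1+n i<))) (e n (ℕₚ.n<1+n n)))
                           (⊕-identityˡ 𝟎)

∑-split : ∀ a b g → ∑ (a + b) g ≈ ∑ a g ⊕ ∑ b (λ i → g (a + i))
∑-split a zero    g rewrite ℕₚ.+-identityʳ a = ≈-sym (⊕-identityʳ _)
∑-split a (suc b) g rewrite ℕₚ.+-suc a b =
  ≈-trans (⊕-cong (∑-split a b g) ≈-refl) (⊕-assoc _ _ _)

ord-∑ : ∀ {j} n {g} → (∀ i → i < n → Ord j (g i)) → Ord j (∑ n g)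
ord-∑ zero    o = ord-𝟎
ord-∑ (suc n) o = ord-⊕ (ord-∑ n (λ i i< → o i (ℕₚ.m<n⇒m<1+n i<))) (o n (ℕₚ.n<1+n n))

∏-cong : ∀ n {g h} → (∀ i → i < n → g i ≈ h i) → ∏ n g ≈ ∏ n h
∏-cong zero    e = ≈-refl
∏-cong (suc n) e = ⊗-cong (∏-cong n (λ i i< → e i (ℕₚ.m<n⇒m<1+n i<))) (e n (ℕₚ.n<1+n n))

interchange⊗ : ∀ a b c d → (a ⊗ b) ⊗ (c ⊗ d) ≈ (a ⊗ c) ⊗ (b ⊗ d)
interchange⊗ = Solver.solve-∀ laurentRing

∏-⊗ : ∀ n g h → ∏ n (λ i → g i ⊗ h i) ≈ ∏ n g ⊗ ∏ n h
∏-⊗ zero    g h = ≈-refl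
∏-⊗ (suc n) g h = ≈-trans (⊗-cong (∏-⊗ n g h) ≈-refl) (interchange⊗ (∏ n g) (∏ n h) (g n) (h n))

∏-split : ∀ a b g → ∏ (a + b) g ≈ ∏ a g ⊗ ∏ b (λ i → g (a + i))
∏-split a zero    g rewrite ℕₚ.+-identityʳ a = ≈-sym (⊗-identityʳ _)
∏-split a (suc b) g rewrite ℕₚ.+-suc a b =
  ≈-trans (⊗-cong (∏-split a b g) ≈-refl) (⊗-assoc _ _ _)

ord-∏ : ∀ n {g} → (∀ i → Ord 0ℤ (g i)) → Ord 0ℤ (∏ n g)
ord-∏ zero    o = ord-con 1ℤ
ord-∏ (suc n) o = ord-⊗ˡ (ord-∏ n o) (o n)

∏ₗ-cong : ∀ {A : Set} (xs : List A) {g h} → (∀ x → g x ≈ h x) → ∏ₗ xs g ≈ ∏ₗ xs h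
∏ₗ-cong []       e = ≈-refl
∏ₗ-cong (x ∷ xs) e = ⊗-cong (e x) (∏ₗ-cong xs e)

∏ₗ-⊗ : ∀ {A : Set} (xs : List A) g h → ∏ₗ xs (λ x → g x ⊗ h x) ≈ ∏ₗ xs g ⊗ ∏ₗ xs h
∏ₗ-⊗ []       g h = ≈-refl
∏ₗ-⊗ (x ∷ xs) g h = ≈-trans (⊗-cong ≈-refl (∏ₗ-⊗ xs g h)) (interchange⊗ (g x) (h x) _ _)

ord-∏ₗ : ∀ {A : Set} (xs : List A) {g} → (∀ x → Ord 0ℤ (g x)) → Ord 0ℤ (∏ₗ xs g)
ord-∏ₗ []       o = ord-con 1ℤ
ord-∏ₗ (x ∷ xs) o = ord-⊗ˡ (o x) (ord-∏ₗ xs o)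

-- Columns of overlined parts

Bits : ℕ → List ℕ → Set
Bits n s = length s ≡ n × All (_≤ 1) s

sum-bits : ∀ {n} s → Bits n s → sum s ≤ n
sum-bits []      (refl , [])     = z≤n
sum-bits (a ∷ s) (refl , p ∷ ps) = ℕₚ.+-mono-≤ p (sum-bits s (refl , ps))

ifPos : ℕ → (ℕ → Laurent) → Laurent
ifPos zero    g = 𝟎
ifPos (suc c) g = g c

-- The sum of b^e · K e c′ over the columns e which may follow the column s when
-- the slack is c: the partial sums of e must not exceed c plus those of s.
bitsum : List Laurent → List ℕ → ℕ → (List ℕ → ℕ → Laurent) → Laurent
bitsum (b ∷ bs) (s ∷ ss) c K =
  bitsum bs ss (s + c) (λ e → K (0 ∷ e)) ⊕ b ⊗ ifPos (s + c) (λ c′ → bitsum bs ss c′ (λ e → K (1 ∷ e)))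
bitsum _        _        c K = K [] c

private
  0≤1 : 0 ≤ 1
  0≤1 = z≤n

  1≤1 : 1 ≤ 1
  1≤1 = s≤s z≤n

-- Each entry of `ss` raises the slack by itself and each bit of the new column lowers it by one;
-- hence the continuations need to agree only where c′ + sum e ≡ c + sum ss.
bitsum-cong : ∀ bs ss c {K K′} → length ss ≡ length bs →
  (∀ e c′ → Bits (length bs) e → c′ + sum e ≡ c + sum ss → K e c′ ≈ K′ e c′) →
  bitsum bs ss c K ≈ bitsum bs ss c K′
bitsum-cong []       []       c len h = h [] c (refl , []) refl
bitsum-cong (b ∷ bs) (s ∷ ss) c {K} {K′} len h = ⊕-cong
  (bitsum-cong bs ss (s + c) (ℕₚ.suc-injective len)
    (λ e c′ (l , a) eq → h (0 ∷ e) c′ (cong suc l , 0≤1 ∷ a) (trans eq (rearrange s c (sum ss)))))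
  (⊗-cong ≈-refl (go (s + c) refl))
  where
  rearrange : ∀ s c t → s + c + t ≡ c + (s + t)
  rearrange = ℕ-Solver.solve-∀
  go : ∀ d → s + c ≡ d →
       ifPos d (λ c′ → bitsum bs ss c′ (λ e → K (1 ∷ e))) ≈ ifPos d (λ c′ → bitsum bs ss c′ (λ e → K′ (1 ∷ e)))
  go zero    eq = ≈-refl
  go (suc d) eq = bitsum-cong bs ss d (ℕₚ.suc-injective len)
    (λ e c′ (l , a) eq′ → h (1 ∷ e) c′ (cong suc l , 1≤1 ∷ a)
      (trans (ℕₚ.+-suc c′ (sum e)) (trans (cong suc eq′) (trans (cong (_+ sum ss) (sym eq)) (rearrange s c (sum ss))))))

bitsum-≃ : ∀ {J} bs ss c {K K′} → length ss ≡ length bs → All (Ord 0ℤ) bs →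
  (∀ e c′ → Bits (length bs) e → c′ + sum e ≡ c + sum ss → K e c′ ≃[ J ] K′ e c′) →
  bitsum bs ss c K ≃[ J ] bitsum bs ss c K′
bitsum-≃ []       []       c len o h = h [] c (refl , []) refl
bitsum-≃ {J} (b ∷ bs) (s ∷ ss) c {K} {K′} len (o ∷ os) h = ≃-⊕
  (bitsum-≃ bs ss (s + c) (ℕₚ.suc-injective len) os
    (λ e c′ (l , a) eq → h (0 ∷ e) c′ (cong suc l , 0≤1 ∷ a) (trans eq (rearrange s c (sum ss)))))
  (≃-⊗ʳ o (go (s + c) refl))
  where
  rearrange : ∀ s c t → s + c + t ≡ c + (s + t)
  rearrange = ℕ-Solver.solve-∀
  go : ∀ d → s + c ≡ d →
       ifPos d (λ c′ → bitsum bs ss c′ (λ e → K (1 ∷ e))) ≃[ J ] ifPos d (λ c′ → bitsum bs ss c′ (λ e → K′ (1 ∷ e)))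
  go zero    eq = ≃-refl
  go (suc d) eq = bitsum-≃ bs ss d (ℕₚ.suc-injective len) os
    (λ e c′ (l , a) eq′ → h (1 ∷ e) c′ (cong suc l , 1≤1 ∷ a)
      (trans (ℕₚ.+-suc c′ (sum e)) (trans (cong suc eq′) (trans (cong (_+ sum ss) (sym eq)) (rearrange s c (sum ss))))))

bitsum-⊕ : ∀ bs ss c K K′ → bitsum bs ss c (λ e c′ → K e c′ ⊕ K′ e c′) ≈ bitsum bs ss c K ⊕ bitsum bs ss c K′
bitsum-⊕ []       ss       c K K′ = ≈-refl
bitsum-⊕ (b ∷ bs) []       c K K′ = ≈-refl
bitsum-⊕ (b ∷ bs) (s ∷ ss) c K K′ = ≈-trans
  (⊕-cong (bitsum-⊕ bs ss (s + c) (λ e → K (0 ∷ e)) (λ e → K′ (0 ∷ e))) (⊗-cong ≈-refl (go (s + c))))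
  (lemma _ _ b _ _)
  where
  lemma : ∀ u v b w z → (u ⊕ v) ⊕ b ⊗ (w ⊕ z) ≈ (u ⊕ b ⊗ w) ⊕ (v ⊕ b ⊗ z)
  lemma = Solver.solve-∀ laurentRing
  go : ∀ d → ifPos d (λ c′ → bitsum bs ss c′ (λ e c′ → K (1 ∷ e) c′ ⊕ K′ (1 ∷ e) c′))
     ≈ ifPos d (λ c′ → bitsum bs ss c′ (λ e → K (1 ∷ e))) ⊕ ifPos d (λ c′ → bitsum bs ss c′ (λ e → K′ (1 ∷ e)))
  go zero    = ≈-refl
  go (suc d) = bitsum-⊕ bs ss d (λ e → K (1 ∷ e)) (λ e → K′ (1 ∷ e))

bitsum-⊗ : ∀ bs ss c p K → p ⊗ bitsum bs ss c K ≈ bitsum bs ss c (λ e c′ → p ⊗ K e c′)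
bitsum-⊗ []       ss       c p K = ≈-refl
bitsum-⊗ (b ∷ bs) []       c p K = ≈-refl
bitsum-⊗ (b ∷ bs) (s ∷ ss) c p K = ≈-trans (lemma p _ b _)
  (⊕-cong (bitsum-⊗ bs ss (s + c) p (λ e → K (0 ∷ e))) (⊗-cong ≈-refl (go (s + c))))
  where
  lemma : ∀ p u b v → p ⊗ (u ⊕ b ⊗ v) ≈ p ⊗ u ⊕ b ⊗ (p ⊗ v)
  lemma = Solver.solve-∀ laurentRing
  go : ∀ d → p ⊗ ifPos d (λ c′ → bitsum bs ss c′ (λ e → K (1 ∷ e)))
     ≈ ifPos d (λ c′ → bitsum bs ss c′ (λ e c′ → p ⊗ K (1 ∷ e) c′))
  go zero    = ⊗-zeroʳ p
  go (suc d) = bitsum-⊗ bs ss d p (λ e → K (1 ∷ e))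

bitsum-𝟎 : ∀ bs ss c → bitsum bs ss c (λ _ _ → 𝟎) ≈ 𝟎
bitsum-𝟎 bs ss c = ≈-trans (≈-sym (bitsum-⊗ bs ss c 𝟎 (λ _ _ → 𝟎))) (⊗-zeroˡ _)

bitsum-∑ : ∀ bs ss c n (K : ℕ → List ℕ → ℕ → Laurent) →
  bitsum bs ss c (λ e c′ → ∑ n (λ i → K i e c′)) ≈ ∑ n (λ i → bitsum bs ss c (K i))
bitsum-∑ bs ss c zero    K = bitsum-𝟎 bs ss c
bitsum-∑ bs ss c (suc n) K = ≈-trans (bitsum-⊕ bs ss c (λ e c′ → ∑ n (λ i → K i e c′)) (K n))
                                     (⊕-cong (bitsum-∑ bs ss c n K) ≈-refl)

infixr 8 _^^_
_^^_ : Laurent → ℕ → Laurent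
y ^^ zero  = 𝟏
y ^^ suc n = y ⊗ y ^^ n

-- Crossings of consecutive columns and the exchange that cancels them

module Free (G : ℤ → Laurent) where

  -- The counterpart of `bitsum` with the restriction on partial sums dropped. For exponentials G it
  -- factors, which `bitsum` does not.
  free : List Laurent → ℤ → Laurent
  free []       i = G i
  free (b ∷ bs) i = free bs i ⊕ b ⊗ free bs (i ℤ.- 1ℤ)

  -- hit collects the part of free which bitsum leaves out: the columns whose
  -- partial sums become too large.
  mutual
    hit : List Laurent → List ℕ → ℕ → Laurent
    hit (b ∷ bs) (a ∷ es) d = hit bs es (a + d) ⊕ b ⊗ cross bs es (a + d)
    hit _        _        d = 𝟎

    cross : List Laurent → List ℕ → ℕ → Laurent
    cross bs es zero    = free bs (+ sum es ℤ.- 1ℤ)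
    cross bs es (suc d) = hit bs es d

  -- A column is either admissible or has a first place at which its partial sum becomes too large.
  -- There the slack is -1, and this is where `cross` starts `free`.
  bitsum-hit : ∀ bs es d → length es ≡ length bs →
    bitsum bs es d (λ _ c → G (+ c)) ⊕ hit bs es d ≈ free bs (+ (d + sum es))
  bitsum-hit []       []       d len rewrite ℕₚ.+-identityʳ d = ⊕-identityʳ (G (+ d))
  bitsum-hit (b ∷ bs) (a ∷ es) d len = ≈-trans (lemma _ b _ _ _)
    (≈-trans (⊕-cong (bitsum-hit bs es (a + d) (ℕₚ.suc-injective len))
                     (⊗-cong ≈-refl (go (a + d))))
             (≈-reflexive (cong (λ j → free bs (+ j) ⊕ b ⊗ free bs (+ j ℤ.- 1ℤ)) (rearrange a d (sum es)))))
    where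
    lemma : ∀ u b v w z → (u ⊕ b ⊗ v) ⊕ (w ⊕ b ⊗ z) ≈ (u ⊕ w) ⊕ b ⊗ (v ⊕ z)
    lemma = Solver.solve-∀ laurentRing
    rearrange : ∀ a d t → a + d + t ≡ d + (a + t)
    rearrange = ℕ-Solver.solve-∀
    go : ∀ j → ifPos j (λ c → bitsum bs es c (λ _ c′ → G (+ c′))) ⊕ cross bs es j
             ≈ free bs (+ (j + sum es) ℤ.- 1ℤ)
    go zero    = ⊕-identityˡ _
    go (suc j) = bitsum-hit bs es j (ℕₚ.suc-injective len)

  -- The unread entries of `es` are at most 1 each, so they cannot make up for a slack that has
  -- dropped below zero; under the bound it never does.
  hit-vacuous : ∀ bs es d → Bits (length bs) es → length bs ≤ d + sum es → hit bs es d ≈ 𝟎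
  hit-vacuous []       []       d _ _ = ≈-refl
  hit-vacuous (b ∷ bs) (a ∷ es) d (len , a≤1 ∷ as) h =
    ≈-trans (⊕-cong (hit-vacuous bs es (a + d) bits (ℕₚ.≤-trans (ℕₚ.n≤1+n _) h′)) (⊗-cong ≈-refl (go (a + d) h′)))
            (lemma b)
    where
    bits : Bits (length bs) es
    bits = ℕₚ.suc-injective len , as
    lemma : ∀ b → 𝟎 ⊕ b ⊗ 𝟎 ≈ 𝟎
    lemma = Solver.solve-∀ laurentRing
    rearrange : ∀ a d t → d + (a + t) ≡ a + d + t
    rearrange = ℕ-Solver.solve-∀
    h′ : suc (length bs) ≤ a + d + sum es
    h′ = subst (suc (length bs) ≤_) (rearrange a d (sum es)) h
    go : ∀ j → suc (length bs) ≤ j + sum es → cross bs es j ≈ 𝟎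
    go zero    le = contradiction (sum-bits es bits) (ℕₚ.<⇒≱ le)
    go (suc j) le = hit-vacuous bs es j bits (ℕₚ.≤-pred le)

  -- Against a zero column, at most d + 1 parts can cross only at the last of them, and there the
  -- contribution is G (-1) = 0. The extra one in the bound is what admits r = lam.
  hit-zeros : G (ℤ.- 1ℤ) ≈ 𝟎 → ∀ bs es d → length es ≡ length bs → sum es ≡ 0 →
    length bs ≤ suc d → hit bs es d ≈ 𝟎
  hit-zeros G₋₁ []       []       d _ _ _ = ≈-refl
  hit-zeros G₋₁ (b ∷ bs) (0 ∷ es) d len z h =
    ≈-trans (⊕-cong (hit-zeros G₋₁ bs es d (ℕₚ.suc-injective len) z (ℕₚ.≤-trans (ℕₚ.n≤1+n _) h))
                    (⊗-cong ≈-refl (go d bs (ℕₚ.suc-injective len) (ℕₚ.≤-pred h))))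
            (lemma b)
    where
    lemma : ∀ b → 𝟎 ⊕ b ⊗ 𝟎 ≈ 𝟎
    lemma = Solver.solve-∀ laurentRing
    go : ∀ j bs → length es ≡ length bs → length bs ≤ j → cross bs es j ≈ 𝟎
    go zero    [] _ le rewrite z = G₋₁
    go (suc j) bs l le = hit-zeros G₋₁ bs es j l z le

  module Swap (ξ η : ℤ)
    (G₋₁ : G (ℤ.- 1ℤ) ≈ 𝟎)
    (antisym : ∀ i → G (ℤ.- 1ℤ ℤ.- i) ≈ ⊖ (mon (ℤ.- (i ℤ.* (ξ ℤ.+ η))) ⊗ G (ℤ.- 1ℤ ℤ.+ i))) where

    -- In the application ξ is the size of the multiple of η between the two columns, and y is the
    -- inverse of its weight x. Thus x^N y^(sum e) = x^f when N = f + sum e.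
    y : Laurent
    y = mon (ℤ.- ξ)

    next : List Laurent → List Laurent
    next = map (_⊗ mon η)

    -- The sum over two independent columns with weights b y and b q^η.
    free₂ : List Laurent → ℤ → Laurent
    free₂ []       i = G i
    free₂ (b ∷ bs) i = (free₂ bs i ⊕ (b ⊗ mon η) ⊗ free₂ bs (i ℤ.- 1ℤ))
                     ⊕ b ⊗ y ⊗ (free₂ bs (i ℤ.+ 1ℤ) ⊕ (b ⊗ mon η) ⊗ free₂ bs i)

    -- Exchanging the columns turns a bit of weight b y into one of weight b q^η. The ratio q^(ξ +
    -- η) is exactly the factor by which the monomial in `antisym` changes when i changes by one.
    free₂-antisym : ∀ bs i → free₂ bs (ℤ.- 1ℤ ℤ.- i) ≈ ⊖ (mon (ℤ.- (i ℤ.* (ξ ℤ.+ η))) ⊗ free₂ bs (ℤ.- 1ℤ ℤ.+ i))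
    free₂-antisym []       i = antisym i
    free₂-antisym (b ∷ bs) i = begin
      (F (ℤ.- 1ℤ ℤ.- i) ⊕ (b ⊗ Q) ⊗ F (ℤ.- 1ℤ ℤ.- i ℤ.- 1ℤ))
        ⊕ b ⊗ y ⊗ (F (ℤ.- 1ℤ ℤ.- i ℤ.+ 1ℤ) ⊕ (b ⊗ Q) ⊗ F (ℤ.- 1ℤ ℤ.- i))
        ≈⟨ ⊕-cong (⊕-cong F₀ (⊗-cong ≈-refl F₊)) (⊗-cong ≈-refl (⊕-cong F₋ (⊗-cong ≈-refl F₀))) ⟩
      (⊖ (w ⊗ f₀) ⊕ (b ⊗ Q) ⊗ ⊖ ((w ⊗ (y ⊗ Q⁻¹)) ⊗ f₊))
        ⊕ b ⊗ y ⊗ (⊖ ((w ⊗ (mon ξ ⊗ Q)) ⊗ f₋) ⊕ (b ⊗ Q) ⊗ ⊖ (w ⊗ f₀))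
        ≈⟨ expand w b Q y Q⁻¹ (mon ξ) f₀ f₊ f₋ ⟩
      ⊖ (w ⊗ ((f₀ ⊕ b ⊗ ((y ⊗ mon ξ) ⊗ (Q ⊗ f₋))) ⊕ b ⊗ y ⊗ ((Q ⊗ Q⁻¹) ⊗ f₊ ⊕ (b ⊗ Q) ⊗ f₀)))
        ≈⟨ ⊖-cong (⊗-cong ≈-refl (⊕-cong (⊕-cong ≈-refl (⊗-cong ≈-refl (⊗-cong (inv ξ) ≈-refl)))
              (⊗-cong ≈-refl (⊕-cong (⊗-cong (inv′ η) ≈-refl) ≈-refl)))) ⟩
      ⊖ (w ⊗ ((f₀ ⊕ b ⊗ (𝟏 ⊗ (Q ⊗ f₋))) ⊕ b ⊗ y ⊗ (𝟏 ⊗ f₊ ⊕ (b ⊗ Q) ⊗ f₀)))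
        ≈⟨ tidy w b Q y f₀ f₊ f₋ ⟩
      ⊖ (w ⊗ ((f₀ ⊕ (b ⊗ Q) ⊗ f₋) ⊕ b ⊗ y ⊗ (f₊ ⊕ (b ⊗ Q) ⊗ f₀)))
        ∎
      where
      F : ℤ → Laurent
      F = free₂ bs
      Q Q⁻¹ w f₀ f₊ f₋ : Laurent
      Q   = mon η
      Q⁻¹ = mon (ℤ.- η)
      w   = mon (ℤ.- (i ℤ.* (ξ ℤ.+ η)))
      f₀  = F (ℤ.- 1ℤ ℤ.+ i)
      f₊  = F (ℤ.- 1ℤ ℤ.+ i ℤ.+ 1ℤ)
      f₋  = F (ℤ.- 1ℤ ℤ.+ i ℤ.- 1ℤ)
      F₀ : F (ℤ.- 1ℤ ℤ.- i) ≈ ⊖ (w ⊗ f₀)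
      F₀ = free₂-antisym bs i
      F₊ : F (ℤ.- 1ℤ ℤ.- i ℤ.- 1ℤ) ≈ ⊖ ((w ⊗ (y ⊗ Q⁻¹)) ⊗ f₊)
      F₊ = ≈-trans (≈-reflexive (cong F (e₁ i))) (≈-trans (free₂-antisym bs (i ℤ.+ 1ℤ))
             (⊖-cong (⊗-cong (≈-trans (mon-≡ (e₂ i ξ η)) (≈-trans (mon-+ (ℤ.- (i ℤ.* (ξ ℤ.+ η))) (ℤ.- ξ ℤ.+ ℤ.- η)) (⊗-cong ≈-refl (mon-+ (ℤ.- ξ) (ℤ.- η)))))
                             (≈-reflexive (cong F (e₃ i))))))
        where
        e₁ : ∀ i → ℤ.- 1ℤ ℤ.- i ℤ.- 1ℤ ≡ ℤ.- 1ℤ ℤ.- (i ℤ.+ 1ℤ)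
        e₁ = ℤ-Solver.solve-∀
        e₂ : ∀ i ξ η → ℤ.- ((i ℤ.+ 1ℤ) ℤ.* (ξ ℤ.+ η)) ≡ ℤ.- (i ℤ.* (ξ ℤ.+ η)) ℤ.+ (ℤ.- ξ ℤ.+ ℤ.- η)
        e₂ = ℤ-Solver.solve-∀
        e₃ : ∀ i → ℤ.- 1ℤ ℤ.+ (i ℤ.+ 1ℤ) ≡ ℤ.- 1ℤ ℤ.+ i ℤ.+ 1ℤ
        e₃ = ℤ-Solver.solve-∀
      F₋ : F (ℤ.- 1ℤ ℤ.- i ℤ.+ 1ℤ) ≈ ⊖ ((w ⊗ (mon ξ ⊗ Q)) ⊗ f₋)
      F₋ = ≈-trans (≈-reflexive (cong F (e₁ i))) (≈-trans (free₂-antisym bs (i ℤ.- 1ℤ))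
             (⊖-cong (⊗-cong (≈-trans (mon-≡ (e₂ i ξ η)) (≈-trans (mon-+ (ℤ.- (i ℤ.* (ξ ℤ.+ η))) (ξ ℤ.+ η)) (⊗-cong ≈-refl (mon-+ ξ η))))
                             (≈-reflexive (cong F (e₃ i))))))
        where
        e₁ : ∀ i → ℤ.- 1ℤ ℤ.- i ℤ.+ 1ℤ ≡ ℤ.- 1ℤ ℤ.- (i ℤ.- 1ℤ)
        e₁ = ℤ-Solver.solve-∀
        e₂ : ∀ i ξ η → ℤ.- ((i ℤ.- 1ℤ) ℤ.* (ξ ℤ.+ η)) ≡ ℤ.- (i ℤ.* (ξ ℤ.+ η)) ℤ.+ (ξ ℤ.+ η)
        e₂ = ℤ-Solver.solve-∀
        e₃ : ∀ i → ℤ.- 1ℤ ℤ.+ (i ℤ.- 1ℤ) ≡ ℤ.- 1ℤ ℤ.+ i ℤ.- 1ℤ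
        e₃ = ℤ-Solver.solve-∀
      inv : ∀ j → mon (ℤ.- j) ⊗ mon j ≈ 𝟏
      inv j = ≈-trans (≈-sym (mon-+ (ℤ.- j) j)) (≈-trans (mon-≡ (ℤₚ.+-inverseˡ j)) mon-0)
      inv′ : ∀ j → mon j ⊗ mon (ℤ.- j) ≈ 𝟏
      inv′ j = ≈-trans (⊗-comm _ _) (inv j)
      expand : ∀ w b Q y Q⁻¹ x f₀ f₊ f₋ →
        (⊖ (w ⊗ f₀) ⊕ (b ⊗ Q) ⊗ ⊖ ((w ⊗ (y ⊗ Q⁻¹)) ⊗ f₊)) ⊕ b ⊗ y ⊗ (⊖ ((w ⊗ (x ⊗ Q)) ⊗ f₋) ⊕ (b ⊗ Q) ⊗ ⊖ (w ⊗ f₀))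
        ≈ ⊖ (w ⊗ ((f₀ ⊕ b ⊗ ((y ⊗ x) ⊗ (Q ⊗ f₋))) ⊕ b ⊗ y ⊗ ((Q ⊗ Q⁻¹) ⊗ f₊ ⊕ (b ⊗ Q) ⊗ f₀)))
      expand = Solver.solve-∀ laurentRing
      tidy : ∀ w b Q y f₀ f₊ f₋ →
        ⊖ (w ⊗ ((f₀ ⊕ b ⊗ (𝟏 ⊗ (Q ⊗ f₋))) ⊕ b ⊗ y ⊗ (𝟏 ⊗ f₊ ⊕ (b ⊗ Q) ⊗ f₀)))
        ≈ ⊖ (w ⊗ ((f₀ ⊕ (b ⊗ Q) ⊗ f₋) ⊕ b ⊗ y ⊗ (f₊ ⊕ (b ⊗ Q) ⊗ f₀)))
      tidy = Solver.solve-∀ laurentRing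

    -- Antisymmetry at i = 0 yields only twice this value. In the induction the two mixed terms, at
    -- -2 and 0, cancel by antisymmetry at i = 1 instead.
    free₂-₋₁ : ∀ bs → free₂ bs (ℤ.- 1ℤ) ≈ 𝟎
    free₂-₋₁ []       = G₋₁
    free₂-₋₁ (b ∷ bs) = begin
      (F (ℤ.- 1ℤ) ⊕ (b ⊗ Q) ⊗ F (ℤ.- 1ℤ ℤ.- 1ℤ)) ⊕ b ⊗ y ⊗ (F 0ℤ ⊕ (b ⊗ Q) ⊗ F (ℤ.- 1ℤ))
        ≈⟨ ⊕-cong (⊕-cong (free₂-₋₁ bs) (⊗-cong ≈-refl (≈-trans (free₂-antisym bs 1ℤ)
              (⊖-cong (⊗-cong (≈-trans (mon-≡ (e ξ η)) (mon-+ (ℤ.- η) (ℤ.- ξ))) ≈-refl)))))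
              (⊗-cong ≈-refl (⊕-cong ≈-refl (⊗-cong ≈-refl (free₂-₋₁ bs)))) ⟩
      (𝟎 ⊕ (b ⊗ Q) ⊗ ⊖ ((mon (ℤ.- η) ⊗ y) ⊗ F 0ℤ)) ⊕ b ⊗ y ⊗ (F 0ℤ ⊕ (b ⊗ Q) ⊗ 𝟎)
        ≈⟨ expand b Q (mon (ℤ.- η)) y (F 0ℤ) ⟩
      (b ⊗ y ⊗ F 0ℤ) ⊗ (𝟏 ⊕ ⊖ (Q ⊗ mon (ℤ.- η)))
        ≈⟨ ⊗-cong ≈-refl (⊕-cong ≈-refl (⊖-cong
             (≈-trans (≈-sym (mon-+ η (ℤ.- η))) (≈-trans (mon-≡ (ℤₚ.+-inverseʳ η)) mon-0)))) ⟩
      (b ⊗ y ⊗ F 0ℤ) ⊗ (𝟏 ⊕ ⊖ 𝟏)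
        ≈⟨ ⊗-zeroʳ _ ⟩
      𝟎 ∎
      where
      F : ℤ → Laurent
      F = free₂ bs
      Q : Laurent
      Q = mon η
      e : ∀ ξ η → ℤ.- (1ℤ ℤ.* (ξ ℤ.+ η)) ≡ ℤ.- η ℤ.+ ℤ.- ξ
      e = ℤ-Solver.solve-∀
      expand : ∀ b Q Q⁻¹ y f → (𝟎 ⊕ (b ⊗ Q) ⊗ ⊖ ((Q⁻¹ ⊗ y) ⊗ f)) ⊕ b ⊗ y ⊗ (f ⊕ (b ⊗ Q) ⊗ 𝟎)
             ≈ (b ⊗ y ⊗ f) ⊗ (𝟏 ⊕ ⊖ (Q ⊗ Q⁻¹))
      expand = Solver.solve-∀ laurentRing

    -- By the bound the older column `ss` no longer restricts e, so the sum runs over all pairs of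
    -- columns.
    bitsum-free₂ : ∀ bs ss p i → Bits (length bs) ss → length bs ≤ p + sum ss →
      bitsum bs ss p (λ e _ → y ^^ sum e ⊗ free (next bs) (+ sum e ℤ.+ i)) ≈ free₂ bs i
    bitsum-free₂ []       []       p i _ _ = ≈-trans (⊗-identityˡ _) (≈-reflexive (cong G (ℤₚ.+-identityˡ i)))
    bitsum-free₂ (b ∷ bs) (s ∷ ss) p i (len , s≤1 ∷ as) h = ⊕-cong
      (≈-trans (two i (s + p) (ℕₚ.≤-trans (ℕₚ.n≤1+n _) h′)) ≈-refl)
      (go (s + p) h′)
      where
      bits : Bits (length bs) ss
      bits = ℕₚ.suc-injective len , as
      Q : Laurent
      Q = mon η
      rearrange : ∀ a d t → d + (a + t) ≡ a + d + t
      rearrange = ℕ-Solver.solve-∀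
      h′ : suc (length bs) ≤ s + p + sum ss
      h′ = subst (suc (length bs) ≤_) (rearrange s p (sum ss)) h
      two : ∀ i p → length bs ≤ p + sum ss →
        bitsum bs ss p (λ e _ → y ^^ sum e ⊗ free (next (b ∷ bs)) (+ sum e ℤ.+ i))
        ≈ free₂ bs i ⊕ (b ⊗ Q) ⊗ free₂ bs (i ℤ.- 1ℤ)
      two i p le = ≈-trans
        (bitsum-cong bs ss p (proj₁ bits) (λ e _ _ _ → ≈-trans (lemma (y ^^ sum e) (b ⊗ Q) _ _)
          (⊕-cong ≈-refl (⊗-cong ≈-refl (⊗-cong ≈-refl (≈-reflexive (cong (free (next bs)) (ℤₚ.+-assoc (+ sum e) i (ℤ.- 1ℤ)))))))))
        (≈-trans (bitsum-⊕ bs ss p _ _)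
          (⊕-cong (bitsum-free₂ bs ss p i bits le)
            (≈-trans (≈-sym (bitsum-⊗ bs ss p (b ⊗ Q) _)) (⊗-cong ≈-refl (bitsum-free₂ bs ss p (i ℤ.- 1ℤ) bits le)))))
        where
        lemma : ∀ v c u w → v ⊗ (u ⊕ c ⊗ w) ≈ v ⊗ u ⊕ c ⊗ (v ⊗ w)
        lemma = Solver.solve-∀ laurentRing
      go : ∀ j → suc (length bs) ≤ j + sum ss →
        b ⊗ ifPos j (λ c′ → bitsum bs ss c′ (λ e _ → y ^^ suc (sum e) ⊗ free (next (b ∷ bs)) (+ suc (sum e) ℤ.+ i)))
        ≈ b ⊗ y ⊗ (free₂ bs (i ℤ.+ 1ℤ) ⊕ (b ⊗ Q) ⊗ free₂ bs i)
      go zero    le = contradiction (sum-bits ss bits) (ℕₚ.<⇒≱ le)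
      go (suc j) le = ≈-trans (⊗-cong ≈-refl
        (≈-trans (bitsum-cong bs ss j (proj₁ bits) (λ e _ _ _ → ≈-trans (⊗-assoc y _ _)
             (⊗-cong ≈-refl (⊗-cong ≈-refl (≈-reflexive (cong (free (next (b ∷ bs))) (up (sum e) i)))))))
          (≈-trans (≈-sym (bitsum-⊗ bs ss j y _)) (⊗-cong ≈-refl
            (≈-trans (two (i ℤ.+ 1ℤ) j (ℕₚ.≤-pred le))
              (⊕-cong ≈-refl (⊗-cong ≈-refl (≈-reflexive (cong (free₂ bs) (back i))))))))))
        (≈-sym (⊗-assoc b y _))
        where
        up : ∀ n i → + suc n ℤ.+ i ≡ + n ℤ.+ (i ℤ.+ 1ℤ)
        up n i = lemma (+ n) i
          where
          lemma : ∀ n i → 1ℤ ℤ.+ n ℤ.+ i ≡ n ℤ.+ (i ℤ.+ 1ℤ)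
          lemma = ℤ-Solver.solve-∀
        back : ∀ i → i ℤ.+ 1ℤ ℤ.- 1ℤ ≡ i
        back = ℤ-Solver.solve-∀

    -- After a crossing the two remaining columns range over all pairs, and
    -- exchanging them reverses the sign of the summand.
    mutual
      bitsum-hit-zero : ∀ bs ss p d → Bits (length bs) ss → length bs ≤ suc (p + d + sum ss) →
        bitsum bs ss p (λ e _ → y ^^ sum e ⊗ hit (next bs) e d) ≈ 𝟎
      bitsum-hit-zero []       []       p d _ _ = ≈-refl
      bitsum-hit-zero (b ∷ bs) (s ∷ ss) p d (len , s≤1 ∷ as) h = ≈-trans
        (⊕-cong (bitsum-hit-zero₀ b bs ss p′ d bits h′) (⊗-cong ≈-refl (go p′ refl)))
        (absorb b)
        where
        bits : Bits (length bs) ss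
        bits = ℕₚ.suc-injective len , as
        p′ : ℕ
        p′ = s + p
        rearrange : ∀ s p d t → p + d + (s + t) ≡ s + p + d + t
        rearrange = ℕ-Solver.solve-∀
        h′ : length bs ≤ p′ + d + sum ss
        h′ = subst (length bs ≤_) (rearrange s p d (sum ss)) (ℕₚ.≤-pred h)
        go : ∀ j → p′ ≡ j →
          ifPos j (λ c′ → bitsum bs ss c′ (λ e _ → y ^^ suc (sum e) ⊗ hit (next (b ∷ bs)) (1 ∷ e) d)) ≈ 𝟎
        go zero    eq = ≈-refl
        go (suc j) eq = ≈-trans
          (bitsum-cong bs ss j (proj₁ bits) (λ e _ _ _ → ⊗-assoc y _ _))
          (≈-trans (≈-sym (bitsum-⊗ bs ss j y _)) (≈-trans (⊗-cong ≈-refl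
            (bitsum-hit-split b bs ss j (suc d) (λ e → hit (next bs) e d) bits
              (subst (λ z → length bs ≤ suc (z + sum ss)) (sym (ℕₚ.+-suc j d)) (ℕₚ.m≤n⇒m≤1+n h″))
              (bitsum-hit-zero bs ss j d bits h″))) (⊗-zeroʳ y)))
          where
          -- A bit of the old column lowers its own slack p by one and raises d by one, and the
          -- bound speaks only of p + d.
          h″ : length bs ≤ suc (j + d + sum ss)
          h″ = subst (λ z → length bs ≤ z + d + sum ss) eq h′

      bitsum-hit-zero₀ : ∀ b bs ss p d → Bits (length bs) ss → length bs ≤ p + d + sum ss →
        bitsum bs ss p (λ e _ → y ^^ sum e ⊗ hit (next (b ∷ bs)) (0 ∷ e) d) ≈ 𝟎
      -- A new bit crosses at once here. By `le` both remainders are unrestricted, and their sum is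
      -- `free₂` at -1.
      bitsum-hit-zero₀ b bs ss p zero    bits le =
        bitsum-hit-split b bs ss p 0 (λ e → free (next bs) (+ sum e ℤ.- 1ℤ)) bits (ℕₚ.m≤n⇒m≤1+n le)
          (≈-trans (bitsum-free₂ bs ss p (ℤ.- 1ℤ) bits (subst (λ j → length bs ≤ j + sum ss) (ℕₚ.+-identityʳ p) le))
                   (free₂-₋₁ bs))
      bitsum-hit-zero₀ b bs ss p (suc d) bits le =
        bitsum-hit-split b bs ss p (suc d) (λ e → hit (next bs) e d) bits (ℕₚ.m≤n⇒m≤1+n le)
          (bitsum-hit-zero bs ss p d bits (subst (λ j → length bs ≤ j + sum ss) (ℕₚ.+-suc p d) le))

      bitsum-hit-split : ∀ b bs ss p d (X : List ℕ → Laurent) → Bits (length bs) ss →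
        length bs ≤ suc (p + d + sum ss) →
        bitsum bs ss p (λ e _ → y ^^ sum e ⊗ X e) ≈ 𝟎 →
        bitsum bs ss p (λ e _ → y ^^ sum e ⊗ (hit (next bs) e d ⊕ (b ⊗ mon η) ⊗ X e)) ≈ 𝟎
      bitsum-hit-split b bs ss p d X bits le z = ≈-trans
        (bitsum-cong bs ss p (proj₁ bits) (λ e _ _ _ → distr (y ^^ sum e) (b ⊗ mon η) _ _))
        (≈-trans (bitsum-⊕ bs ss p _ _) (≈-trans (⊕-cong (bitsum-hit-zero bs ss p d bits le)
          (≈-trans (≈-sym (bitsum-⊗ bs ss p (b ⊗ mon η) _)) (⊗-cong ≈-refl z))) (absorb (b ⊗ mon η))))
        where
        distr : ∀ v c u w → v ⊗ (u ⊕ c ⊗ w) ≈ v ⊗ u ⊕ c ⊗ (v ⊗ w)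
        distr = Solver.solve-∀ laurentRing

      absorb : ∀ b → 𝟎 ⊕ b ⊗ 𝟎 ≈ 𝟎
      absorb = Solver.solve-∀ laurentRing

∏-front : ∀ n g → ∏ (suc n) g ≈ g 0 ⊗ ∏ n (λ i → g (suc i))
∏-front zero    g = ⊗-comm 𝟏 (g 0)
∏-front (suc n) g = ≈-trans (⊗-cong (∏-front n g) ≈-refl) (⊗-assoc _ _ _)

∑-front : ∀ n g → ∑ (suc n) g ≈ g 0 ⊕ ∑ n (λ i → g (suc i))
∑-front zero    g = ⊕-comm 𝟎 (g 0)
∑-front (suc n) g = ≈-trans (⊕-cong (∑-front n g) ≈-refl) (⊕-assoc _ _ _)

mon-inv : ∀ i → mon i ⊗ mon (ℤ.- i) ≈ 𝟏
mon-inv i = ≈-trans (≈-sym (mon-+ i (ℤ.- i))) (≈-trans (mon-≡ (ℤₚ.+-inverseʳ i)) mon-0)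

one+mon : ℤ → Laurent
one+mon i = 𝟏 ⊕ mon i

one-mon : ℤ → Laurent
one-mon i = 𝟏 ⊕ ⊖ mon i

ord-mon₀ : ∀ n → Ord 0ℤ (mon (+ n))
ord-mon₀ n = ord-weaken (ℤ.+≤+ z≤n) ord-mon

ord-one+mon : ∀ n → Ord 0ℤ (one+mon (+ n))
ord-one+mon n = ord-⊕ (ord-con 1ℤ) (ord-mon₀ n)

ord-one-mon : ∀ n → Ord 0ℤ (one-mon (+ n))
ord-one-mon n = ord-⊕ (ord-con 1ℤ) (ord-⊖ (ord-mon₀ n))

-- Unrestricted columns for sums of exponentials

module FreeExponential (N : ℕ) (A : ℕ → Laurent) (κ ν : ℕ → ℤ) where

  -- The exponent i + 1 makes G vanish at -1, and i ↦ -2 - i exchanges the two exponentials of each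
  -- term, up to a monomial, as soon as κ n + ν n is constant.
  G : ℤ → Laurent
  G i = ∑ N (λ n → A n ⊗ (mon (κ n ℤ.* (i ℤ.+ 1ℤ)) ⊕ ⊖ mon (ν n ℤ.* (i ℤ.+ 1ℤ))))

  open Free G public

  factors : List Laurent → ℤ → Laurent
  factors bs j = ∏ₗ bs (λ b → 𝟏 ⊕ b ⊗ mon (ℤ.- j))

  -- A bit of weight b multiplies the exponential q^(j i) by 1 + b q^(-j), so an unrestricted column
  -- becomes a product.
  free-exp : ∀ bs i → free bs i ≈ ∑ N (λ n → A n ⊗
    (mon (κ n ℤ.* (i ℤ.+ 1ℤ)) ⊗ factors bs (κ n) ⊕ ⊖ (mon (ν n ℤ.* (i ℤ.+ 1ℤ)) ⊗ factors bs (ν n))))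
  free-exp [] i = ∑-cong N (λ n _ → ⊗-cong ≈-refl
    (⊕-cong (≈-sym (⊗-identityʳ _)) (⊖-cong (≈-sym (⊗-identityʳ _)))))
  free-exp (b ∷ bs) i = ≈-trans
    (⊕-cong (free-exp bs i) (≈-trans (⊗-cong ≈-refl (free-exp bs (i ℤ.- 1ℤ))) (∑-⊗ N b _)))
    (≈-trans (≈-sym (∑-⊕ N _ _)) (∑-cong N (λ n _ →
      ≈-trans (⊕-cong ≈-refl (⊗-cong ≈-refl (⊗-cong ≈-refl
                (⊕-cong (⊗-cong (down (κ n)) ≈-refl) (⊖-cong (⊗-cong (down (ν n)) ≈-refl))))))
              (collect (A n) b (mon (κ n ℤ.* (i ℤ.+ 1ℤ))) (mon (ℤ.- κ n)) (factors bs (κ n))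
                               (mon (ν n ℤ.* (i ℤ.+ 1ℤ))) (mon (ℤ.- ν n)) (factors bs (ν n))))))
    where
    down : ∀ j → mon (j ℤ.* (i ℤ.- 1ℤ ℤ.+ 1ℤ)) ≈ mon (j ℤ.* (i ℤ.+ 1ℤ)) ⊗ mon (ℤ.- j)
    down j = ≈-trans (mon-≡ (e j i)) (mon-+ (j ℤ.* (i ℤ.+ 1ℤ)) (ℤ.- j))
      where
      e : ∀ j i → j ℤ.* (i ℤ.- 1ℤ ℤ.+ 1ℤ) ≡ j ℤ.* (i ℤ.+ 1ℤ) ℤ.+ ℤ.- j
      e = ℤ-Solver.solve-∀
    collect : ∀ A b u u⁻ f v v⁻ g →
      A ⊗ (u ⊗ f ⊕ ⊖ (v ⊗ g)) ⊕ b ⊗ (A ⊗ ((u ⊗ u⁻) ⊗ f ⊕ ⊖ ((v ⊗ v⁻) ⊗ g)))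
      ≈ A ⊗ (u ⊗ ((𝟏 ⊕ b ⊗ u⁻) ⊗ f) ⊕ ⊖ (v ⊗ ((𝟏 ⊕ b ⊗ v⁻) ⊗ g)))
    collect = Solver.solve-∀ laurentRing

  G₋₁ : G (ℤ.- 1ℤ) ≈ 𝟎
  G₋₁ = ∑-zero N (λ n _ → ≈-trans (⊗-cong ≈-refl (≈-trans
          (⊕-cong (mon-≡ (e (κ n))) (⊖-cong (mon-≡ (e (ν n))))) (⊖-inverseʳ (mon 0ℤ)))) (⊗-zeroʳ (A n)))
    where
    e : ∀ j → j ℤ.* (ℤ.- 1ℤ ℤ.+ 1ℤ) ≡ 0ℤ
    e = ℤ-Solver.solve-∀

  antisym : ∀ t → (∀ n → κ n ℤ.+ ν n ≡ t) → ∀ i →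
    G (ℤ.- 1ℤ ℤ.- i) ≈ ⊖ (mon (ℤ.- (i ℤ.* t)) ⊗ G (ℤ.- 1ℤ ℤ.+ i))
  antisym t eq i = ≈-trans (∑-cong N (λ n _ → ≈-trans
      (⊗-cong ≈-refl (⊕-cong (swap (κ n) (ν n) (eq n)) (⊖-cong (swap (ν n) (κ n) (trans (ℤₚ.+-comm (ν n) (κ n)) (eq n))))))
      (flip (A n) (mon (ℤ.- (i ℤ.* t))) _ _)))
    (≈-trans (∑-⊖ N _) (⊖-cong (≈-sym (∑-⊗ N _ _))))
    where
    e : ∀ a b i → a ℤ.* (ℤ.- 1ℤ ℤ.- i ℤ.+ 1ℤ) ≡ ℤ.- (i ℤ.* (a ℤ.+ b)) ℤ.+ b ℤ.* (ℤ.- 1ℤ ℤ.+ i ℤ.+ 1ℤ)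
    e = ℤ-Solver.solve-∀
    swap : ∀ a b → a ℤ.+ b ≡ t →
      mon (a ℤ.* (ℤ.- 1ℤ ℤ.- i ℤ.+ 1ℤ)) ≈ mon (ℤ.- (i ℤ.* t)) ⊗ mon (b ℤ.* (ℤ.- 1ℤ ℤ.+ i ℤ.+ 1ℤ))
    swap a b refl = ≈-trans (mon-≡ (e a b i)) (mon-+ _ (b ℤ.* (ℤ.- 1ℤ ℤ.+ i ℤ.+ 1ℤ)))
    flip : ∀ A w u v → A ⊗ (w ⊗ v ⊕ ⊖ (w ⊗ u)) ≈ ⊖ (w ⊗ (A ⊗ (u ⊕ ⊖ v)))
    flip = Solver.solve-∀ laurentRing

-- The alternating series

sgn : ℕ → Laurent
sgn zero    = 𝟏
sgn (suc n) = ⊖ sgn n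

ord-sgn : ∀ n → Ord 0ℤ (sgn n)
ord-sgn zero    = ord-con 1ℤ
ord-sgn (suc n) = ord-⊖ (ord-sgn n)

tri : ℕ → ℕ
tri zero    = 0
tri (suc n) = tri n + suc n

module Params (η K lam M σ : ℕ) (rs : List ℕ) (M+lam : M + lam ≡ K + suc K)
  (len-rs : length rs ≡ lam) (sum-rs : sum rs ≡ σ)
  (reflect : ∀ (g : ℤ → Laurent) → ∏ₗ rs (λ j → g (+ η ℤ.- + j)) ≈ ∏ₗ rs (λ j → g (+ j))) where

  H : ℤ
  H = + η

  Q : ℤ → Laurent
  Q j = mon (j ℤ.* H)

  Q-+ : ∀ i j → Q (i ℤ.+ j) ≈ Q i ⊗ Q j
  Q-+ i j = ≈-trans (mon-≡ (ℤₚ.*-distribʳ-+ H i j)) (mon-+ (i ℤ.* H) (j ℤ.* H))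

  φ : ℕ → Laurent
  φ j = ∏ₗ rs (λ α → one+mon (+ (α + j * η)))

  ord-φ : ∀ j → Ord 0ℤ (φ j)
  ord-φ j = ord-∏ₗ rs (λ α → ord-one+mon (α + j * η))

  Qℕ : ∀ j → Q (+ j) ≈ mon (+ (j * η))
  Qℕ j = mon-≡ (sym (ℤₚ.pos-* j η))

  ord-Q : ∀ j → Ord 0ℤ (Q (+ j))
  ord-Q j = ord-≈ (≈-sym (Qℕ j)) (ord-mon₀ (j * η))

  cols : ℕ → List Laurent
  cols zero    = mon 0ℤ ∷ map (λ α → mon (+ α)) rs
  cols (suc m) = map (_⊗ mon H) (cols m)

  alphas : List Laurent
  alphas = map (λ α → mon (+ α)) rs

  ∏ₗ-map : ∀ {A B : Set} (f : A → B) xs (g : B → Laurent) → ∏ₗ (map f xs) g ≈ ∏ₗ xs (λ x → g (f x))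
  ∏ₗ-map f []       g = ≈-refl
  ∏ₗ-map f (x ∷ xs) g = ⊗-cong ≈-refl (∏ₗ-map f xs g)

  ∏ₗ-alphas : ∀ z → ∏ₗ alphas (λ b → 𝟏 ⊕ b ⊗ mon z) ≈ ∏ₗ rs (λ α → one+mon (+ α ℤ.+ z))
  ∏ₗ-alphas z = ≈-trans (∏ₗ-map (λ α → mon (+ α)) rs _)
    (∏ₗ-cong rs (λ α → ⊕-cong ≈-refl (≈-sym (mon-+ (+ α) z))))

  ∏ₗ-cols : ∀ m z → ∏ₗ (cols m) (λ b → 𝟏 ⊕ b ⊗ mon z)
          ≈ one+mon (+ m ℤ.* H ℤ.+ z) ⊗ ∏ₗ rs (λ α → one+mon (+ α ℤ.+ (+ m ℤ.* H ℤ.+ z)))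
  ∏ₗ-cols zero z = ⊗-cong (⊕-cong ≈-refl (≈-trans (≈-sym (mon-+ 0ℤ z)) (mon-≡ (cong (ℤ._+ z) (sym (ℤₚ.*-zeroˡ H))))))
    (≈-trans (∏ₗ-alphas z) (∏ₗ-cong rs (λ α → ⊕-cong ≈-refl (mon-≡ (e (+ α) H z)))))
    where
    e : ∀ a h z → a ℤ.+ z ≡ a ℤ.+ (0ℤ ℤ.* h ℤ.+ z)
    e = ℤ-Solver.solve-∀
  ∏ₗ-cols (suc m) z = ≈-trans (∏ₗ-map (_⊗ mon H) (cols m) _)
    (≈-trans (∏ₗ-cong (cols m) (λ b → ⊕-cong ≈-refl (≈-trans (⊗-assoc b (mon H) (mon z)) (⊗-cong ≈-refl (≈-sym (mon-+ H z))))))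
    (≈-trans (∏ₗ-cols m (H ℤ.+ z)) (⊗-cong (⊕-cong ≈-refl (mon-≡ (e (+ m) H z)))
      (∏ₗ-cong rs (λ α → ⊕-cong ≈-refl (mon-≡ (cong (λ j → + α ℤ.+ j) (e (+ m) H z))))))))
    where
    e : ∀ m h z → m ℤ.* h ℤ.+ (h ℤ.+ z) ≡ (1ℤ ℤ.+ m) ℤ.* h ℤ.+ z
    e = ℤ-Solver.solve-∀

  φ-ℤ : ∀ j z → + j ℤ.* H ≡ z → ∏ₗ rs (λ α → one+mon (+ α ℤ.+ z)) ≈ φ j
  φ-ℤ j z eq = ∏ₗ-cong rs (λ α → ⊕-cong ≈-refl (mon-≡ (cong (λ i → + α ℤ.+ i) (trans (sym eq) (sym (ℤₚ.pos-* j η))))))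

  -- The symmetry of the residues turns the factors with negative exponents
  -- into factors with positive ones.
  φ-neg : ∀ n → ∏ₗ rs (λ α → one+mon (+ α ℤ.+ ℤ.- (+ suc n ℤ.* H)))
        ≈ mon (+ σ ℤ.- + lam ℤ.* (+ suc n ℤ.* H)) ⊗ φ n
  φ-neg n = ≈-trans (∏ₗ-cong rs (λ α → ≈-trans (one+mon-neg _)
      (⊗-cong ≈-refl (⊕-cong ≈-refl (mon-≡ (e (+ α) (+ n) H))))))
    (≈-trans (∏ₗ-⊗ rs _ (λ α → one+mon (+ η ℤ.- + α ℤ.+ + n ℤ.* H)))
      (⊗-cong (collect rs len-rs sum-rs)
        (≈-trans (reflect (λ j → one+mon (j ℤ.+ + n ℤ.* H))) (φ-ℤ n _ refl))))
    where
    one+mon-neg : ∀ i → one+mon i ≈ mon i ⊗ one+mon (ℤ.- i)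
    one+mon-neg i = ≈-trans (⊕-comm 𝟏 (mon i)) (≈-trans (⊕-cong (≈-sym (⊗-identityʳ _)) (≈-sym (mon-inv i)))
                      (≈-sym (⊗-distribˡ (mon i) 𝟏 (mon (ℤ.- i)))))
    e : ∀ a n h → ℤ.- (a ℤ.+ ℤ.- ((1ℤ ℤ.+ n) ℤ.* h)) ≡ h ℤ.- a ℤ.+ n ℤ.* h
    e = ℤ-Solver.solve-∀
    collect : ∀ xs {l s} → length xs ≡ l → sum xs ≡ s → ∏ₗ xs (λ α → mon (+ α ℤ.+ ℤ.- (+ suc n ℤ.* H)))
            ≈ mon (+ s ℤ.- + l ℤ.* (+ suc n ℤ.* H))
    collect []       refl refl = ≈-trans (≈-sym mon-0) (mon-≡ refl)
    collect (x ∷ xs) refl refl = ≈-trans (⊗-cong ≈-refl (collect xs refl refl))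
      (≈-trans (≈-sym (mon-+ _ (+ sum xs ℤ.- + length xs ℤ.* (+ suc n ℤ.* H)))) (mon-≡ (e′ (+ x) (+ sum xs) (+ length xs) (+ suc n ℤ.* H))))
      where
      e′ : ∀ x s l z → x ℤ.+ ℤ.- z ℤ.+ (s ℤ.- l ℤ.* z) ≡ x ℤ.+ s ℤ.- (1ℤ ℤ.+ l) ℤ.* z
      e′ = ℤ-Solver.solve-∀

  -- A m d n is the n-th coefficient of the alternating series G for the columns
  -- m, m + 1, …, m + d, multiplied by (q^η; q^η)_{m + d}.
  expo : ℕ → ℕ → ℕ
  expo m n = η * (M * tri n) + n * σ + m * (n * (K * η))

  κ : ℕ → ℤ
  κ n = ℤ.- (+ n ℤ.* H)

  ν : ℕ → ℕ → ℤ
  ν m n = + suc (n + m) ℤ.* H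

  A₀ : ℕ → ℕ → ℕ → Laurent
  A₀ m d n = sgn n ⊗ mon (+ expo m n) ⊗ ∏ m (λ i → 𝟏 ⊕ ⊖ Q (+ suc (n + i)))
           ⊗ (∏ n φ ⊗ ∏ (d ∸ n) (λ i → φ (suc (n + m) + i)))

  P : ℕ → ℕ → Laurent
  P m d = ∏ d (λ i → 𝟏 ⊕ Q (+ (suc m + i)))

  A : ℕ → ℕ → ℕ → Laurent
  A m d n = P m d ⊗ A₀ m d n

  -- `A m (suc d) n` without its factor 1 + `x m`: the common coefficient through which periods m
  -- and m + 1 are compared.
  a : ℕ → ℕ → ℕ → Laurent
  a m d n = P (suc m) d ⊗ A₀ m (suc d) n

  A≈a : ∀ m d n → A m (suc d) n ≈ (𝟏 ⊕ Q (+ suc m)) ⊗ a m d n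
  A≈a m d n = ≈-trans (⊗-cong (≈-trans (∏-front d _) (⊗-cong
      (⊕-cong ≈-refl (≈-reflexive (cong (λ j → Q (+ suc j)) (ℕₚ.+-identityʳ m))))
      (∏-cong d (λ i _ → ⊕-cong ≈-refl (≈-reflexive (cong (λ j → Q (+ suc j)) (ℕₚ.+-suc m i))))))) ≈-refl)
    (⊗-assoc _ _ _)

  ord-A₀ : ∀ m d n → Ord (+ expo m n) (A₀ m d n)
  ord-A₀ m d n = ord-⊗ˡ (ord-⊗ˡ (ord-⊗ʳ (ord-sgn n) ord-mon)
      (ord-∏ m (λ i → ord-⊕ (ord-con 1ℤ) (ord-⊖ (ord-Q (suc (n + i)))))))
    (ord-⊗ˡ (ord-∏ n ord-φ) (ord-∏ (d ∸ n) (λ i → ord-φ (suc (n + m) + i))))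

  ord-P : ∀ m d → Ord 0ℤ (P m d)
  ord-P m d = ord-∏ d (λ i → ord-⊕ (ord-con 1ℤ) (ord-Q (suc m + i)))

  ord-a : ∀ m d n → Ord (+ expo m n) (a m d n)
  ord-a m d n = ord-⊗ʳ (ord-P (suc m) d) (ord-A₀ m (suc d) n)

  module Col (m d : ℕ) = FreeExponential (suc d) (A m d) κ (ν m)

  factors-κ : ∀ m n → ∏ₗ (cols (suc m)) (λ b → 𝟏 ⊕ b ⊗ mon (ℤ.- κ n)) ≈ (𝟏 ⊕ mon (ν m n)) ⊗ φ (suc (n + m))
  factors-κ m n = ≈-trans (∏ₗ-cols (suc m) (ℤ.- κ n))
    (⊗-cong (⊕-cong ≈-refl (mon-≡ (e (+ n) (+ m) H))) (φ-ℤ (suc (n + m)) _ (sym (e (+ n) (+ m) H))))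
    where
    e : ∀ n m h → (1ℤ ℤ.+ m) ℤ.* h ℤ.+ ℤ.- (ℤ.- (n ℤ.* h)) ≡ (1ℤ ℤ.+ (n ℤ.+ m)) ℤ.* h
    e = ℤ-Solver.solve-∀

  factors-ν : ∀ m n → ∏ₗ (cols (suc m)) (λ b → 𝟏 ⊕ b ⊗ mon (ℤ.- ν (suc m) n))
    ≈ (𝟏 ⊕ Q (ℤ.- + suc n)) ⊗ (mon (+ σ ℤ.- + lam ℤ.* (+ suc n ℤ.* H)) ⊗ φ n)
  factors-ν m n = ≈-trans (∏ₗ-cols (suc m) (ℤ.- ν (suc m) n))
    (⊗-cong (⊕-cong ≈-refl (mon-≡ (e′ m n)))
      (≈-trans (∏ₗ-cong rs (λ α → ⊕-cong ≈-refl (mon-≡ (cong (λ j → + α ℤ.+ j)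
        (trans (e′ m n) (sym (ℤₚ.neg-distribˡ-* (+ suc n) H))))))) (φ-neg n)))
    where
    e : ∀ n m h → (1ℤ ℤ.+ m) ℤ.* h ℤ.+ ℤ.- ((1ℤ ℤ.+ (n ℤ.+ (1ℤ ℤ.+ m))) ℤ.* h) ≡ ℤ.- (1ℤ ℤ.+ n) ℤ.* h
    e = ℤ-Solver.solve-∀
    e′ : ∀ m n → + suc m ℤ.* H ℤ.+ ℤ.- ν (suc m) n ≡ ℤ.- + suc n ℤ.* H
    e′ m n = e (+ n) (+ m) H

  expo-suc : ∀ m n → expo (suc m) n ≡ expo m n + n * (K * η)
  expo-suc m n = lemma (η * (M * tri n)) (n * σ) m (n * (K * η))
    where
    lemma : ∀ a b m c → a + b + suc m * c ≡ a + b + m * c + c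
    lemma = ℕ-Solver.solve-∀

  -- Index n + 1 of period m has to absorb the exponents of the ν-term of index n of period m + 1.
  -- This balance is the origin of M = 2k - lam - 1.
  expo-step : ∀ m n → expo (suc m) n + suc (n + suc m) * η * suc K + σ
            ≡ expo m (suc n) + suc m * η + lam * (suc n * η)
  expo-step m n = trans (l₁ η M (tri n) n σ m K)
    (trans (cong (λ z → η * (M * tri n) + suc n * σ + m * (suc n * (K * η)) + suc n * η * z + suc m * η) (sym M+lam))
      (l₂ η M (tri n) n σ m K lam))
    where
    l₁ : ∀ η M t n σ m K → η * (M * t) + n * σ + suc m * (n * (K * η)) + suc (n + suc m) * η * suc K + σ
       ≡ η * (M * t) + suc n * σ + m * (suc n * (K * η)) + suc n * η * (K + suc K) + suc m * η
    l₁ = ℕ-Solver.solve-∀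
    l₂ : ∀ η M t n σ m K l →
         η * (M * t) + suc n * σ + m * (suc n * (K * η)) + suc n * η * (M + l) + suc m * η
       ≡ η * (M * (t + suc n)) + suc n * σ + m * (suc n * (K * η)) + suc m * η + l * (suc n * η)
    l₂ = ℕ-Solver.solve-∀

  k : ℤ
  k = + suc K

  -- The κ-term keeps its index. The new column supplies φ (n + m + 1), the first of the remaining
  -- factors at period m, and its multiple of η completes 1 - q^ν to 1 - q^(2ν).
  rel₁ : ∀ m d n → n ≤ d →
    A (suc m) d n ⊗ (mon (κ n ℤ.* k) ⊗ ∏ₗ (cols (suc m)) (λ b → 𝟏 ⊕ b ⊗ mon (ℤ.- κ n)))
    ≈ a m d n ⊗ (Q (ℤ.- + n) ⊗ (𝟏 ⊕ ⊖ (mon (ν m n) ⊗ mon (ν m n))))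
  rel₁ m d n n≤d = begin
    P′ ⊗ (s ⊗ mon (+ expo (suc m) n) ⊗ (Pm ⊗ (𝟏 ⊕ ⊖ X)) ⊗ (Φ ⊗ R′))
      ⊗ (mon (κ n ℤ.* k) ⊗ ∏ₗ (cols (suc m)) (λ b → 𝟏 ⊕ b ⊗ mon (ℤ.- κ n)))
      ≈⟨ ⊗-cong ≈-refl (⊗-cong ≈-refl (factors-κ m n)) ⟩
    P′ ⊗ (s ⊗ mon (+ expo (suc m) n) ⊗ (Pm ⊗ (𝟏 ⊕ ⊖ X)) ⊗ (Φ ⊗ R′)) ⊗ (mon (κ n ℤ.* k) ⊗ ((𝟏 ⊕ X) ⊗ f))
      ≈⟨ arrange P′ s (mon (+ expo (suc m) n)) Pm X Φ R′ (mon (κ n ℤ.* k)) f ⟩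
    (mon (+ expo (suc m) n) ⊗ mon (κ n ℤ.* k)) ⊗ (P′ ⊗ (s ⊗ Pm ⊗ (Φ ⊗ (f ⊗ R′))) ⊗ (𝟏 ⊕ ⊖ (X ⊗ X)))
      ≈⟨ ⊗-cong (≈-trans (≈-sym (mon-+ _ (κ n ℤ.* k))) (≈-trans (mon-≡ monos) (mon-+ (+ expo m n) _)))
                (⊗-cong (⊗-cong ≈-refl (⊗-cong ≈-refl (⊗-cong ≈-refl (≈-sym peel)))) ≈-refl) ⟩
    (mon (+ expo m n) ⊗ Q (ℤ.- + n)) ⊗ (P′ ⊗ (s ⊗ Pm ⊗ (Φ ⊗ R)) ⊗ (𝟏 ⊕ ⊖ (X ⊗ X)))
      ≈⟨ arrange′ P′ s (mon (+ expo m n)) Pm (Φ ⊗ R) (Q (ℤ.- + n)) _ ⟩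
    P′ ⊗ (s ⊗ mon (+ expo m n) ⊗ Pm ⊗ (Φ ⊗ R)) ⊗ (Q (ℤ.- + n) ⊗ (𝟏 ⊕ ⊖ (X ⊗ X))) ∎
    where
    P′ s Pm X Φ f R′ R : Laurent
    P′ = P (suc m) d
    s  = sgn n
    Pm = ∏ m (λ i → 𝟏 ⊕ ⊖ Q (+ suc (n + i)))
    X  = mon (ν m n)
    Φ  = ∏ n φ
    f  = φ (suc (n + m))
    R′ = ∏ (d ∸ n) (λ i → φ (suc (n + suc m) + i))
    R  = ∏ (suc d ∸ n) (λ i → φ (suc (n + m) + i))
    peel : R ≈ f ⊗ R′
    peel rewrite ℕₚ.+-∸-assoc 1 n≤d = ≈-trans (∏-front (d ∸ n) _) (⊗-cong
      (≈-reflexive (cong (λ j → φ (suc j)) (ℕₚ.+-identityʳ (n + m))))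
      (∏-cong (d ∸ n) (λ i _ → ≈-reflexive (cong φ (shift-index n m i)))))
      where
      shift-index : ∀ n m i → suc (n + m) + suc i ≡ suc (n + suc m) + i
      shift-index = ℕ-Solver.solve-∀
    monos : + expo (suc m) n ℤ.+ κ n ℤ.* k ≡ + expo m n ℤ.+ ℤ.- + n ℤ.* H
    monos = trans (cong (ℤ._+ κ n ℤ.* k) (trans (cong +_ (expo-suc m n)) (cong (λ z → + expo m n ℤ.+ z)
        (trans (ℤₚ.pos-* n (K * η)) (cong (λ z → + n ℤ.* z) (ℤₚ.pos-* K η))))))
      (e (+ expo m n) (+ n) (+ K) H)
      where
      e : ∀ x n K h → x ℤ.+ n ℤ.* (K ℤ.* h) ℤ.+ ℤ.- (n ℤ.* h) ℤ.* (1ℤ ℤ.+ K) ≡ x ℤ.+ ℤ.- n ℤ.* h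
      e = ℤ-Solver.solve-∀
    arrange : ∀ P s e p X Φ R u f → P ⊗ (s ⊗ e ⊗ (p ⊗ (𝟏 ⊕ ⊖ X)) ⊗ (Φ ⊗ R)) ⊗ (u ⊗ ((𝟏 ⊕ X) ⊗ f))
      ≈ (e ⊗ u) ⊗ (P ⊗ (s ⊗ p ⊗ (Φ ⊗ (f ⊗ R))) ⊗ (𝟏 ⊕ ⊖ (X ⊗ X)))
    arrange = Solver.solve-∀ laurentRing
    arrange′ : ∀ P s e p Φ u w → (e ⊗ u) ⊗ (P ⊗ (s ⊗ p ⊗ Φ) ⊗ w) ≈ P ⊗ (s ⊗ e ⊗ p ⊗ Φ) ⊗ (u ⊗ w)
    arrange′ = Solver.solve-∀ laurentRing

  -- The ν-term moves from index n to n + 1. Its factors have negative exponents; `φ-neg` reflects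
  -- them into φ n, and the monomial left over accounts for the step of `expo`.
  rel₂ : ∀ m d n → n ≤ d →
    A (suc m) d n ⊗ (mon (ν (suc m) n ℤ.* k) ⊗ ∏ₗ (cols (suc m)) (λ b → 𝟏 ⊕ b ⊗ mon (ℤ.- ν (suc m) n)))
    ≈ ⊖ (a m d (suc n) ⊗ (Q (ℤ.- + suc n) ⊗ (𝟏 ⊕ ⊖ (Q (+ suc n) ⊗ Q (+ suc n))) ⊗ Q (+ suc m)))
  rel₂ m d n n≤d = begin
    P′ ⊗ (s ⊗ mon (+ expo (suc m) n) ⊗ Pm′ ⊗ (Φ ⊗ R)) ⊗ (mon (ν (suc m) n ℤ.* k) ⊗ _)
      ≈⟨ ⊗-cong (⊗-cong ≈-refl (⊗-cong (⊗-cong ≈-refl front) ≈-refl))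
                (⊗-cong ≈-refl (≈-trans (factors-ν m n) (⊗-cong flip ≈-refl))) ⟩
    P′ ⊗ (s ⊗ mon (+ expo (suc m) n) ⊗ ((𝟏 ⊕ ⊖ q) ⊗ Pm) ⊗ (Φ ⊗ R))
      ⊗ (mon (ν (suc m) n ℤ.* k) ⊗ (q⁻ ⊗ (𝟏 ⊕ q) ⊗ (mon w ⊗ φ n)))
      ≈⟨ arrange P′ s (mon (+ expo (suc m) n)) q Pm Φ R (mon (ν (suc m) n ℤ.* k)) q⁻ (mon w) (φ n) ⟩
    (mon (+ expo (suc m) n) ⊗ mon (ν (suc m) n ℤ.* k) ⊗ mon w) ⊗ rest
      ≈⟨ ⊗-cong (≈-trans (⊗-cong (≈-sym (mon-+ _ (ν (suc m) n ℤ.* k))) ≈-refl) (≈-trans (≈-sym (mon-+ _ w))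
           (≈-trans (mon-≡ monos) (mon-+ (+ expo m (suc n)) _)))) ≈-refl ⟩
    (mon (+ expo m (suc n)) ⊗ Q (+ suc m)) ⊗ rest
      ≈⟨ arrange′ P′ s (mon (+ expo m (suc n))) (Q (+ suc m)) Pm (Φ ⊗ φ n) R q⁻ _ ⟩
    ⊖ (P′ ⊗ (⊖ s ⊗ mon (+ expo m (suc n)) ⊗ Pm ⊗ ((Φ ⊗ φ n) ⊗ R)) ⊗ (q⁻ ⊗ (𝟏 ⊕ ⊖ (q ⊗ q)) ⊗ Q (+ suc m)))
      ≈⟨ ⊖-cong (⊗-cong (⊗-cong ≈-refl (⊗-cong ≈-refl (⊗-cong ≈-refl (∏-cong (d ∸ n) (λ i _ →
           ≈-reflexive (cong (λ j → φ (suc j + i)) (ℕₚ.+-suc n m))))))) ≈-refl) ⟩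
    _ ∎
    where
    P′ s Pm′ Pm Φ R q q⁻ rest : Laurent
    w : ℤ
    w   = + σ ℤ.- + lam ℤ.* (+ suc n ℤ.* H)
    P′  = P (suc m) d
    s   = sgn n
    Pm′ = ∏ (suc m) (λ i → 𝟏 ⊕ ⊖ Q (+ suc (n + i)))
    Pm  = ∏ m (λ i → 𝟏 ⊕ ⊖ Q (+ suc (suc n + i)))
    Φ   = ∏ n φ
    R   = ∏ (d ∸ n) (λ i → φ (suc (n + suc m) + i))
    q   = Q (+ suc n)
    q⁻  = Q (ℤ.- + suc n)
    rest = ⊖ (P′ ⊗ (⊖ s ⊗ Pm ⊗ ((Φ ⊗ φ n) ⊗ R)) ⊗ (q⁻ ⊗ (𝟏 ⊕ ⊖ (q ⊗ q))))
    front : Pm′ ≈ (𝟏 ⊕ ⊖ q) ⊗ Pm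
    front = ≈-trans (∏-front m _) (⊗-cong
      (≈-reflexive (cong (λ j → 𝟏 ⊕ ⊖ Q (+ suc j)) (ℕₚ.+-identityʳ n)))
      (∏-cong m (λ i _ → ≈-reflexive (cong (λ j → 𝟏 ⊕ ⊖ Q (+ suc j)) (ℕₚ.+-suc n i)))))
    flip : 𝟏 ⊕ q⁻ ≈ q⁻ ⊗ (𝟏 ⊕ q)
    flip = ≈-sym (≈-trans (⊗-distribˡ q⁻ 𝟏 q) (≈-trans (⊕-cong (⊗-identityʳ q⁻)
      (≈-trans (≈-sym (Q-+ (ℤ.- + suc n) (+ suc n))) (≈-trans (mon-≡ (cong (ℤ._* H) (ℤₚ.+-inverseˡ (+ suc n)))) (≈-trans (mon-≡ (ℤₚ.*-zeroˡ H)) mon-0))))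
      (⊕-comm q⁻ 𝟏)))
    monos : + expo (suc m) n ℤ.+ ν (suc m) n ℤ.* k ℤ.+ w ≡ + expo m (suc n) ℤ.+ + suc m ℤ.* H
    monos = ℤ-cancel _ _ (trans left (trans (cong +_ (expo-step m n)) right))
      where
      ℤ-cancel : ∀ x y → x ℤ.+ + lam ℤ.* (+ suc n ℤ.* H) ≡ y ℤ.+ + lam ℤ.* (+ suc n ℤ.* H) → x ≡ y
      ℤ-cancel x y h = trans (e x _) (trans (cong (ℤ._- (+ lam ℤ.* (+ suc n ℤ.* H))) h) (sym (e y _)))
        where
        e : ∀ x z → x ≡ x ℤ.+ z ℤ.- z
        e = ℤ-Solver.solve-∀
      left : + expo (suc m) n ℤ.+ ν (suc m) n ℤ.* k ℤ.+ w ℤ.+ + lam ℤ.* (+ suc n ℤ.* H)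
           ≡ + (expo (suc m) n + suc (n + suc m) * η * suc K + σ)
      left = trans (e (+ expo (suc m) n) (ν (suc m) n ℤ.* k) (+ σ) (+ lam ℤ.* (+ suc n ℤ.* H))) (cong (λ z → + expo (suc m) n ℤ.+ z ℤ.+ + σ)
        (sym (trans (ℤₚ.pos-* (suc (n + suc m) * η) (suc K)) (cong (ℤ._* k) (ℤₚ.pos-* (suc (n + suc m)) η)))))
        where
        e : ∀ a b c d → a ℤ.+ b ℤ.+ (c ℤ.- d) ℤ.+ d ≡ a ℤ.+ b ℤ.+ c
        e = ℤ-Solver.solve-∀
      right : + (expo m (suc n) + suc m * η + lam * (suc n * η))
            ≡ + expo m (suc n) ℤ.+ + suc m ℤ.* H ℤ.+ + lam ℤ.* (+ suc n ℤ.* H)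
      right = cong₂ (λ y z → + expo m (suc n) ℤ.+ y ℤ.+ z) (ℤₚ.pos-* (suc m) η)
        (trans (ℤₚ.pos-* lam (suc n * η)) (cong (λ z → + lam ℤ.* z) (ℤₚ.pos-* (suc n) η)))
    arrange : ∀ P s e q p Φ R u q⁻ w f →
      P ⊗ (s ⊗ e ⊗ ((𝟏 ⊕ ⊖ q) ⊗ p) ⊗ (Φ ⊗ R)) ⊗ (u ⊗ (q⁻ ⊗ (𝟏 ⊕ q) ⊗ (w ⊗ f)))
      ≈ (e ⊗ u ⊗ w) ⊗ ⊖ (P ⊗ (⊖ s ⊗ p ⊗ ((Φ ⊗ f) ⊗ R)) ⊗ (q⁻ ⊗ (𝟏 ⊕ ⊖ (q ⊗ q))))
    arrange = Solver.solve-∀ laurentRing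
    arrange′ : ∀ P s e u p Φ R q⁻ z →
      (e ⊗ u) ⊗ ⊖ (P ⊗ (⊖ s ⊗ p ⊗ (Φ ⊗ R)) ⊗ (q⁻ ⊗ z)) ≈ ⊖ (P ⊗ (⊖ s ⊗ e ⊗ p ⊗ (Φ ⊗ R)) ⊗ (q⁻ ⊗ z ⊗ u))
    arrange′ = Solver.solve-∀ laurentRing

  x : ℕ → Laurent
  x m = Q (+ suc m)

  module Natural (m d : ℕ) where

    private
      module C  = Col m (suc d)
      module C′ = Col (suc m) d

    open C public using (G)
    open C′ public using () renaming (free to free′)

    -- The contributions to free′ (k − 1 − c) that are matched with the two
    -- exponentials of the n-th term of G.
    p s : ℤ → ℕ → Laurent
    p c n = a m d n ⊗ (Q (ℤ.- + n) ⊗ (𝟏 ⊕ ⊖ (mon (ν m n) ⊗ mon (ν m n)))) ⊗ mon (+ n ℤ.* H ℤ.* c)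
    s c n = a m d n ⊗ (Q (ℤ.- + n) ⊗ (𝟏 ⊕ ⊖ (Q (+ n) ⊗ Q (+ n))) ⊗ x m) ⊗ mon (ℤ.- (ν m n ℤ.* c))

    -- Period m has one index more than period m + 1 in the truncated sums, so `p c (suc d)` finds
    -- no partner; it is the truncation error.
    free′-ps : ∀ c → free′ (cols (suc m)) (+ K ℤ.- c) ⊕ p c (suc d) ≈ ∑ (suc (suc d)) (λ n → p c n ⊕ s c n)
    free′-ps c = begin
      free′ (cols (suc m)) (+ K ℤ.- c) ⊕ p c (suc d)
        ≈⟨ ⊕-cong (≈-trans (C′.free-exp (cols (suc m)) (+ K ℤ.- c)) (∑-cong (suc d) term)) ≈-refl ⟩
      ∑ (suc d) (λ n → p c n ⊕ s c (suc n)) ⊕ p c (suc d)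
        ≈⟨ ⊕-cong (∑-⊕ (suc d) (p c) (λ n → s c (suc n))) ≈-refl ⟩
      ∑ (suc d) (p c) ⊕ ∑ (suc d) (λ n → s c (suc n)) ⊕ p c (suc d)
        ≈⟨ shuffle _ _ _ ⟩
      ∑ (suc (suc d)) (p c) ⊕ (𝟎 ⊕ ∑ (suc d) (λ n → s c (suc n)))
        ≈⟨ ⊕-cong ≈-refl (≈-trans (⊕-cong (≈-sym s-zero) ≈-refl) (≈-sym (∑-front (suc d) (s c)))) ⟩
      ∑ (suc (suc d)) (p c) ⊕ ∑ (suc (suc d)) (s c)
        ≈⟨ ∑-⊕ (suc (suc d)) (p c) (s c) ⟨
      ∑ (suc (suc d)) (λ n → p c n ⊕ s c n) ∎
      where
      shuffle : ∀ u v w → u ⊕ v ⊕ w ≈ (u ⊕ w) ⊕ (𝟎 ⊕ v)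
      shuffle = Solver.solve-∀ laurentRing
      s-zero : s c 0 ≈ 𝟎
      s-zero = ≈-trans (⊗-cong (⊗-cong ≈-refl (⊗-cong (⊗-cong ≈-refl (⊕-cong ≈-refl
          (⊖-cong (⊗-cong q₀ q₀)))) ≈-refl)) ≈-refl) (vanishes (a m d 0) (Q (ℤ.- + 0)) (x m) _)
        where
        q₀ : Q (+ 0) ≈ 𝟏
        q₀ = ≈-trans (mon-≡ (ℤₚ.*-zeroˡ H)) mon-0
        vanishes : ∀ a q y z → a ⊗ (q ⊗ (𝟏 ⊕ ⊖ (𝟏 ⊗ 𝟏)) ⊗ y) ⊗ z ≈ 𝟎
        vanishes = Solver.solve-∀ laurentRing
      split : ∀ j → mon (j ℤ.* (+ K ℤ.- c ℤ.+ 1ℤ)) ≈ mon (j ℤ.* k) ⊗ mon (ℤ.- (j ℤ.* c))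
      split j = ≈-trans (mon-≡ (e j (+ K) c)) (mon-+ (j ℤ.* k) (ℤ.- (j ℤ.* c)))
        where
        e : ∀ j K c → j ℤ.* (K ℤ.- c ℤ.+ 1ℤ) ≡ j ℤ.* (1ℤ ℤ.+ K) ℤ.+ ℤ.- (j ℤ.* c)
        e = ℤ-Solver.solve-∀
      term : ∀ n → n < suc d → A (suc m) d n ⊗
        (mon (κ n ℤ.* (+ K ℤ.- c ℤ.+ 1ℤ)) ⊗ C′.factors (cols (suc m)) (κ n)
          ⊕ ⊖ (mon (ν (suc m) n ℤ.* (+ K ℤ.- c ℤ.+ 1ℤ)) ⊗ C′.factors (cols (suc m)) (ν (suc m) n)))
        ≈ p c n ⊕ s c (suc n)
      term n n< = ≈-trans (⊗-cong ≈-refl (⊕-cong (⊗-cong (split (κ n)) ≈-refl) (⊖-cong (⊗-cong (split (ν (suc m) n)) ≈-refl))))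
        (≈-trans (distr (A (suc m) d n) _ _ _ _ _ _)
          (≈-trans (⊕-cong (⊗-cong (rel₁ m d n (ℕₚ.≤-pred n<)) (mon-≡ (e (+ n) H c)))
                           (⊖-cong (⊗-cong (rel₂ m d n (ℕₚ.≤-pred n<)) (mon-≡ (cong (λ z → ℤ.- (+ suc z ℤ.* H ℤ.* c)) (ℕₚ.+-suc n m))))))
             (⊕-cong ≈-refl (neg-neg _ _))))
        where
        e : ∀ n h c → ℤ.- (ℤ.- (n ℤ.* h) ℤ.* c) ≡ n ℤ.* h ℤ.* c
        e = ℤ-Solver.solve-∀
        distr : ∀ A u v f u′ v′ g → A ⊗ ((u ⊗ v) ⊗ f ⊕ ⊖ ((u′ ⊗ v′) ⊗ g)) ≈ (A ⊗ (u ⊗ f)) ⊗ v ⊕ ⊖ ((A ⊗ (u′ ⊗ g)) ⊗ v′)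
        distr = Solver.solve-∀ laurentRing
        neg-neg : ∀ u v → ⊖ (⊖ u ⊗ v) ≈ u ⊗ v
        neg-neg = Solver.solve-∀ laurentRing

    G₀-ps : G 0ℤ ≈ ∑ (suc (suc d)) (λ n → p 0ℤ n ⊕ s 0ℤ n)
    G₀-ps = ∑-cong (suc (suc d)) λ n _ → begin
      A m (suc d) n ⊗ (mon (κ n ℤ.* 1ℤ) ⊕ ⊖ mon (ν m n ℤ.* 1ℤ))
        ≈⟨ ⊗-cong (A≈a m d n) (⊕-cong (mon-≡ (e₁ (+ n) H))
             (⊖-cong (≈-trans (mon-≡ (e₂ (+ n) (+ m) H)) (≈-trans (Q-+ (+ n) (+ suc m)) (⊗-cong ≈-refl ≈-refl))))) ⟩
      (𝟏 ⊕ x m) ⊗ a m d n ⊗ (Q (ℤ.- + n) ⊕ ⊖ (Q (+ n) ⊗ x m))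
        ≈⟨ ⊗-cong ≈-refl (⊕-cong ≈-refl (⊖-cong (≈-trans (≈-sym (⊗-identityˡ _)) (⊗-cong (≈-sym (inv n)) ≈-refl)))) ⟩
      (𝟏 ⊕ x m) ⊗ a m d n ⊗ (Q (ℤ.- + n) ⊕ ⊖ (Q (ℤ.- + n) ⊗ Q (+ n) ⊗ (Q (+ n) ⊗ x m)))
        ≈⟨ collect (a m d n) (Q (ℤ.- + n)) (Q (+ n)) (x m) ⟩
      a m d n ⊗ (Q (ℤ.- + n) ⊗ (𝟏 ⊕ ⊖ ((Q (+ n) ⊗ x m) ⊗ (Q (+ n) ⊗ x m)))) ⊗ 𝟏
        ⊕ a m d n ⊗ (Q (ℤ.- + n) ⊗ (𝟏 ⊕ ⊖ (Q (+ n) ⊗ Q (+ n))) ⊗ x m) ⊗ 𝟏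
        ≈⟨ ⊕-cong (⊗-cong (⊗-cong ≈-refl (⊗-cong ≈-refl (⊕-cong ≈-refl (⊖-cong (⊗-cong (ν-split n) (ν-split n))))))
                     (≈-sym (≈-trans (mon-≡ (ℤₚ.*-zeroʳ (+ n ℤ.* H))) mon-0)))
                  (⊗-cong ≈-refl (≈-sym (≈-trans (mon-≡ (e₃ (ν m n))) mon-0))) ⟩
      p 0ℤ n ⊕ s 0ℤ n ∎
      where
      e₁ : ∀ n h → ℤ.- (n ℤ.* h) ℤ.* 1ℤ ≡ ℤ.- n ℤ.* h
      e₁ = ℤ-Solver.solve-∀
      e₂ : ∀ n m h → (1ℤ ℤ.+ (n ℤ.+ m)) ℤ.* h ℤ.* 1ℤ ≡ (n ℤ.+ (1ℤ ℤ.+ m)) ℤ.* h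
      e₂ = ℤ-Solver.solve-∀
      e₃ : ∀ z → ℤ.- (z ℤ.* 0ℤ) ≡ 0ℤ
      e₃ = ℤ-Solver.solve-∀
      e₄ : ∀ n m h → (n ℤ.+ (1ℤ ℤ.+ m)) ℤ.* h ≡ (1ℤ ℤ.+ (n ℤ.+ m)) ℤ.* h
      e₄ = ℤ-Solver.solve-∀
      ν-split : ∀ n → Q (+ n) ⊗ x m ≈ mon (ν m n)
      ν-split n = ≈-trans (≈-sym (Q-+ (+ n) (+ suc m))) (mon-≡ (e₄ (+ n) (+ m) H))
      inv : ∀ n → Q (ℤ.- + n) ⊗ Q (+ n) ≈ 𝟏
      inv n = ≈-trans (≈-sym (Q-+ (ℤ.- + n) (+ n))) (≈-trans (mon-≡ (trans (cong (ℤ._* H) (ℤₚ.+-inverseˡ (+ n))) (ℤₚ.*-zeroˡ H))) mon-0)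
      collect : ∀ a q⁻ q x → (𝟏 ⊕ x) ⊗ a ⊗ (q⁻ ⊕ ⊖ (q⁻ ⊗ q ⊗ (q ⊗ x)))
        ≈ a ⊗ (q⁻ ⊗ (𝟏 ⊕ ⊖ ((q ⊗ x) ⊗ (q ⊗ x)))) ⊗ 𝟏 ⊕ a ⊗ (q⁻ ⊗ (𝟏 ⊕ ⊖ (q ⊗ q)) ⊗ x) ⊗ 𝟏
      collect = Solver.solve-∀ laurentRing

    -- The step of two in c is the analytic form of the parity in condition (5): from slack c - 1 to
    -- c + 1 the multiplicities c and c + 1 are new, and both leave the same slack to the next
    -- column, whence the factor 1 + x.
    G-step-ps : ∀ c → G (c ℤ.+ 1ℤ) ≈ G (c ℤ.- 1ℤ) ⊕
      Q (+ suc m ℤ.* c) ⊗ (𝟏 ⊕ x m) ⊗ ∑ (suc (suc d)) (λ n → p (c ℤ.+ 1ℤ) n ⊕ s (c ℤ.+ 1ℤ) n)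
    G-step-ps c = ≈-trans (∑-cong (suc (suc d)) term)
      (≈-trans (∑-⊕ (suc (suc d)) _ _) (⊕-cong ≈-refl (≈-sym (∑-⊗ (suc (suc d)) _ _))))
      where
      term : ∀ n → n < suc (suc d) →
        A m (suc d) n ⊗ (mon (κ n ℤ.* (c ℤ.+ 1ℤ ℤ.+ 1ℤ)) ⊕ ⊖ mon (ν m n ℤ.* (c ℤ.+ 1ℤ ℤ.+ 1ℤ)))
        ≈ A m (suc d) n ⊗ (mon (κ n ℤ.* (c ℤ.- 1ℤ ℤ.+ 1ℤ)) ⊕ ⊖ mon (ν m n ℤ.* (c ℤ.- 1ℤ ℤ.+ 1ℤ)))
          ⊕ Q (+ suc m ℤ.* c) ⊗ (𝟏 ⊕ x m) ⊗ (p (c ℤ.+ 1ℤ) n ⊕ s (c ℤ.+ 1ℤ) n)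
      term n _ = begin
        A m (suc d) n ⊗ (mon (κ n ℤ.* (c ℤ.+ 1ℤ ℤ.+ 1ℤ)) ⊕ ⊖ mon (ν m n ℤ.* (c ℤ.+ 1ℤ ℤ.+ 1ℤ)))
          ≈⟨ ⊗-cong (A≈a m d n) (⊕-cong ≈-refl (⊖-cong (≈-trans (mon-≡ (e₁ (ν m n) c)) (mon³ _ _ _)))) ⟩
        (𝟏 ⊕ x m) ⊗ a m d n ⊗ (u⁺ ⊕ ⊖ (v ⊗ X ⊗ X))
          ≈⟨ collect (x m) (a m d n) u⁺ u v X ⟩
        (𝟏 ⊕ x m) ⊗ a m d n ⊗ (u ⊕ ⊖ v) ⊕ (𝟏 ⊕ x m) ⊗ (a m d n ⊗ (v ⊗ (𝟏 ⊕ ⊖ (X ⊗ X))) ⊕ a m d n ⊗ (u⁺ ⊕ ⊖ u))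
          ≈⟨ ⊕-cong (⊗-cong (≈-sym (A≈a m d n)) (⊕-cong (mon-≡ (e₂ (κ n) c)) (⊖-cong (mon-≡ (e₂ (ν m n) c)))))
                    (⊗-cong ≈-refl (⊕-cong (⊗-cong ≈-refl (⊗-cong v-eq ≈-refl)) (⊗-cong ≈-refl (⊕-cong u⁺-eq (⊖-cong u-eq))))) ⟩
        old ⊕ (𝟏 ⊕ x m) ⊗ (a m d n ⊗ (w ⊗ q⁻ ⊗ r ⊗ (𝟏 ⊕ ⊖ (X ⊗ X)))
                             ⊕ a m d n ⊗ (w ⊗ q⁻ ⊗ x m ⊗ t ⊕ ⊖ (w ⊗ q⁻ ⊗ x m ⊗ t ⊗ (q ⊗ q))))
          ≈⟨ collect′ old (x m) (a m d n) w q⁻ r X t q ⟩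
        old ⊕ w ⊗ (𝟏 ⊕ x m) ⊗ (p (c ℤ.+ 1ℤ) n ⊕ s (c ℤ.+ 1ℤ) n) ∎
        where
        old w q⁻ q r X t u u⁺ v : Laurent
        old = A m (suc d) n ⊗ (mon (κ n ℤ.* (c ℤ.- 1ℤ ℤ.+ 1ℤ)) ⊕ ⊖ mon (ν m n ℤ.* (c ℤ.- 1ℤ ℤ.+ 1ℤ)))
        w   = Q (+ suc m ℤ.* c)
        q⁻  = Q (ℤ.- + n)
        q   = Q (+ n)
        r   = mon (+ n ℤ.* H ℤ.* (c ℤ.+ 1ℤ))
        X   = mon (ν m n)
        t   = mon (ℤ.- (ν m n ℤ.* (c ℤ.+ 1ℤ)))
        u   = mon (κ n ℤ.* c)
        u⁺  = mon (κ n ℤ.* (c ℤ.+ 1ℤ ℤ.+ 1ℤ))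
        v   = mon (ν m n ℤ.* c)
        mon³ : ∀ i j l → mon (i ℤ.+ j ℤ.+ l) ≈ mon i ⊗ mon j ⊗ mon l
        mon³ i j l = ≈-trans (mon-+ (i ℤ.+ j) l) (⊗-cong (mon-+ i j) ≈-refl)
        mon⁴ : ∀ i j l h → mon (i ℤ.+ j ℤ.+ l ℤ.+ h) ≈ mon i ⊗ mon j ⊗ mon l ⊗ mon h
        mon⁴ i j l h = ≈-trans (mon-+ (i ℤ.+ j ℤ.+ l) h) (⊗-cong (mon³ i j l) ≈-refl)
        e₁ : ∀ z c → z ℤ.* (c ℤ.+ 1ℤ ℤ.+ 1ℤ) ≡ z ℤ.* c ℤ.+ z ℤ.+ z
        e₁ = ℤ-Solver.solve-∀
        e₂ : ∀ z c → z ℤ.* c ≡ z ℤ.* (c ℤ.- 1ℤ ℤ.+ 1ℤ)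
        e₂ = ℤ-Solver.solve-∀
        v-eq : v ≈ w ⊗ q⁻ ⊗ r
        v-eq = ≈-trans (mon-≡ (e (+ n) (+ m) H c)) (mon³ (+ suc m ℤ.* c ℤ.* H) (ℤ.- + n ℤ.* H) (+ n ℤ.* H ℤ.* (c ℤ.+ 1ℤ)))
          where
          e : ∀ n m h c → (1ℤ ℤ.+ (n ℤ.+ m)) ℤ.* h ℤ.* c
            ≡ (1ℤ ℤ.+ m) ℤ.* c ℤ.* h ℤ.+ ℤ.- n ℤ.* h ℤ.+ n ℤ.* h ℤ.* (c ℤ.+ 1ℤ)
          e = ℤ-Solver.solve-∀
        u⁺-eq : u⁺ ≈ w ⊗ q⁻ ⊗ x m ⊗ t
        u⁺-eq = ≈-trans (mon-≡ (e (+ n) (+ m) H c))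
          (mon⁴ (+ suc m ℤ.* c ℤ.* H) (ℤ.- + n ℤ.* H) (+ suc m ℤ.* H) (ℤ.- (ν m n ℤ.* (c ℤ.+ 1ℤ))))
          where
          e : ∀ n m h c → ℤ.- (n ℤ.* h) ℤ.* (c ℤ.+ 1ℤ ℤ.+ 1ℤ)
            ≡ (1ℤ ℤ.+ m) ℤ.* c ℤ.* h ℤ.+ ℤ.- n ℤ.* h ℤ.+ (1ℤ ℤ.+ m) ℤ.* h ℤ.+ ℤ.- ((1ℤ ℤ.+ (n ℤ.+ m)) ℤ.* h ℤ.* (c ℤ.+ 1ℤ))
          e = ℤ-Solver.solve-∀
        u-eq : u ≈ w ⊗ q⁻ ⊗ x m ⊗ t ⊗ (q ⊗ q)
        u-eq = ≈-trans (mon-≡ (e (+ n) H c)) (≈-trans (mon-+ (κ n ℤ.* (c ℤ.+ 1ℤ ℤ.+ 1ℤ)) _)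
                 (⊗-cong u⁺-eq (mon-+ (+ n ℤ.* H) (+ n ℤ.* H))))
          where
          e : ∀ n h c → ℤ.- (n ℤ.* h) ℤ.* c ≡ ℤ.- (n ℤ.* h) ℤ.* (c ℤ.+ 1ℤ ℤ.+ 1ℤ) ℤ.+ (n ℤ.* h ℤ.+ n ℤ.* h)
          e = ℤ-Solver.solve-∀
        collect : ∀ x a u⁺ u v X → (𝟏 ⊕ x) ⊗ a ⊗ (u⁺ ⊕ ⊖ (v ⊗ X ⊗ X))
          ≈ (𝟏 ⊕ x) ⊗ a ⊗ (u ⊕ ⊖ v) ⊕ (𝟏 ⊕ x) ⊗ (a ⊗ (v ⊗ (𝟏 ⊕ ⊖ (X ⊗ X))) ⊕ a ⊗ (u⁺ ⊕ ⊖ u))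
        collect = Solver.solve-∀ laurentRing
        collect′ : ∀ old x a w q⁻ r X t q →
          old ⊕ (𝟏 ⊕ x) ⊗ (a ⊗ (w ⊗ q⁻ ⊗ r ⊗ (𝟏 ⊕ ⊖ (X ⊗ X))) ⊕ a ⊗ (w ⊗ q⁻ ⊗ x ⊗ t ⊕ ⊖ (w ⊗ q⁻ ⊗ x ⊗ t ⊗ (q ⊗ q))))
          ≈ old ⊕ w ⊗ (𝟏 ⊕ x) ⊗ (a ⊗ (q⁻ ⊗ (𝟏 ⊕ ⊖ (X ⊗ X))) ⊗ r ⊕ a ⊗ (q⁻ ⊗ (𝟏 ⊕ ⊖ (q ⊗ q)) ⊗ x) ⊗ t)
        collect′ = Solver.solve-∀ laurentRing

-- The closed form for all later columns, by induction on the number of periods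

par : ℕ → ℕ
par 0             = 0
par 1             = 1
par (suc (suc n)) = par n

par≤ : ∀ n → par n ≤ n
par≤ 0             = z≤n
par≤ 1             = s≤s z≤n
par≤ (suc (suc n)) = ℕₚ.m≤n⇒m≤1+n (ℕₚ.m≤n⇒m≤1+n (par≤ n))

par≤1 : ∀ n → par n ≤ 1
par≤1 0             = z≤n
par≤1 1             = s≤s z≤n
par≤1 (suc (suc n)) = par≤1 n

tri≥ : ∀ n → n ≤ tri n
tri≥ zero    = z≤n
tri≥ (suc n) = ℕₚ.m≤n+m (suc n) (tri n)

^^-+ : ∀ y i j → y ^^ (i + j) ≈ y ^^ i ⊗ y ^^ j
^^-+ y zero    j = ≈-sym (⊗-identityˡ _)
^^-+ y (suc i) j = ≈-trans (⊗-cong ≈-refl (^^-+ y i j)) (≈-sym (⊗-assoc y _ _))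

^^-inv : ∀ y z n → y ⊗ z ≈ 𝟏 → y ^^ n ⊗ z ^^ n ≈ 𝟏
^^-inv y z zero    e = ≈-refl
^^-inv y z (suc n) e = ≈-trans (interchange⊗ y _ z _) (≈-trans (⊗-cong e (^^-inv y z n e)) (⊗-identityˡ 𝟏))

module Main (η K lam M σ : ℕ) (rs : List ℕ) (M+lam : M + lam ≡ K + suc K)
  (len-rs : length rs ≡ lam) (sum-rs : sum rs ≡ σ)
  (reflect : ∀ (g : ℤ → Laurent) → ∏ₗ rs (λ j → g (+ η ℤ.- + j)) ≈ ∏ₗ rs (λ j → g (+ j)))
  (1≤η : 1 ≤ η) (lam<K : suc lam ≤ K) where

  open Params η K lam M σ rs M+lam len-rs sum-rs reflect

  -- The summand n η pays for the factor q^(-n η) in `p`; what remains makes the truncation error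
  -- vanish to order m + n.
  expo-bound : ∀ m n → 1 ≤ n → m + n + n * η ≤ expo m n
  expo-bound m n 1≤n = ℕₚ.≤-trans (ℕₚ.≤-reflexive (l₁ m n (n * η)))
    (ℕₚ.+-mono-≤ (ℕₚ.≤-trans (ℕₚ.≤-trans left left′) (ℕₚ.m≤m+n _ (n * σ))) right)
    where
    l₁ : ∀ m n z → m + n + z ≡ (n + z) + m
    l₁ = ℕ-Solver.solve-∀
    2≤M : 2 ≤ M
    2≤M = ℕₚ.≤-trans (s≤s 1≤K) (ℕₚ.+-cancelʳ-≤ lam (suc K) M
            (ℕₚ.≤-trans (ℕₚ.+-monoʳ-≤ (suc K) (ℕₚ.≤-trans (ℕₚ.n≤1+n lam) lam<K))
              (ℕₚ.≤-reflexive (trans (sym (ℕₚ.+-suc K K)) (sym M+lam)))))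
      where
      1≤K : 1 ≤ K
      1≤K = ℕₚ.≤-trans (s≤s z≤n) lam<K
    left : n + n * η ≤ η * (2 * n)
    left = ℕₚ.≤-trans (ℕₚ.+-monoˡ-≤ (n * η) (ℕₚ.≤-trans (ℕₚ.≤-reflexive (sym (ℕₚ.*-identityʳ n))) (ℕₚ.*-monoʳ-≤ n 1≤η)))
             (ℕₚ.≤-reflexive (l₂ n η))
      where
      l₂ : ∀ n h → n * h + n * h ≡ h * (2 * n)
      l₂ = ℕ-Solver.solve-∀
    left′ : η * (2 * n) ≤ η * (M * tri n)
    left′ = ℕₚ.*-monoʳ-≤ η (ℕₚ.*-mono-≤ 2≤M (tri≥ n))
    right : m ≤ m * (n * (K * η))
    right = ℕₚ.≤-trans (ℕₚ.≤-reflexive (sym (ℕₚ.*-identityʳ m)))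
      (ℕₚ.*-monoʳ-≤ m (ℕₚ.*-mono-≤ 1≤n (ℕₚ.*-mono-≤ (ℕₚ.≤-trans (s≤s z≤n) lam<K) 1≤η)))

  x^^ : ∀ m c → x m ^^ c ≈ Q (+ suc m ℤ.* + c)
  x^^ m zero    = ≈-sym (≈-trans (mon-≡ (e (+ suc m) H)) mon-0)
    where
    e : ∀ m h → m ℤ.* 0ℤ ℤ.* h ≡ 0ℤ
    e = ℤ-Solver.solve-∀
  x^^ m (suc c) = ≈-trans (⊗-cong ≈-refl (x^^ m c))
    (≈-trans (≈-sym (Q-+ (+ suc m) (+ suc m ℤ.* + c))) (mon-≡ (cong (ℤ._* H) (e (+ suc m) (+ c)))))
    where
    e : ∀ m c → m ℤ.+ m ℤ.* c ≡ m ℤ.* (1ℤ ℤ.+ c)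
    e = ℤ-Solver.solve-∀

  ord-x^^ : ∀ m c → Ord 0ℤ (x m ^^ c)
  ord-x^^ m zero    = ord-con 1ℤ
  ord-x^^ m (suc c) = ord-⊗ˡ (ord-Q (suc m)) (ord-x^^ m c)

  module NaturalRecursion (m d : ℕ) where

    open Natural m d

    J : ℤ
    J = + (m + suc d)

    ord-1-X² : Ord 0ℤ (𝟏 ⊕ ⊖ (mon (ν m (suc d)) ⊗ mon (ν m (suc d))))
    ord-1-X² = ord-⊕ (ord-con 1ℤ) (ord-⊖ (ord-⊗ˡ (ord-Q (suc (suc d + m))) (ord-Q (suc (suc d + m)))))

    ord-p₀ : Ord J (p 0ℤ (suc d))
    ord-p₀ = ord-weaken bound (ord-⊗ˡ (ord-⊗ (ord-a m d (suc d)) (ord-⊗ˡ ord-mon ord-1-X²))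
      (ord-≈ (≈-sym (≈-trans (mon-≡ (ℤₚ.*-zeroʳ (+ suc d ℤ.* H))) mon-0)) (ord-con 1ℤ)))
      where
      bound : J ℤ.≤ + expo m (suc d) ℤ.+ (ℤ.- + suc d ℤ.* H)
      bound = subst (ℤ._≤ + expo m (suc d) ℤ.+ (ℤ.- + suc d ℤ.* H)) (e J (+ suc d) H)
        (ℤₚ.+-monoˡ-≤ (ℤ.- + suc d ℤ.* H) (subst (λ z → J ℤ.+ z ℤ.≤ + expo m (suc d)) (ℤₚ.pos-* (suc d) η)
          (ℤ.+≤+ (expo-bound m (suc d) (s≤s z≤n)))))
        where
        e : ∀ j n h → j ℤ.+ n ℤ.* h ℤ.+ ℤ.- n ℤ.* h ≡ j
        e = ℤ-Solver.solve-∀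

    ord-p₊ : ∀ c → Ord J (p (+ c ℤ.+ 1ℤ) (suc d))
    ord-p₊ c = ord-≈ (≈-sym merge) (ord-weaken (ℤ.+≤+ (ℕₚ.≤-trans (ℕₚ.m≤m+n _ _) (expo-bound m (suc d) (s≤s z≤n))))
      (ord-⊗ˡ (ord-⊗ˡ (ord-a m d (suc d)) ord-1-X²) (ord-mon₀ (suc d * η * c))))
      where
      e : ∀ n h c → ℤ.- n ℤ.* h ℤ.+ n ℤ.* h ℤ.* (c ℤ.+ 1ℤ) ≡ n ℤ.* h ℤ.* c
      e = ℤ-Solver.solve-∀
      arrange : ∀ a q z t → a ⊗ (q ⊗ z) ⊗ t ≈ a ⊗ z ⊗ (q ⊗ t)
      arrange = Solver.solve-∀ laurentRing
      merge : p (+ c ℤ.+ 1ℤ) (suc d) ≈ a m d (suc d) ⊗ (𝟏 ⊕ ⊖ (mon (ν m (suc d)) ⊗ mon (ν m (suc d)))) ⊗ mon (+ (suc d * η * c))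
      merge = ≈-trans (arrange _ _ _ _) (⊗-cong ≈-refl (≈-trans (≈-sym (mon-+ (ℤ.- + suc d ℤ.* H) (+ suc d ℤ.* H ℤ.* (+ c ℤ.+ 1ℤ))))
        (mon-≡ (trans (e (+ suc d) H (+ c)) (sym (trans (ℤₚ.pos-* (suc d * η) c) (cong (ℤ._* + c) (ℤₚ.pos-* (suc d) η))))))))

    free∸ : ℕ → Laurent
    free∸ j = free′ (cols (suc m)) (+ (K ∸ j))

    recursion : ℕ → Laurent
    recursion c = ∑ (suc c) (λ f → x m ^^ f ⊗ free∸ (f + par (c ∸ f)))

    recursion-step : ∀ c → recursion (suc (suc c))
      ≈ recursion c ⊕ Q (+ suc m ℤ.* + suc c) ⊗ (𝟏 ⊕ x m) ⊗ free∸ (suc (suc c))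
    recursion-step c = ≈-trans
      (⊕-cong (⊕-cong (∑-cong (suc c) (λ f f< → ⊗-cong ≈-refl
          (≈-reflexive (cong (λ z → free∸ (f + par z)) (ℕₚ.+-∸-assoc 2 (ℕₚ.≤-pred f<))))))
        (⊗-cong (x^^ m (suc c)) (≈-reflexive (cong free∸ e₁))))
        (⊗-cong (⊗-cong ≈-refl (x^^ m (suc c))) (≈-reflexive (cong free∸ e₂))))
      (lemma _ _ (x m) _)
      where
      e₁ : suc c + par (suc (suc c) ∸ suc c) ≡ suc (suc c)
      e₁ = trans (cong (λ z → suc c + par z) (ℕₚ.m+n∸n≡m 1 c)) (ℕₚ.+-comm (suc c) 1)
      e₂ : suc (suc c) + par (suc (suc c) ∸ suc (suc c)) ≡ suc (suc c)
      e₂ = trans (cong (λ z → suc (suc c) + par z) (ℕₚ.n∸n≡0 c)) (ℕₚ.+-identityʳ _)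
      lemma : ∀ r w x f → r ⊕ w ⊗ f ⊕ (x ⊗ w) ⊗ f ≈ r ⊕ w ⊗ (𝟏 ⊕ x) ⊗ f
      lemma = Solver.solve-∀ laurentRing

    ∸-ℤ : ∀ {c} → c ≤ K → + K ℤ.- + c ≡ + (K ∸ c)
    ∸-ℤ {c} c≤K = trans (ℤₚ.m-n≡m⊖n K c) (ℤₚ.⊖-≥ c≤K)

    ps-≃ : ∀ c → Ord J (p (+ c) (suc d)) → c ≤ K →
      ∑ (suc (suc d)) (λ n → p (+ c) n ⊕ s (+ c) n) ≃[ J ] free∸ c
    ps-≃ c o c≤K = ≃-trans (≈⇒≃ (≈-sym (free′-ps (+ c)))) (≃-trans (≃-⊕ ≃-refl (≃𝟎 o))
      (≈⇒≃ (≈-trans (⊕-identityʳ _) (≈-reflexive (cong (free′ (cols (suc m))) (∸-ℤ c≤K))))))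

    +1≡suc : ∀ c → + c ℤ.+ 1ℤ ≡ + suc c
    +1≡suc c = cong +_ (ℕₚ.+-comm c 1)

    step-≃ : ∀ c → suc c ≤ K → G (+ suc c) ≃[ J ] G (+ c ℤ.- 1ℤ) ⊕ Q (+ suc m ℤ.* + c) ⊗ (𝟏 ⊕ x m) ⊗ free∸ (suc c)
    step-≃ c c<K = ≃-trans (≈⇒≃ (≈-trans (≈-reflexive (cong G (sym (+1≡suc c)))) (G-step-ps (+ c))))
      (≃-⊕ ≃-refl (≃-⊗ʳ (ord-⊗ˡ (ord-≈ (x^^ m c) (ord-x^^ m c)) (ord-⊕ (ord-con 1ℤ) (ord-Q (suc m))))
        (subst (λ z → ∑ (suc (suc d)) (λ n → p z n ⊕ s z n) ≃[ J ] free∸ (suc c)) (sym (+1≡suc c))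
          (ps-≃ (suc c) (subst (λ z → Ord J (p z (suc d))) (+1≡suc c) (ord-p₊ c)) c<K))))

    -- Up to truncation G obeys the recursion over the multiplicity of (m + 1) η, with the next
    -- column unrestricted. The case c = 1 starts from G (-1) = 0.
    natural : ∀ c → c ≤ K → G (+ c) ≃[ J ] recursion c
    natural zero c≤K = ≃-trans (≈⇒≃ G₀-ps) (≃-trans (ps-≃ 0 ord-p₀ c≤K) (≈⇒≃ (lemma _)))
      where
      lemma : ∀ z → z ≈ 𝟎 ⊕ 𝟏 ⊗ z
      lemma = Solver.solve-∀ laurentRing
    natural (suc zero) c≤K = ≃-trans (step-≃ 0 c≤K) (≈⇒≃ (≈-trans
      (⊕-cong (FreeExponential.G₋₁ (suc (suc d)) (A m (suc d)) κ (ν m)) (⊗-cong (⊗-cong (≈-sym (x^^ m 0)) ≈-refl) ≈-refl))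
      (lemma (x m) _)))
      where
      lemma : ∀ x z → 𝟎 ⊕ 𝟏 ⊗ (𝟏 ⊕ x) ⊗ z ≈ 𝟎 ⊕ 𝟏 ⊗ z ⊕ (x ⊗ 𝟏) ⊗ z
      lemma = Solver.solve-∀ laurentRing
    natural (suc (suc c)) c≤K = ≃-trans (step-≃ (suc c) c≤K)
      (≃-trans (≃-⊕ (natural c (ℕₚ.≤-trans (ℕₚ.n≤1+n c) (ℕₚ.≤-trans (ℕₚ.n≤1+n _) c≤K))) ≃-refl)
        (≈⇒≃ (≈-sym (recursion-step c))))

  -- What follows the column e of period m when the slack is c and d further
  -- periods are allowed; f is the number of parts (m + 1) η.  If c ∸ f is odd,
  -- filling up the next window violates condition (5), which costs one unit of slack.
  tail : ℕ → ℕ → List ℕ → ℕ → Laurent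
  tail zero    m e c = 𝟏
  tail (suc d) m e c = ∑ (suc c) (λ f → x m ^^ f ⊗
    bitsum (cols (suc m)) e (K ∸ (sum e + (f + par (c ∸ f)))) (tail d (suc m)))

  D : ℕ → Laurent
  D n = ∏ n (λ i → 𝟏 ⊕ ⊖ Q (+ suc i))

  ord-D : ∀ n → Ord 0ℤ (D n)
  ord-D n = ord-∏ n (λ i → ord-⊕ (ord-con 1ℤ) (ord-⊖ (ord-Q (suc i))))

  length-cols : ∀ m → length (cols m) ≡ suc lam
  length-cols zero    = cong suc (trans (Listₚ.length-map (λ α → mon (+ α)) rs) len-rs)
  length-cols (suc m) = trans (Listₚ.length-map (_⊗ mon H) (cols m)) (length-cols m)

  ord-alphas : ∀ xs → All (Ord 0ℤ) (map (λ α → mon (+ α)) xs)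
  ord-alphas []       = []
  ord-alphas (α ∷ xs) = ord-mon₀ α ∷ ord-alphas xs

  ord-cols : ∀ m → All (Ord 0ℤ) (cols m)
  ord-cols zero    = ord-mon₀ 0 ∷ ord-alphas rs
  ord-cols (suc m) = go (cols m) (ord-cols m)
    where
    go : ∀ bs → All (Ord 0ℤ) bs → All (Ord 0ℤ) (map (_⊗ mon H) bs)
    go []       []       = []
    go (b ∷ bs) (o ∷ os) = ord-⊗ˡ o (ord-mon₀ η) ∷ go bs os

  -- The sum m + d is the same for (m, suc d) and (suc m, d), so the factor D and the precision stay
  -- fixed along the induction.
  Closed : ℕ → ℕ → Set
  Closed m d = ∀ s c → Bits (suc lam) s → c + sum s ≤ K →
    D (m + d) ⊗ bitsum (cols m) s c (tail d m) ≃[ + (m + d) ] bitsum (cols m) s c (λ _ c′ → Col.G m d (+ c′))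

  -- Only the index 0 is left: G c is D m times 1 - q^((m + 1) η (c + 1)), and that monomial lies
  -- beyond the precision.
  closed-base : ∀ m → Closed m 0
  closed-base m s c (len , _) _ = ≃-trans (≈⇒≃ (bitsum-⊗ (cols m) s c (D (m + 0)) (tail 0 m)))
    (bitsum-≃ (cols m) s c (trans len (sym (length-cols m))) (ord-cols m) (λ e c′ _ _ → ≃-sym (leading c′)))
    where
    leading : ∀ c → Col.G m 0 (+ c) ≃[ + (m + 0) ] D (m + 0) ⊗ 𝟏
    leading c rewrite ℕₚ.+-identityʳ m = ≃-trans (≈⇒≃ (≈-trans
        (⊕-cong ≈-refl (⊗-cong (⊗-cong ≈-refl (⊗-cong (⊗-cong (⊗-cong ≈-refl e₀) ≈-refl) ≈-refl))
          (⊕-cong (≈-trans (mon-≡ (e₁ H (+ c ℤ.+ 1ℤ))) mon-0)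
                  (⊖-cong (mon-≡ e₂))))) (tidy (D m) (mon (+ (suc m * η * (c + 1)))))))
      (≃-trans (≃-⊕ ≃-refl (≃𝟎 (ord-⊖ (ord-⊗ʳ (ord-D m) (ord-weaken (ℤ.+≤+ bound) ord-mon)))))
               (≈⇒≃ (tidy′ (D m))))
      where
      e₀ : mon (+ expo m 0) ≈ 𝟏
      e₀ = ≈-trans (mon-≡ (cong +_ (z η M m))) mon-0
        where
        z : ∀ η M m → η * (M * 0) + 0 + m * 0 ≡ 0
        z = ℕ-Solver.solve-∀
      e₁ : ∀ h c → ℤ.- (0ℤ ℤ.* h) ℤ.* c ≡ 0ℤ
      e₁ = ℤ-Solver.solve-∀
      e₂ : ν m 0 ℤ.* (+ c ℤ.+ 1ℤ) ≡ + (suc m * η * (c + 1))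
      e₂ = sym (trans (ℤₚ.pos-* (suc m * η) (c + 1)) (cong (ℤ._* (+ c ℤ.+ 1ℤ)) (ℤₚ.pos-* (suc m) η)))
      tidy : ∀ D z → 𝟎 ⊕ 𝟏 ⊗ (𝟏 ⊗ 𝟏 ⊗ D ⊗ (𝟏 ⊗ 𝟏)) ⊗ (𝟏 ⊕ ⊖ z) ≈ D ⊕ ⊖ (D ⊗ z)
      tidy = Solver.solve-∀ laurentRing
      tidy′ : ∀ D → D ⊕ 𝟎 ≈ D ⊗ 𝟏
      tidy′ = Solver.solve-∀ laurentRing
      bound : m ≤ suc m * η * (c + 1)
      bound = ℕₚ.≤-trans (ℕₚ.≤-trans (ℕₚ.n≤1+n m) (ℕₚ.≤-reflexive (l (suc m))))
                (ℕₚ.*-mono-≤ (ℕₚ.*-monoʳ-≤ (suc m) 1≤η) (ℕₚ.m≤n+m 1 c))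
        where
        l : ∀ m → m ≡ m * 1 * 1
        l = ℕ-Solver.solve-∀

  module Step (m d : ℕ) (IH : Closed (suc m) d) where

    open NaturalRecursion m d
    open Natural m d using (G)
    private
      module C′ = Col (suc m) d

    κ+ν : ∀ n → κ n ℤ.+ ν (suc m) n ≡ + suc m ℤ.* H ℤ.+ H
    κ+ν n = e (+ n) (+ m) H
      where
      e : ∀ n m h → ℤ.- (n ℤ.* h) ℤ.+ (1ℤ ℤ.+ (n ℤ.+ (1ℤ ℤ.+ m))) ℤ.* h ≡ (1ℤ ℤ.+ m) ℤ.* h ℤ.+ h
      e = ℤ-Solver.solve-∀

    open C′.Swap (+ suc m ℤ.* H) H C′.G₋₁ (C′.antisym (+ suc m ℤ.* H ℤ.+ H) κ+ν) public

    cols′ : List Laurent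
    cols′ = cols (suc m)

    D′ : Laurent
    D′ = D (m + suc d)

    IH′ : ∀ s c → Bits (suc lam) s → c + sum s ≤ K →
      D′ ⊗ bitsum cols′ s c (tail d (suc m)) ≃[ J ] bitsum cols′ s c (λ _ c′ → C′.G (+ c′))
    IH′ s c b h = subst (λ z → D z ⊗ bitsum cols′ s c (tail d (suc m)) ≃[ + z ] bitsum cols′ s c (λ _ c′ → C′.G (+ c′)))
      (sym (ℕₚ.+-suc m d)) (IH s c b h)

    hits : List ℕ → ℕ → Laurent
    hits e c = ∑ (suc c) (λ f → x m ^^ f ⊗ C′.hit cols′ e (K ∸ (sum e + (f + par (c ∸ f)))))

    used≤ : ∀ {c f} → f ≤ c → f + par (c ∸ f) ≤ c
    used≤ {c} {f} f≤c = ℕₚ.≤-trans (ℕₚ.+-monoʳ-≤ f (par≤ (c ∸ f))) (ℕₚ.≤-reflexive (ℕₚ.m+[n∸m]≡n f≤c))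

    -- Replacing the restricted sums by unrestricted ones costs `hits`, and the unrestricted ones
    -- add up to G by `natural`.
    tail-≃ : ∀ e c → Bits (suc lam) e → c + sum e ≤ K → D′ ⊗ tail (suc d) m e c ≃[ J ] G (+ c) ⊕ ⊖ hits e c
    tail-≃ e c bits h = ≃-trans (≈⇒≃ (∑-⊗ (suc c) D′ _)) (≃-trans (∑-≃ (suc c) term)
      (≃-trans (≈⇒≃ (≈-trans (∑-⊕ (suc c) _ _) (⊕-cong ≈-refl (∑-⊖ (suc c) _))))
        (≃-⊕ (≃-sym (natural c (ℕₚ.≤-trans (ℕₚ.m≤m+n c _) h))) ≃-refl)))
      where
      term : ∀ f → f < suc c →
        D′ ⊗ (x m ^^ f ⊗ bitsum cols′ e (K ∸ (sum e + (f + par (c ∸ f)))) (tail d (suc m)))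
        ≃[ J ] x m ^^ f ⊗ free∸ (f + par (c ∸ f)) ⊕ ⊖ (x m ^^ f ⊗ C′.hit cols′ e (K ∸ (sum e + (f + par (c ∸ f)))))
      term f f< = ≃-trans (≈⇒≃ (swap D′ (x m ^^ f) _)) (≃-trans
        (≃-⊗ʳ (ord-x^^ m f) (IH′ e δ′ bits (ℕₚ.≤-trans (ℕₚ.≤-reflexive δ′+) (ℕₚ.m∸n≤m K u))))
        (≈⇒≃ (≈-trans (⊗-cong ≈-refl (≈-trans (move _ _) (⊕-cong
          (≈-trans (C′.bitsum-hit cols′ e δ′ (trans (proj₁ bits) (sym (length-cols (suc m)))))
                   (≈-reflexive (cong (λ z → C′.free cols′ (+ z)) δ′+))) ≈-refl))) (distr _ _ _))))
        where
        u δ′ : ℕ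
        u  = f + par (c ∸ f)
        δ′ = K ∸ (sum e + u)
        δ′+ : δ′ + sum e ≡ K ∸ u
        δ′+ = trans (cong (_+ sum e) (trans (cong (K ∸_) (ℕₚ.+-comm (sum e) u)) (sym (ℕₚ.∸-+-assoc K u (sum e)))))
                (ℕₚ.m∸n+n≡m (ℕₚ.m+n≤o⇒m≤o∸n (sum e) (ℕₚ.≤-trans (ℕₚ.+-monoʳ-≤ (sum e) (used≤ (ℕₚ.≤-pred f<)))
                  (ℕₚ.≤-trans (ℕₚ.≤-reflexive (ℕₚ.+-comm (sum e) c)) h))))
        swap : ∀ a b c → a ⊗ (b ⊗ c) ≈ b ⊗ (a ⊗ c)
        swap = Solver.solve-∀ laurentRing
        move : ∀ a b → a ≈ a ⊕ b ⊕ ⊖ b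
        move = Solver.solve-∀ laurentRing
        distr : ∀ a b c → a ⊗ (b ⊕ ⊖ c) ≈ a ⊗ b ⊕ ⊖ (a ⊗ c)
        distr = Solver.solve-∀ laurentRing

    -- Grouped by N = f + sum e, the slack left to the next column does not depend on e.
    hits-regroup : ∀ e c → Bits (suc lam) e → c + sum e ≤ K → hits e c ≈
      ∑ (suc (c + sum e)) (λ N → x m ^^ N ⊗ (y ^^ sum e ⊗ C′.hit cols′ e (K ∸ (N + par (c + sum e ∸ N)))))
    hits-regroup e c bits h = ≈-sym (≈-trans
      (≈-reflexive (cong (λ z → ∑ z g) (trans (cong suc (ℕₚ.+-comm c (sum e))) (sym (ℕₚ.+-suc (sum e) c)))))
      (≈-trans (∑-split (sum e) (suc c) g) (≈-trans (⊕-cong (∑-zero (sum e) low) (∑-cong (suc c) (λ i _ → high i))) (⊕-identityˡ _))))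
      where
      g : ℕ → Laurent
      g N = x m ^^ N ⊗ (y ^^ sum e ⊗ C′.hit cols′ e (K ∸ (N + par (c + sum e ∸ N))))
      -- Indices below sum e come from no f. Their terms vanish, since lam < K leaves no room for a
      -- crossing at so large a slack, and may be added to make the range of N independent of e.
      low : ∀ N → N < sum e → g N ≈ 𝟎
      low N N< = ≈-trans (⊗-cong ≈-refl (≈-trans (⊗-cong ≈-refl (C′.hit-vacuous cols′ e _
          (trans (proj₁ bits) (sym (length-cols (suc m))) , proj₂ bits)
          (ℕₚ.≤-trans (ℕₚ.≤-reflexive (length-cols (suc m))) (ℕₚ.≤-trans lam<K bound)))) (⊗-zeroʳ _))) (⊗-zeroʳ _)
        where
        bound : K ≤ K ∸ (N + par (c + sum e ∸ N)) + sum e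
        bound = ℕₚ.≤-trans (ℕₚ.m≤n+m∸n K (N + par (c + sum e ∸ N)))
          (ℕₚ.≤-trans (ℕₚ.+-monoˡ-≤ _ (ℕₚ.≤-trans (ℕₚ.+-monoʳ-≤ N (par≤1 (c + sum e ∸ N))) (ℕₚ.≤-trans (ℕₚ.≤-reflexive (ℕₚ.+-comm N 1)) N<)))
            (ℕₚ.≤-reflexive (ℕₚ.+-comm (sum e) _)))
      x⊗y : x m ⊗ y ≈ 𝟏
      x⊗y = mon-inv (+ suc m ℤ.* H)
      high : ∀ i → g (sum e + i) ≈ x m ^^ i ⊗ C′.hit cols′ e (K ∸ (sum e + (i + par (c ∸ i))))
      high i = ≈-trans (⊗-cong (^^-+ (x m) (sum e) i) (⊗-cong ≈-refl (≈-reflexive (cong (λ z → C′.hit cols′ e (K ∸ z)) e₁))))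
        (≈-trans (arrange (x m ^^ sum e) _ _ _) (≈-trans (⊗-cong (^^-inv (x m) y (sum e) x⊗y) ≈-refl) (⊗-identityˡ _)))
        where
        e₁ : sum e + i + par (c + sum e ∸ (sum e + i)) ≡ sum e + (i + par (c ∸ i))
        e₁ = trans (cong (λ z → sum e + i + par z)
               (trans (cong (_∸ (sum e + i)) (ℕₚ.+-comm c (sum e))) (ℕₚ.[m+n]∸[m+o]≡n∸o (sum e) c i)))
             (ℕₚ.+-assoc (sum e) i _)
        arrange : ∀ a b c d → (a ⊗ b) ⊗ (c ⊗ d) ≈ (a ⊗ c) ⊗ (b ⊗ d)
        arrange = interchange⊗

    -- `emb` completes the bits summed over to a whole column: the identity in general, a leading 0
    -- in the first column, where an overlined part 0 does not exist.
    step : ∀ bs ss c (emb : List ℕ → List ℕ) → length ss ≡ length bs → All (Ord 0ℤ) bs → c + sum ss ≤ K →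
      (∀ e → sum (emb e) ≡ sum e) → (∀ e → Bits (length bs) e → Bits (suc lam) (emb e)) →
      (∀ δ′ → K ≤ δ′ + (c + sum ss) → bitsum bs ss c (λ e _ → y ^^ sum e ⊗ C′.hit cols′ (emb e) δ′) ≈ 𝟎) →
      D′ ⊗ bitsum bs ss c (λ e → tail (suc d) m (emb e)) ≃[ J ] bitsum bs ss c (λ _ c′ → G (+ c′))
    step bs ss c emb len os c≤ sum-emb bits-emb zeros = ≃-trans (≈⇒≃ (bitsum-⊗ bs ss c D′ _))
      (≃-trans (bitsum-≃ bs ss c len os (λ e c′ b eq → tail-≃ (emb e) c′ (bits-emb e b) (bound e c′ eq)))
        (≈⇒≃ (≈-trans (bitsum-cong bs ss c len (λ e c′ b eq → ⊕-cong ≈-refl (≈-trans (neg₁ (hits (emb e) c′))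
               (⊗-cong ≈-refl (≈-trans (hits-regroup (emb e) c′ (bits-emb e b) (bound e c′ eq)) (regroup e c′ eq))))))
          (≈-trans (bitsum-⊕ bs ss c _ _) (≈-trans (⊕-cong ≈-refl
            (≈-trans (≈-sym (bitsum-⊗ bs ss c (⊖ 𝟏) _)) (≈-trans (⊗-cong ≈-refl
              (≈-trans (bitsum-∑ bs ss c (suc (c + sum ss)) _)
                (∑-zero (suc (c + sum ss)) (λ N N< → ≈-trans (≈-sym (bitsum-⊗ bs ss c (x m ^^ N) _))
                  (≈-trans (⊗-cong ≈-refl (zeros _ (enough N (ℕₚ.≤-pred N<)))) (⊗-zeroʳ _)))))) (⊗-zeroʳ (⊖ 𝟏)))))
            (⊕-identityʳ _))))))
      where
      neg₁ : ∀ z → ⊖ z ≈ ⊖ 𝟏 ⊗ z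
      neg₁ = Solver.solve-∀ laurentRing
      bound : ∀ e c′ → c′ + sum e ≡ c + sum ss → c′ + sum (emb e) ≤ K
      bound e c′ eq = ℕₚ.≤-trans (ℕₚ.≤-reflexive (trans (cong (λ z → c′ + z) (sum-emb e)) eq)) c≤
      regroup : ∀ e c′ → c′ + sum e ≡ c + sum ss →
        ∑ (suc (c′ + sum (emb e))) (λ N → x m ^^ N ⊗ (y ^^ sum (emb e) ⊗ C′.hit cols′ (emb e) (K ∸ (N + par (c′ + sum (emb e) ∸ N)))))
        ≈ ∑ (suc (c + sum ss)) (λ N → x m ^^ N ⊗ (y ^^ sum e ⊗ C′.hit cols′ (emb e) (K ∸ (N + par (c + sum ss ∸ N)))))
      regroup e c′ eq rewrite sum-emb e | eq = ≈-refl
      enough : ∀ N → N ≤ c + sum ss → K ≤ K ∸ (N + par (c + sum ss ∸ N)) + (c + sum ss)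
      enough N N≤ = ℕₚ.≤-trans (ℕₚ.m≤n+m∸n K (N + par (c + sum ss ∸ N)))
        (ℕₚ.≤-trans (ℕₚ.+-monoˡ-≤ _ (used≤ N≤)) (ℕₚ.≤-reflexive (ℕₚ.+-comm (c + sum ss) _)))

    closed-step : Closed m (suc d)
    closed-step s c bits c≤ = step (cols m) s c (λ e → e) (trans (proj₁ bits) (sym (length-cols m))) (ord-cols m) c≤
      (λ _ → refl) (λ e (l , b) → trans l (length-cols m) , b)
      (λ δ′ h → bitsum-hit-zero (cols m) s c δ′ (trans (proj₁ bits) (sym (length-cols m)) , proj₂ bits)
        (ℕₚ.≤-trans (ℕₚ.≤-reflexive (length-cols m)) (ℕₚ.≤-trans lam<K (ℕₚ.≤-trans h
          (ℕₚ.≤-trans (ℕₚ.≤-reflexive (l δ′ c (sum s))) (ℕₚ.n≤1+n _))))))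
      where
      l : ∀ d c s → d + (c + s) ≡ c + d + s
      l = ℕ-Solver.solve-∀

  closed : ∀ d m → Closed m d
  closed zero    m = closed-base m
  closed (suc d) m = Step.closed-step m d (closed d (suc m))

  zeros : List ℕ → List ℕ
  zeros = map (λ _ → 0)

  sum-zeros : ∀ xs → sum (zeros xs) ≡ 0
  sum-zeros []       = refl
  sum-zeros (_ ∷ xs) = sum-zeros xs

  bits-zeros : ∀ xs → Bits (length xs) (zeros xs)
  bits-zeros xs = Listₚ.length-map _ xs , go xs
    where
    go : ∀ xs → All (_≤ 1) (zeros xs)
    go []       = []
    go (_ ∷ xs) = z≤n ∷ go xs

  length-alphas : length alphas ≡ lam
  length-alphas = trans (Listₚ.length-map _ rs) len-rs

  -- The first column contains no overlined part 0.
  first-column : ∀ L ρ → ρ ≤ K → lam ≤ suc ρ →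
    D (suc L) ⊗ bitsum alphas (zeros rs) ρ (λ e → tail (suc L) 0 (0 ∷ e))
    ≃[ + suc L ] Col.free 0 (suc L) alphas (+ ρ)
  first-column L ρ ρ≤K lam≤ = ≃-trans
    (S.step alphas (zeros rs) ρ (0 ∷_) len (ord-alphas rs) (ℕₚ.≤-trans (ℕₚ.≤-reflexive ρ+) ρ≤K) (λ _ → refl)
      (λ e (l , b) → cong suc (trans l length-alphas) , z≤n ∷ b)
      (λ δ′ h → S.bitsum-hit-zero₀ (mon 0ℤ) alphas (zeros rs) ρ δ′ (bits-alphas)
        (ℕₚ.≤-trans (ℕₚ.≤-reflexive length-alphas) (ℕₚ.≤-trans (ℕₚ.≤-trans (ℕₚ.n≤1+n lam) lam<K)
          (ℕₚ.≤-trans h (ℕₚ.≤-reflexive (l δ′ ρ (sum (zeros rs)))))))))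
    (≈⇒≃ (≈-trans (≈-sym (⊕-identityʳ _)) (≈-trans (⊕-cong ≈-refl (≈-sym
        (C.hit-zeros C.G₋₁ alphas (zeros rs) ρ len (sum-zeros rs) (ℕₚ.≤-trans (ℕₚ.≤-reflexive length-alphas) lam≤))))
      (≈-trans (C.bitsum-hit alphas (zeros rs) ρ len) (≈-reflexive (cong (λ z → C.free alphas (+ z)) ρ+))))))
    where
    module S = Step 0 L (closed L 1)
    module C = Col 0 (suc L)
    bits-alphas : Bits (length alphas) (zeros rs)
    bits-alphas = subst (λ n → Bits n (zeros rs)) (sym (Listₚ.length-map _ rs)) (bits-zeros rs)
    len : length (zeros rs) ≡ length alphas
    len = proj₁ bits-alphas
    ρ+ : ρ + sum (zeros rs) ≡ ρ
    ρ+ = trans (cong (λ z → ρ + z) (sum-zeros rs)) (ℕₚ.+-identityʳ ρ)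
    l : ∀ d c s → d + (c + s) ≡ c + d + s
    l = ℕ-Solver.solve-∀

-- Jacobi's triple product modulo q^L

trip : ℕ → ℕ
trip zero    = 0
trip (suc n) = tri n

tri-+ : ∀ n j → tri (n + j) ≡ tri n + n * j + tri j
tri-+ n zero    = trans (cong tri (ℕₚ.+-identityʳ n)) (sym (trans (ℕₚ.+-identityʳ _) (trans (cong (λ z → tri n + z) (ℕₚ.*-zeroʳ n)) (ℕₚ.+-identityʳ _))))
tri-+ n (suc j) = trans (cong tri (ℕₚ.+-suc n j)) (trans (cong (_+ suc (n + j)) (tri-+ n j)) (l (tri n) n j (tri j)))
  where
  l : ∀ t n j u → t + n * j + u + suc (n + j) ≡ t + n * suc j + (u + suc j)
  l = ℕ-Solver.solve-∀

tri+tri : ∀ n → tri n + tri n ≡ n * n + n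
tri+tri zero    = refl
tri+tri (suc n) = trans (l₁ (tri n) n) (trans (cong (_+ (2 * n + 2)) (tri+tri n)) (l₂ n))
  where
  l₁ : ∀ t n → t + suc n + (t + suc n) ≡ t + t + (2 * n + 2)
  l₁ = ℕ-Solver.solve-∀
  l₂ : ∀ n → n * n + n + (2 * n + 2) ≡ suc n * suc n + suc n
  l₂ = ℕ-Solver.solve-∀

trip+tri : ∀ n → trip n + tri n ≡ n * n
trip+tri zero    = refl
trip+tri (suc n) = trans (l₁ (tri n) n) (trans (cong (_+ suc n) (tri+tri n)) (l₂ n))
  where
  l₁ : ∀ t n → t + (t + suc n) ≡ t + t + suc n
  l₁ = ℕ-Solver.solve-∀
  l₂ : ∀ n → n * n + n + suc n ≡ suc n * suc n
  l₂ = ℕ-Solver.solve-∀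

sgn-+ : ∀ m n → sgn (m + n) ≈ sgn m ⊗ sgn n
sgn-+ zero    n = ≈-sym (⊗-identityˡ _)
sgn-+ (suc m) n = ≈-trans (⊖-cong (sgn-+ m n)) (l (sgn m) (sgn n))
  where
  l : ∀ a b → ⊖ (a ⊗ b) ≈ ⊖ a ⊗ b
  l = Solver.solve-∀ laurentRing

sgn² : ∀ n → sgn n ⊗ sgn n ≈ 𝟏
sgn² zero    = ≈-refl
sgn² (suc n) = ≈-trans (l (sgn n)) (sgn² n)
  where
  l : ∀ a → ⊖ a ⊗ ⊖ a ≈ a ⊗ a
  l = Solver.solve-∀ laurentRing

∑-reverse : ∀ n g → ∑ (suc n) g ≈ ∑ (suc n) (λ i → g (n ∸ i))
∑-reverse zero    g = ≈-refl
∑-reverse (suc n) g = ≈-trans (⊕-comm _ _) (≈-trans (⊕-cong ≈-refl (∑-reverse n g)) (≈-sym (∑-front (suc n) (λ i → g (suc n ∸ i)))))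

∏-reverse : ∀ n g → ∏ n g ≈ ∏ n (λ i → g (n ∸ suc i))
∏-reverse zero    g = ≈-refl
∏-reverse (suc n) g = ≈-trans (⊗-comm _ _) (≈-trans (⊗-cong ≈-refl (∏-reverse n g)) (≈-sym (∏-front n (λ i → g (n ∸ i)))))

ord-∏< : ∀ n {g} → (∀ i → i < n → Ord 0ℤ (g i)) → Ord 0ℤ (∏ n g)
ord-∏< zero    o = ord-con 1ℤ
ord-∏< (suc n) o = ord-⊗ˡ (ord-∏< n (λ i i< → o i (ℕₚ.m<n⇒m<1+n i<))) (o n (ℕₚ.n<1+n n))

∏-≃ : ∀ {J} n {g h} → (∀ i → i < n → Ord 0ℤ (g i)) → (∀ i → i < n → Ord 0ℤ (h i)) →
  (∀ i → i < n → g i ≃[ J ] h i) → ∏ n g ≃[ J ] ∏ n h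
∏-≃ zero    o o′ e = ≃-refl
∏-≃ (suc n) o o′ e = ≃-⊗ (ord-∏< n (λ i i< → o i (ℕₚ.m<n⇒m<1+n i<))) (o′ n (ℕₚ.n<1+n n))
  (∏-≃ n (λ i i< → o i (ℕₚ.m<n⇒m<1+n i<)) (λ i i< → o′ i (ℕₚ.m<n⇒m<1+n i<)) (λ i i< → e i (ℕₚ.m<n⇒m<1+n i<)))
  (e n (ℕₚ.n<1+n n))

∏-𝟏 : ∀ n → ∏ n (λ _ → 𝟏) ≈ 𝟏
∏-𝟏 zero    = ≈-refl
∏-𝟏 (suc n) = ≈-trans (⊗-cong (∏-𝟏 n) ≈-refl) (⊗-identityˡ 𝟏)

∏-≃𝟏 : ∀ {J} n {g} → (∀ i → i < n → Ord 0ℤ (g i)) → (∀ i → i < n → g i ≃[ J ] 𝟏) → ∏ n g ≃[ J ] 𝟏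
∏-≃𝟏 n o e = ≃-trans (∏-≃ n o (λ _ _ → ord-con 1ℤ) e) (≈⇒≃ (∏-𝟏 n))

one-mon-≃𝟏 : ∀ {J} n → J ≤ n → one-mon (+ n) ≃[ + J ] 𝟏
one-mon-≃𝟏 n le = ≃-trans (≃-⊕ ≃-refl (≃𝟎 (ord-⊖ (ord-weaken (ℤ.+≤+ le) ord-mon)))) (≈⇒≃ (⊕-identityʳ 𝟏))

ord-≃𝟏 : ∀ {J p} i → Ord i p → ∀ {r} → r ≃[ J ] 𝟏 → p ⊗ r ≃[ i ℤ.+ J ] p
ord-≃𝟏 {J} {p} i o {r} e = mk≃ (ord-≈ (l p r) (ord-⊗ o (_≃[_]_.ord e)))
  where
  l : ∀ p r → p ⊗ (r ⊕ ⊖ 𝟏) ≈ p ⊗ r ⊕ ⊖ p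
  l = Solver.solve-∀ laurentRing

≃-weaken : ∀ {i j p r} → i ℤ.≤ j → p ≃[ j ] r → p ≃[ i ] r
≃-weaken le e = mk≃ (ord-weaken le (_≃[_]_.ord e))

module TripleProduct (N a : ℕ) (1≤a : 1 ≤ a) (a<N : a < N) where

  pw : ℤ → Laurent
  pw j = mon (j ℤ.* + N)

  pw-+ : ∀ i j → pw (i ℤ.+ j) ≈ pw i ⊗ pw j
  pw-+ i j = ≈-trans (mon-≡ (ℤₚ.*-distribʳ-+ (+ N) i j)) (mon-+ (i ℤ.* + N) (j ℤ.* + N))

  -- The Gaussian binomial coefficient in base q^N.
  binom : ℕ → ℕ → Laurent
  binom n       zero    = 𝟏
  binom zero    (suc i) = 𝟎
  binom (suc n) (suc i) = binom n (suc i) ⊕ pw (+ n ℤ.- + i) ⊗ binom n i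

  binom-0 : ∀ n i → n < i → binom n i ≈ 𝟎
  binom-0 zero    (suc i) _       = ≈-refl
  binom-0 (suc n) (suc i) (s≤s h) = ≈-trans (⊕-cong (binom-0 n (suc i) (ℕₚ.m<n⇒m<1+n h)) (⊗-cong ≈-refl (binom-0 n i h)))
    (l (pw (+ n ℤ.- + i)))
    where
    l : ∀ b → 𝟎 ⊕ b ⊗ 𝟎 ≈ 𝟎
    l = Solver.solve-∀ laurentRing

  term : ℤ → ℕ → Laurent
  term ζ i = sgn i ⊗ mon (+ i ℤ.* ζ ℤ.+ + trip i ℤ.* + N)

  term-suc : ∀ ζ n i → term ζ (suc i) ⊗ pw (+ n ℤ.- + i) ≈ ⊖ (mon (ζ ℤ.+ + n ℤ.* + N) ⊗ term ζ i)
  term-suc ζ n i = ≈-trans (⊗-assoc _ _ _) (≈-trans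
    (⊗-cong ≈-refl (≈-trans (≈-sym (mon-+ (+ suc i ℤ.* ζ ℤ.+ + tri i ℤ.* + N) ((+ n ℤ.- + i) ℤ.* + N)))
      (≈-trans (mon-≡ eq) (mon-+ (ζ ℤ.+ + n ℤ.* + N) (+ i ℤ.* ζ ℤ.+ + trip i ℤ.* + N)))))
    (l (sgn i) _ _))
    where
    l : ∀ s u v → ⊖ s ⊗ (u ⊗ v) ≈ ⊖ (u ⊗ (s ⊗ v))
    l = Solver.solve-∀ laurentRing
    tri≡ : ∀ i → tri i ≡ trip i + i
    tri≡ zero    = refl
    tri≡ (suc i) = refl
    e : ∀ i ζ t N n → (1ℤ ℤ.+ i) ℤ.* ζ ℤ.+ (t ℤ.+ i) ℤ.* N ℤ.+ (n ℤ.- i) ℤ.* N ≡ (ζ ℤ.+ n ℤ.* N) ℤ.+ (i ℤ.* ζ ℤ.+ t ℤ.* N)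
    e = ℤ-Solver.solve-∀
    eq : + suc i ℤ.* ζ ℤ.+ + tri i ℤ.* + N ℤ.+ (+ n ℤ.- + i) ℤ.* + N ≡ (ζ ℤ.+ + n ℤ.* + N) ℤ.+ (+ i ℤ.* ζ ℤ.+ + trip i ℤ.* + N)
    eq = trans (cong (λ z → + suc i ℤ.* ζ ℤ.+ + z ℤ.* + N ℤ.+ (+ n ℤ.- + i) ℤ.* + N) (tri≡ i)) (e (+ i) ζ (+ trip i) (+ N) (+ n))

  -- The finite q-binomial theorem in base q^N at z = q^ζ. `term-suc` turns the second summand of
  -- the recursion of `binom` into multiplication by the new factor.
  binomial-theorem : ∀ ζ n → ∏ n (λ i → one-mon (ζ ℤ.+ + i ℤ.* + N)) ≈ ∑ (suc n) (λ i → term ζ i ⊗ binom n i)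
  binomial-theorem ζ zero = ≈-sym (≈-trans (⊕-identityˡ _) (≈-trans (⊗-identityʳ _) (≈-trans (⊗-identityˡ _)
    (≈-trans (mon-≡ (e ζ (+ N))) mon-0))))
    where
    e : ∀ ζ N → 0ℤ ℤ.* ζ ℤ.+ 0ℤ ℤ.* N ≡ 0ℤ
    e = ℤ-Solver.solve-∀
  binomial-theorem ζ (suc n) = ≈-sym (begin
    ∑ (suc (suc n)) (λ i → term ζ i ⊗ binom (suc n) i)
      ≈⟨ ∑-front (suc n) _ ⟩
    term ζ 0 ⊗ 𝟏 ⊕ ∑ (suc n) (λ i → term ζ (suc i) ⊗ (binom n (suc i) ⊕ pw (+ n ℤ.- + i) ⊗ binom n i))
      ≈⟨ ⊕-cong ≈-refl (≈-trans (∑-cong (suc n) (λ i _ → ≈-trans (l₁ _ _ _ _)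
           (⊕-cong ≈-refl (≈-trans (⊗-cong (term-suc ζ n i) ≈-refl) (l₂ _ _ _))))) (∑-⊕ (suc n) _ _)) ⟩
    term ζ 0 ⊗ 𝟏 ⊕ (∑ (suc n) (λ i → term ζ (suc i) ⊗ binom n (suc i)) ⊕ ∑ (suc n) (λ i → ⊖ Z ⊗ (term ζ i ⊗ binom n i)))
      ≈⟨ ≈-trans (≈-sym (⊕-assoc _ _ _)) (⊕-cong
           (≈-trans (≈-sym (∑-front (suc n) (λ i → term ζ i ⊗ binom n i)))
             (≈-trans (⊕-cong ≈-refl (≈-trans (⊗-cong ≈-refl (binom-0 n (suc n) (ℕₚ.n<1+n n))) (⊗-zeroʳ _))) (⊕-identityʳ _)))
           (≈-sym (∑-⊗ (suc n) (⊖ Z) _))) ⟩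
    ∑ (suc n) (λ i → term ζ i ⊗ binom n i) ⊕ ⊖ Z ⊗ ∑ (suc n) (λ i → term ζ i ⊗ binom n i)
      ≈⟨ l₃ _ Z ⟩
    ∑ (suc n) (λ i → term ζ i ⊗ binom n i) ⊗ (𝟏 ⊕ ⊖ Z)
      ≈⟨ ⊗-cong (≈-sym (binomial-theorem ζ n)) ≈-refl ⟩
    ∏ n (λ i → one-mon (ζ ℤ.+ + i ℤ.* + N)) ⊗ (𝟏 ⊕ ⊖ Z) ∎)
    where
    Z : Laurent
    Z = mon (ζ ℤ.+ + n ℤ.* + N)
    l₁ : ∀ t b p c → t ⊗ (b ⊕ p ⊗ c) ≈ t ⊗ b ⊕ (t ⊗ p) ⊗ c
    l₁ = Solver.solve-∀ laurentRing
    l₂ : ∀ z t b → ⊖ (z ⊗ t) ⊗ b ≈ ⊖ z ⊗ (t ⊗ b)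
    l₂ = Solver.solve-∀ laurentRing
    l₃ : ∀ s z → s ⊕ ⊖ z ⊗ s ≈ s ⊗ (𝟏 ⊕ ⊖ z)
    l₃ = Solver.solve-∀ laurentRing

  poch : ℕ → Laurent
  poch n = ∏ n (λ i → 𝟏 ⊕ ⊖ pw (+ suc i))

  falling : ℤ → ℕ → Laurent
  falling n i = ∏ i (λ t → 𝟏 ⊕ ⊖ pw (n ℤ.- + t))

  -- The quotient formula for the Gaussian binomial with its denominator multiplied out.
  poch-binom : ∀ n i → poch i ⊗ binom n i ≈ falling (+ n) i
  poch-binom n       zero    = ≈-refl
  poch-binom zero    (suc i) = ≈-trans (⊗-zeroʳ _) (≈-sym (zero-falling i))
    where
    zero-falling : ∀ i → falling 0ℤ (suc i) ≈ 𝟎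
    zero-falling i = ≈-trans (∏-front i _) (≈-trans (⊗-cong (≈-trans (⊕-cong ≈-refl (⊖-cong
      (≈-trans (mon-≡ (ℤₚ.*-zeroˡ (+ N))) mon-0))) (⊖-inverseʳ 𝟏)) ≈-refl) (⊗-zeroˡ _))
  poch-binom (suc n) (suc i) = begin
    poch i ⊗ (𝟏 ⊕ ⊖ pw (+ suc i)) ⊗ (binom n (suc i) ⊕ pw (+ n ℤ.- + i) ⊗ binom n i)
      ≈⟨ l₁ _ _ _ _ _ ⟩
    poch i ⊗ (𝟏 ⊕ ⊖ pw (+ suc i)) ⊗ binom n (suc i) ⊕ (𝟏 ⊕ ⊖ pw (+ suc i)) ⊗ pw (+ n ℤ.- + i) ⊗ (poch i ⊗ binom n i)
      ≈⟨ ⊕-cong (poch-binom n (suc i)) (⊗-cong ≈-refl (poch-binom n i)) ⟩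
    falling (+ n) i ⊗ (𝟏 ⊕ ⊖ u) ⊕ (𝟏 ⊕ ⊖ pw (+ suc i)) ⊗ u ⊗ falling (+ n) i
      ≈⟨ l₂ _ u (pw (+ suc i)) ⟩
    (𝟏 ⊕ ⊖ (pw (+ suc i) ⊗ u)) ⊗ falling (+ n) i
      ≈⟨ ⊗-cong (⊕-cong ≈-refl (⊖-cong (≈-trans (≈-sym (pw-+ (+ suc i) (+ n ℤ.- + i))) (mon-≡ (cong (ℤ._* + N) (e (+ i) (+ n)))))))
                (∏-cong i (λ t _ → ⊕-cong ≈-refl (⊖-cong (mon-≡ (cong (ℤ._* + N) (e′ (+ n) (+ t))))))) ⟩
    (𝟏 ⊕ ⊖ pw (+ suc n ℤ.- + 0)) ⊗ ∏ i (λ t → 𝟏 ⊕ ⊖ pw (+ suc n ℤ.- + suc t))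
      ≈⟨ ∏-front i (λ t → 𝟏 ⊕ ⊖ pw (+ suc n ℤ.- + t)) ⟨
    falling (+ suc n) (suc i) ∎
    where
    u : Laurent
    u = pw (+ n ℤ.- + i)
    e : ∀ i n → (1ℤ ℤ.+ i) ℤ.+ (n ℤ.- i) ≡ (1ℤ ℤ.+ n) ℤ.- 0ℤ
    e = ℤ-Solver.solve-∀
    e′ : ∀ n t → n ℤ.- t ≡ (1ℤ ℤ.+ n) ℤ.- (1ℤ ℤ.+ t)
    e′ = ℤ-Solver.solve-∀
    l₁ : ∀ p o b u c → p ⊗ o ⊗ (b ⊕ u ⊗ c) ≈ p ⊗ o ⊗ b ⊕ o ⊗ u ⊗ (p ⊗ c)
    l₁ = Solver.solve-∀ laurentRing
    l₂ : ∀ f u q → f ⊗ (𝟏 ⊕ ⊖ u) ⊕ (𝟏 ⊕ ⊖ q) ⊗ u ⊗ f ≈ (𝟏 ⊕ ⊖ (q ⊗ u)) ⊗ f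
    l₂ = Solver.solve-∀ laurentRing

  one-pw : ∀ n → 𝟏 ⊕ ⊖ pw (+ n) ≈ one-mon (+ (n * N))
  one-pw n = ⊕-cong ≈-refl (⊖-cong (mon-≡ (sym (ℤₚ.pos-* n N))))

  1≤N : 1 ≤ N
  1≤N = ℕₚ.≤-trans 1≤a (ℕₚ.<⇒≤ a<N)

  ord-one-pw : ∀ n → Ord 0ℤ (𝟏 ⊕ ⊖ pw (+ n))
  ord-one-pw n = ord-≈ (≈-sym (one-pw n)) (ord-one-mon (n * N))

  one-pw-≃ : ∀ {J} n → J ≤ n → 𝟏 ⊕ ⊖ pw (+ n) ≃[ + J ] 𝟏
  one-pw-≃ n le = ≃-trans (≈⇒≃ (one-pw n)) (one-mon-≃𝟏 (n * N)
    (ℕₚ.≤-trans le (ℕₚ.≤-trans (ℕₚ.≤-reflexive (sym (ℕₚ.*-identityʳ n))) (ℕₚ.*-monoʳ-≤ n 1≤N))))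

  ord-poch : ∀ n → Ord 0ℤ (poch n)
  ord-poch n = ord-∏ n (λ i → ord-one-pw (suc i))

  poch-+ : ∀ {J} n j → J ≤ suc n → poch (n + j) ≃[ + J ] poch n
  poch-+ {J} n j le = ≃-trans (≈⇒≃ (∏-split n j _)) (≃-trans
    (≃-⊗ʳ (ord-poch n) (∏-≃𝟏 j (λ i _ → ord-one-pw (suc (n + i))) (λ i _ → one-pw-≃ (suc (n + i)) (ℕₚ.≤-trans le (s≤s (ℕₚ.m≤m+n n i))))))
    (≈⇒≃ (⊗-identityʳ _)))

  ord-binom : ∀ n i → i ≤ n → Ord 0ℤ (binom n i)
  ord-binom n       zero    _       = ord-con 1ℤ
  ord-binom (suc n) (suc i) (s≤s h) with ℕₚ.m≤n⇒m<n∨m≡n h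
  ... | inj₁ i<n = ord-⊕ (ord-binom n (suc i) i<n) (ord-⊗ˡ ord-u (ord-binom n i h))
    where
    ord-u : Ord 0ℤ (pw (+ n ℤ.- + i))
    ord-u = ord-≈ (mon-≡ (sym (trans (cong (ℤ._* + N) (trans (ℤₚ.m-n≡m⊖n n i) (ℤₚ.⊖-≥ h))) (sym (ℤₚ.pos-* (n ∸ i) N))))) (ord-mon₀ ((n ∸ i) * N))
  ... | inj₂ refl = ord-⊕ (ord-≈ (≈-sym (binom-0 n (suc n) (ℕₚ.n<1+n n))) ord-𝟎)
      (ord-⊗ˡ (ord-≈ (≈-sym (≈-trans (mon-≡ (trans (cong (ℤ._* + N) (ℤₚ.+-inverseʳ (+ n))) (ℤₚ.*-zeroˡ (+ N)))) mon-0)) (ord-con 1ℤ)) (ord-binom n n h))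

  falling-≃ : ∀ {J} n i → i ≤ n → J + i ≤ suc n → falling (+ n) i ≃[ + J ] 𝟏
  falling-≃ {J} n i i≤n le = ∏-≃𝟏 i (λ t t< → ord-≈ (≈-sym (nat t t<)) (ord-one-pw (n ∸ t)))
    (λ t t< → ≃-trans (≈⇒≃ (nat t t<)) (one-pw-≃ (n ∸ t) (ℕₚ.m+n≤o⇒m≤o∸n J (ℕₚ.≤-pred (ℕₚ.≤-trans
      (ℕₚ.≤-trans (ℕₚ.≤-reflexive (sym (ℕₚ.+-suc J t))) (ℕₚ.+-monoʳ-≤ J t<)) le)))))
    where
    nat : ∀ t → t < i → 𝟏 ⊕ ⊖ pw (+ n ℤ.- + t) ≈ 𝟏 ⊕ ⊖ pw (+ (n ∸ t))
    nat t t< = ⊕-cong ≈-refl (⊖-cong (mon-≡ (cong (ℤ._* + N) (trans (ℤₚ.m-n≡m⊖n n t) (ℤₚ.⊖-≥ (ℕₚ.≤-trans (ℕₚ.<⇒≤ t<) i≤n))))))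

  module At (L : ℕ) where

    -- Starting L steps of N below a centres the product of 2 L factors: its upper half is T₁ and
    -- its lower half, after `norm` is extracted, is T₂.
    ζ : ℤ
    ζ = + a ℤ.- + L ℤ.* + N

    T₁ T₂ : Laurent
    T₁ = ∏ L (λ i → one-mon (+ (a + i * N)))
    T₂ = ∏ L (λ i → one-mon (+ suc i ℤ.* + N ℤ.- + a))

    norm : Laurent
    norm = sgn L ⊗ mon (+ L ℤ.* + a ℤ.- + tri L ℤ.* + N)

    norm⁻¹ : Laurent
    norm⁻¹ = sgn L ⊗ mon (ℤ.- (+ L ℤ.* + a ℤ.- + tri L ℤ.* + N))

    norm-inv : norm⁻¹ ⊗ norm ≈ 𝟏
    norm-inv = ≈-trans (l (sgn L) _ _) (≈-trans (⊗-cong (sgn² L) (mon-inv (+ L ℤ.* + a ℤ.- + tri L ℤ.* + N))) (⊗-identityˡ 𝟏))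
      where
      l : ∀ s u v → (s ⊗ v) ⊗ (s ⊗ u) ≈ (s ⊗ s) ⊗ (u ⊗ v)
      l = Solver.solve-∀ laurentRing

    product-split : ∏ (L + L) (λ i → one-mon (ζ ℤ.+ + i ℤ.* + N)) ≈ norm ⊗ (T₂ ⊗ T₁)
    product-split = ≈-trans (∏-split L L _) (≈-trans (⊗-cong
        (≈-trans (∏-reverse L _) (≈-trans (∏-cong L low) (lower L)))
        (∏-cong L (λ i _ → ⊕-cong ≈-refl (⊖-cong (mon-≡ (high i))))))
      (⊗-assoc norm T₂ T₁))
      where
      high : ∀ i → ζ ℤ.+ + (L + i) ℤ.* + N ≡ + (a + i * N)
      high i = trans (e (+ a) (+ L) (+ N) (+ i)) (cong (λ z → + a ℤ.+ z) (sym (ℤₚ.pos-* i N)))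
        where
        e : ∀ a L N i → a ℤ.- L ℤ.* N ℤ.+ (L ℤ.+ i) ℤ.* N ≡ a ℤ.+ i ℤ.* N
        e = ℤ-Solver.solve-∀
      low : ∀ i → i < L → one-mon (ζ ℤ.+ + (L ∸ suc i) ℤ.* + N) ≈ one-mon (+ a ℤ.- + suc i ℤ.* + N)
      low i i< = ⊕-cong ≈-refl (⊖-cong (mon-≡ (trans (cong (λ z → ζ ℤ.+ z ℤ.* + N)
          (sym (trans (ℤₚ.m-n≡m⊖n L (suc i)) (ℤₚ.⊖-≥ i<)))) (e (+ a) (+ L) (+ N) (+ suc i)))))
        where
        e : ∀ a L N i → a ℤ.- L ℤ.* N ℤ.+ (L ℤ.- i) ℤ.* N ≡ a ℤ.- i ℤ.* N
        e = ℤ-Solver.solve-∀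
      lower : ∀ n → ∏ n (λ i → one-mon (+ a ℤ.- + suc i ℤ.* + N))
        ≈ sgn n ⊗ mon (+ n ℤ.* + a ℤ.- + tri n ℤ.* + N) ⊗ ∏ n (λ i → one-mon (+ suc i ℤ.* + N ℤ.- + a))
      lower zero    = ≈-sym (≈-trans (⊗-identityʳ _) (≈-trans (⊗-identityˡ _) (≈-trans (mon-≡ (e (+ a) (+ N))) mon-0)))
        where
        e : ∀ a N → 0ℤ ℤ.* a ℤ.- 0ℤ ℤ.* N ≡ 0ℤ
        e = ℤ-Solver.solve-∀
      lower (suc n) = ≈-trans (⊗-cong (lower n) (flip z _ z⁻ z⁻¹)) (≈-trans (l (sgn n) _ _ _ _)
          (⊗-cong (⊗-cong ≈-refl (≈-trans (≈-sym (mon-+ _ (+ a ℤ.- + suc n ℤ.* + N))) (mon-≡ (e (+ n) (+ a) (+ tri n) (+ N))))) ≈-refl))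
        where
        z : ℤ
        z = + a ℤ.- + suc n ℤ.* + N
        z⁻ : + suc n ℤ.* + N ℤ.- + a ≡ ℤ.- z
        z⁻ = e′ (+ suc n ℤ.* + N) (+ a)
          where
          e′ : ∀ x a → x ℤ.- a ≡ ℤ.- (a ℤ.- x)
          e′ = ℤ-Solver.solve-∀
        z⁻¹ : mon z ⊗ mon (ℤ.- z) ≈ 𝟏
        z⁻¹ = mon-inv z
        flip : ∀ z w → w ≡ ℤ.- z → mon z ⊗ mon (ℤ.- z) ≈ 𝟏 → one-mon z ≈ ⊖ mon z ⊗ one-mon w
        flip z w refl h = ≈-trans (⊕-cong (≈-sym h) ≈-refl) (l′ (mon z) (mon (ℤ.- z)))
          where
          l′ : ∀ u v → u ⊗ v ⊕ ⊖ u ≈ ⊖ u ⊗ (𝟏 ⊕ ⊖ v)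
          l′ = Solver.solve-∀ laurentRing
        l : ∀ s m T z o → (s ⊗ m ⊗ T) ⊗ (⊖ z ⊗ o) ≈ ⊖ s ⊗ (m ⊗ z) ⊗ (T ⊗ o)
        l = Solver.solve-∀ laurentRing
        e : ∀ n a t N → n ℤ.* a ℤ.- t ℤ.* N ℤ.+ (a ℤ.- (1ℤ ℤ.+ n) ℤ.* N) ≡ (1ℤ ℤ.+ n) ℤ.* a ℤ.- (t ℤ.+ (1ℤ ℤ.+ n)) ℤ.* N
        e = ℤ-Solver.solve-∀

    u v : ℕ → Laurent
    u n = sgn n ⊗ mon (+ tri n ℤ.* + N ℤ.- + n ℤ.* + a)
    v n = ⊖ (sgn n ⊗ mon (+ tri n ℤ.* + N ℤ.+ + suc n ℤ.* + a))

    norm-u : ∀ n → n ≤ L → norm⁻¹ ⊗ term ζ (L ∸ n) ≈ u n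
    norm-u n n≤L = ≈-trans (l (sgn L) _ _ _) (⊗-cong signs (≈-trans (≈-sym (mon-+ _ (+ j ℤ.* ζ ℤ.+ + trip j ℤ.* + N))) (mon-≡ eq)))
      where
      j : ℕ
      j = L ∸ n
      L≡ : L ≡ n + j
      L≡ = sym (ℕₚ.m+[n∸m]≡n n≤L)
      l : ∀ s m t w → (s ⊗ m) ⊗ (t ⊗ w) ≈ (s ⊗ t) ⊗ (m ⊗ w)
      l = interchange⊗
      signs : sgn L ⊗ sgn j ≈ sgn n
      signs = ≈-trans (⊗-cong (≈-trans (≈-reflexive (cong sgn L≡)) (sgn-+ n j)) ≈-refl)
        (≈-trans (⊗-assoc _ _ _) (≈-trans (⊗-cong ≈-refl (sgn² j)) (⊗-identityʳ _)))
      eq : ℤ.- (+ L ℤ.* + a ℤ.- + tri L ℤ.* + N) ℤ.+ (+ j ℤ.* ζ ℤ.+ + trip j ℤ.* + N) ≡ + tri n ℤ.* + N ℤ.- + n ℤ.* + a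
      eq = trans (cong₂ (λ z t → ℤ.- (z ℤ.* + a ℤ.- t ℤ.* + N) ℤ.+ (+ j ℤ.* (+ a ℤ.- z ℤ.* + N) ℤ.+ + trip j ℤ.* + N))
                   (cong +_ L≡) triL)
             (trans (e (+ n) (+ j) (+ a) (+ N) (+ tri n) (+ tri j) (+ trip j))
               (trans (cong (λ z → + tri n ℤ.* + N ℤ.- + n ℤ.* + a ℤ.+ (z ℤ.- + j ℤ.* + j) ℤ.* + N)
                  (trans (cong +_ (trip+tri j)) (ℤₚ.pos-* j j))) (e′ _ (+ j ℤ.* + j) (+ N))))
        where
        triL : + tri L ≡ + tri n ℤ.+ + n ℤ.* + j ℤ.+ + tri j
        triL = trans (cong (λ z → + tri z) L≡) (trans (cong +_ (tri-+ n j)) (cong (λ z → + tri n ℤ.+ z ℤ.+ + tri j) (ℤₚ.pos-* n j)))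
        e : ∀ n j a N t t′ t″ →
          ℤ.- ((n ℤ.+ j) ℤ.* a ℤ.- (t ℤ.+ n ℤ.* j ℤ.+ t′) ℤ.* N) ℤ.+ (j ℤ.* (a ℤ.- (n ℤ.+ j) ℤ.* N) ℤ.+ t″ ℤ.* N)
          ≡ t ℤ.* N ℤ.- n ℤ.* a ℤ.+ ((t″ ℤ.+ t′) ℤ.- j ℤ.* j) ℤ.* N
        e = ℤ-Solver.solve-∀
        e′ : ∀ b z N → b ℤ.+ (z ℤ.- z) ℤ.* N ≡ b
        e′ = ℤ-Solver.solve-∀

    norm-v : ∀ n → norm⁻¹ ⊗ term ζ (suc L + n) ≈ v n
    norm-v n = ≈-trans (⊗-cong ≈-refl (⊗-cong (⊖-cong (sgn-+ L n)) ≈-refl)) (≈-trans (l (sgn L) _ (sgn n) _)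
      (⊖-cong (≈-trans (⊗-cong (sgn² L) ≈-refl) (≈-trans (⊗-identityˡ _)
        (⊗-cong ≈-refl (≈-trans (≈-sym (mon-+ _ (+ (suc L + n) ℤ.* ζ ℤ.+ + tri (L + n) ℤ.* + N))) (mon-≡ eq)))))))
      where
      l : ∀ s m t w → (s ⊗ m) ⊗ (⊖ (s ⊗ t) ⊗ w) ≈ ⊖ ((s ⊗ s) ⊗ (t ⊗ (m ⊗ w)))
      l = Solver.solve-∀ laurentRing
      eq : ℤ.- (+ L ℤ.* + a ℤ.- + tri L ℤ.* + N) ℤ.+ (+ (suc L + n) ℤ.* ζ ℤ.+ + tri (L + n) ℤ.* + N)
         ≡ + tri n ℤ.* + N ℤ.+ + suc n ℤ.* + a
      eq = trans (cong (λ t → ℤ.- (+ L ℤ.* + a ℤ.- + tri L ℤ.* + N) ℤ.+ (+ (suc L + n) ℤ.* ζ ℤ.+ t ℤ.* + N))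
                   (trans (cong +_ (tri-+ L n)) (cong (λ z → + tri L ℤ.+ z ℤ.+ + tri n) (ℤₚ.pos-* L n))))
             (trans (e (+ L) (+ n) (+ a) (+ N) (+ tri L) (+ tri n))
               (trans (cong (λ z → + tri n ℤ.* + N ℤ.+ + suc n ℤ.* + a ℤ.+ (z ℤ.- (+ L ℤ.* + L ℤ.+ + L)) ℤ.* + N)
                 (trans (cong +_ (tri+tri L)) (cong (ℤ._+ + L) (ℤₚ.pos-* L L)))) (e′ _ (+ L ℤ.* + L ℤ.+ + L) (+ N))))
        where
        e : ∀ L n a N t t′ →
          ℤ.- (L ℤ.* a ℤ.- t ℤ.* N) ℤ.+ ((1ℤ ℤ.+ L ℤ.+ n) ℤ.* (a ℤ.- L ℤ.* N) ℤ.+ (t ℤ.+ L ℤ.* n ℤ.+ t′) ℤ.* N)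
          ≡ t′ ℤ.* N ℤ.+ (1ℤ ℤ.+ n) ℤ.* a ℤ.+ ((t ℤ.+ t) ℤ.- (L ℤ.* L ℤ.+ L)) ℤ.* N
        e = ℤ-Solver.solve-∀
        e′ : ∀ b z N → b ℤ.+ (z ℤ.- z) ℤ.* N ≡ b
        e′ = ℤ-Solver.solve-∀

    finite : T₂ ⊗ T₁ ≈ ∑ (suc L) (λ n → u n ⊗ binom (L + L) (L ∸ n)) ⊕ ∑ L (λ n → v n ⊗ binom (L + L) (suc L + n))
    finite = begin
      T₂ ⊗ T₁
        ≈⟨ ≈-sym (≈-trans (⊗-cong norm-inv ≈-refl) (⊗-identityˡ _)) ⟩
      norm⁻¹ ⊗ norm ⊗ (T₂ ⊗ T₁)
        ≈⟨ ≈-trans (⊗-assoc _ _ _) (⊗-cong ≈-refl (≈-trans (≈-sym product-split) (binomial-theorem ζ (L + L)))) ⟩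
      norm⁻¹ ⊗ ∑ (suc L + L) f
        ≈⟨ ⊗-cong ≈-refl (≈-trans (∑-split (suc L) L f) (⊕-cong (∑-reverse L f) ≈-refl)) ⟩
      norm⁻¹ ⊗ (∑ (suc L) (λ n → f (L ∸ n)) ⊕ ∑ L (λ n → f (suc L + n)))
        ≈⟨ ≈-trans (⊗-distribˡ _ _ _) (⊕-cong
             (≈-trans (∑-⊗ (suc L) norm⁻¹ _) (∑-cong (suc L) (λ n n< → ≈-trans (≈-sym (⊗-assoc _ _ _)) (⊗-cong (norm-u n (ℕₚ.≤-pred n<)) ≈-refl))))
             (≈-trans (∑-⊗ L norm⁻¹ _) (∑-cong L (λ n _ → ≈-trans (≈-sym (⊗-assoc _ _ _)) (⊗-cong (norm-v n) ≈-refl))))) ⟩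
      _ ∎
      where
      f : ℕ → Laurent
      f i = term ζ i ⊗ binom (L + L) i

    ord-u : ∀ n → Ord (+ n) (u n)
    ord-u n = ord-⊗ʳ (ord-sgn n) (ord-weaken bound ord-mon)
      where
      le : n + n * a ≤ tri n * N
      le = ℕₚ.≤-trans (ℕₚ.≤-reflexive (sym (ℕₚ.*-suc n a))) (ℕₚ.*-mono-≤ (tri≥ n) a<N)
      bound : + n ℤ.≤ + tri n ℤ.* + N ℤ.- + n ℤ.* + a
      bound = subst (ℤ._≤ + tri n ℤ.* + N ℤ.- + n ℤ.* + a) (e (+ n) (+ n ℤ.* + a))
        (ℤₚ.+-monoˡ-≤ (ℤ.- (+ n ℤ.* + a)) (subst₂ ℤ._≤_ (cong (λ z → + n ℤ.+ z) (ℤₚ.pos-* n a)) (ℤₚ.pos-* (tri n) N) (ℤ.+≤+ le)))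
        where
        e : ∀ n z → n ℤ.+ z ℤ.- z ≡ n
        e = ℤ-Solver.solve-∀

    ord-v : ∀ n → Ord (+ suc n) (v n)
    ord-v n = ord-⊖ (ord-⊗ʳ (ord-sgn n) (ord-≈ (mon-≡ (cong₂ ℤ._+_ (ℤₚ.pos-* (tri n) N) (ℤₚ.pos-* (suc n) a)))
      (ord-weaken (ℤ.+≤+ (ℕₚ.≤-trans (ℕₚ.≤-reflexive (sym (ℕₚ.*-identityʳ (suc n)))) (ℕₚ.≤-trans (ℕₚ.*-monoʳ-≤ (suc n) 1≤a) (ℕₚ.m≤n+m _ (tri n * N))))) ord-mon)))

    -- The precision L - n falls short of L by n, which the order of `u n` restores in the product.
    poch-u : ∀ n → n ≤ L → poch L ⊗ binom (L + L) (L ∸ n) ≃[ + (L ∸ n) ] 𝟏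
    poch-u n n≤L = ≃-trans (≃-⊗ (ord-poch L) (ord-binom (L + L) j j≤) (subst (λ z → poch z ≃[ + j ] poch j) (ℕₚ.m∸n+n≡m n≤L) (poch-+ j n (ℕₚ.n≤1+n j))) ≃-refl)
      (≃-trans (≈⇒≃ (poch-binom (L + L) j)) (falling-≃ (L + L) j j≤ (ℕₚ.m≤n⇒m≤1+n (ℕₚ.+-mono-≤ (ℕₚ.m∸n≤m L n) (ℕₚ.m∸n≤m L n)))))
      where
      j : ℕ
      j = L ∸ n
      j≤ : j ≤ L + L
      j≤ = ℕₚ.≤-trans (ℕₚ.m∸n≤m L n) (ℕₚ.m≤m+n L L)

    poch-v : ∀ n → n < L → poch L ⊗ binom (L + L) (suc L + n) ≃[ + (L ∸ n) ] 𝟏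
    poch-v n n< = ≃-trans (≃-⊗ (ord-poch L) (ord-binom (L + L) (suc L + n) i≤)
        (≃-sym (subst (λ z → poch z ≃[ + (L ∸ n) ] poch L) (ℕₚ.+-suc L n) (poch-+ L (suc n) (ℕₚ.m≤n⇒m≤1+n (ℕₚ.m∸n≤m L n))))) ≃-refl)
      (≃-trans (≈⇒≃ (poch-binom (L + L) (suc L + n))) (falling-≃ (L + L) (suc L + n) i≤ (ℕₚ.≤-reflexive
        (trans (l (L ∸ n) L n) (cong (λ z → suc (L + z)) (ℕₚ.m∸n+n≡m (ℕₚ.<⇒≤ n<)))))))
      where
      i≤ : suc L + n ≤ L + L
      i≤ = ℕₚ.≤-trans (ℕₚ.≤-reflexive (sym (ℕₚ.+-suc L n))) (ℕₚ.+-monoʳ-≤ L n<)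
      l : ∀ d L n → d + (suc L + n) ≡ suc (L + (d + n))
      l = ℕ-Solver.solve-∀

    theta : Laurent
    theta = ∑ (suc L) (λ n → sgn n ⊗ (mon (+ tri n ℤ.* + N ℤ.- + n ℤ.* + a) ⊕ ⊖ mon (+ tri n ℤ.* + N ℤ.+ + suc n ℤ.* + a)))

    triple-product : theta ≃[ + L ] poch L ⊗ (T₂ ⊗ T₁)
    triple-product = ≃-sym (≃-trans (≈⇒≃ (≈-trans (⊗-cong ≈-refl finite) (≈-trans (⊗-distribˡ _ _ _)
        (⊕-cong (≈-trans (∑-⊗ (suc L) (poch L) _) (∑-cong (suc L) (λ n _ → swap (poch L) (u n) _)))
                (≈-trans (∑-⊗ L (poch L) _) (∑-cong L (λ n _ → swap (poch L) (v n) _)))))))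
      (≃-trans (≃-⊕
        (∑-≃ (suc L) (λ n n< → ≃-weaken (ℤ.+≤+ (ℕₚ.≤-reflexive (sym (ℕₚ.m+[n∸m]≡n (ℕₚ.≤-pred n<)))))
          (ord-≃𝟏 (+ n) (ord-u n) (poch-u n (ℕₚ.≤-pred n<)))))
        (≃-trans (∑-≃ L (λ n n< → ≃-weaken (ℤ.+≤+ (ℕₚ.m≤n⇒m≤1+n (ℕₚ.≤-reflexive (sym (ℕₚ.m+[n∸m]≡n (ℕₚ.<⇒≤ n<))))))
          (ord-≃𝟏 (+ suc n) (ord-v n) (poch-v n n<))))
          -- `v L` lies beyond the precision, so the second sum may be extended to the range of
          -- `theta`.
          (≃-trans (≈⇒≃ (≈-sym (⊕-identityʳ _))) (≃-⊕ ≃-refl (≃-sym (≃𝟎 (ord-weaken (ℤ.+≤+ (ℕₚ.n≤1+n L)) (ord-v L))))))))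
        (≈⇒≃ (≈-sym (≈-trans (∑-cong (suc L) (λ n _ → l (sgn n) _ _)) (∑-⊕ (suc L) u v))))))
      where
      swap : ∀ a b c → a ⊗ (b ⊗ c) ≈ b ⊗ (a ⊗ c)
      swap = Solver.solve-∀ laurentRing
      l : ∀ s a b → s ⊗ (a ⊕ ⊖ b) ≈ s ⊗ a ⊕ ⊖ (s ⊗ b)
      l = Solver.solve-∀ laurentRing

-- The first column in product form

module Evaluate (η K lam M σ ρ a : ℕ) (rs : List ℕ) (M+lam : M + lam ≡ K + suc K)
  (len-rs : length rs ≡ lam) (sum-rs : sum rs ≡ σ)
  (reflect : ∀ (g : ℤ → Laurent) → ∏ₗ rs (λ j → g (+ η ℤ.- + j)) ≈ ∏ₗ rs (λ j → g (+ j)))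
  (1≤η : 1 ≤ η) (lam<K : suc lam ≤ K) (2σ : σ + σ ≡ lam * η) (a+σ : a + σ ≡ suc ρ * η)
  (ρ≤K : ρ ≤ K) (lam≤ : lam ≤ suc ρ) (1≤a : 1 ≤ a) (a<N : a < η * M) where

  open Params η K lam M σ rs M+lam len-rs sum-rs reflect public hiding (a; A≈a; ord-a)
  open Main η K lam M σ rs M+lam len-rs sum-rs reflect 1≤η lam<K public
  open TripleProduct (η * M) a 1≤a a<N public

  -- Together with 2 σ = lam η this says a = η (r - lam / 2), the residue forbidden to non-overlined
  -- parts in `Ā₀`.
  a-ℤ : + suc ρ ℤ.* H ≡ + a ℤ.+ + σ
  a-ℤ = sym (trans (cong +_ a+σ) (ℤₚ.pos-* (suc ρ) η))

  σ-ℤ : + lam ℤ.* H ≡ + σ ℤ.+ + σ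
  σ-ℤ = sym (trans (cong +_ 2σ) (ℤₚ.pos-* lam η))

  N : ℤ
  N = + (η * M)

  expo₀ : ∀ n → + expo 0 n ≡ + tri n ℤ.* N ℤ.+ + n ℤ.* + σ
  expo₀ n = trans (cong +_ (l η M (tri n) (n * σ))) (cong₂ ℤ._+_ (ℤₚ.pos-* (tri n) (η * M)) (ℤₚ.pos-* n σ))
    where
    l : ∀ η M t s → η * (M * t) + s + 0 ≡ t * (η * M) + s
    l = ℕ-Solver.solve-∀

  module _ (L : ℕ) where

    open At L

    Φ : Laurent
    Φ = ∏ (suc L) φ

    Φ-split : ∀ n → n ≤ L → Φ ≈ ∏ n φ ⊗ φ n ⊗ ∏ (L ∸ n) (λ i → φ (suc (n + 0) + i))
    Φ-split n n≤L = ≈-trans (≈-reflexive (cong (λ z → ∏ (suc z) φ) (sym (ℕₚ.m+[n∸m]≡n n≤L))))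
      (≈-trans (∏-split (suc n) (L ∸ n) φ) (⊗-cong ≈-refl (∏-cong (L ∸ n) (λ i _ →
        ≈-reflexive (cong (λ z → φ (suc z + i)) (sym (ℕₚ.+-identityʳ n)))))))

    evaluate-free : Col.free 0 L alphas (+ ρ) ≈ P 0 L ⊗ Φ ⊗ theta
    evaluate-free = ≈-trans (Col.free-exp 0 L alphas (+ ρ)) (≈-trans (∑-cong (suc L) term′) (≈-sym (∑-⊗ (suc L) (P 0 L ⊗ Φ) _)))
      where
      fκ : ∀ n → ∏ₗ alphas (λ b → 𝟏 ⊕ b ⊗ mon (ℤ.- κ n)) ≈ φ n
      fκ n = ≈-trans (∏ₗ-alphas (ℤ.- κ n)) (φ-ℤ n (ℤ.- κ n) (sym (ℤₚ.neg-involutive (+ n ℤ.* H))))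
      fν : ∀ n → ∏ₗ alphas (λ b → 𝟏 ⊕ b ⊗ mon (ℤ.- ν 0 n)) ≈ mon (+ σ ℤ.- + lam ℤ.* (+ suc n ℤ.* H)) ⊗ φ n
      fν n = ≈-trans (∏ₗ-alphas (ℤ.- ν 0 n)) (≈-trans (≈-reflexive (cong (λ z → ∏ₗ rs (λ α → one+mon (+ α ℤ.+ ℤ.- (+ suc z ℤ.* H))))
        (ℕₚ.+-identityʳ n))) (φ-neg n))
      term′ : ∀ n → n < suc L → A 0 L n ⊗
        (mon (κ n ℤ.* (+ ρ ℤ.+ 1ℤ)) ⊗ ∏ₗ alphas (λ b → 𝟏 ⊕ b ⊗ mon (ℤ.- κ n))
         ⊕ ⊖ (mon (ν 0 n ℤ.* (+ ρ ℤ.+ 1ℤ)) ⊗ ∏ₗ alphas (λ b → 𝟏 ⊕ b ⊗ mon (ℤ.- ν 0 n))))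
        ≈ P 0 L ⊗ Φ ⊗ (sgn n ⊗ (mon (+ tri n ℤ.* N ℤ.- + n ℤ.* + a) ⊕ ⊖ mon (+ tri n ℤ.* N ℤ.+ + suc n ℤ.* + a)))
      term′ n n< = begin
        _ ≈⟨ ⊗-cong ≈-refl (⊕-cong (⊗-cong ≈-refl (fκ n)) (⊖-cong (⊗-cong ≈-refl (fν n)))) ⟩
        P 0 L ⊗ (sgn n ⊗ E ⊗ 𝟏 ⊗ (∏ n φ ⊗ R)) ⊗ (U ⊗ φ n ⊕ ⊖ (V ⊗ (W ⊗ φ n)))
          ≈⟨ l (P 0 L) (sgn n) E (∏ n φ) R U (φ n) V W ⟩
        P 0 L ⊗ (∏ n φ ⊗ φ n ⊗ R) ⊗ (sgn n ⊗ (E ⊗ U ⊕ ⊖ (E ⊗ V ⊗ W)))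
          ≈⟨ ⊗-cong (⊗-cong ≈-refl (≈-sym (Φ-split n (ℕₚ.≤-pred n<)))) (⊗-cong ≈-refl (⊕-cong
               (≈-trans (≈-sym (mon-+ (+ expo 0 n) (κ n ℤ.* (+ ρ ℤ.+ 1ℤ)))) (mon-≡ eU))
               (⊖-cong (≈-trans (⊗-cong (≈-sym (mon-+ (+ expo 0 n) (ν 0 n ℤ.* (+ ρ ℤ.+ 1ℤ)))) ≈-refl)
                 (≈-trans (≈-sym (mon-+ _ (+ σ ℤ.- + lam ℤ.* (+ suc n ℤ.* H)))) (mon-≡ eV)))))) ⟩
        _ ∎
        where
        E U V W R : Laurent
        E = mon (+ expo 0 n)
        U = mon (κ n ℤ.* (+ ρ ℤ.+ 1ℤ))
        V = mon (ν 0 n ℤ.* (+ ρ ℤ.+ 1ℤ))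
        W = mon (+ σ ℤ.- + lam ℤ.* (+ suc n ℤ.* H))
        R = ∏ (L ∸ n) (λ i → φ (suc (n + 0) + i))
        l : ∀ P s E F R U f V W → P ⊗ (s ⊗ E ⊗ 𝟏 ⊗ (F ⊗ R)) ⊗ (U ⊗ f ⊕ ⊖ (V ⊗ (W ⊗ f)))
          ≈ P ⊗ (F ⊗ f ⊗ R) ⊗ (s ⊗ (E ⊗ U ⊕ ⊖ (E ⊗ V ⊗ W)))
        l = Solver.solve-∀ laurentRing
        eU : + expo 0 n ℤ.+ κ n ℤ.* (+ ρ ℤ.+ 1ℤ) ≡ + tri n ℤ.* N ℤ.- + n ℤ.* + a
        eU = trans (cong (ℤ._+ κ n ℤ.* (+ ρ ℤ.+ 1ℤ)) (expo₀ n)) (trans (e₁ (+ tri n ℤ.* N) (+ n) (+ σ) H (+ ρ))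
               (trans (cong (λ z → + tri n ℤ.* N ℤ.+ + n ℤ.* + σ ℤ.- + n ℤ.* z) a-ℤ) (e₂ (+ tri n ℤ.* N) (+ n) (+ σ) (+ a))))
          where
          e₁ : ∀ t n s h r → t ℤ.+ n ℤ.* s ℤ.+ ℤ.- (n ℤ.* h) ℤ.* (r ℤ.+ 1ℤ) ≡ t ℤ.+ n ℤ.* s ℤ.- n ℤ.* ((1ℤ ℤ.+ r) ℤ.* h)
          e₁ = ℤ-Solver.solve-∀
          e₂ : ∀ t n s a → t ℤ.+ n ℤ.* s ℤ.- n ℤ.* (a ℤ.+ s) ≡ t ℤ.- n ℤ.* a
          e₂ = ℤ-Solver.solve-∀
        eV : + expo 0 n ℤ.+ ν 0 n ℤ.* (+ ρ ℤ.+ 1ℤ) ℤ.+ (+ σ ℤ.- + lam ℤ.* (+ suc n ℤ.* H)) ≡ + tri n ℤ.* N ℤ.+ + suc n ℤ.* + a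
        eV = trans (cong₂ (λ y z → y ℤ.+ + suc z ℤ.* H ℤ.* (+ ρ ℤ.+ 1ℤ) ℤ.+ (+ σ ℤ.- + lam ℤ.* (+ suc n ℤ.* H))) (expo₀ n) (ℕₚ.+-identityʳ n))
               (trans (e₁ (+ tri n ℤ.* N) (+ n) (+ σ) H (+ ρ) (+ lam))
                 (trans (cong₂ (λ y z → + tri n ℤ.* N ℤ.+ + n ℤ.* + σ ℤ.+ + σ ℤ.+ + suc n ℤ.* y ℤ.- + suc n ℤ.* z) a-ℤ σ-ℤ)
                   (e₂ (+ tri n ℤ.* N) (+ n) (+ σ) (+ a))))
          where
          e₁ : ∀ t n s h r l → t ℤ.+ n ℤ.* s ℤ.+ (1ℤ ℤ.+ n) ℤ.* h ℤ.* (r ℤ.+ 1ℤ) ℤ.+ (s ℤ.- l ℤ.* ((1ℤ ℤ.+ n) ℤ.* h))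
             ≡ t ℤ.+ n ℤ.* s ℤ.+ s ℤ.+ (1ℤ ℤ.+ n) ℤ.* ((1ℤ ℤ.+ r) ℤ.* h) ℤ.- (1ℤ ℤ.+ n) ℤ.* (l ℤ.* h)
          e₁ = ℤ-Solver.solve-∀
          e₂ : ∀ t n s a → t ℤ.+ n ℤ.* s ℤ.+ s ℤ.+ (1ℤ ℤ.+ n) ℤ.* (a ℤ.+ s) ℤ.- (1ℤ ℤ.+ n) ℤ.* (s ℤ.+ s) ≡ t ℤ.+ (1ℤ ℤ.+ n) ℤ.* a
          e₂ = ℤ-Solver.solve-∀

  genB : ℕ → Laurent
  genB L = bitsum alphas (zeros rs) ρ (λ e → tail (suc L) 0 (0 ∷ e))

  genB-product : ∀ L → D (suc L) ⊗ genB L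
    ≃[ + suc L ] P 0 (suc L) ⊗ ∏ (suc (suc L)) φ ⊗ (poch (suc L) ⊗ (At.T₂ (suc L) ⊗ At.T₁ (suc L)))
  genB-product L = ≃-trans (first-column L ρ ρ≤K lam≤) (≃-trans (≈⇒≃ (evaluate-free (suc L)))
    (≃-⊗ʳ (ord-⊗ˡ (ord-P 0 (suc L)) (ord-∏ (suc (suc L)) ord-φ)) (At.triple-product (suc L))))

-- Enumeration of overpartitions

unique⇒↭ : ∀ {A : Set} {xs ys : List A} → Unique xs → Unique ys →
  (∀ x → x ∈ xs → x ∈ ys) → (∀ x → x ∈ ys → x ∈ xs) → xs ↭ ys
unique⇒↭ u v f g = ∼bag⇒↭ (unique∧set⇒bag u v (mk⇔ (f _) (g _)))

unique-concatMap : ∀ {A B : Set} (f : A → List B) xs → Unique xs → (∀ x → Unique (f x)) →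
  (∀ {x y z} → z ∈ f x → z ∈ f y → x ≡ y) → Unique (concatMap f xs)
unique-concatMap f []       []       u d = []
unique-concatMap f (x ∷ xs) (p ∷ ps) u d = Uniqueₚ.++⁺ (u x) (unique-concatMap f xs ps u d)
  λ { (z∈x , z∈xs) → let y , y∈xs , z∈y = find (∈-concatMap⁻ f {xs = xs} z∈xs) in All.lookup p y∈xs (d z∈x z∈y) }

alphabet-unique : ∀ n → Unique (alphabet n)
alphabet-unique n = unique-concatMap _ (upTo n) (Uniqueₚ.upTo⁺ n)
  (λ m → ((λ ()) ∷ []) ∷ [] ∷ [])
  (λ {x} {y} z∈x z∈y → ℕₚ.suc-injective (trans (sym (size≡ x z∈x)) (size≡ y z∈y)))
  where
  size≡ : ∀ m {z} → z ∈ ((suc m , false) ∷ (suc m , true) ∷ []) → size z ≡ suc m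
  size≡ m (here refl)         = refl
  size≡ m (there (here refl)) = refl

listsOfLength-unique : ∀ L as → Unique as → Unique (listsOfLength L as)
listsOfLength-unique zero    as u = [] ∷ []
listsOfLength-unique (suc L) as u = unique-concatMap _ as u
  (λ a → Uniqueₚ.map⁺ Listₚ.∷-injectiveʳ (listsOfLength-unique L as u))
  λ z∈x z∈y → let _ , _ , e = ∈-map⁻ _ z∈x ; _ , _ , e′ = ∈-map⁻ _ z∈y in Listₚ.∷-injectiveˡ (trans (sym e) e′)

∈-listsOfLength⁻ : ∀ L as {π} → π ∈ listsOfLength L as → length π ≡ L
∈-listsOfLength⁻ zero    as (here refl) = refl
∈-listsOfLength⁻ (suc L) as π∈ with a , _ , π∈a ← find (∈-concatMap⁻ _ {xs = as} π∈)
  with π′ , π′∈ , refl ← ∈-map⁻ _ π∈a = cong suc (∈-listsOfLength⁻ L as π′∈)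

∈-listsOfLength⁺ : ∀ as {π} → All (_∈ as) π → π ∈ listsOfLength (length π) as
∈-listsOfLength⁺ as []       = here refl
∈-listsOfLength⁺ as (p ∷ ps) = ∈-concatMap⁺ _ (lose p (∈-map⁺ _ (∈-listsOfLength⁺ as ps)))

candidates-unique : ∀ n → Unique (candidates n)
candidates-unique n = unique-concatMap _ (upTo (suc n)) (Uniqueₚ.upTo⁺ (suc n))
  (λ L → listsOfLength-unique L (alphabet n) (alphabet-unique n))
  λ {x} {y} z∈x z∈y → trans (sym (∈-listsOfLength⁻ x _ z∈x)) (∈-listsOfLength⁻ y _ z∈y)

weight : List Part → ℕ
weight π = sum (map size π)

weight-++ : ∀ π ρ → weight (π ++ ρ) ≡ weight π + weight ρ
weight-++ π ρ = trans (cong sum (Listₚ.map-++ size π ρ)) (sum-++ (map size π) (map size ρ))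

weight-replicate : ∀ f p → weight (replicate f p) ≡ f * size p
weight-replicate zero    p = refl
weight-replicate (suc f) p = cong (λ z → size p + z) (weight-replicate f p)

∈-alphabet : ∀ {n} p → 1 ≤ size p → size p ≤ n → p ∈ alphabet n
∈-alphabet (suc m , false) _ h = ∈-concatMap⁺ _ (lose (∈-upTo⁺ h) (here refl))
∈-alphabet (suc m , true)  _ h = ∈-concatMap⁺ _ (lose (∈-upTo⁺ h) (there (here refl)))

size≤weight : ∀ π → All (λ p → size p ≤ weight π) π
size≤weight []      = []
size≤weight (p ∷ π) = ℕₚ.m≤m+n (size p) (weight π) ∷ All.map (λ h → ℕₚ.≤-trans h (ℕₚ.m≤n+m (weight π) (size p))) (size≤weight π)

length≤weight : ∀ π → All (λ p → 1 ≤ size p) π → length π ≤ weight π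
length≤weight []      []       = z≤n
length≤weight (p ∷ π) (h ∷ hs) = ℕₚ.+-mono-≤ h (length≤weight π hs)

∈-candidates : ∀ π → All (λ p → 1 ≤ size p) π → π ∈ candidates (weight π)
∈-candidates π hs = ∈-concatMap⁺ (λ L → listsOfLength L (alphabet (weight π))) (lose (∈-upTo⁺ (s≤s (length≤weight π hs)))
  (∈-listsOfLength⁺ (alphabet (weight π)) (All.zipWith (λ {p} (h , h′) → ∈-alphabet p h h′) (hs , size≤weight π))))

infix 4 _⊒_

-- The strict clause forbids two equal overlined parts. The relation is transitive, so the tests on
-- neighbours in `nonincreasing` and `overlinesDistinct` extend to all pairs.
_⊒_ : Part → Part → Set
p ⊒ q = key q ≤ key p × (T (ov q) → key q < key p)

⊒-trans : ∀ {p q r} → p ⊒ q → q ⊒ r → p ⊒ r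
⊒-trans (a , b) (c , d) = ℕₚ.≤-trans c a , λ t → ℕₚ.<-≤-trans (d t) a

Sorted : List Part → Set
Sorted = AllPairs _⊒_

sorted⁺ : ∀ π → T (nonincreasing π) → T (overlinesDistinct π) → Sorted π
sorted⁺ π h h′ = Linkedₚ.Linked⇒AllPairs (λ {p} {q} {r} → ⊒-trans {p} {q} {r}) (go π h h′)
  where
  go : ∀ π → T (nonincreasing π) → T (overlinesDistinct π) → Linked _⊒_ π
  go []          h h′ = []
  go (p ∷ [])    h h′ = [-]
  go (p ∷ (s , false) ∷ π) h h′ =
    let a , b = Equivalence.to (T-∧ {key (s , false) ≤ᵇ key p}) h
    in (ℕₚ.≤ᵇ⇒≤ _ _ a , λ ()) ∷ go ((s , false) ∷ π) b h′
  go (p ∷ (s , true) ∷ π) h h′ =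
    let a , b = Equivalence.to (T-∧ {key (s , true) ≤ᵇ key p}) h
        c , d = Equivalence.to (T-∧ {key (s , true) <ᵇ key p}) h′
    in (ℕₚ.≤ᵇ⇒≤ _ _ a , λ _ → ℕₚ.<ᵇ⇒< _ _ c) ∷ go ((s , true) ∷ π) b d

sorted⁻ : ∀ π → Sorted π → T (nonincreasing π) × T (overlinesDistinct π)
sorted⁻ []       s = tt , tt
sorted⁻ (p ∷ []) s = tt , tt
sorted⁻ (p ∷ (n , false) ∷ π) (((a , _) ∷ _) ∷ s) with b , c ← sorted⁻ ((n , false) ∷ π) s =
  Equivalence.from T-∧ (ℕₚ.≤⇒≤ᵇ a , b) , c
sorted⁻ (p ∷ (n , true) ∷ π) (((a , a′) ∷ _) ∷ s) with b , c ← sorted⁻ ((n , true) ∷ π) s =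
  Equivalence.from T-∧ (ℕₚ.≤⇒≤ᵇ a , b) , Equivalence.from T-∧ (ℕₚ.<⇒<ᵇ (a′ tt) , c)

cap : ℕ → Part → ℕ
cap N p = if ov p then 1 else N

-- The lists obtained from acc by putting, for each part p of the increasing
-- list ps, at most cap N p copies of p in front.
configs : ℕ → List Part → List Part → List (List Part)
configs N []       acc = acc ∷ []
configs N (p ∷ ps) acc = concatMap (λ f → configs N ps (replicate f p ++ acc)) (upTo (suc (cap N p)))

Ascending : List Part → Set
Ascending = AllPairs (λ p q → key p < key q)

All-replicate : ∀ {A : Set} {P : A → Set} f {x} → P x → All P (replicate f x)
All-replicate zero    h = []
All-replicate (suc f) h = h ∷ All-replicate f h

configs-suffix : ∀ N ps acc {π} → π ∈ configs N ps acc → ∃ λ X → π ≡ X ++ acc × All (_∈ ps) X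
configs-suffix N []       acc (here refl) = [] , refl , []
configs-suffix N (p ∷ ps) acc π∈
  with f , _ , π∈f ← find (∈-concatMap⁻ _ {xs = upTo (suc (cap N p))} π∈)
  with X , refl , all ← configs-suffix N ps (replicate f p ++ acc) π∈f =
  X ++ replicate f p , sym (Listₚ.++-assoc X _ _) , Allₚ.++⁺ (All.map there all) (All-replicate f (here refl))

-- The multiplicity f is recovered by counting the copies of p: all parts still to be placed are
-- larger.
configs-unique : ∀ N ps acc → Ascending ps → Unique (configs N ps acc)
configs-unique N []       acc _        = [] ∷ []
configs-unique N (p ∷ ps) acc (h ∷ hs) = unique-concatMap _ (upTo (suc (cap N p))) (Uniqueₚ.upTo⁺ _)
  (λ f → configs-unique N ps _ hs)
  λ {f} {f′} π∈ π∈′ → same f f′ (configs-suffix N ps _ π∈) (configs-suffix N ps _ π∈′)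
  where
  copies : List Part → ℕ
  copies = length ∘ filterᵇ (λ x → key x ≡ᵇ key p)
  copies-++ : ∀ X Y → copies (X ++ Y) ≡ copies X + copies Y
  copies-++ X Y = trans (cong length (Listₚ.filter-++ (T? ∘ (λ x → key x ≡ᵇ key p)) X Y)) (Listₚ.length-++ (filterᵇ _ X))
  copies-X : ∀ {X} → All (_∈ ps) X → copies X ≡ 0
  copies-X all = cong length (Listₚ.filter-none (T? ∘ (λ x → key x ≡ᵇ key p))
    (All.map (λ x∈ t → ℕₚ.<⇒≢ (All.lookup h x∈) (sym (ℕₚ.≡ᵇ⇒≡ _ _ t))) all))
  copies-p : ∀ f → copies (replicate f p) ≡ f
  copies-p f = trans (cong length (Listₚ.filter-all (T? ∘ (λ x → key x ≡ᵇ key p)) (All-replicate f (ℕₚ.≡⇒≡ᵇ (key p) (key p) refl))))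
    (Listₚ.length-replicate f)
  count : ∀ {X} f → All (_∈ ps) X → copies (X ++ replicate f p ++ acc) ≡ f + copies acc
  count {X} f all = trans (copies-++ X _) (trans (cong₂ _+_ (copies-X all) (copies-++ (replicate f p) acc)) (cong (_+ copies acc) (copies-p f)))
  same : ∀ f f′ {π} → (∃ λ X → π ≡ X ++ replicate f p ++ acc × All (_∈ ps) X) →
    (∃ λ X → π ≡ X ++ replicate f′ p ++ acc × All (_∈ ps) X) → f ≡ f′
  same f f′ (X , refl , all) (X′ , e , all′) = ℕₚ.+-cancelʳ-≡ (copies acc) f f′
    (trans (sym (count f all)) (trans (cong copies e) (count f′ all′)))

sorted-replicate : ∀ f p → (T (ov p) → f ≤ 1) → Sorted (replicate f p)
sorted-replicate zero          p h = []
sorted-replicate (suc zero)    p h = [] ∷ []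
sorted-replicate (suc (suc f)) p h =
  All-replicate (suc f) (ℕₚ.≤-refl , no-ov) ∷ sorted-replicate (suc f) p (λ t → contradiction (h t) λ { (s≤s ()) })
  where
  no-ov : T (ov p) → key p < key p
  no-ov t = contradiction (h t) λ { (s≤s ()) }

configs-sorted : ∀ N ps acc {π} → Ascending ps → All (λ p → All (λ x → key x < key p) acc) ps → Sorted acc →
  π ∈ configs N ps acc → Sorted π
configs-sorted N []       acc _        _        s (here refl) = s
configs-sorted N (p ∷ ps) acc (h ∷ hs) (b ∷ bs) s π∈
  with f , f∈ , π∈f ← find (∈-concatMap⁻ _ {xs = upTo (suc (cap N p))} π∈) =
  configs-sorted N ps _ hs
    (All.zipWith (λ (p<q , b) → Allₚ.++⁺ (All-replicate f p<q) b) (h , bs))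
    (AllPairsₚ.++⁺ (sorted-replicate f p (bound p (ℕₚ.≤-pred (∈-upTo⁻ f∈)))) s
      (All-replicate f (All.map (λ x<p → ℕₚ.<⇒≤ x<p , λ _ → x<p) b))) π∈f
  where
  bound : ∀ p {f} → f ≤ cap N p → T (ov p) → f ≤ 1
  bound (_ , true) h _ = h

split-smallest : ∀ p ps → All (λ q → key p < key q) ps → ∀ π → All (_∈ p ∷ ps) π → Sorted π →
  ∃₂ λ X f → π ≡ X ++ replicate f p × All (_∈ ps) X
split-smallest p ps h []      _        _ = [] , 0 , refl , []
split-smallest p ps h (a ∷ π) (there a∈ ∷ as) (_ ∷ s) with X , f , refl , all ← split-smallest p ps h π as s =
  a ∷ X , f , refl , a∈ ∷ all
split-smallest p ps h (.p ∷ π) (here refl ∷ as) (g ∷ s) = [] , suc (length π) , cong (p ∷_) (go π as g) , []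
  where
  go : ∀ π → All (_∈ p ∷ ps) π → All (p ⊒_) π → π ≡ replicate (length π) p
  go []      _                _              = refl
  go (x ∷ π) (here refl ∷ as) (_ ∷ gs)       = cong (p ∷_) (go π as gs)
  go (x ∷ π) (there x∈ ∷ as)  ((le , _) ∷ gs) = contradiction le (ℕₚ.<⇒≱ (All.lookup h x∈))

sorted-++ˡ : ∀ X {Y} → Sorted (X ++ Y) → Sorted X
sorted-++ˡ []      s       = []
sorted-++ˡ (x ∷ X) (h ∷ s) = Allₚ.++⁻ˡ X h ∷ sorted-++ˡ X s

sorted-++ʳ : ∀ X {Y} → Sorted (X ++ Y) → Sorted Y
sorted-++ʳ []      s       = s
sorted-++ʳ (x ∷ X) (h ∷ s) = sorted-++ʳ X s

∈-configs : ∀ N ps acc π → Ascending ps → All (λ p → 1 ≤ size p) ps → All (_∈ ps) π → Sorted π → weight π ≤ N →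
  π ++ acc ∈ configs N ps acc
∈-configs N []       acc []      _        _        _   _ _ = here refl
∈-configs N []       acc (_ ∷ _) _        _        (() ∷ _) _ _
∈-configs N (p ∷ ps) acc π       (h ∷ hs) (1≤ ∷ 1≤s) all s w
  with X , f , refl , allX ← split-smallest p ps h π all s =
  ∈-concatMap⁺ _ (lose (∈-upTo⁺ (s≤s (bound p (sorted-++ʳ X s) f≤N)))
    (subst (_∈ configs N ps (replicate f p ++ acc)) (sym (Listₚ.++-assoc X (replicate f p) acc))
      (∈-configs N ps (replicate f p ++ acc) X hs 1≤s allX (sorted-++ˡ X s) w-X)))
  where
  w-X : weight X ≤ N
  w-X = ℕₚ.≤-trans (ℕₚ.m≤m+n _ _) (ℕₚ.≤-trans (ℕₚ.≤-reflexive (sym (weight-++ X (replicate f p)))) w)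
  f≤N : f ≤ N
  f≤N = ℕₚ.≤-trans (ℕₚ.≤-trans (ℕₚ.≤-reflexive (sym (ℕₚ.*-identityʳ f))) (ℕₚ.*-monoʳ-≤ f 1≤))
    (ℕₚ.≤-trans (ℕₚ.≤-reflexive (sym (weight-replicate f p))) (ℕₚ.≤-trans (ℕₚ.m≤n+m _ (weight X))
      (ℕₚ.≤-trans (ℕₚ.≤-reflexive (sym (weight-++ X (replicate f p)))) w)))
  bound : ∀ p {f} → Sorted (replicate f p) → f ≤ N → f ≤ cap N p
  bound (_ , false) {f}           s le = le
  bound (_ , true)  {zero}        s le = z≤n
  bound (_ , true)  {suc zero}    s le = s≤s z≤n
  bound (_ , true)  {suc (suc f)} (((_ , lt) ∷ _) ∷ _) le = contradiction (lt tt) (ℕₚ.<-irrefl refl)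

all⁺ : ∀ {A : Set} (f : A → Bool) xs → All (T ∘ f) xs → T (all f xs)
all⁺ f []       []       = tt
all⁺ f (x ∷ xs) (h ∷ hs) = Equivalence.from T-∧ (h , all⁺ f xs hs)

all⁻ : ∀ {A : Set} (f : A → Bool) xs → T (all f xs) → All (T ∘ f) xs
all⁻ f []       h = []
all⁻ f (x ∷ xs) h with a , b ← Equivalence.to (T-∧ {f x}) h = a ∷ all⁻ f xs b

-- Replaces the search among all candidate lists by a construction part by part, which a generating
-- function can follow.
count-configs : ∀ (P : List Part → Bool) N n ps → n ≤ N → Ascending ps → All (λ p → 1 ≤ size p) ps →
  (∀ π → Sorted π → All (λ p → 1 ≤ size p × size p ≤ n) π → T (P π) → All (_∈ ps) π) →
  countOverpartitions P n ≡ length (filterᵇ (λ π → (weight π ≡ᵇ n) ∧ P π) (configs N ps []))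
count-configs P N n ps n≤N asc 1≤ps within = ↭-length (unique⇒↭
  (Uniqueₚ.filter⁺ (T? ∘ (λ π → IsOverpartitionOf n π ∧ P π)) (candidates-unique n))
  (Uniqueₚ.filter⁺ (T? ∘ (λ π → (weight π ≡ᵇ n) ∧ P π)) (configs-unique N ps [] asc)) to from)
  where
  to : ∀ π → π ∈ filterᵇ (λ π → IsOverpartitionOf n π ∧ P π) (candidates n) →
       π ∈ filterᵇ (λ π → (weight π ≡ᵇ n) ∧ P π) (configs N ps [])
  to π π∈ with _ , h ← ∈-filter⁻ (T? ∘ (λ π → IsOverpartitionOf n π ∧ P π)) {xs = candidates n} π∈
    with op , hP ← Equivalence.to (T-∧ {IsOverpartitionOf n π}) h
    with h₁ , op ← Equivalence.to (T-∧ {all (λ p → 1 ≤ᵇ size p) π}) op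
    with h₂ , op ← Equivalence.to (T-∧ {nonincreasing π}) op
    with h₃ , h₄ ← Equivalence.to (T-∧ {overlinesDistinct π}) op
    with refl ← ℕₚ.≡ᵇ⇒≡ (weight π) n h₄ =
    ∈-filter⁺ (T? ∘ (λ π → (weight π ≡ᵇ n) ∧ P π)) (subst (_∈ configs N ps []) (Listₚ.++-identityʳ π)
      (∈-configs N ps [] π asc 1≤ps (within π s (All.zip (1≤π , size≤weight π)) hP) s n≤N))
      (Equivalence.from T-∧ (h₄ , hP))
    where
    s : Sorted π
    s = sorted⁺ π h₂ h₃
    1≤π : All (λ p → 1 ≤ size p) π
    1≤π = All.map (ℕₚ.≤ᵇ⇒≤ 1 _) (all⁻ (λ p → 1 ≤ᵇ size p) π h₁)
  from : ∀ π → π ∈ filterᵇ (λ π → (weight π ≡ᵇ n) ∧ P π) (configs N ps []) →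
         π ∈ filterᵇ (λ π → IsOverpartitionOf n π ∧ P π) (candidates n)
  from π π∈ with π∈c , h ← ∈-filter⁻ (T? ∘ (λ π → (weight π ≡ᵇ n) ∧ P π)) {xs = configs N ps []} π∈
    with hw , hP ← Equivalence.to (T-∧ {weight π ≡ᵇ n}) h
    with refl ← ℕₚ.≡ᵇ⇒≡ (weight π) n hw
    with X , refl , allX ← configs-suffix N ps [] π∈c =
    ∈-filter⁺ (T? ∘ (λ π → IsOverpartitionOf n π ∧ P π)) (∈-candidates π 1≤π) (Equivalence.from T-∧ (Equivalence.from T-∧
      (all⁺ (λ p → 1 ≤ᵇ size p) π (All.map ℕₚ.≤⇒≤ᵇ 1≤π) , Equivalence.from T-∧ (proj₁ ss , Equivalence.from T-∧ (proj₂ ss , hw))) , hP))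
    where
    1≤π : All (λ p → 1 ≤ size p) (X ++ [])
    1≤π = Allₚ.++⁺ (All.map (All.lookup 1≤ps) allX) []
    ss : T (nonincreasing (X ++ [])) × T (overlinesDistinct (X ++ []))
    ss = sorted⁻ (X ++ []) (configs-sorted N ps [] asc (All.map (λ _ → []) 1≤ps) [] π∈c)

gen : (List Part → Bool) → List (List Part) → Laurent
gen P []       = 𝟎
gen P (π ∷ πs) = (if P π then mon (+ weight π) else 𝟎) ⊕ gen P πs

gen-++ : ∀ P πs ρs → gen P (πs ++ ρs) ≈ gen P πs ⊕ gen P ρs
gen-++ P []       ρs = ≈-sym (⊕-identityˡ _)
gen-++ P (π ∷ πs) ρs = ≈-trans (⊕-cong ≈-refl (gen-++ P πs ρs)) (≈-sym (⊕-assoc _ _ _))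

coeff-mon : ∀ n m → coeff n (mon (+ m)) ≡ (if m ≡ᵇ n then 1ℤ else 0ℤ)
coeff-mon n m = trans (act-mon (+ m) δ (+ n)) (trans (cong δ (ℤₚ.m-n≡m⊖n n m)) (go n m))
  where
  go : ∀ n m → δ (n ℤ.⊖ m) ≡ (if m ≡ᵇ n then 1ℤ else 0ℤ)
  go zero    zero    = refl
  go zero    (suc m) = refl
  go (suc n) zero    = refl
  go (suc n) (suc m) = trans (cong δ (ℤₚ.[1+m]⊖[1+n]≡m⊖n n m)) (go n m)

coeff-gen : ∀ P n πs → coeff n (gen P πs) ≡ + length (filterᵇ (λ π → (weight π ≡ᵇ n) ∧ P π) πs)
coeff-gen P n []       = refl
coeff-gen P n (π ∷ πs) = trans (act-⊕ (if P π then mon (+ weight π) else 𝟎) (gen P πs) δ (+ n)) go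
  where
  go : coeff n (if P π then mon (+ weight π) else 𝟎) ℤ.+ coeff n (gen P πs)
     ≡ + length (filterᵇ (λ π → (weight π ≡ᵇ n) ∧ P π) (π ∷ πs))
  go with P π | weight π ≡ᵇ n | coeff-mon n (weight π)
  ... | true  | true  | e rewrite e | coeff-gen P n πs = refl
  ... | true  | false | e rewrite e | coeff-gen P n πs = refl
  ... | false | true  | e rewrite coeff-gen P n πs = refl
  ... | false | false | e rewrite coeff-gen P n πs = refl

gen-concatMap : ∀ {P} (f : ℕ → List (List Part)) n → gen P (concatMap f (upTo n)) ≈ ∑ n (λ i → gen P (f i))
gen-concatMap {P} f n = go n (λ i → i)
  where
  go : ∀ n (g : ℕ → ℕ) → gen P (concatMap f (applyUpTo g n)) ≈ ∑ n (λ i → gen P (f (g i)))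
  go zero    g = ≈-refl
  go (suc n) g = ≈-trans (gen-++ P (f (g 0)) _) (≈-trans (⊕-cong ≈-refl (go n (λ i → g (suc i)))) (≈-sym (∑-front n (λ i → gen P (f (g i))))))

-- Scanning an overpartition from its smallest part

mod-unique : ∀ {n m j} k → j < m → n ≡ k * m + j → n mod m ≡ j
mod-unique {m = suc m} {j} k j<m refl =
  trans (cong (DM._% suc m) (ℕₚ.+-comm (k * suc m) j)) (trans (DM.[m+kn]%n≡m%n j k (suc m)) (DM.m<n⇒m%n≡m j<m))

div-unique : ∀ {n m j} k → j < m → n ≡ k * m + j → n div m ≡ k
div-unique {m = suc m} {j} k j<m refl = trans (DM.+-distrib-/ (k * suc m) j small)
  (trans (cong₂ _+_ (DM.m*n/n≡m k (suc m)) (DM.m<n⇒m/n≡0 j<m)) (ℕₚ.+-identityʳ k))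
  where
  small : (k * suc m) DM.% suc m + j DM.% suc m < suc m
  small rewrite DM.m*n%n≡0 k (suc m) {{_}} | DM.m<n⇒m%n≡m j<m = j<m

par-2* : ∀ n x → par (n + 2 * x) ≡ par n
par-2* n zero    = cong par (ℕₚ.+-identityʳ n)
par-2* n (suc x) = trans (cong par (l n x)) (par-2* n x)
  where
  l : ∀ n x → n + 2 * suc x ≡ suc (suc (n + 2 * x))
  l = ℕ-Solver.solve-∀

par-≡ : ∀ a b x y → a + 2 * x ≡ b + 2 * y → par a ≡ par b
par-≡ a b x y e = trans (sym (par-2* a x)) (trans (cong par e) (par-2* b y))

par-+ˡ : ∀ {a b} c → par a ≡ par b → par (a + c) ≡ par (b + c)
par-+ˡ {a} {b} c e = trans (sym (split a)) (trans (cong (λ z → par (z + c)) e) (split b))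
  where
  split : ∀ a → par (par a + c) ≡ par (a + c)
  split 0             = refl
  split 1             = refl
  split (suc (suc a)) = split a

mod2 : ∀ n → n mod 2 ≡ par n
mod2 0             = refl
mod2 1             = refl
mod2 (suc (suc n)) = trans (cong (_mod 2) (ℕₚ.+-comm 2 n)) (trans (DM.[m+n]%n≡m%n n 2) (mod2 n))

par-mod⁻ : ∀ a b → T (a mod 2 ≡ᵇ b mod 2) → par a ≡ par b
par-mod⁻ a b h = trans (sym (mod2 a)) (trans (ℕₚ.≡ᵇ⇒≡ (a mod 2) (b mod 2) h) (mod2 b))

par-mod⁺ : ∀ a b → par a ≡ par b → T (a mod 2 ≡ᵇ b mod 2)
par-mod⁺ a b e = ℕₚ.≡⇒≡ᵇ (a mod 2) (b mod 2) (trans (mod2 a) (trans e (sym (mod2 b))))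

<ᵇ⁺ : ∀ m n → m < n → T (m <ᵇ n)
<ᵇ⁺ m n = ℕₚ.<⇒<ᵇ

≤ᵇ⁺ : ∀ m n → m ≤ n → T (m ≤ᵇ n)
≤ᵇ⁺ m n = ℕₚ.≤⇒≤ᵇ

bitsum-bs : ∀ {bs bs′} ss c K → Pointwise _≈_ bs bs′ → bitsum bs ss c K ≈ bitsum bs′ ss c K
bitsum-bs ss       c K []       = ≈-refl
bitsum-bs []       c K (e ∷ es) = ≈-refl
bitsum-bs {_ ∷ bs} {_ ∷ bs′} (s ∷ ss) c K (e ∷ es) = ⊕-cong (bitsum-bs ss (s + c) _ es) (⊗-cong e (go (s + c)))
  where
  go : ∀ j → ifPos j (λ c′ → bitsum bs ss c′ (λ e → K (1 ∷ e))) ≈ ifPos j (λ c′ → bitsum bs′ ss c′ (λ e → K (1 ∷ e)))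
  go zero    = ≈-refl
  go (suc j) = bitsum-bs ss j (λ e → K (1 ∷ e)) es

par-split : ∀ a b → par (a + b) ≡ par (par a + par b)
par-split 0             0             = refl
par-split 0             1             = refl
par-split 0             (suc (suc b)) = par-split 0 b
par-split 1             0             = refl
par-split 1             1             = refl
par-split 1             (suc (suc b)) = par-split 1 b
par-split (suc (suc a)) b             = par-split a b

par-same : ∀ a b → par a ≡ par b → par (a + b) ≡ 0
par-same a b e = trans (par-split a b) (trans (cong (λ z → par (z + par b)) e) (double (par b)))
  where
  double : ∀ z → par (z + z) ≡ 0
  double z = trans (cong par (cong (λ y → z + y) (sym (ℕₚ.+-identityʳ z)))) (par-2* 0 z)

par-sum0 : ∀ a b → par (a + b) ≡ 0 → par a ≡ par b
par-sum0 a b e = trans (sym (par-2* a b)) (trans (cong par (l a b)) (trans (par-split (a + b) b)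
  (trans (cong (λ z → par (z + par b)) e) (par-idem b))))
  where
  l : ∀ a b → a + 2 * b ≡ a + b + b
  l = ℕ-Solver.solve-∀
  par-idem : ∀ b → par (par b) ≡ par b
  par-idem 0             = refl
  par-idem 1             = refl
  par-idem (suc (suc b)) = par-idem b

gen-zero : ∀ P πs → (∀ π → π ∈ πs → ¬ T (P π)) → gen P πs ≈ 𝟎
gen-zero P []       h = ≈-refl
gen-zero P (π ∷ πs) h with P π in eq
... | true  = contradiction (subst T (sym eq) tt) (h π (here refl))
... | false = ≈-trans (⊕-identityˡ _) (gen-zero P πs (λ ρ ρ∈ → h ρ (there ρ∈)))

key-shift : ∀ x n → key x + 2 * n ≡ key (size x + n , ov x)
key-shift (s , b) n = l s (if b then 1 else 0) n
  where
  l : ∀ s b n → 2 * s + b + 2 * n ≡ 2 * (s + n) + b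
  l = ℕ-Solver.solve-∀

ov≤1 : ∀ b → (if b then 1 else 0) ≤ 1
ov≤1 true  = s≤s z≤n
ov≤1 false = z≤n

key-< : ∀ p q → size p < size q → key p < key q
key-< p q h = ℕₚ.≤-trans (s≤s (ℕₚ.≤-trans (ℕₚ.+-monoʳ-≤ (2 * size p) (ov≤1 (ov p))) (ℕₚ.≤-reflexive (ℕₚ.+-comm (2 * size p) 1))))
  (ℕₚ.≤-trans (ℕₚ.≤-reflexive (sym (l (size p)))) (ℕₚ.≤-trans (ℕₚ.*-monoʳ-≤ 2 h) (ℕₚ.m≤m+n _ _)))
  where
  l : ∀ s → 2 * suc s ≡ suc (suc (2 * s))
  l = ℕ-Solver.solve-∀

ovs : List Part → ℕ
ovs π = length (filterᵇ ov π)

ovs-++ : ∀ π ρ → ovs (π ++ ρ) ≡ ovs π + ovs ρ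
ovs-++ π ρ = trans (cong length (Listₚ.filter-++ (T? ∘ ov) π ρ)) (Listₚ.length-++ (filterᵇ ov π))

ovs-replicate : ∀ n s → ovs (replicate n (s , false)) ≡ 0
ovs-replicate zero    s = refl
ovs-replicate (suc n) s = ovs-replicate n s

module Windows (η K ρ : ℕ) where

  -- At once the failure of the inequality in condition (3) and the premise of condition (5).
  inW : Part → Part → Bool
  inW p x = if ov p then key p <ᵇ key x + 2 * η else key p ≤ᵇ key x + 2 * η

  window : Part → List Part → List Part
  window p acc = filterᵇ (inW p) (p ∷ acc)

  floors : List Part → ℕ
  floors π = sum (map (λ x → size x div η) π)

  -- In a sorted list the window of p is a prefix. Having at most K = k - 1 parts in it is condition
  -- (3), and condition (5) speaks exactly when there are K; ρ is r - 1, and the overlined parts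
  -- from p downwards are those counted by `Vbar`.
  step : Part → List Part → Bool
  step p acc = (length (window p acc) ≤ᵇ K)
    ∧ (not (length (window p acc) ≡ᵇ K) ∨ (floors (window p acc) mod 2 ≡ᵇ (ρ + ovs (p ∷ acc)) mod 2))

  -- Virtual parts 0: with them condition (4) becomes an instance of condition (3).
  virt : List Part
  virt = replicate (K ∸ ρ) (0 , false)

  Good : List Part → Bool
  Good []      = true
  Good (p ∷ π) = step p (π ++ virt) ∧ Good π

  Good-suffix : ∀ X {π} → T (Good (X ++ π)) → T (Good π)
  Good-suffix []      h = h
  Good-suffix (x ∷ X) {π} h = Good-suffix X (proj₂ (Equivalence.to (T-∧ {step x ((X ++ π) ++ virt)}) h))

  -- `Good` tests every suffix, so a bad beginning spoils all its extensions.
  gen-bad : ∀ N ps acc → ¬ T (Good acc) → gen Good (configs N ps acc) ≈ 𝟎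
  gen-bad N ps acc bad = gen-zero Good _ (λ π π∈ h → bad (go (configs-suffix N ps acc π∈) h))
    where
    go : ∀ {π} → (∃ λ X → π ≡ X ++ acc × All (_∈ ps) X) → T (Good π) → T (Good acc)
    go (X , refl , _) h = Good-suffix X h

  floors-++ : ∀ π ρ → floors (π ++ ρ) ≡ floors π + floors ρ
  floors-++ π ρ = trans (cong sum (Listₚ.map-++ _ π ρ)) (sum-++ (map _ π) (map _ ρ))

  module _ (1≤η : 1 ≤ η) where

    inW-refl : ∀ p → T (inW p p)
    inW-refl (s , true)  = <ᵇ⁺ (key (s , true)) (key (s , true) + 2 * η) (ℕₚ.m<m+n (key (s , true)) (ℕₚ.≤-trans 1≤η (ℕₚ.m≤m+n η (1 * η))))
    inW-refl (s , false) = ≤ᵇ⁺ (key (s , false)) (key (s , false) + 2 * η) (ℕₚ.m≤m+n (key (s , false)) (2 * η))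

    window-split : ∀ p X Y → All (T ∘ inW p) X → All (¬_ ∘ T ∘ inW p) Y → window p (X ++ Y) ≡ p ∷ X
    window-split p X Y hX hY = trans (Listₚ.filter-accept (T? ∘ inW p) (inW-refl p)) (cong (p ∷_)
      (trans (Listₚ.filter-++ (T? ∘ inW p) X Y) (trans (cong₂ _++_ (Listₚ.filter-all (T? ∘ inW p) hX)
        (Listₚ.filter-none (T? ∘ inW p) hY)) (Listₚ.++-identityʳ X))))

    StepSpec : Part → List Part → List Part → Set
    StepSpec p X acc = suc (length X) ≤ K × (suc (length X) ≡ K → par (floors (p ∷ X)) ≡ par (ρ + ovs (p ∷ acc)))

    step⁻ : ∀ p X Y → All (T ∘ inW p) X → All (¬_ ∘ T ∘ inW p) Y → T (step p (X ++ Y)) → StepSpec p X (X ++ Y)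
    step⁻ p X Y hX hY h rewrite window-split p X Y hX hY with a , b ← Equivalence.to (T-∧ {suc (length X) ≤ᵇ K}) h =
      ℕₚ.≤ᵇ⇒≤ (suc (length X)) K a , λ e → go (suc (length X) ≡ᵇ K) (ℕₚ.≡⇒≡ᵇ (suc (length X)) K e) b
      where
      go : ∀ z → T z → T (not z ∨ (floors (p ∷ X) mod 2 ≡ᵇ (ρ + ovs (p ∷ X ++ Y)) mod 2)) →
        par (floors (p ∷ X)) ≡ par (ρ + ovs (p ∷ X ++ Y))
      go true _ h = par-mod⁻ (floors (p ∷ X)) (ρ + ovs (p ∷ X ++ Y)) h

    step⁺ : ∀ p X Y → All (T ∘ inW p) X → All (¬_ ∘ T ∘ inW p) Y → StepSpec p X (X ++ Y) → T (step p (X ++ Y))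
    step⁺ p X Y hX hY (a , b) rewrite window-split p X Y hX hY =
      Equivalence.from T-∧ (≤ᵇ⁺ (suc (length X)) K a , go (suc (length X) ≡ᵇ K) (λ t → b (ℕₚ.≡ᵇ⇒≡ (suc (length X)) K t)))
      where
      go : ∀ z → (T z → par (floors (p ∷ X)) ≡ par (ρ + ovs (p ∷ X ++ Y))) →
        T (not z ∨ (floors (p ∷ X) mod 2 ≡ᵇ (ρ + ovs (p ∷ X ++ Y)) mod 2))
      go false h = tt
      go true  h = par-mod⁺ (floors (p ∷ X)) (ρ + ovs (p ∷ X ++ Y)) (h tt)

flat : (ℕ → Part) → List ℕ → List ℕ → List Part
flat g (j ∷ js) (e ∷ es) = flat g js es ++ replicate e (g j)
flat g _        _        = []

length-flat : ∀ g js es → length es ≡ length js → length (flat g js es) ≡ sum es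
length-flat g []       []       _ = refl
length-flat g (j ∷ js) (e ∷ es) l = trans (Listₚ.length-++ (flat g js es))
  (trans (cong₂ _+_ (length-flat g js es (ℕₚ.suc-injective l)) (Listₚ.length-replicate e)) (ℕₚ.+-comm (sum es) e))

All-flat : ∀ {P : Part → Set} {g} js es → All (P ∘ g) js → All P (flat g js es)
All-flat []       es       _        = []
All-flat (j ∷ js) []       _        = []
All-flat (j ∷ js) (e ∷ es) (h ∷ hs) = Allₚ.++⁺ (All-flat js es hs) (All-replicate e h)

flat-cong : ∀ {g h} js es → All (λ j → g j ≡ h j) js → flat g js es ≡ flat h js es
flat-cong []       es       _        = refl
flat-cong (j ∷ js) []       _        = refl
flat-cong (j ∷ js) (e ∷ es) (p ∷ ps) = cong₂ (λ X y → X ++ replicate e y) (flat-cong js es ps) p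

flat-∷ʳ : ∀ g js es j e → length es ≡ length js → flat g (js ++ j ∷ []) (es ++ e ∷ []) ≡ replicate e (g j) ++ flat g js es
flat-∷ʳ g []       []        j e _ = sym (Listₚ.++-identityʳ _)
flat-∷ʳ g (i ∷ js) (e′ ∷ es) j e l = trans (cong (_++ replicate e′ (g i)) (flat-∷ʳ g js es j e (ℕₚ.suc-injective l)))
  (Listₚ.++-assoc (replicate e (g j)) _ _)

module Scan (η K ρ : ℕ) (1≤η : 1 ≤ η) (rs : List ℕ) (rs<η : All (_< η) (0 ∷ rs)) where

  open Windows η K ρ public

  newp oldp : ℕ → ℕ → Part
  newp m j = m * η + j , true
  oldp m j = (m * η + j) ∸ η , true

  fpart : ℕ → Part
  fpart m = m * η , false

  after : ℕ → ℕ → List Part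
  after zero    m = []
  after (suc d) m = fpart (suc m) ∷ map (newp (suc m)) (0 ∷ rs) ++ after d (suc m)

  bound : ℕ → List ℕ → ℕ
  bound m []      = key (fpart (suc m))
  bound m (j ∷ _) = key (newp m j)

  size-fpart : ∀ m → suc m * η ≡ m * η + η
  size-fpart m = ℕₚ.+-comm η (m * η)

  newp<bound : ∀ m j js → j < η → All (j <_) js → key (newp m j) < bound m js
  newp<bound m j []       j<η _       = key-< (newp m j) (fpart (suc m)) (subst (m * η + j <_) (sym (size-fpart m)) (ℕₚ.+-monoʳ-< (m * η) j<η))
  newp<bound m j (i ∷ js) j<η (h ∷ _) = key-< (newp m j) (newp m i) (ℕₚ.+-monoʳ-< (m * η) h)

  -- The parts of acc that the next part sees in its window are those of epre
  -- (period m), f copies of m η, and those of ss (period m − 1).  The slack c is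
  -- diminished by o = 1 if a window of exactly K parts would violate condition (5).
  record Inv (m : ℕ) (pre epre js ss : List ℕ) (f c : ℕ) (acc Y : List Part) : Set where
    field
      o      : ℕ
      o≤1    : o ≤ 1
      shape  : acc ++ virt ≡ flat (newp m) pre epre ++ replicate f (fpart m) ++ flat (oldp m) js ss ++ Y
      count  : sum epre + f + sum ss + c + o ≡ K
      -- The floors m - 1 of the previous period appear as m + 1, equal modulo 2, and each of the c
      -- + o free places counts m + 1 however it is filled. The value is therefore fixed in advance:
      -- 0 if a window filled up to K parts satisfies condition (5), 1 otherwise.
      parity : par (m * (sum epre + f) + suc m * sum ss + ovs acc + ρ + suc m * (c + o)) ≡ o
      len    : length epre ≡ length pre
      len′   : length ss ≡ length js
      -- `oldp` subtracts η with truncation and is meaningful only from period 1 on; in period 0 the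
      -- old column has to be empty.
      real   : 1 ≤ m ⊎ sum ss ≡ 0
      old    : All (λ y → key y + 2 * η < bound m js) Y

  ovs-virt : ∀ acc → ovs (acc ++ virt) ≡ ovs acc
  ovs-virt acc = trans (ovs-++ acc virt) (trans (cong (λ z → ovs acc + z) (ovs-replicate (K ∸ ρ) 0)) (ℕₚ.+-identityʳ _))

  floors-const : ∀ c X → All (λ x → size x div η ≡ c) X → floors X ≡ length X * c
  floors-const c []      []       = refl
  floors-const c (x ∷ X) (h ∷ hs) = cong₂ _+_ h (floors-const c X hs)

  floors-flat-new : ∀ m js es → All (_< η) js → length es ≡ length js → floors (flat (newp m) js es) ≡ m * sum es
  floors-flat-new m js es h l = trans (floors-const m _ (All-flat js es (All.map (λ j<η → div-unique m j<η refl) h)))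
    (trans (cong (_* m) (length-flat (newp m) js es l)) (ℕₚ.*-comm (sum es) m))

  oldp-suc : ∀ m j → oldp (suc m) j ≡ newp m j
  oldp-suc m j = cong (_, true) (trans (cong (_∸ η) (l η (m * η) j)) (ℕₚ.m+n∸n≡m (m * η + j) η))
    where
    l : ∀ h x j → h + x + j ≡ x + j + h
    l = ℕ-Solver.solve-∀

  flat-zero : ∀ g js es → sum es ≡ 0 → flat g js es ≡ []
  flat-zero g []       es       _ = refl
  flat-zero g (j ∷ js) []       _ = refl
  flat-zero g (j ∷ js) (0 ∷ es) h rewrite flat-zero g js es h = refl

  floors-flat-old : ∀ m js es → All (_< η) js → length es ≡ length js → 1 ≤ m ⊎ sum es ≡ 0 →
    par (floors (flat (oldp m) js es)) ≡ par (suc m * sum es)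
  floors-flat-old m       js es h l (inj₂ z) rewrite flat-zero (oldp m) js es z | z = cong par (sym (ℕₚ.*-zeroʳ m))
  floors-flat-old (suc m) js es h l (inj₁ _) = trans
    (cong par (trans (cong floors (flat-cong js es (All.map (λ {j} _ → oldp-suc m j) h))) (floors-flat-new m js es h l)))
    (par-≡ (m * sum es) (suc (suc m) * sum es) (sum es) 0 (r m (sum es)))
    where
    r : ∀ m s → m * s + 2 * s ≡ suc (suc m) * s + 0
    r = ℕ-Solver.solve-∀

  m≤m∸n+n : ∀ m n → m ≤ m ∸ n + n
  m≤m∸n+n m n = ℕₚ.≤-trans (ℕₚ.m≤n+m∸n m n) (ℕₚ.≤-reflexive (ℕₚ.+-comm n _))

  inW-new : ∀ m j i → j < η → T (inW (newp m j) (newp m i))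
  inW-new m j i j<η = <ᵇ⁺ (key (newp m j)) (key (newp m i) + 2 * η) (subst (key (newp m j) <_) (sym (key-shift (newp m i) η))
    (key-< (newp m j) (m * η + i + η , true) (ℕₚ.≤-trans (ℕₚ.+-monoʳ-< (m * η) j<η) (ℕₚ.+-monoˡ-≤ η (ℕₚ.m≤m+n (m * η) i)))))

  inW-f : ∀ m j → j < η → T (inW (newp m j) (fpart m))
  inW-f m j j<η = <ᵇ⁺ (key (newp m j)) (key (fpart m) + 2 * η) (subst (key (newp m j) <_) (sym (key-shift (fpart m) η))
    (key-< (newp m j) (m * η + η , false) (ℕₚ.+-monoʳ-< (m * η) j<η)))

  inW-old : ∀ m j i → j < i → T (inW (newp m j) (oldp m i))
  inW-old m j i j<i = <ᵇ⁺ (key (newp m j)) (key (oldp m i) + 2 * η) (subst (key (newp m j) <_) (sym (key-shift (oldp m i) η))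
    (key-< (newp m j) (m * η + i ∸ η + η , true) (ℕₚ.≤-trans (ℕₚ.+-monoʳ-< (m * η) j<i) (m≤m∸n+n (m * η + i) η))))

  ∉W : ∀ m j {y} → key y + 2 * η ≤ key (newp m j) → ¬ T (inW (newp m j) y)
  ∉W m j {y} h t = ℕₚ.<⇒≱ (ℕₚ.<ᵇ⇒< (key (newp m j)) (key y + 2 * η) t) h

  leaving : ∀ m j s → 1 ≤ m ⊎ s ≡ 0 → All (λ y → key y + 2 * η ≤ key (newp m j)) (replicate s (oldp m j))
  leaving m       j s (inj₂ refl) = []
  leaving (suc m) j s (inj₁ _)    = All-replicate s (ℕₚ.≤-reflexive (trans (key-shift (oldp (suc m) j) η)
    (cong (λ z → key (z , true)) (ℕₚ.m∸n+n≡m (ℕₚ.≤-trans (ℕₚ.m≤m+n η (m * η)) (ℕₚ.m≤m+n _ j))))))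

  module BitArithmetic (m E S s c o V : ℕ) (o≤1 : o ≤ 1) (count : E + (s + S) + c + o ≡ K)
    (parity : par (m * E + suc m * (s + S) + V + ρ + suc m * (c + o)) ≡ o) where

    K≡ : K ≡ E + S + (s + c + o)
    K≡ = trans (sym count) (l E s S c o)
      where
      l : ∀ E s S c o → E + (s + S) + c + o ≡ E + S + (s + c + o)
      l = ℕ-Solver.solve-∀

    left right : ℕ
    left  = m + m * E + suc m * S
    right = ρ + suc V

    -- If the new part is the K-th of its window, then s + c + o = 1 and the invariant evaluates the
    -- sum which condition (5) wants to be even.
    total : s + c + o ≡ 1 → par (left + right) ≡ o
    total h = trans (cong par (trans (l₁ m E S V ρ) (trans (cong (λ z → m * E + suc m * S + V + ρ + suc m * z) (sym h)) (l₂ m E S V ρ s c o)))) parity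
      where
      l₁ : ∀ m E S V ρ → m + m * E + suc m * S + (ρ + suc V) ≡ m * E + suc m * S + V + ρ + suc m * 1
      l₁ = ℕ-Solver.solve-∀
      l₂ : ∀ m E S V ρ s c o → m * E + suc m * S + V + ρ + suc m * (s + c + o) ≡ m * E + suc m * (s + S) + V + ρ + suc m * (c + o)
      l₂ = ℕ-Solver.solve-∀

    sum≡1 : suc (E + S) ≡ K → s + c + o ≡ 1
    sum≡1 h = ℕₚ.+-cancelˡ-≡ (E + S) _ 1 (trans (sym K≡) (trans (sym h) (ℕₚ.+-comm 1 (E + S))))

    ok : 1 ≤ s + c → suc (E + S) ≤ K × (suc (E + S) ≡ K → par left ≡ par right)
    ok h = subst (suc (E + S) ≤_) (sym K≡) (ℕₚ.≤-trans (ℕₚ.≤-reflexive (ℕₚ.+-comm 1 (E + S)))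
             (ℕₚ.+-monoʳ-≤ (E + S) (ℕₚ.≤-trans h (ℕₚ.m≤m+n (s + c) o))))
         , λ e → par-sum0 left right (trans (total (sum≡1 e)) (o≡0 (sum≡1 e)))
      where
      o≡0 : s + c + o ≡ 1 → o ≡ 0
      o≡0 e = ℕₚ.n≤0⇒n≡0 (ℕₚ.+-cancelˡ-≤ 1 o 0 (ℕₚ.≤-trans (ℕₚ.+-monoˡ-≤ o h) (ℕₚ.≤-reflexive e)))

    -- Without slack either o = 0 and the window would receive K + 1 parts, or o = 1 and it would
    -- receive K parts of the wrong parity.
    bad : s + c ≡ 0 → ¬ (suc (E + S) ≤ K × (suc (E + S) ≡ K → par left ≡ par right))
    bad z (le , h) = go o o≤1 refl
      where
      s+c+o : ∀ p → o ≡ p → s + c + o ≡ p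
      s+c+o p e = cong₂ _+_ z e
      go : ∀ p → p ≤ 1 → o ≡ p → _
      go 0 _ e = ℕₚ.<⇒≱ le (ℕₚ.≤-reflexive (trans K≡ (trans (cong (λ y → E + S + y) (s+c+o 0 e)) (ℕₚ.+-identityʳ _))))
      go 1 _ e = contradiction (trans (sym (par-same left right (h (sym eq)))) (trans (total (s+c+o 1 e)) e)) λ ()
        where
        eq : K ≡ suc (E + S)
        eq = trans K≡ (trans (cong (λ y → E + S + y) (s+c+o 1 e)) (ℕₚ.+-comm (E + S) 1))
      go (suc (suc p)) (s≤s ()) e

  module FArithmetic (m w c o V : ℕ) (o≤1 : o ≤ 1) (count : w + c + o ≡ K)
    (parity : par (m * w + V + ρ + suc m * (c + o)) ≡ o) where

    left : ℕ → ℕ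
    left i = suc i * suc m + m * w

    total : ∀ i → suc i ≡ c + o → par (left i + (ρ + V)) ≡ o
    total i h = trans (cong par (trans (cong (λ z → z * suc m + m * w + (ρ + V)) h) (l m w V ρ c o))) parity
      where
      l : ∀ m w V ρ c o → (c + o) * suc m + m * w + (ρ + V) ≡ m * w + V + ρ + suc m * (c + o)
      l = ℕ-Solver.solve-∀

    sum≡ : ∀ i → suc (i + w) ≡ K → suc i ≡ c + o
    sum≡ i h = ℕₚ.+-cancelʳ-≡ w (suc i) (c + o) (trans h (trans (sym count) (l w c o)))
      where
      l : ∀ w c o → w + c + o ≡ c + o + w
      l = ℕ-Solver.solve-∀

    ok : ∀ i → suc i ≤ c → suc (i + w) ≤ K × (suc (i + w) ≡ K → par (left i) ≡ par (ρ + V))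
    ok i h = ℕₚ.≤-trans (ℕₚ.+-monoˡ-≤ w h) (ℕₚ.≤-trans (ℕₚ.m≤m+n (c + w) o) (ℕₚ.≤-reflexive (trans (cong (_+ o) (ℕₚ.+-comm c w)) count)))
           , λ e → par-sum0 (left i) (ρ + V) (trans (total i (sum≡ i e)) (o≡0 (sum≡ i e)))
      where
      o≡0 : suc i ≡ c + o → o ≡ 0
      o≡0 e = ℕₚ.n≤0⇒n≡0 (ℕₚ.+-cancelˡ-≤ c o 0 (ℕₚ.≤-trans (ℕₚ.≤-reflexive (sym e)) (ℕₚ.≤-trans h (ℕₚ.≤-reflexive (sym (ℕₚ.+-identityʳ c))))))

    bad : ¬ (suc (c + w) ≤ K × (suc (c + w) ≡ K → par (left c) ≡ par (ρ + V)))
    bad (le , h) = go o o≤1 refl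
      where
      go : ∀ p → p ≤ 1 → o ≡ p → _
      go 0 _ e = ℕₚ.<⇒≱ le (ℕₚ.≤-reflexive (trans (sym count) (trans (cong (λ z → w + c + z) e) (trans (ℕₚ.+-identityʳ _) (ℕₚ.+-comm w c)))))
      go 1 _ e = contradiction (trans (sym (par-same (left c) (ρ + V) (h eq))) (trans (total c (trans (ℕₚ.+-comm 1 c) (cong (λ z → c + z) (sym e)))) e)) λ ()
        where
        eq : suc (c + w) ≡ K
        eq = trans (l c w) (trans (cong (λ z → w + c + z) (sym e)) count)
          where
          l : ∀ c w → suc (c + w) ≡ w + c + 1
          l = ℕ-Solver.solve-∀
      go (suc (suc p)) (s≤s ()) e

    -- Modulo 2 the old parity sum is m K + c + o + V + ρ and the new one is m K + f + V + ρ. As the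
    -- old one is o, the new one is c - f: the origin of `par (c ∸ f)` in `tail`.
    next : ∀ f e f₀ → e + f₀ ≡ w → f ≤ c →
      let c′ = K ∸ (e + (f + par (c ∸ f))) in
      (f + e + c′ + par (c ∸ f) ≡ K) ×
      par (suc m * f + suc (suc m) * e + V + ρ + suc (suc m) * (c′ + par (c ∸ f))) ≡ par (c ∸ f)
    next f e f₀ refl f≤c = count′ , trans
        (par-≡ new (old + (f + (c + o))) (c + o) (e + c′ + o′) eq)
        (trans (cong par (ℕₚ.+-comm old (f + (c + o)))) (trans (par-split (f + (c + o)) old) (trans (cong (λ z → par (par (f + (c + o)) + z)) parity)
          (trans (cong (λ z → par (par (f + (c + o)) + z)) (sym par-o)) (trans (sym (par-split (f + (c + o)) o)) last′)))))
      where
      d o′ c′ new old : ℕ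
      d   = c ∸ f
      o′  = par d
      c′  = K ∸ (e + (f + o′))
      new = suc m * f + suc (suc m) * e + V + ρ + suc (suc m) * (c′ + o′)
      old = m * (e + f₀) + V + ρ + suc m * (c + o)
      c≡ : c ≡ f + d
      c≡ = sym (ℕₚ.m+[n∸m]≡n f≤c)
      fits : e + (f + o′) ≤ K
      fits = ℕₚ.≤-trans (ℕₚ.+-monoʳ-≤ e (ℕₚ.≤-trans (ℕₚ.+-monoʳ-≤ f (par≤ d)) (ℕₚ.≤-reflexive (sym c≡))))
        (ℕₚ.≤-trans (ℕₚ.+-monoˡ-≤ c (ℕₚ.m≤m+n e f₀)) (ℕₚ.≤-trans (ℕₚ.m≤m+n _ o) (ℕₚ.≤-reflexive count)))
      count′ : f + e + c′ + o′ ≡ K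
      count′ = trans (l f e c′ o′) (ℕₚ.m+[n∸m]≡n fits)
        where
        l : ∀ f e c o → f + e + c + o ≡ e + (f + o) + c
        l = ℕ-Solver.solve-∀
      par-o : par o ≡ o
      par-o = go o o≤1
        where
        go : ∀ o → o ≤ 1 → par o ≡ o
        go 0 _ = refl
        go 1 _ = refl
        go (suc (suc o)) (s≤s ())
      last′ : par (f + (c + o) + o) ≡ par d
      last′ = trans (cong (λ z → par (f + (z + o) + o)) c≡) (trans (cong par (l f d o)) (par-2* d (f + o)))
        where
        l : ∀ f d o → f + (f + d + o) + o ≡ d + 2 * (f + o)
        l = ℕ-Solver.solve-∀
      eq : new + 2 * (c + o) ≡ old + (f + (c + o)) + 2 * (e + c′ + o′)
      eq = trans (l₁ m f e V ρ c′ o′ c o) (trans (cong (λ z → m * z + f + 2 * e + 2 * (c′ + o′) + V + ρ + 2 * (c + o)) (trans count′ (sym count)))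
             (l₂ m f e V ρ c′ o′ c o f₀))
        where
        l₁ : ∀ m f e V ρ c′ o′ c o → suc m * f + suc (suc m) * e + V + ρ + suc (suc m) * (c′ + o′) + 2 * (c + o)
           ≡ m * (f + e + c′ + o′) + f + 2 * e + 2 * (c′ + o′) + V + ρ + 2 * (c + o)
        l₁ = ℕ-Solver.solve-∀
        l₂ : ∀ m f e V ρ c′ o′ c o f₀ → m * (e + f₀ + c + o) + f + 2 * e + 2 * (c′ + o′) + V + ρ + 2 * (c + o)
           ≡ m * (e + f₀) + V + ρ + suc m * (c + o) + (f + (c + o)) + 2 * (e + c′ + o′)
        l₂ = ℕ-Solver.solve-∀

  module BitStep {m : ℕ} {pre epre : List ℕ} {j : ℕ} {js : List ℕ} {s : ℕ} {ss : List ℕ} {f c : ℕ} {acc Y : List Part}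
    (inv : Inv m pre epre (j ∷ js) (s ∷ ss) f c acc Y)
    (j<η : j < η) (j<js : All (j <_) js) (pre<η : All (_< η) pre) (js<η : All (_< η) js) where

    open Inv inv

    X Y′ : List Part
    X  = flat (newp m) pre epre ++ replicate f (fpart m) ++ flat (oldp m) js ss
    Y′ = replicate s (oldp m j) ++ Y

    shape′ : acc ++ virt ≡ X ++ Y′
    shape′ = trans shape (sym (trans (Listₚ.++-assoc (flat (newp m) pre epre) _ Y′)
      (cong (flat (newp m) pre epre ++_) (trans (Listₚ.++-assoc (replicate f (fpart m)) _ Y′)
        (cong (replicate f (fpart m) ++_) (sym (Listₚ.++-assoc (flat (oldp m) js ss) (replicate s (oldp m j)) Y)))))))

    real-s : 1 ≤ m ⊎ s ≡ 0
    real-s with real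
    ... | inj₁ h = inj₁ h
    ... | inj₂ z = inj₂ (ℕₚ.m+n≡0⇒m≡0 s z)

    real-ss : 1 ≤ m ⊎ sum ss ≡ 0
    real-ss with real
    ... | inj₁ h = inj₁ h
    ... | inj₂ z = inj₂ (ℕₚ.m+n≡0⇒n≡0 s z)

    len-ss : length ss ≡ length js
    len-ss = ℕₚ.suc-injective len′

    p : Part
    p = newp m j

    inX : All (T ∘ inW p) X
    inX = Allₚ.++⁺ (All-flat pre epre (All.map (λ {i} _ → inW-new m j i j<η) pre<η))
      (Allₚ.++⁺ (All-replicate f (inW-f m j j<η)) (All-flat js ss (All.map (λ {i} h → inW-old m j i h) j<js)))

    gone : All (λ y → key y + 2 * η ≤ key p) Y′
    gone = Allₚ.++⁺ (leaving m j s real-s) (All.map ℕₚ.<⇒≤ old)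

    outY : All (¬_ ∘ T ∘ inW p) Y′
    outY = All.map (λ {y} → ∉W m j {y}) gone

    E : ℕ
    E = sum epre + f

    length-X : length X ≡ E + sum ss
    length-X = trans (Listₚ.length-++ (flat (newp m) pre epre)) (trans (cong₂ _+_ (length-flat (newp m) pre epre len)
      (trans (Listₚ.length-++ (replicate f (fpart m))) (cong₂ _+_ (Listₚ.length-replicate f) (length-flat (oldp m) js ss len-ss))))
      (sym (ℕₚ.+-assoc (sum epre) f (sum ss))))

    floors-X : par (floors (p ∷ X)) ≡ par (m + m * E + suc m * sum ss)
    floors-X = trans (cong par (trans (cong₂ _+_ (div-unique m j<η refl) (trans (floors-++ (flat (newp m) pre epre) _)
        (cong₂ _+_ (floors-flat-new m pre epre pre<η len) (trans (floors-++ (replicate f (fpart m)) _)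
          (cong (_+ floors (flat (oldp m) js ss)) (trans (floors-const m _ (All-replicate f (div-unique m 1≤η (sym (ℕₚ.+-identityʳ (m * η))))))
            (cong (_* m) (Listₚ.length-replicate f))))))))
        (l₁ m (sum epre) f (floors (flat (oldp m) js ss)))))
      (trans (par-+ˡ {floors (flat (oldp m) js ss)} {suc m * sum ss} (m + m * E) (floors-flat-old m js ss js<η len-ss real-ss))
        (cong par (ℕₚ.+-comm (suc m * sum ss) (m + m * E))))
      where
      l₁ : ∀ m e f o → m + (m * e + (f * m + o)) ≡ o + (m + m * (e + f))
      l₁ = ℕ-Solver.solve-∀

    open BitArithmetic m E (sum ss) s c o (ovs acc) o≤1 count parity

    spec : ∀ {Z : Set} → (StepSpec 1≤η p X (X ++ Y′) → Z) →
      (suc (E + sum ss) ≤ K × (suc (E + sum ss) ≡ K → par left ≡ par right)) → Z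
    spec k (a , b) = k (subst (λ z → suc z ≤ K) (sym length-X) a ,
      λ e → trans floors-X (trans (b (trans (cong suc (sym length-X)) e)) (cong (λ z → par (ρ + suc z)) ovs-X)))
      where
      ovs-X : ovs acc ≡ ovs (X ++ Y′)
      ovs-X = trans (sym (ovs-virt acc)) (cong ovs shape′)

    unspec : StepSpec 1≤η p X (X ++ Y′) → (suc (E + sum ss) ≤ K × (suc (E + sum ss) ≡ K → par left ≡ par right))
    unspec (a , b) = subst (λ z → suc z ≤ K) length-X a ,
      λ e → trans (sym floors-X) (trans (b (trans (cong suc length-X) e)) (cong (λ z → par (ρ + suc z)) (sym (trans (sym (ovs-virt acc)) (cong ovs shape′)))))

    step-ok : 1 ≤ s + c → T (step p (acc ++ virt))
    step-ok h = subst (T ∘ step p) (sym shape′) (spec (step⁺ 1≤η p X Y′ inX outY) (ok h))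

    step-bad : s + c ≡ 0 → ¬ T (step p (acc ++ virt))
    step-bad z t = bad z (unspec (step⁻ 1≤η p X Y′ inX outY (subst (T ∘ step p) shape′ t)))

    old′ : All (λ y → key y + 2 * η < bound m js) Y′
    old′ = All.map (λ h → ℕₚ.≤-<-trans h (newp<bound m j js j<η j<js)) gone

    sum-∷ʳ : ∀ e → sum (epre ++ e ∷ []) ≡ sum epre + e
    sum-∷ʳ e = trans (sum-++ epre (e ∷ [])) (cong (λ z → sum epre + z) (ℕₚ.+-identityʳ e))

    len-∷ʳ : ∀ e → length (epre ++ e ∷ []) ≡ length (pre ++ j ∷ [])
    len-∷ʳ e = trans (Listₚ.length-++ epre) (trans (cong (_+ 1) len) (sym (Listₚ.length-++ pre)))

    -- The old part of residue j leaves the window whether or not a new one is placed, so s turns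
    -- into slack.
    skip : Inv m (pre ++ j ∷ []) (epre ++ 0 ∷ []) js ss f (s + c) acc Y′
    skip = record
      { o = o ; o≤1 = o≤1
      ; shape = trans shape′ (trans (Listₚ.++-assoc (flat (newp m) pre epre) _ Y′)
          (cong₂ _++_ (sym (flat-∷ʳ (newp m) pre epre j 0 len)) (Listₚ.++-assoc (replicate f (fpart m)) _ Y′)))
      ; count = trans (cong (λ z → z + f + sum ss + (s + c) + o) (trans (sum-∷ʳ 0) (ℕₚ.+-identityʳ _))) (trans (l₁ (sum epre) f s (sum ss) c o) count)
      ; parity = trans (cong (λ z → par (m * (z + f) + suc m * sum ss + ovs acc + ρ + suc m * (s + c + o))) (trans (sum-∷ʳ 0) (ℕₚ.+-identityʳ _)))
          (trans (cong par (l₂ m E s (sum ss) (ovs acc) ρ c o)) parity)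
      ; len = len-∷ʳ 0 ; len′ = len-ss ; real = real-ss ; old = old′ }
      where
      l₁ : ∀ e f s S c o → e + f + S + (s + c) + o ≡ e + f + (s + S) + c + o
      l₁ = ℕ-Solver.solve-∀
      l₂ : ∀ m E s S V r c o → m * E + suc m * S + V + r + suc m * (s + c + o) ≡ m * E + suc m * (s + S) + V + r + suc m * (c + o)
      l₂ = ℕ-Solver.solve-∀

    put : ∀ {c′} → s + c ≡ suc c′ → Inv m (pre ++ j ∷ []) (epre ++ 1 ∷ []) js ss f c′ (p ∷ acc) Y′
    put {c′} eq = record
      { o = o ; o≤1 = o≤1
      ; shape = trans (cong (p ∷_) shape′) (trans (cong (p ∷_) (Listₚ.++-assoc (flat (newp m) pre epre) _ Y′))
          (cong₂ _++_ (sym (flat-∷ʳ (newp m) pre epre j 1 len)) (Listₚ.++-assoc (replicate f (fpart m)) _ Y′)))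
      ; count = trans (cong (λ z → z + f + sum ss + c′ + o) (sum-∷ʳ 1)) (trans (l₁ (sum epre) f (sum ss) c′ o)
          (trans (cong (λ z → sum epre + f + sum ss + z + o) (sym eq)) (trans (l₁′ (sum epre) f s (sum ss) c o) count)))
      ; parity = trans (cong (λ z → par (m * (z + f) + suc m * sum ss + suc (ovs acc) + ρ + suc m * (c′ + o))) (sum-∷ʳ 1))
          (trans (cong par (trans (l₂ m (sum epre) f (sum ss) (ovs acc) ρ c′ o) (trans (cong (λ z → m * E + suc m * sum ss + ovs acc + ρ + suc m * (z + o)) (sym eq))
            (l₃ m E s (sum ss) (ovs acc) ρ c o)))) parity)
      ; len = len-∷ʳ 1 ; len′ = len-ss ; real = real-ss ; old = old′ }
      where
      l₁ : ∀ e f S c o → e + 1 + f + S + c + o ≡ e + f + S + suc c + o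
      l₁ = ℕ-Solver.solve-∀
      l₁′ : ∀ e f s S c o → e + f + S + (s + c) + o ≡ e + f + (s + S) + c + o
      l₁′ = ℕ-Solver.solve-∀
      l₂ : ∀ m e f S V r c o → m * (e + 1 + f) + suc m * S + suc V + r + suc m * (c + o) ≡ m * (e + f) + suc m * S + V + r + suc m * (suc c + o)
      l₂ = ℕ-Solver.solve-∀
      l₃ : ∀ m E s S V r c o → m * E + suc m * S + V + r + suc m * (s + c + o) ≡ m * E + suc m * (s + S) + V + r + suc m * (c + o)
      l₃ = ℕ-Solver.solve-∀

  key-≤f : ∀ n x → n ≤ size x → key (n , false) ≤ key x
  key-≤f n x h = ℕₚ.≤-trans (ℕₚ.≤-reflexive (ℕₚ.+-identityʳ (2 * n))) (ℕₚ.≤-trans (ℕₚ.*-monoʳ-≤ 2 h) (ℕₚ.m≤m+n (2 * size x) _))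

  module FStep {m : ℕ} {e : List ℕ} {f₀ c : ℕ} {acc Y : List Part} (inv : Inv m (0 ∷ rs) e [] [] f₀ c acc Y) where

    open Inv inv

    p : Part
    p = fpart (suc m)

    X₀ : List Part
    X₀ = flat (newp m) (0 ∷ rs) e ++ replicate f₀ (fpart m)

    X : ℕ → List Part
    X i = replicate i p ++ X₀

    shape′ : ∀ i → (replicate i p ++ acc) ++ virt ≡ X i ++ Y
    shape′ i = trans (Listₚ.++-assoc (replicate i p) acc virt) (trans (cong (replicate i p ++_) (trans shape
      (sym (Listₚ.++-assoc (flat (newp m) (0 ∷ rs) e) (replicate f₀ (fpart m)) Y)))) (sym (Listₚ.++-assoc (replicate i p) X₀ Y)))

    inW-near : ∀ x → m * η ≤ size x → T (inW p x)
    inW-near x h = ≤ᵇ⁺ (key p) (key x + 2 * η) (subst (key p ≤_) (sym (key-shift x η))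
      (key-≤f (suc m * η) (size x + η , ov x) (ℕₚ.≤-trans (ℕₚ.≤-reflexive (size-fpart m)) (ℕₚ.+-monoˡ-≤ η h))))

    inX : ∀ i → All (T ∘ inW p) (X i)
    inX i = Allₚ.++⁺ (All-replicate i (inW-near p (ℕₚ.m≤n+m (m * η) η))) (Allₚ.++⁺
      (All-flat (0 ∷ rs) e (All.map (λ {j} _ → inW-near (newp m j) (ℕₚ.m≤m+n (m * η) j)) rs<η))
      (All-replicate f₀ (inW-near (fpart m) ℕₚ.≤-refl)))

    outY : All (¬_ ∘ T ∘ inW p) Y
    outY = All.map (λ {y} h t → ℕₚ.<⇒≱ h (ℕₚ.≤ᵇ⇒≤ (key p) (key y + 2 * η) t)) old

    w : ℕ
    w = sum e + f₀

    length-X : ∀ i → length (X i) ≡ i + w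
    length-X i = trans (Listₚ.length-++ (replicate i p)) (cong₂ _+_ (Listₚ.length-replicate i)
      (trans (Listₚ.length-++ (flat (newp m) (0 ∷ rs) e)) (cong₂ _+_ (length-flat (newp m) (0 ∷ rs) e len) (Listₚ.length-replicate f₀))))

    floor-f : ∀ m → size (fpart m) div η ≡ m
    floor-f m = div-unique m 1≤η (sym (ℕₚ.+-identityʳ (m * η)))

    floors-X : ∀ i → floors (p ∷ X i) ≡ suc i * suc m + m * w
    floors-X i = trans (cong₂ _+_ (floor-f (suc m)) (trans (floors-++ (replicate i p) X₀)
        (cong₂ _+_ (trans (floors-const (suc m) _ (All-replicate i (floor-f (suc m)))) (cong (_* suc m) (Listₚ.length-replicate i)))
          (trans (floors-++ (flat (newp m) (0 ∷ rs) e) _) (cong₂ _+_ (floors-flat-new m (0 ∷ rs) e rs<η len)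
            (trans (floors-const m _ (All-replicate f₀ (floor-f m))) (cong (_* m) (Listₚ.length-replicate f₀))))))))
      (l m i (sum e) f₀)
      where
      l : ∀ m i e f → suc m + (i * suc m + (m * e + f * m)) ≡ suc i * suc m + m * (e + f)
      l = ℕ-Solver.solve-∀

    ovs-copies : ∀ i → ovs (replicate i p ++ acc) ≡ ovs acc
    ovs-copies i = trans (ovs-++ (replicate i p) acc) (cong (_+ ovs acc) (ovs-replicate i (suc m * η)))

    ovs-X : ∀ i → ovs (p ∷ (X i ++ Y)) ≡ ovs acc
    ovs-X i = trans (cong ovs (sym (shape′ i))) (trans (ovs-virt (replicate i p ++ acc)) (ovs-copies i))

    count₀ : w + c + o ≡ K
    count₀ = trans (cong (λ z → z + c + o) (sym (ℕₚ.+-identityʳ w))) count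

    parity₀ : par (m * w + ovs acc + ρ + suc m * (c + o)) ≡ o
    parity₀ = trans (cong par (l m w (ovs acc) ρ (c + o))) parity
      where
      l : ∀ m w V r z → m * w + V + r + suc m * z ≡ m * w + suc m * 0 + V + r + suc m * z
      l = ℕ-Solver.solve-∀

    open FArithmetic m w c o (ovs acc) o≤1 count₀ parity₀

    step-ok : ∀ i → suc i ≤ c → T (step p ((replicate i p ++ acc) ++ virt))
    step-ok i h = subst (T ∘ step p) (sym (shape′ i)) (step⁺ 1≤η p (X i) Y (inX i) outY
      (subst (λ z → suc z ≤ K) (sym (length-X i)) (proj₁ (ok i h)) ,
       λ eq → trans (cong par (floors-X i)) (trans (proj₂ (ok i h) (trans (cong suc (sym (length-X i))) eq)) (cong (λ z → par (ρ + z)) (sym (ovs-X i))))))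

    step-bad : ¬ T (step p ((replicate c p ++ acc) ++ virt))
    step-bad t with a , b ← step⁻ 1≤η p (X c) Y (inX c) outY (subst (T ∘ step p) (shape′ c) t) =
      bad (subst (λ z → suc z ≤ K) (length-X c) a ,
           λ eq → trans (cong par (sym (floors-X c))) (trans (b (trans (cong suc (length-X c)) eq)) (cong (λ z → par (ρ + z)) (ovs-X c))))

    good : T (Good acc) → ∀ i → i ≤ c → T (Good (replicate i p ++ acc))
    good h zero    _ = h
    good h (suc i) le = Equivalence.from T-∧ (step-ok i le , good h i (ℕₚ.<⇒≤ le))

    not-good : ∀ i → ¬ T (Good (replicate (suc c + i) p ++ acc))
    not-good i t = step-bad (proj₁ (Equivalence.to (T-∧ {step p ((replicate c p ++ acc) ++ virt)})
      (Good-suffix (replicate i p) (subst (T ∘ Good) (trans (cong (λ z → replicate z p ++ acc) (ℕₚ.+-comm (suc c) i))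
        (trans (cong (_++ acc) (replicate-+ i (suc c))) (Listₚ.++-assoc (replicate i p) (replicate (suc c) p) acc))) t))))
      where
      replicate-+ : ∀ i j → replicate (i + j) p ≡ replicate i p ++ replicate j p
      replicate-+ zero    j = refl
      replicate-+ (suc i) j = cong (p ∷_) (replicate-+ i j)

    -- The copies of m η lie exactly η below (m + 1) η: they belong to the window of that
    -- non-overlined part but to no window of an overlined part above it. They join the discarded
    -- parts only now, when column e becomes the old one.
    next-inv : ∀ i → i ≤ c → Inv (suc m) [] [] (0 ∷ rs) e i (K ∸ (sum e + (i + par (c ∸ i)))) (replicate i p ++ acc) (replicate f₀ (fpart m) ++ Y)
    next-inv i i≤c = record
      { o = par (c ∸ i) ; o≤1 = par≤1 (c ∸ i)
      ; shape = trans (shape′ i) (trans (Listₚ.++-assoc (replicate i p) X₀ Y) (cong (replicate i p ++_)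
          (trans (Listₚ.++-assoc (flat (newp m) (0 ∷ rs) e) _ Y)
            (cong (_++ replicate f₀ (fpart m) ++ Y) (flat-cong (0 ∷ rs) e (All.map (λ {j} _ → sym (oldp-suc m j)) rs<η))))))
      ; count = proj₁ nx
      ; parity = trans (cong (λ z → par (suc m * i + suc (suc m) * sum e + z + ρ + suc (suc m) * (K ∸ (sum e + (i + par (c ∸ i))) + par (c ∸ i)))) (ovs-copies i)) (proj₂ nx)
      ; len = refl ; len′ = len ; real = inj₁ (s≤s z≤n)
      ; old = All.map (λ h → ℕₚ.≤-<-trans h below) (Allₚ.++⁺ (All-replicate f₀ (ℕₚ.≤-reflexive
          (trans (key-shift (fpart m) η) (cong (λ z → key (z , false)) (sym (size-fpart m)))))) (All.map ℕₚ.<⇒≤ old)) }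
      where
      nx = next i (sum e) f₀ refl i≤c
      below : key (fpart (suc m)) < key (newp (suc m) 0)
      below = ℕₚ.≤-reflexive (l (suc m * η))
        where
        l : ∀ n → suc (2 * n + 0) ≡ 2 * (n + 0) + 1
        l = ℕ-Solver.solve-∀

-- The generating function of the scanned overpartitions

module Generate (η K lam M σ ρ : ℕ) (rs : List ℕ) (M+lam : M + lam ≡ K + suc K)
  (len-rs : length rs ≡ lam) (sum-rs : sum rs ≡ σ)
  (reflect : ∀ (g : ℤ → Laurent) → ∏ₗ rs (λ j → g (+ η ℤ.- + j)) ≈ ∏ₗ rs (λ j → g (+ j)))
  (1≤η : 1 ≤ η) (lam<K : suc lam ≤ K) (ρ≤K : ρ ≤ K)
  (rs-sorted : AllPairs _<_ (0 ∷ rs)) (rs<η : All (_< η) (0 ∷ rs)) where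

  open Params η K lam M σ rs M+lam len-rs sum-rs reflect
  open Main η K lam M σ rs M+lam len-rs sum-rs reflect 1≤η lam<K
  open Scan η K ρ 1≤η rs rs<η

  weights : ℕ → List ℕ → List Laurent
  weights m = map (λ j → mon (+ (m * η + j)))

  weights-cols : ∀ m → Pointwise _≈_ (weights m (0 ∷ rs)) (cols m)
  weights-cols zero    = Pointwise.refl ≈-refl
  weights-cols (suc m) = Pointwise.map⁺ (λ j → mon (+ (suc m * η + j))) (_⊗ mon H) (go (0 ∷ rs) (weights-cols m))
    where
    go : ∀ js {bs} → Pointwise _≈_ (weights m js) bs → Pointwise (λ j b → mon (+ (suc m * η + j)) ≈ b ⊗ mon H) js bs
    go []       []       = []
    go (j ∷ js) (e ∷ es) = ≈-trans (mon-≡ (cong +_ (l η (m * η) j))) (≈-trans (mon-+ (+ (m * η + j)) H) (⊗-cong e ≈-refl)) ∷ go js es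
      where
      l : ∀ h x j → h + x + j ≡ x + j + h
      l = ℕ-Solver.solve-∀

  FClaim : ℕ → ℕ → ℕ → Set
  FClaim N d m = ∀ {e f₀ c acc Y} → Inv m (0 ∷ rs) e [] [] f₀ c acc Y → T (Good acc) →
    gen Good (configs N (after d m) acc) ≈ mon (+ weight acc) ⊗ tail d m e c

  gen-ov : ∀ N p ps acc → ov p ≡ true →
    gen Good (configs N (p ∷ ps) acc) ≈ gen Good (configs N ps acc) ⊕ gen Good (configs N ps (p ∷ acc))
  gen-ov N (s , true) ps acc refl = ≈-trans (gen-concatMap (λ f → configs N ps (replicate f (s , true) ++ acc)) 2) (⊕-cong (⊕-identityˡ _) ≈-refl)

  -- The two branches of `bitsum` are the two multiplicities of an overlined part: `skip` and `put`
  -- restore the invariant, and where no slack is left every continuation is bad.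
  column : ∀ N d m → FClaim N d m → ∀ js {pre epre ss f c acc Y} → pre ++ js ≡ 0 ∷ rs →
    Inv m pre epre js ss f c acc Y → T (Good acc) →
    gen Good (configs N (map (newp m) js ++ after d m) acc)
    ≈ mon (+ weight acc) ⊗ bitsum (weights m js) ss c (λ e → tail d m (epre ++ e))
  column N d m F [] {pre} {epre} {[]} {f} {c} {acc} {Y} eq inv h =
    subst (λ e → gen Good (configs N (after d m) acc) ≈ mon (+ weight acc) ⊗ tail d m e c) (sym (Listₚ.++-identityʳ epre))
      (F (subst (λ z → Inv m z epre [] [] f c acc Y) (trans (sym (Listₚ.++-identityʳ pre)) eq) inv) h)
  column N d m F [] {ss = _ ∷ _} eq inv h with () ← Inv.len′ inv
  column N d m F (j ∷ js) {ss = []} eq inv h with () ← Inv.len′ inv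
  column N d m F (j ∷ js) {pre} {epre} {s ∷ ss} {f} {c} {acc} {Y} eq inv h = ≈-trans
    (gen-ov N (newp m j) (map (newp m) js ++ after d m) acc refl)
    (≈-trans (⊕-cong skipped (placed (s + c) refl)) (collect (mon (+ weight acc)) _ _ _))
    where
    all< : All (_< η) (pre ++ j ∷ js)
    all< = subst (All (_< η)) (sym eq) rs<η
    j∷js< : All (_< η) (j ∷ js)
    j∷js< = Allₚ.++⁻ʳ pre all<
    drop-pre : ∀ pre {ys} → AllPairs _<_ (pre ++ ys) → AllPairs _<_ ys
    drop-pre []        s       = s
    drop-pre (_ ∷ pre) (_ ∷ s) = drop-pre pre s
    module B = BitStep inv (All.head j∷js<) (AllPairs.head (drop-pre pre (subst (AllPairs _<_) (sym eq) rs-sorted)))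
      (Allₚ.++⁻ˡ pre all<) (All.tail j∷js<)
    eq′ : (pre ++ j ∷ []) ++ js ≡ 0 ∷ rs
    eq′ = trans (Listₚ.++-assoc pre (j ∷ []) js) eq
    assoc′ : ∀ {b c e′} → bitsum (weights m js) ss c (λ e → tail d m ((epre ++ b ∷ []) ++ e)) ≈ e′ →
      bitsum (weights m js) ss c (λ e → tail d m (epre ++ b ∷ e)) ≈ e′
    assoc′ {b} {c} h = ≈-trans (bitsum-cong (weights m js) ss c (trans (ℕₚ.suc-injective (Inv.len′ inv)) (sym (Listₚ.length-map _ js)))
      (λ e c′ _ _ → ≈-reflexive (cong (λ z → tail d m z c′) (sym (Listₚ.++-assoc epre (b ∷ []) e))))) h
    skipped : gen Good (configs N (map (newp m) js ++ after d m) acc)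
      ≈ mon (+ weight acc) ⊗ bitsum (weights m js) ss (s + c) (λ e → tail d m (epre ++ 0 ∷ e))
    skipped = ≈-trans (column N d m F js eq′ B.skip h) (⊗-cong ≈-refl (≈-sym (assoc′ ≈-refl)))
    placed : ∀ t → s + c ≡ t → gen Good (configs N (map (newp m) js ++ after d m) (newp m j ∷ acc))
      ≈ mon (+ weight acc) ⊗ (mon (+ (m * η + j)) ⊗ ifPos t (λ c′ → bitsum (weights m js) ss c′ (λ e → tail d m (epre ++ 1 ∷ e))))
    placed zero    e = ≈-trans (gen-bad N (map (newp m) js ++ after d m) (newp m j ∷ acc) (λ t → B.step-bad e (proj₁ (Equivalence.to (T-∧ {step (newp m j) (acc ++ virt)}) t))))
      (≈-sym (vanishes (mon (+ weight acc)) _))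
      where
      vanishes : ∀ a b → a ⊗ (b ⊗ 𝟎) ≈ 𝟎
      vanishes = Solver.solve-∀ laurentRing
    placed (suc c′) e = ≈-trans (column N d m F js eq′ (B.put e)
        (Equivalence.from T-∧ (B.step-ok (subst (1 ≤_) (sym e) (s≤s z≤n)) , h)))
      (≈-trans (⊗-cong (≈-trans (mon-+ (+ (m * η + j)) (+ weight acc)) (⊗-comm _ _)) (≈-sym (assoc′ ≈-refl))) (⊗-assoc _ _ _))
    collect : ∀ w u b v → w ⊗ u ⊕ w ⊗ (b ⊗ v) ≈ w ⊗ (u ⊕ b ⊗ v)
    collect = Solver.solve-∀ laurentRing

  -- The bound K ≤ N keeps the cap N on copies from cutting off an admissible multiplicity; beyond c
  -- copies the list is bad.
  fclaim : ∀ N → K ≤ N → ∀ d m → FClaim N d m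
  fclaim N K≤N zero    m {acc = acc} inv h = ≈-trans (⊕-identityʳ _) (go (Good acc) h)
    where
    go : ∀ b → T b → (if b then mon (+ weight acc) else 𝟎) ≈ mon (+ weight acc) ⊗ 𝟏
    go true _ = ≈-sym (⊗-identityʳ _)
  fclaim N K≤N (suc d) m {e} {f₀} {c} {acc} {Y} inv h = begin
    gen Good (configs N (after (suc d) m) acc)
      ≈⟨ gen-concatMap (λ i → configs N rest (replicate i p ++ acc)) (suc N) ⟩
    ∑ (suc N) g
      ≈⟨ ≈-reflexive (cong (λ z → ∑ (suc z) g) (sym (ℕₚ.m+[n∸m]≡n c≤N))) ⟩
    ∑ (suc c + (N ∸ c)) g
      ≈⟨ ∑-split (suc c) (N ∸ c) g ⟩
    ∑ (suc c) g ⊕ ∑ (N ∸ c) (λ i → g (suc c + i))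
      ≈⟨ ⊕-cong (∑-cong (suc c) (λ i i< → low i (ℕₚ.≤-pred i<))) (∑-zero (N ∸ c) (λ i _ → gen-bad N rest _ (S.not-good i))) ⟩
    ∑ (suc c) (λ i → mon (+ weight acc) ⊗ (x m ^^ i ⊗ bitsum (cols (suc m)) e (c″ i) (tail d (suc m)))) ⊕ 𝟎
      ≈⟨ ≈-trans (⊕-identityʳ _) (≈-sym (∑-⊗ (suc c) (mon (+ weight acc)) _)) ⟩
    mon (+ weight acc) ⊗ tail (suc d) m e c ∎
    where
    module S = FStep inv
    p : Part
    p = fpart (suc m)
    rest : List Part
    rest = map (newp (suc m)) (0 ∷ rs) ++ after d (suc m)
    g : ℕ → Laurent
    g i = gen Good (configs N rest (replicate i p ++ acc))
    c″ : ℕ → ℕ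
    c″ i = K ∸ (sum e + (i + par (c ∸ i)))
    c≤N : c ≤ N
    c≤N = ℕₚ.≤-trans (ℕₚ.≤-trans (ℕₚ.m≤n+m c (S.w)) (ℕₚ.≤-trans (ℕₚ.m≤m+n (S.w + c) _) (ℕₚ.≤-reflexive S.count₀))) K≤N
    weights-p : ∀ i → mon (+ weight (replicate i p ++ acc)) ≈ mon (+ weight acc) ⊗ x m ^^ i
    weights-p i = ≈-trans (mon-≡ (cong +_ (trans (weight-++ (replicate i p) acc) (trans (cong (_+ weight acc) (weight-replicate i p)) (ℕₚ.+-comm _ (weight acc))))))
      (≈-trans (mon-+ (+ weight acc) (+ (i * (suc m * η)))) (⊗-cong ≈-refl (≈-trans (mon-≡ exponent) (≈-sym (x^^ m i)))))
      where
      exponent : + (i * (suc m * η)) ≡ + suc m ℤ.* + i ℤ.* H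
      exponent = trans (cong +_ (l i (suc m) η)) (trans (ℤₚ.pos-* (suc m * i) η) (cong (ℤ._* H) (ℤₚ.pos-* (suc m) i)))
        where
        l : ∀ i m h → i * (m * h) ≡ m * i * h
        l = ℕ-Solver.solve-∀
    low : ∀ i → i ≤ c → g i ≈ mon (+ weight acc) ⊗ (x m ^^ i ⊗ bitsum (cols (suc m)) e (c″ i) (tail d (suc m)))
    low i i≤c = ≈-trans (column N d (suc m) (fclaim N K≤N d (suc m)) (0 ∷ rs) refl (S.next-inv i i≤c) (S.good h i i≤c))
      (≈-trans (⊗-cong (weights-p i) (bitsum-bs e (c″ i) (tail d (suc m)) (weights-cols (suc m)))) (⊗-assoc _ _ _))

  spots : ℕ → List Part
  spots d = map (newp 0) rs ++ after d 0

  generate : ∀ N d → K ≤ N → gen Good (configs N (spots d) []) ≈ bitsum alphas (zeros rs) ρ (λ e → tail d 0 (0 ∷ e))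
  generate N d K≤N = ≈-trans (column N d 0 (fclaim N K≤N d 0) rs refl initial tt)
    (≈-trans (⊗-cong mon-0 ≈-refl) (⊗-identityˡ _))
    where
    -- The virtual parts serve as f = K ∸ ρ copies of 0 · η, and residue 0 of period 0 counts as
    -- already passed without a part.
    initial : Inv 0 (0 ∷ []) (0 ∷ []) rs (zeros rs) (K ∸ ρ) ρ [] []
    initial = record
      { o = 0 ; o≤1 = z≤n
      ; shape = sym (trans (cong (replicate (K ∸ ρ) (0 , false) ++_) (trans (Listₚ.++-identityʳ _) (flat-zero (oldp 0) rs (zeros rs) (sum-zeros rs)))) (Listₚ.++-identityʳ _))
      ; count = trans (cong (λ z → K ∸ ρ + z + ρ + 0) (sum-zeros rs)) (trans (l (K ∸ ρ) ρ) (ℕₚ.m∸n+n≡m ρ≤K))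
      ; parity = trans (cong (λ z → par (1 * z + 0 + ρ + 1 * (ρ + 0))) (sum-zeros rs)) (trans (cong par (l′ ρ)) (par-2* 0 ρ))
      ; len = refl ; len′ = proj₁ (bits-zeros rs) ; real = inj₂ (sum-zeros rs) ; old = [] }
      where
      l : ∀ a b → a + 0 + b + 0 ≡ a + b
      l = ℕ-Solver.solve-∀
      l′ : ∀ r → 1 * 0 + 0 + r + 1 * (r + 0) ≡ 0 + 2 * r
      l′ = ℕ-Solver.solve-∀

-- The conditions defining B̄₀, suffix by suffix

T-⇔⇒≡ : ∀ {a b} → (T a → T b) → (T b → T a) → a ≡ b
T-⇔⇒≡ {true}  {true}  f g = refl
T-⇔⇒≡ {true}  {false} f g = contradiction (f tt) λ ()
T-⇔⇒≡ {false} {true}  f g = contradiction (g tt) λ ()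
T-⇔⇒≡ {false} {false} f g = refl

T-not⁺ : ∀ {b} → ¬ T b → T (not b)
T-not⁺ {true}  h = contradiction tt h
T-not⁺ {false} h = tt

T-not⁻ : ∀ {b} → T (not b) → ¬ T b
T-not⁻ {false} _ ()

gen-cong : ∀ P P′ πs → (∀ π → π ∈ πs → P π ≡ P′ π) → gen P πs ≈ gen P′ πs
gen-cong P P′ []       h = ≈-refl
gen-cong P P′ (π ∷ πs) h rewrite h π (here refl) = ⊕-cong ≈-refl (gen-cong P P′ πs (λ ρ ρ∈ → h ρ (there ρ∈)))

mod-< : ∀ n m → 1 ≤ m → n mod m < m
mod-< n (suc m) _ = DM.m%n<n n (suc m)

div-mod : ∀ n m → 1 ≤ m → n ≡ n div m * m + n mod m
div-mod n (suc m) _ = trans (DM.m≡m%n+[m/n]*n n (suc m)) (ℕₚ.+-comm (n DM.% suc m) _)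

module _ (f : List Part → Bool) (m : ℕ) (p : Part) (π : List Part) where

  private
    w : List Part
    w = take m (p ∷ π)

    windows-∷ : windows m (p ∷ π) ≡ filterᵇ (λ w → length w ≡ᵇ m) (w ∷ map (λ i → take m (drop i π)) (upTo (length π)))
    windows-∷ = cong (λ z → filterᵇ (λ w → length w ≡ᵇ m) (w ∷ z))
      (trans (Listₚ.map-applyUpTo suc (λ i → take m (drop i (p ∷ π))) (length π))
        (sym (Listₚ.map-applyUpTo (λ i → i) (λ i → take m (drop i π)) (length π))))

  windows⁻ : T (all f (windows m (p ∷ π))) → (length w ≡ m → T (f w)) × T (all f (windows m π))
  windows⁻ h with subst (T ∘ all f) windows-∷ h
  ... | h′ with length w ≡ᵇ m in eq
  ...   | true  with a , b ← Equivalence.to (T-∧ {f w}) h′ = (λ _ → a) , b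
  ...   | false = (λ e → contradiction (subst T eq (ℕₚ.≡⇒≡ᵇ (length w) m e)) λ ()) , h′

  windows⁺ : (length w ≡ m → T (f w)) → T (all f (windows m π)) → T (all f (windows m (p ∷ π)))
  windows⁺ g h = subst (T ∘ all f) (sym windows-∷) go
    where
    go : T (all f (filterᵇ (λ w → length w ≡ᵇ m) (w ∷ map (λ i → take m (drop i π)) (upTo (length π)))))
    go with length w ≡ᵇ m in eq
    ... | true  = Equivalence.from T-∧ (g (ℕₚ.≡ᵇ⇒≡ (length w) m (subst T (sym eq) tt)) , h)
    ... | false = h

last-in : ∀ {P : Part → Set} a X Y j → P a → All P X → j ≤ length X → P (lastOr a (take j (X ++ Y)))
last-in a X       Y zero    pa ps       le       = pa
last-in a (x ∷ X) Y (suc j) pa (p ∷ ps) (s≤s le) = last-in x X Y j p ps le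

last-out : ∀ {P : Part → Set} a X Y j → All P Y → length X < j → length (take j (X ++ Y)) ≡ j → P (lastOr a (take j (X ++ Y)))
last-out a (x ∷ X) Y       (suc j)       ps       (s≤s le) e = last-out x X Y j ps le (ℕₚ.suc-injective e)
last-out a []      (y ∷ Y) (suc zero)    (p ∷ ps) le       e = p
last-out a []      (y ∷ Y) (suc (suc j)) (p ∷ ps) le       e = last-out y [] Y (suc j) ps (s≤s z≤n) (ℕₚ.suc-injective e)

key-ov : ∀ x y → key x ≡ key y → T (ov x) → T (ov y)
key-ov (s , true) (t , true)  e _ = tt
key-ov (s , true) (t , false) e _ = contradiction (trans (sym (par-2* 1 s)) (trans (cong par (trans (ℕₚ.+-comm 1 (2 * s)) (trans e (ℕₚ.+-identityʳ (2 * t))))) (par-2* 0 t))) λ ()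

-- Parts before a are at least a, and an overlined one with the same key is excluded by the strict
-- clause of `_⊒_`. Hence condition (5) looks at the suffix alone.
Vbar-suffix : ∀ pre a π → Sorted (pre ++ a ∷ π) → Vbar (pre ++ a ∷ π) a ≡ ovs (a ∷ π)
Vbar-suffix []        a π (h ∷ s) = cong length (go (a ∷ π) (ℕₚ.≤-refl ∷ All.map proj₁ h))
  where
  go : ∀ xs → All (λ x → key x ≤ key a) xs → filterᵇ (λ p → ov p ∧ (key p ≤ᵇ key a)) xs ≡ filterᵇ ov xs
  go []       []       = refl
  go ((s , false) ∷ xs) (h ∷ hs) = go xs hs
  go (x@(s , true) ∷ xs) (h ∷ hs) rewrite Equivalence.to T-≡ (≤ᵇ⁺ (key x) (key a) h) = cong (x ∷_) (go xs hs)
Vbar-suffix (x ∷ pre) a π (h ∷ s) = trans (cong length (Listₚ.filter-reject (T? ∘ (λ p → ov p ∧ (key p ≤ᵇ key a))) {x = x} {xs = pre ++ a ∷ π} out)) (Vbar-suffix pre a π s)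
  where
  x⊒a : x ⊒ a
  x⊒a = All.head (Allₚ.++⁻ʳ pre h)
  out : ¬ T (ov x ∧ (key x ≤ᵇ key a))
  out t with ovx , le ← Equivalence.to (T-∧ {ov x}) t =
    ℕₚ.<⇒≱ (proj₂ x⊒a (key-ov x a (ℕₚ.≤-antisym (ℕₚ.≤ᵇ⇒≤ (key x) (key a) le) (proj₁ x⊒a)) ovx)) (ℕₚ.≤ᵇ⇒≤ (key x) (key a) le)

module Conditions (η K′ ρ : ℕ) (1≤η : 1 ≤ η) (ρ≤K : ρ ≤ suc K′) where

  K k r : ℕ
  K = suc K′
  k = suc K
  r = suc ρ

  open Windows η K ρ

  Plain : Part → Set
  Plain p = 1 ≤ size p × (T (ov p) ⊎ size p mod η ≡ 0)

  small : List Part → ℕ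
  small π = length (filterᵇ (λ p → key p ≤ᵇ key (η , false)) π)

  Suffix : List Part → Part → List Part → Set
  Suffix Π p π = (length (take k (p ∷ π)) ≡ k → T (B-cond3 η (take k (p ∷ π))))
    -- Condition (4) read at p: if p is at most η, then so is everything after it.
    × (key p ≤ key (η , false) → suc (length π) ≤ ρ)
    × (length (take K (p ∷ π)) ≡ K → T (B-cond5 η r Π (take K (p ∷ π))))

  cond3⁻ : ∀ p w → T (B-cond3 η (p ∷ w)) → ¬ T (inW p (lastOr p w))
  cond3⁻ p@(s , true)  w h t = ℕₚ.<⇒≱ (ℕₚ.<ᵇ⇒< (key p) (key (lastOr p w) + 2 * η) t) (ℕₚ.≤ᵇ⇒≤ (key (lastOr p w) + 2 * η) (key p) h)
  cond3⁻ p@(s , false) w h t = ℕₚ.<⇒≱ (ℕₚ.<ᵇ⇒< (key (lastOr p w) + 2 * η) (key p) h) (ℕₚ.≤ᵇ⇒≤ (key p) (key (lastOr p w) + 2 * η) t)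

  cond3⁺ : ∀ p w → ¬ T (inW p (lastOr p w)) → T (B-cond3 η (p ∷ w))
  cond3⁺ p@(s , true)  w h = ≤ᵇ⁺ (key (lastOr p w) + 2 * η) (key p) (ℕₚ.≮⇒≥ (λ lt → h (<ᵇ⁺ (key p) (key (lastOr p w) + 2 * η) lt)))
  cond3⁺ p@(s , false) w h = <ᵇ⁺ (key (lastOr p w) + 2 * η) (key p) (ℕₚ.≰⇒> (λ le → h (≤ᵇ⁺ (key p) (key (lastOr p w) + 2 * η) le)))

  cond5⁻ : ∀ Π p w → T (B-cond5 η r Π (p ∷ w)) → T (inW p (lastOr p w)) → par (floors (p ∷ w)) ≡ par (ρ + Vbar Π p)
  cond5⁻ Π p w h t with Equivalence.to (T-∨ {not (inW p (lastOr p w))}) h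
  ... | inj₁ n = contradiction t (T-not⁻ n)
  ... | inj₂ e = par-mod⁻ (floors (p ∷ w)) (ρ + Vbar Π p) e

  cond5⁺ : ∀ Π p w → (T (inW p (lastOr p w)) → par (floors (p ∷ w)) ≡ par (ρ + Vbar Π p)) → T (B-cond5 η r Π (p ∷ w))
  cond5⁺ Π p w h with T? (inW p (lastOr p w))
  ... | yes t = Equivalence.from (T-∨ {not (inW p (lastOr p w))}) (inj₂ (par-mod⁺ (floors (p ∷ w)) (ρ + Vbar Π p) (h t)))
  ... | no ¬t = Equivalence.from (T-∨ {not (inW p (lastOr p w))}) (inj₁ (T-not⁺ ¬t))

  inW-mono : ∀ p x y → key x ≤ key y → T (inW p x) → T (inW p y)
  inW-mono p@(s , true)  x y le t = <ᵇ⁺ (key p) (key y + 2 * η) (ℕₚ.≤-trans (ℕₚ.<ᵇ⇒< (key p) (key x + 2 * η) t) (ℕₚ.+-monoˡ-≤ (2 * η) le))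
  inW-mono p@(s , false) x y le t = ≤ᵇ⁺ (key p) (key y + 2 * η) (ℕₚ.≤-trans (ℕₚ.≤ᵇ⇒≤ (key p) (key x + 2 * η) t) (ℕₚ.+-monoˡ-≤ (2 * η) le))

  split-window : ∀ p π → Sorted π → ∃₂ λ X Y → π ≡ X ++ Y × All (T ∘ inW p) X × All (¬_ ∘ T ∘ inW p) Y
  split-window p []      s       = [] , [] , refl , [] , []
  split-window p (x ∷ π) (h ∷ s) with T? (inW p x)
  ... | yes t with X , Y , refl , hX , hY ← split-window p π s = x ∷ X , Y , refl , t ∷ hX , hY
  ... | no ¬t = [] , x ∷ π , refl , [] , ¬t ∷ All.map (λ {y} x⊒y t → ¬t (inW-mono p y x (proj₁ x⊒y) t)) h

  key-η : key (η , false) ≡ 2 * η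
  key-η = ℕₚ.+-identityʳ (2 * η)

  -- A part at most η is either overlined with floor 0 or equal to η with floor 1. This makes the
  -- parity test hold by itself when virtual parts fill a window up to K, as condition (4) knows no
  -- parity.
  floor+ov : ∀ x → Plain x → key x ≤ key (η , false) → size x div η + ovs (x ∷ []) ≡ 1
  floor+ov (s , true)  _ le = cong (_+ 1) (div-unique 0 (ℕₚ.*-cancelˡ-< 2 s η (subst₂ _≤_ (ℕₚ.+-comm (2 * s) 1) key-η le)) refl)
  floor+ov (s , false) (1≤s , inj₂ z) le = trans (ℕₚ.+-identityʳ (s div η)) (div-unique 1 1≤η (trans s≡η (sym (trans (ℕₚ.+-identityʳ (1 * η)) (ℕₚ.+-identityʳ η)))))
    where
    s≤η : s ≤ η
    s≤η = ℕₚ.*-cancelˡ-≤ 2 (subst₂ _≤_ (ℕₚ.+-identityʳ (2 * s)) key-η le)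
    s≡η : s ≡ η
    s≡η with ℕₚ.m≤n⇒m<n∨m≡n s≤η
    ... | inj₂ e = e
    ... | inj₁ s<η = contradiction (trans (sym (mod-unique 0 s<η refl)) z) (λ e → ℕₚ.<⇒≢ 1≤s (sym e))

  floors+ovs : ∀ π → All Plain π → All (λ x → key x ≤ key (η , false)) π → floors π + ovs π ≡ length π
  floors+ovs []      _        _        = refl
  floors+ovs (x ∷ π) (c ∷ cs) (h ∷ hs) = trans (cong (λ z → size x div η + floors π + z) (ovs-++ (x ∷ []) π))
    (trans (l (size x div η) (floors π) (ovs (x ∷ [])) (ovs π)) (cong₂ _+_ (floor+ov x c h) (floors+ovs π cs hs)))
    where
    l : ∀ a b c d → a + b + (c + d) ≡ (a + c) + (b + d)
    l = ℕ-Solver.solve-∀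

  floors-virt : floors virt ≡ 0
  floors-virt = go (K ∸ ρ)
    where
    go : ∀ n → floors (replicate n (0 , false)) ≡ 0
    go zero    = refl
    go (suc n) = cong₂ _+_ (div-unique 0 1≤η refl) (go n)

  ovs-virt′ : ∀ π → ovs (π ++ virt) ≡ ovs π
  ovs-virt′ π = trans (ovs-++ π virt) (trans (cong (λ z → ovs π + z) (ovs-replicate (K ∸ ρ) 0)) (ℕₚ.+-identityʳ _))

  take-all : ∀ (w : List Part) j → length w ≤ j → take j w ≡ w
  take-all w j le = Listₚ.take-all j w le

  length-take≤ : ∀ j (w : List Part) → length (take j w) ≡ j → j ≤ length w
  length-take≤ zero    w       e = z≤n
  length-take≤ (suc j) (x ∷ w) e = s≤s (length-take≤ j w (ℕₚ.suc-injective e))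

  take-length : ∀ j (w : List Part) → j ≤ length w → length (take j w) ≡ j
  take-length zero    w       le       = refl
  take-length (suc j) (x ∷ w) (s≤s le) = cong suc (take-length j w le)

  take-++ˡ : ∀ (X Y : List Part) → take (length X) (X ++ Y) ≡ X
  take-++ˡ []      Y = refl
  take-++ˡ (x ∷ X) Y = cong (x ∷_) (take-++ˡ X Y)

  module Low (Π : List Part) (p : Part) (π : List Part) (V : Vbar Π p ≡ ovs (p ∷ π)) (s : Sorted (p ∷ π))
    (plain : All Plain (p ∷ π)) (le : key p ≤ key (η , false)) where

    all≤ : All (λ x → key x ≤ key (η , false)) (p ∷ π)
    all≤ = le ∷ All.map (λ p⊒x → ℕₚ.≤-trans (proj₁ p⊒x) le) (AllPairs.head s)

    parity : suc (length π) ≡ ρ → par (floors (p ∷ π)) ≡ par (ρ + ovs (p ∷ π))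
    parity e = par-sum0 (floors (p ∷ π)) (ρ + ovs (p ∷ π)) (trans (cong par
      (trans (l (floors (p ∷ π)) ρ (ovs (p ∷ π))) (trans (cong (_+ ρ) (trans (floors+ovs (p ∷ π) plain all≤) e)) (l′ ρ)))) (par-2* 0 ρ))
      where
      l : ∀ a b c → a + (b + c) ≡ a + c + b
      l = ℕ-Solver.solve-∀
      l′ : ∀ r → r + r ≡ 0 + 2 * r
      l′ = ℕ-Solver.solve-∀

    inW-any : ∀ x → T (inW p x)
    inW-any x = go p le
      where
      go : ∀ p → key p ≤ key (η , false) → T (inW p x)
      go (s , true)  le = <ᵇ⁺ (key (s , true)) (key x + 2 * η) (ℕₚ.≤-trans (odd< s (subst (key (s , true) ≤_) key-η le)) (ℕₚ.m≤n+m (2 * η) (key x)))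
        where
        odd< : ∀ s → 2 * s + 1 ≤ 2 * η → 2 * s + 1 < 2 * η
        odd< s le = ℕₚ.≤∧≢⇒< le λ e → contradiction (trans (sym (par-2* 1 s)) (trans (cong par (trans (ℕₚ.+-comm 1 (2 * s)) e)) (par-2* 0 η))) λ ()
      go (s , false) le = ≤ᵇ⁺ (key (s , false)) (key x + 2 * η) (ℕₚ.≤-trans (subst (key (s , false) ≤_) key-η le) (ℕₚ.m≤n+m (2 * η) (key x)))

    inX : All (T ∘ inW p) (π ++ virt)
    inX = All.tabulate (λ {x} _ → inW-any x)

    length-X : length (π ++ virt) ≡ length π + (K ∸ ρ)
    length-X = trans (Listₚ.length-++ π) (cong (λ z → length π + z) (Listₚ.length-replicate (K ∸ ρ)))

    floors-X : floors (p ∷ (π ++ virt)) ≡ floors (p ∷ π)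
    floors-X = cong (λ z → size p div η + z) (trans (floors-++ π virt) (trans (cong (λ z → floors π + z) floors-virt) (ℕₚ.+-identityʳ _)))

    ++[] : (π ++ virt) ++ [] ≡ π ++ virt
    ++[] = Listₚ.++-identityʳ (π ++ virt)

    to : Suffix Π p π → T (step p (π ++ virt))
    to (_ , h , _) = subst (T ∘ step p) ++[] (step⁺ 1≤η p (π ++ virt) [] inX []
      ( subst (λ z → suc z ≤ K) (sym length-X) (ℕₚ.≤-trans (ℕₚ.+-monoˡ-≤ (K ∸ ρ) (h le)) (ℕₚ.≤-reflexive (ℕₚ.m+[n∸m]≡n ρ≤K)))
      , λ e → trans (cong par floors-X) (trans (parity (ℕₚ.+-cancelʳ-≡ (K ∸ ρ) (suc (length π)) ρ
            (trans (cong suc (sym length-X)) (trans e (sym (ℕₚ.m+[n∸m]≡n ρ≤K))))))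
          (cong (λ z → par (ρ + z)) (sym (trans (cong (λ z → ovs (p ∷ z)) ++[]) (ovs-virt′ (p ∷ π)))))) ))

    from : T (step p (π ++ virt)) → Suffix Π p π
    from t = (λ e → contradiction (ℕₚ.≤-trans (length-take≤ k (p ∷ π) e) (ℕₚ.≤-trans short ρ≤K)) (ℕₚ.<⇒≱ (ℕₚ.n<1+n K)))
           , (λ _ → short)
           , λ e → cond5⁺ Π p (take K′ π) (λ _ → subst (λ z → par (floors z) ≡ par (ρ + Vbar Π p)) (sym (take-all (p ∷ π) K (ℕₚ.≤-trans short ρ≤K)))
               (trans (parity (ℕₚ.≤-antisym short (ℕₚ.≤-trans ρ≤K (length-take≤ K (p ∷ π) e)))) (cong (λ z → par (ρ + z)) (sym V))))
      where
      short : suc (length π) ≤ ρ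
      short = ℕₚ.+-cancelʳ-≤ (K ∸ ρ) (suc (length π)) ρ (subst₂ _≤_ (cong suc length-X) (sym (ℕₚ.m+[n∸m]≡n ρ≤K))
        (proj₁ (step⁻ 1≤η p (π ++ virt) [] inX [] (subst (T ∘ step p) (sym ++[]) t))))

  module High (Π : List Part) (p : Part) (π : List Part) (V : Vbar Π p ≡ ovs (p ∷ π)) (s : Sorted (p ∷ π))
    (gt : key (η , false) < key p) where

    out-virt : All (¬_ ∘ T ∘ inW p) virt
    out-virt = All-replicate (K ∸ ρ) (go p gt)
      where
      go : ∀ p → key (η , false) < key p → ¬ T (inW p (0 , false))
      go p@(_ , true)  gt t = ℕₚ.<⇒≱ (ℕₚ.<ᵇ⇒< (key p) (2 * η) t) (ℕₚ.<⇒≤ (subst (_< key p) key-η gt))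
      go p@(_ , false) gt t = ℕₚ.<⇒≱ (subst (_< key p) key-η gt) (ℕₚ.≤ᵇ⇒≤ (key p) (2 * η) t)

    module _ (X Y : List Part) (eq : π ≡ X ++ Y) (hX : All (T ∘ inW p) X) (hY : All (¬_ ∘ T ∘ inW p) Y) where

      shape : π ++ virt ≡ X ++ (Y ++ virt)
      shape = trans (cong (_++ virt) eq) (Listₚ.++-assoc X Y virt)

      outY : All (¬_ ∘ T ∘ inW p) (Y ++ virt)
      outY = Allₚ.++⁺ hY out-virt

      |X|≤ : length X ≤ length π
      |X|≤ = ℕₚ.≤-trans (ℕₚ.m≤m+n _ _) (ℕₚ.≤-reflexive (trans (sym (Listₚ.length-++ X)) (cong length (sym eq))))

      ovs-eq : ovs (p ∷ (X ++ (Y ++ virt))) ≡ Vbar Π p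
      ovs-eq = trans (cong (λ z → ovs (p ∷ z)) (sym shape)) (trans (ovs-virt′ (p ∷ π)) (sym V))

      in-last : ∀ j → j ≤ length X → T (inW p (lastOr p (take j π)))
      in-last j le rewrite eq = last-in p X Y j (inW-refl 1≤η p) hX le

      out-last : ∀ j → length X < j → length (take j π) ≡ j → ¬ T (inW p (lastOr p (take j π)))
      out-last j lt e rewrite eq = last-out p X Y j hY lt e

      to : Suffix Π p π → T (step p (π ++ virt))
      to (c3 , _ , c5) = subst (T ∘ step p) (sym shape) (step⁺ 1≤η p X (Y ++ virt) hX outY (short , par-eq))
        where
        short : suc (length X) ≤ K
        short = ℕₚ.≰⇒> λ K≤ → cond3⁻ p (take K π) (c3 (cong suc (take-length K π (ℕₚ.≤-trans K≤ |X|≤)))) (in-last K K≤)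
        par-eq : suc (length X) ≡ K → par (floors (p ∷ X)) ≡ par (ρ + ovs (p ∷ (X ++ (Y ++ virt))))
        par-eq refl = trans (cong (λ z → par (floors (p ∷ z))) (sym (trans (cong (take K′) eq) (take-++ˡ X Y))))
          (trans (cond5⁻ Π p (take K′ π) (c5 (cong suc (take-length K′ π |X|≤))) (in-last K′ ℕₚ.≤-refl)) (cong (λ z → par (ρ + z)) (sym ovs-eq)))

      from : T (step p (π ++ virt)) → Suffix Π p π
      from t with short , par-eq ← step⁻ 1≤η p X (Y ++ virt) hX outY (subst (T ∘ step p) shape t) =
          (λ e → cond3⁺ p (take K π) (out-last K short (ℕₚ.suc-injective e)))
        , (λ le → contradiction le (ℕₚ.<⇒≱ gt))
        , λ e → cond5⁺ Π p (take K′ π) (λ t → go (ℕₚ.m≤n⇒m<n∨m≡n (ℕₚ.≤-pred short)) (ℕₚ.suc-injective e) t par-eq)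
        where
        go : length X < K′ ⊎ length X ≡ K′ → length (take K′ π) ≡ K′ → T (inW p (lastOr p (take K′ π))) →
          (suc (length X) ≡ K → par (floors (p ∷ X)) ≡ par (ρ + ovs (p ∷ (X ++ (Y ++ virt))))) →
          par (floors (p ∷ take K′ π)) ≡ par (ρ + Vbar Π p)
        go (inj₁ lt)   e t h = contradiction t (out-last K′ lt e)
        go (inj₂ refl) e t h = trans (cong (λ z → par (floors (p ∷ z))) (trans (cong (take K′) eq) (take-++ˡ X Y)))
          (trans (h refl) (cong (λ z → par (ρ + z)) ovs-eq))

  suffix-to : ∀ Π p π → Vbar Π p ≡ ovs (p ∷ π) → Sorted (p ∷ π) → All Plain (p ∷ π) → Suffix Π p π → T (step p (π ++ virt))
  suffix-to Π p π V s c h with key p ℕₚ.≤? key (η , false)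
  ... | yes le = Low.to Π p π V s c le h
  ... | no ≰ with X , Y , eq , hX , hY ← split-window p π (AllPairs.tail s) = High.to Π p π V s (ℕₚ.≰⇒> ≰) X Y eq hX hY h

  suffix-from : ∀ Π p π → Vbar Π p ≡ ovs (p ∷ π) → Sorted (p ∷ π) → All Plain (p ∷ π) → T (step p (π ++ virt)) → Suffix Π p π
  suffix-from Π p π V s c h with key p ℕₚ.≤? key (η , false)
  ... | yes le = Low.from Π p π V s c le h
  ... | no ≰ with X , Y , eq , hX , hY ← split-window p π (AllPairs.tail s) = High.from Π p π V s (ℕₚ.≰⇒> ≰) X Y eq hX hY h

  Conds : List Part → List Part → Set
  Conds Π π = T (all (B-cond3 η) (windows k π)) × small π ≤ ρ × T (all (B-cond5 η r Π) (windows K π))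

  small≤length : ∀ π → small π ≤ length π
  small≤length π = Listₚ.length-filter (T? ∘ (λ p → key p ≤ᵇ key (η , false))) π

  small-head : ∀ p π → Sorted (p ∷ π) → key p ≤ key (η , false) → small (p ∷ π) ≡ suc (length π)
  small-head p π (h ∷ _) le = cong length (Listₚ.filter-all (T? ∘ (λ p → key p ≤ᵇ key (η , false))) {xs = p ∷ π}
    (≤ᵇ⁺ (key p) (key (η , false)) le ∷ All.map (λ {x} p⊒x → ≤ᵇ⁺ (key x) (key (η , false)) (ℕₚ.≤-trans (proj₁ p⊒x) le)) h))

  small-tail : ∀ p π → ¬ key p ≤ key (η , false) → small (p ∷ π) ≡ small π
  small-tail p π ≰ = cong length (Listₚ.filter-reject (T? ∘ (λ p → key p ≤ᵇ key (η , false))) {x = p} {xs = π} (λ t → ≰ (ℕₚ.≤ᵇ⇒≤ (key p) (key (η , false)) t)))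

  small⁻ : ∀ p π → Sorted (p ∷ π) → small (p ∷ π) ≤ ρ → (key p ≤ key (η , false) → suc (length π) ≤ ρ) × small π ≤ ρ
  small⁻ p π s h = (λ le → subst (_≤ ρ) (small-head p π s le) h) , ℕₚ.≤-trans (mono (key p ℕₚ.≤? key (η , false))) h
    where
    mono : Dec (key p ≤ key (η , false)) → small π ≤ small (p ∷ π)
    mono (yes le) = ℕₚ.≤-trans (small≤length π) (ℕₚ.≤-trans (ℕₚ.n≤1+n _) (ℕₚ.≤-reflexive (sym (small-head p π s le))))
    mono (no ≰)   = ℕₚ.≤-reflexive (sym (small-tail p π ≰))

  small⁺ : ∀ p π → Sorted (p ∷ π) → (key p ≤ key (η , false) → suc (length π) ≤ ρ) → small π ≤ ρ → small (p ∷ π) ≤ ρ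
  small⁺ p π s h h′ with key p ℕₚ.≤? key (η , false)
  ... | yes le = subst (_≤ ρ) (sym (small-head p π s le)) (h le)
  ... | no ≰   = subst (_≤ ρ) (sym (small-tail p π ≰)) h′

  conds-to : ∀ pre π → Sorted (pre ++ π) → All Plain π → Conds (pre ++ π) π → T (Good π)
  conds-to pre []      s c h = tt
  conds-to pre (p ∷ π) s (c ∷ cs) (h3 , h4 , h5)
    with a3 , b3 ← windows⁻ (B-cond3 η) k p π h3
    with a4 , b4 ← small⁻ p π (sorted-++ʳ pre s) h4
    with a5 , b5 ← windows⁻ (B-cond5 η r (pre ++ p ∷ π)) K p π h5 =
    Equivalence.from T-∧ (suffix-to (pre ++ p ∷ π) p π (Vbar-suffix pre p π s) (sorted-++ʳ pre s) (c ∷ cs) (a3 , a4 , a5) ,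
      conds-to (pre ++ p ∷ []) π (subst Sorted (sym assoc) s) cs
        (b3 , b4 , subst (λ Π → T (all (B-cond5 η r Π) (windows K π))) (sym assoc) b5))
    where
    assoc : (pre ++ p ∷ []) ++ π ≡ pre ++ p ∷ π
    assoc = Listₚ.++-assoc pre (p ∷ []) π

  conds-from : ∀ pre π → Sorted (pre ++ π) → All Plain π → T (Good π) → Conds (pre ++ π) π
  conds-from pre []      s c h = tt , z≤n , tt
  conds-from pre (p ∷ π) s (c ∷ cs) h
    with g , gs ← Equivalence.to (T-∧ {step p (π ++ virt)}) h
    with a3 , a4 , a5 ← suffix-from (pre ++ p ∷ π) p π (Vbar-suffix pre p π s) (sorted-++ʳ pre s) (c ∷ cs) g
    with b3 , b4 , b5 ← conds-from (pre ++ p ∷ []) π (subst Sorted (sym (Listₚ.++-assoc pre (p ∷ []) π)) s) cs gs =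
    windows⁺ (B-cond3 η) k p π a3 b3 , small⁺ p π (sorted-++ʳ pre s) a4 b4 ,
    windows⁺ (B-cond5 η r (pre ++ p ∷ π)) K p π a5
      (subst (λ Π → T (all (B-cond5 η r Π) (windows K π))) (Listₚ.++-assoc pre (p ∷ []) π) b5)

  module _ (lam : ℕ) (α : Fin lam → ℕ) where

    mult : Part → Bool
    mult p = ov p ∨ (size p mod η ≡ᵇ 0)

    B-prop⇔Good : ∀ π → Sorted π → All (λ p → 1 ≤ size p) π → All (T ∘ residueOK lam η α) π → All (T ∘ mult) π →
      B-prop lam η α k r π ≡ Good π
    B-prop⇔Good π s 1≤ hr hm = T-⇔⇒≡ to from
      where
      plain : All Plain π
      plain = All.zipWith (λ {p} (a , b) → a , go p (Equivalence.to (T-∨ {ov p}) b)) (1≤ , hm)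
        where
        go : ∀ p → T (ov p) ⊎ T (size p mod η ≡ᵇ 0) → T (ov p) ⊎ size p mod η ≡ 0
        go p (inj₁ t) = inj₁ t
        go p (inj₂ t) = inj₂ (ℕₚ.≡ᵇ⇒≡ (size p mod η) 0 t)
      to : T (B-prop lam η α k r π) → T (Good π)
      to h with _ , h ← Equivalence.to (T-∧ {all (residueOK lam η α) π}) h
        with _ , h ← Equivalence.to (T-∧ {all mult π}) h
        with h3 , h ← Equivalence.to (T-∧ {all (B-cond3 η) (windows k π)}) h
        with h4 , h5 ← Equivalence.to (T-∧ {small π <ᵇ r}) h =
        conds-to [] π s plain (h3 , ℕₚ.≤-pred (ℕₚ.<ᵇ⇒< (small π) r h4) , h5)
      from : T (Good π) → T (B-prop lam η α k r π)
      from h with h3 , h4 , h5 ← conds-from [] π s plain h =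
        Equivalence.from T-∧ (all⁺ _ π hr , Equivalence.from T-∧ (all⁺ _ π hm , Equivalence.from T-∧ (h3 , Equivalence.from T-∧ (<ᵇ⁺ (small π) r (s≤s h4) , h5))))

-- Residues and admissible parts

∏ₗ-↭ : ∀ {A : Set} {xs ys : List A} (g : A → Laurent) → xs ↭ ys → ∏ₗ xs g ≈ ∏ₗ ys g
∏ₗ-↭ g _↭_.refl          = ≈-refl
∏ₗ-↭ g (_↭_.prep x p)    = ⊗-cong ≈-refl (∏ₗ-↭ g p)
∏ₗ-↭ g (_↭_.swap x y p)  = ≈-trans (⊗-cong ≈-refl (⊗-cong ≈-refl (∏ₗ-↭ g p))) (l (g x) (g y) _)
  where
  l : ∀ a b c → a ⊗ (b ⊗ c) ≈ b ⊗ (a ⊗ c)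
  l = Solver.solve-∀ laurentRing
∏ₗ-↭ g (_↭_.trans p q)   = ≈-trans (∏ₗ-↭ g p) (∏ₗ-↭ g q)

module Residues (lam η : ℕ) (α : Fin lam → ℕ) (1≤η : 1 ≤ η) (0<α : ∀ i → 0 < α i)
  (α-mono : ∀ i j → i <ᶠ j → α i < α j) (α<η : ∀ i → α i < η) (α-sym : ∀ i → α i ≡ η ∸ α (opposite i)) where

  sel : ℕ → Bool
  sel j = any (λ a → j ≡ᵇ a mod η) (tabulate α)

  -- Filtered from the interval instead of read off from `α`: this list is increasing by
  -- construction and selected by the very test in `residueOK`.
  rs : List ℕ
  rs = filterᵇ sel (upTo η)

  sel⁺ : ∀ i → T (sel (α i))
  sel⁺ i = any⁺ (λ a → α i ≡ᵇ a mod η) (tabulate⁺ i (ℕₚ.≡⇒≡ᵇ (α i) (α i mod η) (sym (mod-unique 0 (α<η i) refl))))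

  sel⁻ : ∀ j → T (sel j) → ∃ λ i → j ≡ α i
  sel⁻ j h with i , e ← tabulate⁻ {f = α} (any⁻ (λ a → j ≡ᵇ a mod η) (tabulate α) h) =
    i , trans (ℕₚ.≡ᵇ⇒≡ j (α i mod η) e) (mod-unique 0 (α<η i) refl)

  ∈rs⁺ : ∀ i → α i ∈ rs
  ∈rs⁺ i = ∈-filter⁺ (T? ∘ sel) (∈-upTo⁺ (α<η i)) (sel⁺ i)

  ∈rs⁻ : ∀ {j} → j ∈ rs → ∃ λ i → j ≡ α i
  ∈rs⁻ j∈ = sel⁻ _ (proj₂ (∈-filter⁻ (T? ∘ sel) {xs = upTo η} j∈))

  rs-unique : Unique rs
  rs-unique = Uniqueₚ.filter⁺ (T? ∘ sel) (Uniqueₚ.upTo⁺ η)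

  α-injective : ∀ {i j} → α i ≡ α j → i ≡ j
  α-injective {i} {j} e with Finₚ.<-cmp i j
  ... | tri< lt _ _ = contradiction e (ℕₚ.<⇒≢ (α-mono i j lt))
  ... | tri≈ _ eq _ = eq
  ... | tri> _ _ gt = contradiction (sym e) (ℕₚ.<⇒≢ (α-mono j i gt))

  rs↭α : rs ↭ tabulate α
  rs↭α = unique⇒↭ rs-unique (Uniqueₚ.tabulate⁺ α-injective)
    (λ j j∈ → let i , e = ∈rs⁻ j∈ in subst (_∈ tabulate α) (sym e) (∈-tabulate⁺ i))
    (λ j j∈ → let i , e = ∈-tabulate⁻ j∈ in subst (_∈ rs) (sym e) (∈rs⁺ i))

  len-rs : length rs ≡ lam
  len-rs = trans (↭-length rs↭α) (Listₚ.length-tabulate α)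

  rs<η : All (_< η) rs
  rs<η = All.tabulate (λ j∈ → let i , e = ∈rs⁻ j∈ in subst (_< η) (sym e) (α<η i))

  0<rs : All (0 <_) rs
  0<rs = All.tabulate (λ j∈ → let i , e = ∈rs⁻ j∈ in subst (0 <_) (sym e) (0<α i))

  rs₀-sorted : AllPairs _<_ (0 ∷ rs)
  rs₀-sorted = 0<rs ∷ AllPairsₚ.filter⁺ (T? ∘ sel) (AllPairsₚ.applyUpTo⁺₁ (λ i → i) η (λ i<j _ → i<j))

  rs₀<η : All (_< η) (0 ∷ rs)
  rs₀<η = 1≤η ∷ rs<η

  mirror : map (η ∸_) rs ↭ rs
  mirror = unique⇒↭ (mirror-unique rs rs<η rs-unique) rs-unique
    (λ j j∈ → let i , i∈ , e = ∈-map⁻ (η ∸_) j∈ in subst (_∈ rs) (sym e) (closed i i∈))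
    (λ j j∈ → subst (_∈ map (η ∸_) rs) (ℕₚ.m∸[m∸n]≡n (ℕₚ.<⇒≤ (All.lookup rs<η j∈))) (∈-map⁺ (η ∸_) (closed j j∈)))
    where
    closed : ∀ j → j ∈ rs → η ∸ j ∈ rs
    closed j j∈ with i , refl ← ∈rs⁻ j∈ = subst (_∈ rs)
      (trans (α-sym (opposite i)) (cong (λ z → η ∸ α z) (Finₚ.opposite-involutive i))) (∈rs⁺ (opposite i))
    mirror-unique : ∀ xs → All (_< η) xs → Unique xs → Unique (map (η ∸_) xs)
    mirror-unique []       _        _        = []
    mirror-unique (x ∷ xs) (h ∷ hs) (u ∷ us) = Allₚ.map⁺ (All.zipWith (λ (y< , x≢y) e → x≢y (ℕₚ.∸-cancelˡ-≡ (ℕₚ.<⇒≤ h) (ℕₚ.<⇒≤ y<) e)) (hs , u))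
      ∷ mirror-unique xs hs us

  σ : ℕ
  σ = sum rs

  2σ : σ + σ ≡ lam * η
  2σ = trans (cong (_+ σ) (sym (sum-↭ mirror))) (trans (go rs rs<η) (cong (_* η) len-rs))
    where
    go : ∀ xs → All (_< η) xs → sum (map (η ∸_) xs) + sum xs ≡ length xs * η
    go []       _        = refl
    go (x ∷ xs) (h ∷ hs) = trans (l (η ∸ x) (sum (map (η ∸_) xs)) x (sum xs)) (cong₂ _+_ (ℕₚ.m∸n+n≡m (ℕₚ.<⇒≤ h)) (go xs hs))
      where
      l : ∀ a b c d → a + b + (c + d) ≡ a + c + (b + d)
      l = ℕ-Solver.solve-∀

  reflect : ∀ g → ∏ₗ rs (λ j → g (+ η ℤ.- + j)) ≈ ∏ₗ rs (λ j → g (+ j))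
  reflect g = ≈-trans (go rs rs<η) (∏ₗ-↭ (λ j → g (+ j)) mirror)
    where
    go : ∀ xs → All (_< η) xs → ∏ₗ xs (λ j → g (+ η ℤ.- + j)) ≈ ∏ₗ (map (η ∸_) xs) (λ j → g (+ j))
    go []       _        = ≈-refl
    go (x ∷ xs) (h ∷ hs) = ⊗-cong (≈-reflexive (cong g (trans (ℤₚ.m-n≡m⊖n η x) (ℤₚ.⊖-≥ (ℕₚ.<⇒≤ h))))) (go xs hs)

  module Spots (K′ ρ : ℕ) (ρ≤K : ρ ≤ suc K′) where

    K : ℕ
    K = suc K′

    open Scan η K ρ 1≤η rs rs₀<η

    spots : ℕ → List Part
    spots d = map (newp 0) rs ++ after d 0

    Fine : Part → Set
    Fine p = 1 ≤ size p × T (residueOK lam η α p) × T (ov p ∨ (size p mod η ≡ᵇ 0))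

    fine-f : ∀ m → Fine (fpart (suc m))
    fine-f m = ℕₚ.≤-trans 1≤η (ℕₚ.m≤m+n η _) , Equivalence.from (T-∨ {fm}) (inj₁ ok) , ok
      where
      fm : Bool
      fm = (suc m * η) mod η ≡ᵇ 0
      ok : T fm
      ok = ℕₚ.≡⇒≡ᵇ ((suc m * η) mod η) 0 (mod-unique (suc m) 1≤η (sym (ℕₚ.+-identityʳ (suc m * η))))

    residue-new : ∀ m j → j < η → j ≡ 0 ⊎ T (sel j) → T (residueOK lam η α (newp m j))
    residue-new m j j<η h = go h
      where
      e : (m * η + j) mod η ≡ j
      e = mod-unique m j<η refl
      go : j ≡ 0 ⊎ T (sel j) → T (residueOK lam η α (newp m j))
      go (inj₁ z) = Equivalence.from (T-∨ {(m * η + j) mod η ≡ᵇ 0}) (inj₁ (ℕₚ.≡⇒≡ᵇ ((m * η + j) mod η) 0 (trans e z)))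
      go (inj₂ t) = Equivalence.from (T-∨ {(m * η + j) mod η ≡ᵇ 0}) (inj₂ (subst (T ∘ sel) (sym e) t))

    sel-rs : All (λ j → T (sel j)) rs
    sel-rs = All.tabulate (λ j∈ → proj₂ (∈-filter⁻ (T? ∘ sel) {xs = upTo η} j∈))

    fine-col : ∀ m → All Fine (map (newp (suc m)) (0 ∷ rs))
    fine-col m = Allₚ.map⁺ ((ℕₚ.≤-trans 1≤η (ℕₚ.≤-trans (ℕₚ.m≤m+n η _) (ℕₚ.m≤m+n _ 0)) , residue-new (suc m) 0 1≤η (inj₁ refl) , tt)
      ∷ All.zipWith (λ {j} (j<η , t) → ℕₚ.≤-trans 1≤η (ℕₚ.≤-trans (ℕₚ.m≤m+n η _) (ℕₚ.m≤m+n _ j)) , residue-new (suc m) j j<η (inj₂ t) , tt) (rs<η , sel-rs))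

    fine-after : ∀ d m → All Fine (after d m)
    fine-after zero    m = []
    fine-after (suc d) m = fine-f m ∷ Allₚ.++⁺ (fine-col m) (fine-after d (suc m))

    fine-spots : ∀ d → All Fine (spots d)
    fine-spots d = Allₚ.++⁺ (Allₚ.map⁺ (All.zipWith (λ {j} (0<j , j<η , t) → 0<j , residue-new 0 j j<η (inj₂ t) , tt) (0<rs , All.zip (rs<η , sel-rs))))
      (fine-after d 0)

    after-size : ∀ d m → All (λ q → suc m * η ≤ size q) (after d m)
    after-size zero    m = []
    after-size (suc d) m = ℕₚ.≤-refl ∷ Allₚ.++⁺ (Allₚ.map⁺ (All.tabulate (λ {j} _ → ℕₚ.m≤m+n (suc m * η) j)))
      (All.map (λ h → ℕₚ.≤-trans (ℕₚ.m≤n+m (suc m * η) η) h) (after-size d (suc m)))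

    col-ascending : ∀ m js → AllPairs _<_ js → Ascending (map (newp m) js)
    col-ascending m js s = AllPairsₚ.map⁺ (AllPairs.map (λ {i} {j} i<j → key-< (newp m i) (newp m j) (ℕₚ.+-monoʳ-< (m * η) i<j)) s)

    col-below : ∀ d m js → All (_< η) js → All (λ p → All (λ q → key p < key q) (after d m)) (map (newp m) js)
    col-below d m js h = Allₚ.map⁺ (All.map (λ {j} j<η → All.map (λ {q} le → key-< (newp m j) q
      (ℕₚ.≤-trans (ℕₚ.+-monoʳ-< (m * η) j<η) (ℕₚ.≤-trans (ℕₚ.≤-reflexive (ℕₚ.+-comm (m * η) η)) le))) (after-size d m)) h)

    after-ascending : ∀ d m → Ascending (after d m)
    after-ascending zero    m = []
    after-ascending (suc d) m = Allₚ.++⁺ (Allₚ.map⁺ (first ∷ All.map (λ {j} 0<j → key-< (fpart (suc m)) (newp (suc m) j) (ℕₚ.m<m+n (suc m * η) 0<j)) 0<rs))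
        (All.map (λ {q} le → key-< (fpart (suc m)) q (ℕₚ.≤-trans (ℕₚ.+-monoˡ-≤ (suc m * η) 1≤η) le)) (after-size d (suc m)))
      ∷ AllPairsₚ.++⁺ (col-ascending (suc m) (0 ∷ rs) rs₀-sorted) (after-ascending d (suc m)) (col-below d (suc m) (0 ∷ rs) rs₀<η)
      where
      first : key (fpart (suc m)) < key (newp (suc m) 0)
      first = ℕₚ.≤-reflexive (l (suc m * η))
        where
        l : ∀ n → suc (2 * n + 0) ≡ 2 * (n + 0) + 1
        l = ℕ-Solver.solve-∀

    spots-ascending : ∀ d → Ascending (spots d)
    spots-ascending d = AllPairsₚ.++⁺ (col-ascending 0 rs (AllPairs.tail rs₀-sorted)) (after-ascending d 0) (col-below d 0 rs rs<η)

    ∈after-f : ∀ d m i → i < d → fpart (suc (m + i)) ∈ after d m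
    ∈after-f (suc d) m zero    _       = here (cong (λ z → fpart (suc z)) (ℕₚ.+-identityʳ m))
    ∈after-f (suc d) m (suc i) (s≤s h) = there (∈-++⁺ʳ (map (newp (suc m)) (0 ∷ rs))
      (subst (λ z → fpart (suc z) ∈ after d (suc m)) (sym (ℕₚ.+-suc m i)) (∈after-f d (suc m) i h)))

    ∈after-new : ∀ d m i j → i < d → j ∈ 0 ∷ rs → newp (suc (m + i)) j ∈ after d m
    ∈after-new (suc d) m zero    j _       j∈ = there (∈-++⁺ˡ (subst (λ z → newp (suc z) j ∈ map (newp (suc m)) (0 ∷ rs)) (sym (ℕₚ.+-identityʳ m)) (∈-map⁺ (newp (suc m)) j∈)))
    ∈after-new (suc d) m (suc i) j (s≤s h) j∈ = there (∈-++⁺ʳ (map (newp (suc m)) (0 ∷ rs))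
      (subst (λ z → newp (suc z) j ∈ after d (suc m)) (sym (ℕₚ.+-suc m i)) (∈after-new d (suc m) i j h j∈)))

    ∈spots : ∀ d p → size p ≤ d → Fine p → p ∈ spots d
    ∈spots d (s , b) s≤d (1≤s , res , mlt) = subst (λ z → (z , b) ∈ spots d) (sym (div-mod s η 1≤η)) (go (s div η) (s mod η) b refl refl mlt)
      where
      q≤d : s div η ≤ d
      q≤d = ℕₚ.≤-trans (ℕₚ.≤-trans (ℕₚ.≤-reflexive (sym (ℕₚ.*-identityʳ (s div η)))) (ℕₚ.*-monoʳ-≤ (s div η) 1≤η))
        (ℕₚ.≤-trans (ℕₚ.m≤m+n _ (s mod η)) (ℕₚ.≤-trans (ℕₚ.≤-reflexive (sym (div-mod s η 1≤η))) s≤d))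
      j∈ : s mod η ∈ 0 ∷ rs
      j∈ with Equivalence.to (T-∨ {s mod η ≡ᵇ 0}) res
      ... | inj₁ z = here (ℕₚ.≡ᵇ⇒≡ (s mod η) 0 z)
      ... | inj₂ t = there (∈-filter⁺ (T? ∘ sel) (∈-upTo⁺ (mod-< s η 1≤η)) t)
      pos : ∀ m j → m ≡ s div η → j ≡ s mod η → 1 ≤ m * η + j
      pos m j refl refl = subst (1 ≤_) (div-mod s η 1≤η) 1≤s
      go : ∀ m j c → m ≡ s div η → j ≡ s mod η → T (c ∨ (s mod η ≡ᵇ 0)) → (m * η + j , c) ∈ spots d
      go zero    j true  e e′ _ = ∈-++⁺ˡ (∈-map⁺ (newp 0) (nonzero (subst (_∈ 0 ∷ rs) (sym e′) j∈) (pos 0 j e e′)))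
        where
        nonzero : ∀ {j} → j ∈ 0 ∷ rs → 1 ≤ j → j ∈ rs
        nonzero (there j∈) _ = j∈
        nonzero (here refl) ()
      go (suc m) j true  e e′ _ = ∈-++⁺ʳ (map (newp 0) rs) (∈after-new d 0 m j (subst (_≤ d) (sym e) q≤d) (subst (_∈ 0 ∷ rs) (sym e′) j∈))
      go m       j false e e′ z with refl ← trans e′ (ℕₚ.≡ᵇ⇒≡ (s mod η) 0 z) = plain m e (pos m 0 e e′)
        where
        plain : ∀ m → m ≡ s div η → 1 ≤ m * η + 0 → (m * η + 0 , false) ∈ spots d
        plain zero    _ ()
        plain (suc m) e _ = ∈-++⁺ʳ (map (newp 0) rs) (subst (λ z → (z , false) ∈ after d 0) (sym (ℕₚ.+-identityʳ (suc m * η)))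
          (∈after-f d 0 m (subst (_≤ d) (sym e) q≤d)))

    open Conditions η K′ ρ 1≤η ρ≤K using (B-prop⇔Good)

    count-B : ∀ N n d → n ≤ N → n ≤ d →
      + B̄₀ lam η α (suc K) (suc ρ) n ≡ coeff n (gen Good (configs N (spots d) []))
    count-B N n d n≤N n≤d = trans (cong +_ (count-configs P N n (spots d) n≤N (spots-ascending d) (All.map proj₁ (fine-spots d)) within))
      (trans (sym (coeff-gen P n πs)) (_≈_.at (gen-cong P Good πs (λ π π∈ → same π π∈)) δ (+ n)))
      where
      P : List Part → Bool
      P = B-prop lam η α (suc K) (suc ρ)
      πs : List (List Part)
      πs = configs N (spots d) []
      within : ∀ π → Sorted π → All (λ p → 1 ≤ size p × size p ≤ n) π → T (P π) → All (_∈ spots d) π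
      within π s sizes h with h₁ , h ← Equivalence.to (T-∧ {all (residueOK lam η α) π}) h
        with h₂ , _ ← Equivalence.to (T-∧ {all (λ p → ov p ∨ (size p mod η ≡ᵇ 0)) π}) h =
        All.zipWith (λ {p} ((1≤s , s≤n) , r , m) → ∈spots d p (ℕₚ.≤-trans s≤n n≤d) (1≤s , r , m))
          (sizes , All.zip (all⁻ (residueOK lam η α) π h₁ , all⁻ (λ p → ov p ∨ (size p mod η ≡ᵇ 0)) π h₂))
      same : ∀ π → π ∈ πs → P π ≡ Good π
      same π π∈ = B-prop⇔Good lam α π (configs-sorted N (spots d) [] (spots-ascending d) (All.map (λ _ → []) (fine-spots d)) [] π∈)
          (All.map proj₁ fine) (All.map (proj₁ ∘ proj₂) fine) (All.map (proj₂ ∘ proj₂) fine)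
        where
        fine : All Fine π
        fine with X , refl , all ← configs-suffix N (spots d) [] π∈ = Allₚ.++⁺ (All.map (All.lookup (fine-spots d)) all) []

-- Products over part sizes

ind : (Part → Bool) → List Part → Laurent
ind f π = if all f π then mon (+ weight π) else 𝟎

ind-++ : ∀ f π ρ → ind f (π ++ ρ) ≈ ind f π ⊗ ind f ρ
ind-++ f []      ρ = ≈-sym (≈-trans (⊗-cong mon-0 ≈-refl) (⊗-identityˡ _))
ind-++ f (p ∷ π) ρ with f p
... | false = ≈-sym (⊗-zeroˡ _)
... | true with all f π | all f (π ++ ρ) | ind-++ f π ρ
...   | false | false | _ = ≈-sym (⊗-zeroˡ _)
...   | false | true  | e = ≈-trans (mon-+ (+ size p) (+ weight (π ++ ρ))) (≈-trans (⊗-cong ≈-refl (≈-trans e (⊗-zeroˡ _))) (≈-trans (⊗-zeroʳ _) (≈-sym (⊗-zeroˡ _))))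
...   | true  | false | e = ≈-sym (≈-trans (⊗-cong (mon-+ (+ size p) (+ weight π)) ≈-refl) (≈-trans (⊗-assoc _ _ _) (≈-trans (⊗-cong ≈-refl (≈-sym e)) (⊗-zeroʳ _))))
...   | true  | true  | e = ≈-trans (mon-+ (+ size p) (+ weight (π ++ ρ))) (≈-trans (⊗-cong ≈-refl e) (≈-trans (≈-sym (⊗-assoc _ _ _)) (⊗-cong (≈-sym (mon-+ (+ size p) (+ weight π))) ≈-refl)))

fac : (Part → Bool) → ℕ → Part → Laurent
fac f N p = ∑ (suc (cap N p)) (λ i → ind f (replicate i p))

gen-all : ∀ f N ps acc → gen (all f) (configs N ps acc) ≈ ind f acc ⊗ ∏ₗ ps (fac f N)
gen-all f N []       acc = ≈-trans (⊕-identityʳ _) (≈-sym (⊗-identityʳ _))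
gen-all f N (p ∷ ps) acc = ≈-trans (gen-concatMap (λ i → configs N ps (replicate i p ++ acc)) (suc (cap N p)))
  (≈-trans (∑-cong (suc (cap N p)) (λ i _ → ≈-trans (gen-all f N ps (replicate i p ++ acc))
      (≈-trans (⊗-cong (ind-++ f (replicate i p) acc) ≈-refl) (l _ _ _))))
    (≈-trans (≈-sym (∑-⊗ (suc (cap N p)) (ind f acc ⊗ ∏ₗ ps (fac f N)) _)) (l′ _ _ _)))
  where
  l : ∀ a b c → a ⊗ b ⊗ c ≈ (b ⊗ c) ⊗ a
  l = Solver.solve-∀ laurentRing
  l′ : ∀ b c a → (b ⊗ c) ⊗ a ≈ b ⊗ (a ⊗ c)
  l′ = Solver.solve-∀ laurentRing

SP : ℕ → (ℕ → Laurent) → Laurent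
SP S g = ∏ S (λ s → g (suc s))

∏ₗ-++ : ∀ {A : Set} (xs ys : List A) g → ∏ₗ (xs ++ ys) g ≈ ∏ₗ xs g ⊗ ∏ₗ ys g
∏ₗ-++ []       ys g = ≈-sym (⊗-identityˡ _)
∏ₗ-++ (x ∷ xs) ys g = ≈-trans (⊗-cong ≈-refl (∏ₗ-++ xs ys g)) (≈-sym (⊗-assoc _ _ _))

∏ₗ-concatMap : ∀ {A B : Set} (f : A → List B) (g : B → Laurent) (h : ℕ → A) n →
  ∏ₗ (concatMap f (applyUpTo h n)) g ≈ ∏ n (λ i → ∏ₗ (f (h i)) g)
∏ₗ-concatMap f g h zero    = ≈-refl
∏ₗ-concatMap f g h (suc n) = ≈-trans (∏ₗ-++ (f (h 0)) _ g) (≈-trans (⊗-cong ≈-refl (∏ₗ-concatMap f g (λ i → h (suc i)) n))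
  (≈-sym (∏-front n (λ i → ∏ₗ (f (h i)) g))))

∏ₗ-alphabet : ∀ S g → ∏ₗ (alphabet S) g ≈ SP S (λ s → g (s , false) ⊗ g (s , true))
∏ₗ-alphabet S g = ≈-trans (∏ₗ-concatMap (λ m → (suc m , false) ∷ (suc m , true) ∷ []) g (λ i → i) S)
  (∏-cong S (λ s _ → ⊗-cong ≈-refl (⊗-identityʳ _)))

alphabet-ascending : ∀ n → Ascending (alphabet n)
alphabet-ascending n = go n (λ i → i) (λ i<j → i<j)
  where
  Block : ℕ → List Part
  Block m = (suc m , false) ∷ (suc m , true) ∷ []
  below : ∀ h n m → (∀ i → m < h i) → All (λ q → key (suc m , true) < key q) (concatMap Block (applyUpTo h n))
  below h zero    m lt = []
  below h (suc n) m lt = key-< (suc m , true) (suc (h 0) , false) (s≤s (lt 0)) ∷ key-< (suc m , true) (suc (h 0) , true) (s≤s (lt 0))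
    ∷ below (λ i → h (suc i)) n m (λ i → lt (suc i))
  pair : ∀ m → key (suc m , false) < key (suc m , true)
  pair m = ℕₚ.+-monoʳ-< (2 * suc m) (s≤s z≤n)
  go : ∀ n h → (∀ {i j} → i < j → h i < h j) → Ascending (concatMap Block (applyUpTo h n))
  go zero    h mono = []
  go (suc n) h mono = (pair (h 0) ∷ All.map (λ lt → ℕₚ.<-trans (pair (h 0)) lt) b) ∷ b ∷ go n (λ i → h (suc i)) (λ i<j → mono (s≤s i<j))
    where
    b : All (λ q → key (suc (h 0) , true) < key q) (concatMap Block (applyUpTo (λ i → h (suc i)) n))
    b = below (λ i → h (suc i)) n (h 0) (λ i → mono (s≤s z≤n))

alphabet-sizes : ∀ n → All (λ p → 1 ≤ size p) (alphabet n)
alphabet-sizes n = All.tabulate (λ p∈ → let m , _ , p∈m = find (∈-concatMap⁻ (λ m → (suc m , false) ∷ (suc m , true) ∷ []) {xs = upTo n} p∈) in go p∈m)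
  where
  go : ∀ {m p} → p ∈ ((suc m , false) ∷ (suc m , true) ∷ []) → 1 ≤ size p
  go (here refl)         = s≤s z≤n
  go (there (here refl)) = s≤s z≤n

count-all : ∀ f N n S → n ≤ N → n ≤ S →
  + countOverpartitions (all f) n ≡ coeff n (SP S (λ s → fac f N (s , false) ⊗ fac f N (s , true)))
count-all f N n S n≤N n≤S = trans
  (cong +_ (count-configs (all f) N n (alphabet S) n≤N (alphabet-ascending S) (alphabet-sizes S)
    (λ π _ sizes _ → All.map (λ {p} (1≤s , s≤n) → ∈-alphabet p 1≤s (ℕₚ.≤-trans s≤n n≤S)) sizes)))
  (trans (sym (coeff-gen (all f) n (configs N (alphabet S) [])))
    (_≈_.at (≈-trans (gen-all f N (alphabet S) []) (≈-trans (⊗-cong mon-0 ≈-refl) (≈-trans (⊗-identityˡ _) (∏ₗ-alphabet S (fac f N))))) δ (+ n)))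

pl mi : Bool → ℕ → Laurent
pl b s = if b then one+mon (+ s) else 𝟏
mi b s = if b then one-mon (+ s) else 𝟏

geo : ℕ → ℕ → Laurent
geo n s = ∑ n (λ i → mon (+ (i * s)))

geo-sum : ∀ n s → one-mon (+ s) ⊗ geo n s ≈ one-mon (+ (n * s))
geo-sum zero    s = ≈-trans (⊗-zeroʳ _) (≈-sym (≈-trans (⊕-cong ≈-refl (⊖-cong mon-0)) (⊖-inverseʳ 𝟏)))
geo-sum (suc n) s = ≈-trans (⊗-distribˡ (one-mon (+ s)) _ _) (≈-trans (⊕-cong (geo-sum n s) ≈-refl) (≈-trans (l (mon (+ (n * s))) (mon (+ s)))
  (⊕-cong ≈-refl (⊖-cong (≈-sym (mon-+ (+ s) (+ (n * s))))))))
  where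
  l : ∀ a b → (𝟏 ⊕ ⊖ a) ⊕ (𝟏 ⊕ ⊖ b) ⊗ a ≈ 𝟏 ⊕ ⊖ (b ⊗ a)
  l = Solver.solve-∀ laurentRing

geo-≃ : ∀ L N s → L ≤ N → 1 ≤ s → one-mon (+ s) ⊗ geo (suc N) s ≃[ + L ] 𝟏
geo-≃ L N s L≤N 1≤s = ≃-trans (≈⇒≃ (geo-sum (suc N) s)) (one-mon-≃𝟏 (suc N * s)
  (ℕₚ.≤-trans L≤N (ℕₚ.≤-trans (ℕₚ.n≤1+n N) (ℕₚ.≤-trans (ℕₚ.≤-reflexive (sym (ℕₚ.*-identityʳ (suc N)))) (ℕₚ.*-monoʳ-≤ (suc N) 1≤s)))))

fac-ov : ∀ f N s → fac f N (s , true) ≈ pl (f (s , true)) s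
fac-ov f N s with f (s , true)
... | true  = ⊕-cong (≈-trans (⊕-identityˡ _) mon-0) (mon-≡ (cong +_ (ℕₚ.+-identityʳ s)))
... | false = ≈-trans (⊕-identityʳ _) (≈-trans (⊕-identityˡ _) mon-0)

all-replicate : ∀ (f : Part → Bool) p i → f p ≡ true → all f (replicate i p) ≡ true
all-replicate f p zero    e = refl
all-replicate f p (suc i) e rewrite e = all-replicate f p i e

fac-plain : ∀ f N s → fac f N (s , false) ≈ (if f (s , false) then geo (suc N) s else 𝟏)
fac-plain f N s with f (s , false) in eq
... | true  = ∑-cong (suc N) (λ i _ → ≈-trans (≈-reflexive (cong (λ b → if b then mon (+ weight (replicate i (s , false))) else 𝟎) (all-replicate f (s , false) i eq)))
                (mon-≡ (cong +_ (weight-replicate i (s , false)))))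
... | false = ≈-trans (∑-front N _) (≈-trans (⊕-cong mon-0 (∑-zero N (λ i _ → ≈-reflexive (cong (λ b → if b ∧ all f (replicate i (s , false)) then mon (+ weight (replicate (suc i) (s , false))) else 𝟎) eq)))) (⊕-identityʳ 𝟏))

ord-geo : ∀ n s → Ord 0ℤ (geo n s)
ord-geo n s = ord-∑ n (λ i _ → ord-mon₀ (i * s))

ord-if : ∀ b {p} → Ord 0ℤ p → Ord 0ℤ (if b then p else 𝟏)
ord-if true  o = o
ord-if false o = ord-con 1ℤ

ord-pl : ∀ b s → Ord 0ℤ (pl b s)
ord-pl b s = ord-if b (ord-one+mon s)

ord-mi : ∀ b s → Ord 0ℤ (mi b s)
ord-mi b s = ord-if b (ord-one-mon s)

SP-≃ : ∀ {J} S {g h} → (∀ s → Ord 0ℤ (g s)) → (∀ s → Ord 0ℤ (h s)) → (∀ s → 1 ≤ s → g s ≃[ J ] h s) → SP S g ≃[ J ] SP S h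
SP-≃ S o o′ e = ∏-≃ S (λ i _ → o (suc i)) (λ i _ → o′ (suc i)) (λ i _ → e (suc i) (s≤s z≤n))

SP-⊗ : ∀ S g h → SP S (λ s → g s ⊗ h s) ≈ SP S g ⊗ SP S h
SP-⊗ S g h = ∏-⊗ S (λ s → g (suc s)) (λ s → h (suc s))

SP-cong : ∀ S {g h} → (∀ s → 1 ≤ s → g s ≈ h s) → SP S g ≈ SP S h
SP-cong S e = ∏-cong S (λ i _ → e (suc i) (s≤s z≤n))

ord-SP : ∀ S {g} → (∀ s → Ord 0ℤ (g s)) → Ord 0ℤ (SP S g)
ord-SP S o = ord-∏ S (λ i → o (suc i))

∏-blocks : ∀ R b g → ∏ (R * b) g ≈ ∏ R (λ m → ∏ b (λ j → g (m * b + j)))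
∏-blocks zero    b g = ≈-refl
∏-blocks (suc R) b g = ≈-trans (≈-reflexive (cong (λ z → ∏ z g) (ℕₚ.+-comm b (R * b)))) (≈-trans (∏-split (R * b) b g) (⊗-cong (∏-blocks R b g) ≈-refl))

∏-select : ∀ b t (g : ℕ → Laurent) → t < b → ∏ b (λ j → if j ≡ᵇ t then g j else 𝟏) ≈ g t
∏-select (suc b) zero    g _       = ≈-trans (∏-front b _) (≈-trans (⊗-cong ≈-refl (∏-𝟏 b)) (⊗-identityʳ _))
∏-select (suc b) (suc t) g (s≤s h) = ≈-trans (∏-front b _) (≈-trans (⊗-identityˡ _) (∏-select b t (λ j → g (suc j)) h))

∏-filter : ∀ b (c : ℕ → Bool) (g : ℕ → Laurent) → ∏ b (λ j → if c j then g j else 𝟏) ≈ ∏ₗ (filterᵇ c (upTo b)) g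
∏-filter b c g = go b (λ j → j)
  where
  go : ∀ b h → ∏ b (λ j → if c (h j) then g (h j) else 𝟏) ≈ ∏ₗ (filterᵇ c (applyUpTo h b)) g
  go zero    h = ≈-refl
  go (suc b) h with go b (λ j → h (suc j)) | ∏-front b (λ j → if c (h j) then g (h j) else 𝟏)
  ... | e | f with c (h 0)
  ...   | true  = ≈-trans f (⊗-cong ≈-refl e)
  ...   | false = ≈-trans f (≈-trans (⊗-identityˡ _) e)

module Truncated (L : ℕ) (F : ℕ → Laurent) (ord-F : ∀ s → Ord 0ℤ (F s)) (F-≃ : ∀ s → L ≤ s → F s ≃[ + L ] 𝟏) where

  -- Index 0 is added to obtain full blocks of b consecutive sizes. In the applications F 0 is 0 or
  -- 2, hence the neutral value.
  F̃ : ℕ → Laurent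
  F̃ zero    = 𝟏
  F̃ (suc s) = F (suc s)

  select : (ℕ → Bool) → ℕ → Laurent
  select c s = if c s then F s else 𝟏

  ord-select : ∀ c s → Ord 0ℤ (select c s)
  ord-select c s = ord-if (c s) (ord-F s)

  trunc : ∀ S c → L ≤ S → SP S (select c) ≃[ + L ] SP L (select c)
  trunc S c L≤S = subst (λ z → SP z (select c) ≃[ + L ] SP L (select c)) (ℕₚ.m+[n∸m]≡n L≤S)
    (≃-trans (≈⇒≃ (∏-split L (S ∸ L) _)) (≃-trans (≃-⊗ʳ (ord-SP L (ord-select c))
      (∏-≃𝟏 (S ∸ L) (λ i _ → ord-select c (suc (L + i))) (λ i _ → one (suc (L + i)) (ℕₚ.m≤n⇒m≤1+n (ℕₚ.m≤m+n L i)))))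
      (≈⇒≃ (⊗-identityʳ _))))
    where
    one : ∀ s → L ≤ s → select c s ≃[ + L ] 𝟏
    one s le with c s
    ... | true  = F-≃ s le
    ... | false = ≃-refl

  by-residue : ∀ S b (c : ℕ → Bool) → L ≤ S → 1 ≤ b →
    SP S (select (λ s → c (s mod b))) ≃[ + L ] ∏ (suc L) (λ m → ∏ b (λ j → if c j then F̃ (m * b + j) else 𝟏))
  by-residue S (suc b) c L≤S 1≤b = ≃-trans (trunc S c′ L≤S) (≃-trans (≃-sym (trunc S′ c′ L≤S′)) (≈⇒≃
    (≈-trans (≈-sym (≈-trans (∏-front S′ g̃) (⊗-identityˡ _))) (≈-trans (∏-blocks (suc L) (suc b) g̃)
      (∏-cong (suc L) (λ m _ → ∏-cong (suc b) (λ j j< → entry m j j<)))))))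
    where
    c′ : ℕ → Bool
    c′ s = c (s mod suc b)
    S′ : ℕ
    S′ = b + L * suc b
    L≤S′ : L ≤ S′
    L≤S′ = ℕₚ.≤-trans (ℕₚ.≤-trans (ℕₚ.≤-reflexive (sym (ℕₚ.*-identityʳ L))) (ℕₚ.*-monoʳ-≤ L 1≤b)) (ℕₚ.m≤n+m (L * suc b) b)
    g̃ : ℕ → Laurent
    g̃ zero    = 𝟏
    g̃ (suc s) = select c′ (suc s)
    g̃-eq : ∀ s → g̃ s ≈ (if c′ s then F̃ s else 𝟏)
    g̃-eq (suc s) = ≈-refl
    g̃-eq zero with c′ 0
    ... | true  = ≈-refl
    ... | false = ≈-refl
    entry : ∀ m j → j < suc b → g̃ (m * suc b + j) ≈ (if c j then F̃ (m * suc b + j) else 𝟏)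
    entry m j j< = ≈-trans (g̃-eq (m * suc b + j)) (≈-reflexive (cong (λ z → if c z then F̃ (m * suc b + j) else 𝟏) (mod-unique m j< refl)))

  F̃-pos : ∀ s → 1 ≤ s → F̃ s ≈ F s
  F̃-pos (suc s) _ = ≈-refl

  residue₀ : ∀ S b → L ≤ S → 1 ≤ b → SP S (select (λ s → s mod b ≡ᵇ 0)) ≃[ + L ] ∏ L (λ m → F (suc m * b))
  residue₀ S b L≤S 1≤b = ≃-trans (by-residue S b (_≡ᵇ 0) L≤S 1≤b) (≈⇒≃
    (≈-trans (∏-cong (suc L) (λ m _ → ∏-select b 0 (λ j → F̃ (m * b + j)) 1≤b))
      (≈-trans (∏-front L _) (≈-trans (⊗-identityˡ _) (∏-cong L (λ m _ →
        ≈-trans (≈-reflexive (cong F̃ (ℕₚ.+-identityʳ (suc m * b)))) (F̃-pos (suc m * b) (ℕₚ.≤-trans 1≤b (ℕₚ.m≤m+n b _)))))))))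

  residue : ∀ S b t → L ≤ S → 1 ≤ t → t < b → SP S (select (λ s → s mod b ≡ᵇ t)) ≃[ + L ] ∏ L (λ m → F (m * b + t))
  residue S b t L≤S 1≤t t<b = ≃-trans (by-residue S b (_≡ᵇ t) L≤S 1≤b) (≃-trans (≈⇒≃
    (∏-cong (suc L) (λ m _ → ≈-trans (∏-select b t (λ j → F̃ (m * b + j)) t<b) (F̃-pos (m * b + t) (ℕₚ.≤-trans 1≤t (ℕₚ.m≤n+m t (m * b)))))))
    (≃-trans (≃-⊗ʳ (ord-∏ L (λ m → ord-F (m * b + t))) (F-≃ (L * b + t) big)) (≈⇒≃ (⊗-identityʳ _))))
    where
    1≤b : 1 ≤ b
    1≤b = ℕₚ.≤-trans 1≤t (ℕₚ.<⇒≤ t<b)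
    big : L ≤ L * b + t
    big = ℕₚ.≤-trans (ℕₚ.≤-reflexive (sym (ℕₚ.*-identityʳ L))) (ℕₚ.≤-trans (ℕₚ.*-monoʳ-≤ L 1≤b) (ℕₚ.m≤m+n (L * b) t))

  residues : ∀ S b (c : ℕ → Bool) → L ≤ S → 1 ≤ b → ¬ T (c 0) →
    SP S (select (λ s → c (s mod b))) ≃[ + L ] ∏ (suc L) (λ m → ∏ₗ (filterᵇ c (upTo b)) (λ j → F (m * b + j)))
  residues S b c L≤S 1≤b c0 = ≃-trans (by-residue S b c L≤S 1≤b) (≈⇒≃ (∏-cong (suc L) (λ m _ →
    ≈-trans (∏-cong b (λ j _ → entry m j)) (∏-filter b c (λ j → F (m * b + j))))))
    where
    entry : ∀ m j → (if c j then F̃ (m * b + j) else 𝟏) ≈ (if c j then F (m * b + j) else 𝟏)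
    entry m zero    with c 0
    ... | true  = contradiction tt c0
    ... | false = ≈-refl
    entry m (suc j) with c (suc j)
    ... | true  = F̃-pos (m * b + suc j) (ℕₚ.≤-trans (s≤s z≤n) (ℕₚ.m≤n+m (suc j) (m * b)))
    ... | false = ≈-refl

one+mon-≃𝟏 : ∀ {J} n → J ≤ n → one+mon (+ n) ≃[ + J ] 𝟏
one+mon-≃𝟏 n le = ≃-trans (≃-⊕ ≃-refl (≃𝟎 (ord-weaken (ℤ.+≤+ le) ord-mon))) (≈⇒≃ (⊕-identityʳ 𝟏))

≡ᵇ-true : ∀ {m n} → m ≡ n → (m ≡ᵇ n) ≡ true
≡ᵇ-true {m} {n} e = Equivalence.to T-≡ (ℕₚ.≡⇒≡ᵇ m n e)

≡ᵇ-false : ∀ {m n} → m ≢ n → (m ≡ᵇ n) ≡ false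
≡ᵇ-false {m} {n} ne with m ≡ᵇ n in eq
... | false = refl
... | true  = contradiction (ℕₚ.≡ᵇ⇒≡ m n (subst T (sym eq) tt)) ne

module _ {L : ℕ} where

  open Truncated L (λ s → one-mon (+ s)) ord-one-mon (λ s → one-mon-≃𝟏 s) public
    using () renaming (residue₀ to residue₀-mi; residue to residue-mi)
  open Truncated L (λ s → one+mon (+ s)) ord-one+mon (λ s → one+mon-≃𝟏 s) public
    using () renaming (residue₀ to residue₀-pl; residues to residues-pl)

pl-∨ : ∀ x y s → ¬ (T x × T y) → pl (x ∨ y) s ≈ pl x s ⊗ pl y s
pl-∨ true  true  s h = contradiction (tt , tt) h
pl-∨ true  false s h = ≈-sym (⊗-identityʳ _)
pl-∨ false y     s h = ≈-sym (⊗-identityˡ _)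

mi-∨ : ∀ x y s → ¬ (T x × T y) → mi (x ∨ y) s ≈ mi x s ⊗ mi y s
mi-∨ true  true  s h = contradiction (tt , tt) h
mi-∨ true  false s h = ≈-sym (⊗-identityʳ _)
mi-∨ false y     s h = ≈-sym (⊗-identityˡ _)

-- Comparison of the two generating functions, size by size

module Compare (lam η : ℕ) (α : Fin lam → ℕ) (1≤η : 1 ≤ η) (0<α : ∀ i → 0 < α i)
  (α-mono : ∀ i j → i <ᶠ j → α i < α j) (α<η : ∀ i → α i < η) (α-sym : ∀ i → α i ≡ η ∸ α (opposite i))
  (K′ ρ M a : ℕ) (lam<K : suc lam ≤ suc K′) (ρ≤K : ρ ≤ suc K′) (lam≤ : lam ≤ suc ρ)
  (M+lam : M + lam ≡ suc K′ + suc (suc K′))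
  (a+σ : a + Residues.σ lam η α 1≤η 0<α α-mono α<η α-sym ≡ suc ρ * η) (1≤a : 1 ≤ a) (a<N : a < η * M) (N≢2a : η * M ≢ a + a)
  where

  open Residues lam η α 1≤η 0<α α-mono α<η α-sym
  open Spots K′ ρ ρ≤K
  open Evaluate η K lam M σ ρ a rs M+lam len-rs refl reflect 1≤η lam<K 2σ a+σ ρ≤K lam≤ 1≤a a<N hiding (N)
  open Generate η K lam M σ ρ rs M+lam len-rs refl reflect 1≤η lam<K ρ≤K rs₀-sorted rs₀<η using (generate)

  N₀ : ℕ
  N₀ = η * M

  fb resid z : ℕ → Bool
  fb s    = (s mod N₀ ≡ᵇ 0) ∨ (s mod N₀ ≡ᵇ a) ∨ (s mod N₀ ≡ᵇ N₀ ∸ a)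
  z s     = s mod η ≡ᵇ 0
  resid s = z s ∨ sel (s mod η)

  1≤N₀ : 1 ≤ N₀
  1≤N₀ = ℕₚ.≤-trans 1≤a (ℕₚ.<⇒≤ a<N)

  N∸a+a : N₀ ∸ a + a ≡ N₀
  N∸a+a = ℕₚ.m∸n+n≡m (ℕₚ.<⇒≤ a<N)

  forbidden≡fb : ∀ s → forbidden N₀ s a ≡ fb s
  forbidden≡fb s = cong₂ (λ x y → (s mod N₀ ≡ᵇ 0) ∨ x ∨ y) (cong (s mod N₀ ≡ᵇ_) (mod-unique 0 a<N refl)) third
    where
    u q : ℕ
    u = s mod N₀
    q = s div N₀
    s≡ : s ≡ q * N₀ + u
    s≡ = div-mod s N₀ 1≤N₀
    third : ((s + a) mod N₀ ≡ᵇ 0) ≡ (s mod N₀ ≡ᵇ N₀ ∸ a)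
    third with ℕₚ.<-cmp (u + a) N₀
    ... | tri< lt _ _ = trans (≡ᵇ-false (λ e → ℕₚ.<⇒≢ (ℕₚ.≤-trans 1≤a (ℕₚ.m≤n+m a u)) (sym (trans (sym m≡) e))))
        (sym (≡ᵇ-false (λ e → ℕₚ.<⇒≢ lt (trans (cong (_+ a) e) N∸a+a))))
      where
      m≡ : (s + a) mod N₀ ≡ u + a
      m≡ = mod-unique q lt (trans (cong (_+ a) s≡) (ℕₚ.+-assoc (q * N₀) u a))
    ... | tri≈ _ e _ = trans (≡ᵇ-true (mod-unique (suc q) 1≤N₀ (trans (cong (_+ a) s≡) (trans (ℕₚ.+-assoc (q * N₀) u a)
          (trans (cong (λ y → q * N₀ + y) e) (trans (ℕₚ.+-comm (q * N₀) N₀) (sym (ℕₚ.+-identityʳ _))))))))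
        (sym (≡ᵇ-true (ℕₚ.+-cancelʳ-≡ a u (N₀ ∸ a) (trans e (sym N∸a+a)))))
    ... | tri> _ _ gt = trans (≡ᵇ-false (λ e → ℕₚ.<⇒≢ (ℕₚ.m<n⇒0<n∸m gt) (sym (trans (sym m≡) e))))
        (sym (≡ᵇ-false (λ e → ℕₚ.<⇒≢ gt (sym (trans (cong (_+ a) e) N∸a+a)))))
      where
      v<N : u + a ∸ N₀ < N₀
      v<N = ℕₚ.+-cancelʳ-< N₀ (u + a ∸ N₀) N₀ (subst (_< N₀ + N₀) (sym (ℕₚ.m∸n+n≡m (ℕₚ.<⇒≤ gt))) (ℕₚ.+-mono-< (mod-< s N₀ 1≤N₀) a<N))
      m≡ : (s + a) mod N₀ ≡ u + a ∸ N₀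
      m≡ = mod-unique (suc q) v<N (trans (cong (_+ a) s≡) (trans (ℕₚ.+-assoc (q * N₀) u a)
        (trans (cong (λ y → q * N₀ + y) (sym (ℕₚ.m+[n∸m]≡n (ℕₚ.<⇒≤ gt)))) (l (q * N₀) N₀ (u + a ∸ N₀)))))
        where
        l : ∀ a b c → a + (b + c) ≡ b + a + c
        l = ℕ-Solver.solve-∀

  fb⁻ : ∀ s → T (fb s) → s mod N₀ ≡ 0 ⊎ s mod N₀ ≡ a ⊎ s mod N₀ ≡ N₀ ∸ a
  fb⁻ s t with Equivalence.to (T-∨ {s mod N₀ ≡ᵇ 0}) t
  ... | inj₁ e = inj₁ (ℕₚ.≡ᵇ⇒≡ (s mod N₀) 0 e)
  ... | inj₂ t′ with Equivalence.to (T-∨ {s mod N₀ ≡ᵇ a}) t′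
  ...   | inj₁ e = inj₂ (inj₁ (ℕₚ.≡ᵇ⇒≡ (s mod N₀) a e))
  ...   | inj₂ e = inj₂ (inj₂ (ℕₚ.≡ᵇ⇒≡ (s mod N₀) (N₀ ∸ a) e))

  module _ (L′ : ℕ) where

    L : ℕ
    L = suc L′

    D-SP : ∀ S → L ≤ S → D L ≃[ + L ] SP S (λ s → mi (z s) s)
    D-SP S L≤S = ≃-trans (≈⇒≃ (∏-cong L (λ i _ → ⊕-cong ≈-refl (⊖-cong (Qℕ (suc i)))))) (≃-sym (residue₀-mi S η L≤S 1≤η))

    resid-SP : ∀ S → L ≤ S → P 0 L ⊗ ∏ (suc L) φ ≃[ + L ] SP S (λ s → pl (resid s) s)
    resid-SP S L≤S = ≃-sym (≃-trans (≈⇒≃ (≈-trans (SP-cong S (λ s _ → pl-∨ (z s) (sel (s mod η)) s (exclusive s))) (SP-⊗ S (λ s → pl (z s) s) (λ s → pl (sel (s mod η)) s))))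
      (≃-⊗ (ord-SP S (λ s → ord-pl (z s) s)) (ord-∏ (suc L) ord-φ)
        (≃-trans (residue₀-pl S η L≤S 1≤η) (≈⇒≃ (∏-cong L (λ i _ → ⊕-cong ≈-refl (≈-sym (Qℕ (suc i)))))))
        (≃-trans (residues-pl S η sel L≤S 1≤η sel0) (≈⇒≃ (∏-cong (suc L) (λ m _ → ∏ₗ-cong rs (λ j → ⊕-cong ≈-refl (mon-≡ (cong +_ (ℕₚ.+-comm (m * η) j))))))))))
      where
      sel0 : ¬ T (sel 0)
      sel0 t with i , e ← sel⁻ 0 t = ℕₚ.<⇒≢ (0<α i) e
      exclusive : ∀ s → ¬ (T (z s) × T (sel (s mod η)))
      exclusive s (x , y) = sel0 (subst (T ∘ sel) (ℕₚ.≡ᵇ⇒≡ (s mod η) 0 x) y)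

    module TP = At L

    -- The classes 0, a and -a modulo N₀ are disjoint because 0 < a < N₀ and N₀ ≠ 2 a, so the
    -- product over the forbidden sizes splits into the three factors of the triple product.
    fb-SP : ∀ S → L ≤ S → poch L ⊗ (TP.T₂ ⊗ TP.T₁) ≃[ + L ] SP S (λ s → mi (fb s) s)
    fb-SP S L≤S = ≃-sym (≃-trans (≈⇒≃ (≈-trans (SP-cong S (λ s _ → three s))
        (≈-trans (SP-⊗ S m₀ (λ s → m₂ s ⊗ m₁ s)) (⊗-cong ≈-refl (SP-⊗ S m₂ m₁)))))
      (≃-⊗ (ord-SP S o₀) (ord-⊗ˡ ord-T₂ ord-T₁) (≃-trans (residue₀-mi S N₀ L≤S 1≤N₀) (≈⇒≃ (∏-cong L (λ i _ → ≈-sym (one-pw (suc i))))))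
        (≃-⊗ (ord-SP S o₂) ord-T₁
          (≃-trans (residue-mi S N₀ (N₀ ∸ a) L≤S (ℕₚ.m<n⇒0<n∸m a<N) N∸a<N) (≈⇒≃ (≈-sym T₂-eq)))
          (≃-trans (residue-mi S N₀ a L≤S 1≤a a<N) (≈⇒≃ (≈-sym T₁-eq))))))
      where
      m₀ m₁ m₂ : ℕ → Laurent
      m₀ s = mi (s mod N₀ ≡ᵇ 0) s
      m₁ s = mi (s mod N₀ ≡ᵇ a) s
      m₂ s = mi (s mod N₀ ≡ᵇ N₀ ∸ a) s
      o₀ : ∀ s → Ord 0ℤ (m₀ s)
      o₀ s = ord-mi (s mod N₀ ≡ᵇ 0) s
      o₂ : ∀ s → Ord 0ℤ (m₂ s)
      o₂ s = ord-mi (s mod N₀ ≡ᵇ N₀ ∸ a) s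
      N∸a<N : N₀ ∸ a < N₀
      N∸a<N = ℕₚ.∸-monoʳ-< 1≤a (ℕₚ.<⇒≤ a<N)
      T₁-eq : TP.T₁ ≈ ∏ L (λ m → one-mon (+ (m * N₀ + a)))
      T₁-eq = ∏-cong L (λ m _ → ⊕-cong ≈-refl (⊖-cong (mon-≡ (cong +_ (ℕₚ.+-comm a (m * N₀))))))
      T₂-eq : TP.T₂ ≈ ∏ L (λ m → one-mon (+ (m * N₀ + (N₀ ∸ a))))
      T₂-eq = ∏-cong L (λ m _ → ⊕-cong ≈-refl (⊖-cong (mon-≡ (e m))))
        where
        e : ∀ m → + suc m ℤ.* + N₀ ℤ.- + a ≡ + (m * N₀ + (N₀ ∸ a))
        e m = trans (cong (ℤ._- + a) (trans (sym (ℤₚ.pos-* (suc m) N₀)) (cong +_ (trans (cong (_+ m * N₀) (sym N∸a+a)) (l (N₀ ∸ a) a (m * N₀))))))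
            (l′ (+ (m * N₀ + (N₀ ∸ a))) (+ a))
          where
          l : ∀ x y w → x + y + w ≡ w + x + y
          l = ℕ-Solver.solve-∀
          l′ : ∀ x y → x ℤ.+ y ℤ.- y ≡ x
          l′ = ℤ-Solver.solve-∀
      ord-T₁ : Ord 0ℤ TP.T₁
      ord-T₁ = ord-∏ L (λ i → ord-one-mon (a + i * N₀))
      ord-T₂ : Ord 0ℤ TP.T₂
      ord-T₂ = ord-≈ (≈-sym T₂-eq) (ord-∏ L (λ m → ord-one-mon (m * N₀ + (N₀ ∸ a))))
      a≢ : a ≢ N₀ ∸ a
      a≢ e = N≢2a (trans (sym N∸a+a) (cong (_+ a) (sym e)))
      three : ∀ s → mi (fb s) s ≈ m₀ s ⊗ (m₂ s ⊗ m₁ s)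
      three s = ≈-trans (mi-∨ (u ≡ᵇ 0) ((u ≡ᵇ a) ∨ (u ≡ᵇ N₀ ∸ a)) s ex₁) (⊗-cong ≈-refl (≈-trans (mi-∨ (u ≡ᵇ a) (u ≡ᵇ N₀ ∸ a) s ex₂) (⊗-comm _ _)))
        where
        u : ℕ
        u = s mod N₀
        ex₁ : ¬ (T (u ≡ᵇ 0) × T ((u ≡ᵇ a) ∨ (u ≡ᵇ N₀ ∸ a)))
        ex₁ (x , y) with Equivalence.to (T-∨ {u ≡ᵇ a}) y
        ... | inj₁ w = ℕₚ.<⇒≢ 1≤a (trans (sym (ℕₚ.≡ᵇ⇒≡ u 0 x)) (ℕₚ.≡ᵇ⇒≡ u a w))
        ... | inj₂ w = ℕₚ.<⇒≢ (ℕₚ.m<n⇒0<n∸m a<N) (trans (sym (ℕₚ.≡ᵇ⇒≡ u 0 x)) (ℕₚ.≡ᵇ⇒≡ u (N₀ ∸ a) w))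
        ex₂ : ¬ (T (u ≡ᵇ a) × T (u ≡ᵇ N₀ ∸ a))
        ex₂ (x , y) = a≢ (trans (sym (ℕₚ.≡ᵇ⇒≡ u a x)) (ℕₚ.≡ᵇ⇒≡ u (N₀ ∸ a) y))

  sizeFactor : ℕ → (Part → Bool) → ℕ → Laurent
  sizeFactor N f s = (if f (s , false) then geo (suc N) s else 𝟏) ⊗ pl (f (s , true)) s

  ord-sizeFactor : ∀ N f s → Ord 0ℤ (sizeFactor N f s)
  ord-sizeFactor N f s = ord-⊗ˡ (ord-if (f (s , false)) (ord-geo (suc N) s)) (ord-pl (f (s , true)) s)

  -- E must agree with the product over the multiples of η, and cancel the
  -- generating function of the admissible parts size by size.
  compare : ∀ (f : Part → Bool) n →
    (E : ℕ → Laurent) → (∀ s → Ord 0ℤ (E s)) →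
    (∀ L S → L ≤ S → SP S (λ s → mi (z s) s) ≃[ + L ] SP S E) →
    (∀ L N s → L ≤ N → 1 ≤ s → E s ⊗ sizeFactor N f s ≃[ + L ] pl (resid s) s ⊗ mi (fb s) s) →
    countOverpartitions (all f) n ≡ B̄₀ lam η α (suc K) (suc ρ) n
  compare f n E ord-E E-SP E-fac = ℤₚ.+-injective (trans (count-all f N n N n≤N n≤N)
    (trans (coeff-≃ n (ℤ.+<+ (ℕₚ.n<1+n n)) (≃-cancel (suc n) monic ord-A ord-B both)) (sym (count-B N n (suc n) n≤N (ℕₚ.n≤1+n n)))))
    where
    N : ℕ
    -- Large enough for sizes and multiplicities at precision n + 1, and at least K as `generate`
    -- demands.
    N = suc n + K
    J : ℤ
    J = + suc n
    n≤N : n ≤ N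
    n≤N = ℕₚ.≤-trans (ℕₚ.n≤1+n n) (ℕₚ.m≤m+n (suc n) K)
    sn≤N : suc n ≤ N
    sn≤N = ℕₚ.m≤m+n (suc n) K
    genA genB′ : Laurent
    genA  = SP N (λ s → fac f N (s , false) ⊗ fac f N (s , true))
    genB′ = gen Good (configs N (spots (suc n)) [])
      where open Windows η K ρ
    genA≈ : genA ≈ SP N (sizeFactor N f)
    genA≈ = SP-cong N (λ s _ → ⊗-cong (fac-plain f N s) (fac-ov f N s))
    ord-A : Ord 0ℤ genA
    ord-A = ord-≈ (≈-sym genA≈) (ord-SP N (ord-sizeFactor N f))
    ord-gen : ∀ P πs → Ord 0ℤ (gen P πs)
    ord-gen P []       = ord-𝟎
    ord-gen P (π ∷ πs) with P π
    ... | true  = ord-⊕ (ord-mon₀ (weight π)) (ord-gen P πs)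
    ... | false = ord-⊕ ord-𝟎 (ord-gen P πs)
    ord-B : Ord 0ℤ genB′
    ord-B = ord-gen _ (configs N (spots (suc n)) [])
    monic : Ord 1ℤ (D (suc n) ⊕ ⊖ 𝟏)
    monic = _≃[_]_.ord (∏-≃𝟏 (suc n) (λ i _ → ord-⊕ (ord-con 1ℤ) (ord-⊖ (ord-Q (suc i))))
      (λ i _ → ≃-trans (≈⇒≃ (⊕-cong ≈-refl (⊖-cong (Qℕ (suc i))))) (one-mon-≃𝟏 (suc i * η) (ℕₚ.*-mono-≤ {1} {suc i} (s≤s z≤n) 1≤η))))
    right : Laurent
    right = P 0 (suc n) ⊗ ∏ (suc (suc n)) φ ⊗ (poch (suc n) ⊗ (At.T₂ (suc n) ⊗ At.T₁ (suc n)))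
    sideA : D (suc n) ⊗ genA ≃[ J ] right
    sideA = ≃-trans (≃-⊗ (ord-D (suc n)) ord-A
        (≃-trans (D-SP n N sn≤N) (E-SP (suc n) N sn≤N)) ≃-refl)
      (≃-trans (≈⇒≃ (≈-trans (⊗-cong ≈-refl genA≈) (≈-sym (SP-⊗ N E (sizeFactor N f)))))
        (≃-trans (SP-≃ N (λ s → ord-⊗ˡ (ord-E s) (ord-sizeFactor N f s)) (λ s → ord-⊗ˡ (ord-pl (resid s) s) (ord-mi (fb s) s))
            (λ s 1≤s → E-fac (suc n) N s sn≤N 1≤s))
          (≃-trans (≈⇒≃ (SP-⊗ N (λ s → pl (resid s) s) (λ s → mi (fb s) s)))
            (≃-sym (≃-⊗ (ord-⊗ˡ (ord-P 0 (suc n)) (ord-∏ (suc (suc n)) ord-φ)) (ord-SP N (λ s → ord-mi (fb s) s))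
              (resid-SP n N sn≤N) (fb-SP n N sn≤N))))))
    both : D (suc n) ⊗ genA ≃[ J ] D (suc n) ⊗ genB′
    both = ≃-trans sideA (≃-sym (≃-trans (≈⇒≃ (⊗-cong ≈-refl (generate N (suc n) (ℕₚ.m≤n+m K (suc n))))) (genB-product n)))

-- The two parities of `lam`

halve : ∀ n → (∃ λ l → n ≡ l + l) ⊎ (∃ λ l → n ≡ suc (l + l))
halve zero    = inj₁ (0 , refl)
halve (suc n) with halve n
... | inj₁ (l , e) = inj₂ (l , cong suc e)
... | inj₂ (l , e) = inj₁ (suc l , trans (cong suc e) (cong suc (sym (ℕₚ.+-suc l l))))

double-injective : ∀ {m n} → m + m ≡ n + n → m ≡ n
double-injective {m} {n} e = ℕₚ.*-cancelˡ-≡ m n 2 (trans (cong (λ z → m + z) (ℕₚ.+-identityʳ m)) (trans e (sym (cong (λ z → n + z) (ℕₚ.+-identityʳ n)))))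

par-double : ∀ n → par (n + n) ≡ 0
par-double n = trans (cong par (cong (λ z → n + z) (sym (ℕₚ.+-identityʳ n)))) (par-2* 0 n)

par-suc-double : ∀ n → par (suc (n + n)) ≡ 1
par-suc-double n = trans (cong (λ z → par (suc (n + z))) (sym (ℕₚ.+-identityʳ n))) (par-2* 1 n)

modulus : ∀ {M lam} K → M + lam ≡ K + suc K → 2 * suc K ∸ lam ∸ 1 ≡ M
modulus {M} {lam} K e = trans (ℕₚ.∸-+-assoc (2 * suc K) lam 1) (trans (cong (2 * suc K ∸_) (ℕₚ.+-comm lam 1))
  (trans (cong (λ z → z ∸ lam) (trans (cong (λ z → K + z) (ℕₚ.+-identityʳ (suc K))) (sym e))) (ℕₚ.m+n∸n≡m M lam)))

*-<ˡ : ∀ h {m n} → 1 ≤ h → m < n → h * m < h * n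
*-<ˡ (suc h) _ lt = ℕₚ.*-monoʳ-< (suc h) lt

*-cancel : ∀ h {m n} → 1 ≤ h → h * m ≡ h * n → m ≡ n
*-cancel (suc h) {m} {n} _ e = ℕₚ.*-cancelˡ-≡ m n (suc h) e

-- Divisibility of a size by η = h + h, 2η and h, and congruence to h modulo η, in the odd case.
data Kind : (z mid q4 q2 hz : Bool) → Set where
  k4 : Kind true  false true  false true
  k2 : Kind true  false false true  true
  km : Kind false true  false false true
  k0 : Kind false false false false false

module _ (L N s : ℕ) (L≤N : L ≤ N) (1≤s : 1 ≤ s) where

  private
    o p g : Laurent
    o = one-mon (+ s)
    p = one+mon (+ s)
    g = geo (suc N) s

  perSize-even : ∀ z fb R → (T fb → T z) → mi z s ⊗ ((if z ∧ not fb then g else 𝟏) ⊗ pl R s) ≃[ + L ] pl R s ⊗ mi fb s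
  perSize-even true  true  R h = ≈⇒≃ (l o (pl R s))
    where
    l : ∀ o p → o ⊗ (𝟏 ⊗ p) ≈ p ⊗ o
    l = Solver.solve-∀ laurentRing
  perSize-even true  false R h = ≃-trans (≈⇒≃ (l o g (pl R s))) (≃-⊗ʳ (ord-pl R s) (geo-≃ L N s L≤N 1≤s))
    where
    l : ∀ o g p → o ⊗ (g ⊗ p) ≈ p ⊗ (o ⊗ g)
    l = Solver.solve-∀ laurentRing
  perSize-even false true  R h = contradiction (h tt) λ ()
  perSize-even false false R h = ≈⇒≃ (l (pl R s))
    where
    l : ∀ p → 𝟏 ⊗ (𝟏 ⊗ p) ≈ p ⊗ 𝟏
    l = Solver.solve-∀ laurentRing

  -- Sizes η modulo 2 η (`k2`) get neither a geometric series nor a factor on the left to cancel it.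
  -- Sizes η / 2 modulo η (`km`) may not be overlined; the missing 1 + q^s is supplied by
  -- `pl mid s`.
  perSize-odd : ∀ {z mid q4 q2 hz} → Kind z mid q4 q2 hz → ∀ R fb → (T z → T R) → (T mid → T R) → (T fb → T (q4 ∨ mid)) →
    pl mid s ⊗ mi mid s ⊗ mi q4 s ⊗ ((if R ∧ ((hz ∧ not q2 ∧ not fb) ∧ true) then g else 𝟏) ⊗ pl (R ∧ not mid) s)
    ≃[ + L ] pl R s ⊗ mi fb s
  perSize-odd k4 false fb    hz hm hf = contradiction (hz tt) λ ()
  perSize-odd k4 true  true  hz hm hf = ≈⇒≃ (l o p)
    where
    l : ∀ o p → 𝟏 ⊗ 𝟏 ⊗ o ⊗ (𝟏 ⊗ p) ≈ p ⊗ o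
    l = Solver.solve-∀ laurentRing
  perSize-odd k4 true  false hz hm hf = ≃-trans (≈⇒≃ (l o g p)) (≃-⊗ʳ (ord-one+mon s) (geo-≃ L N s L≤N 1≤s))
    where
    l : ∀ o g p → 𝟏 ⊗ 𝟏 ⊗ o ⊗ (g ⊗ p) ≈ p ⊗ (o ⊗ g)
    l = Solver.solve-∀ laurentRing
  perSize-odd k2 R     true  hz hm hf = contradiction (hf tt) λ ()
  perSize-odd k2 false false hz hm hf = contradiction (hz tt) λ ()
  perSize-odd k2 true  false hz hm hf = ≈⇒≃ (l p)
    where
    l : ∀ p → 𝟏 ⊗ 𝟏 ⊗ 𝟏 ⊗ (𝟏 ⊗ p) ≈ p ⊗ 𝟏
    l = Solver.solve-∀ laurentRing
  perSize-odd km false fb    hz hm hf = contradiction (hm tt) λ ()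
  perSize-odd km true  true  hz hm hf = ≈⇒≃ (l p o)
    where
    l : ∀ p o → p ⊗ o ⊗ 𝟏 ⊗ (𝟏 ⊗ 𝟏) ≈ p ⊗ o
    l = Solver.solve-∀ laurentRing
  perSize-odd km true  false hz hm hf = ≃-trans (≈⇒≃ (l o g p)) (≃-⊗ʳ (ord-one+mon s) (geo-≃ L N s L≤N 1≤s))
    where
    l : ∀ o g p → p ⊗ o ⊗ 𝟏 ⊗ (g ⊗ 𝟏) ≈ p ⊗ (o ⊗ g)
    l = Solver.solve-∀ laurentRing
  perSize-odd k0 R     true  hz hm hf = contradiction (hf tt) λ ()
  perSize-odd k0 true  false hz hm hf = ≈⇒≃ (l p)
    where
    l : ∀ p → 𝟏 ⊗ 𝟏 ⊗ 𝟏 ⊗ (𝟏 ⊗ p) ≈ p ⊗ 𝟏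
    l = Solver.solve-∀ laurentRing
  perSize-odd k0 false false hz hm hf = ≈⇒≃ ≈-refl

module Theorem (lam η : ℕ) (α : Fin lam → ℕ) (1≤η : 1 ≤ η) (0<α : ∀ i → 0 < α i)
  (α-mono : ∀ i j → i <ᶠ j → α i < α j) (α<η : ∀ i → α i < η) (α-sym : ∀ i → α i ≡ η ∸ α (opposite i))
  (K′ ρ : ℕ) (lam<K : suc lam ≤ suc K′) (ρ≤K : ρ ≤ suc K′) (lam≤ : lam ≤ suc ρ) where

  open Residues lam η α 1≤η 0<α α-mono α<η α-sym

  K k r : ℕ
  K = suc K′
  k = suc K
  r = suc ρ

  admissible : Part → Bool
  admissible = A-part lam η α k r

  module Even (l : ℕ) (lam≡ : lam ≡ l + l) where

    l<K : l < K
    l<K = ℕₚ.≤-trans (s≤s (ℕₚ.≤-trans (ℕₚ.m≤m+n l l) (ℕₚ.≤-reflexive (sym lam≡)))) lam<K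

    l≤ρ : l ≤ ρ
    l≤ρ = go l (subst (_≤ suc ρ) lam≡ lam≤)
      where
      go : ∀ l → l + l ≤ suc ρ → l ≤ ρ
      go zero    _       = z≤n
      go (suc l) (s≤s h) = ℕₚ.≤-trans (ℕₚ.m≤n+m (suc l) l) h

    v M a : ℕ
    v = r ∸ l
    M = (K ∸ l) + suc (K ∸ l)
    a = η * v

    l≤r : l ≤ r
    l≤r = ℕₚ.m≤n⇒m≤1+n l≤ρ

    v+l : v + l ≡ r
    v+l = ℕₚ.m∸n+n≡m l≤r

    K∸l+l : K ∸ l + l ≡ K
    K∸l+l = ℕₚ.m∸n+n≡m (ℕₚ.<⇒≤ l<K)

    M+lam : M + lam ≡ K + suc K
    M+lam = trans (cong (λ z → M + z) lam≡) (trans (sort (K ∸ l) l) (cong (λ z → z + suc z) K∸l+l))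
      where
      sort : ∀ x l → x + suc x + (l + l) ≡ x + l + suc (x + l)
      sort = ℕ-Solver.solve-∀

    σ≡ : σ ≡ l * η
    σ≡ = double-injective (trans 2σ (trans (cong (_* η) lam≡) (ℕₚ.*-distribʳ-+ η l l)))

    a+σ : a + σ ≡ r * η
    a+σ = trans (cong₂ _+_ (ℕₚ.*-comm η v) σ≡) (trans (sym (ℕₚ.*-distribʳ-+ η v l)) (cong (_* η) v+l))

    1≤a : 1 ≤ a
    1≤a = ℕₚ.*-mono-≤ 1≤η (ℕₚ.m<n⇒0<n∸m (s≤s l≤ρ))

    v<M : v < M
    v<M = ℕₚ.+-cancelʳ-< l v M (subst₂ _<_ (sym v+l) (sort (K ∸ l) l)
      (ℕₚ.≤-trans (s≤s (s≤s ρ≤K)) (ℕₚ.≤-trans (ℕₚ.≤-reflexive (ℕₚ.+-comm 2 K)) (ℕₚ.≤-trans (ℕₚ.+-monoˡ-≤ 2 (ℕₚ.≤-reflexive (sym K∸l+l)))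
        (ℕₚ.≤-trans (ℕₚ.≤-reflexive (ℕₚ.+-comm (K ∸ l + l) 2)) (ℕₚ.+-monoˡ-≤ (K ∸ l + l) (s≤s (ℕₚ.m<n⇒0<n∸m l<K))))))))
      where
      sort : ∀ x l → suc x + (x + l) ≡ x + suc x + l
      sort = ℕ-Solver.solve-∀

    -- M = 2 (K - l) + 1 is odd and therefore not 2 v.
    N≢2a : η * M ≢ a + a
    N≢2a e = contradiction (trans (sym (par-double v)) (trans (cong par (sym M≡)) (trans (cong par (ℕₚ.+-suc (K ∸ l) (K ∸ l))) (par-suc-double (K ∸ l))))) λ ()
      where
      M≡ : M ≡ v + v
      M≡ = *-cancel η 1≤η (trans e (sym (ℕₚ.*-distribˡ-+ η v v)))

    open Compare lam η α 1≤η 0<α α-mono α<η α-sym K′ ρ M a lam<K ρ≤K lam≤ M+lam a+σ 1≤a (*-<ˡ η 1≤η v<M) N≢2a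

    lam-even : (lam mod 2 ≡ᵇ 0) ≡ true
    lam-even = ≡ᵇ-true (mod-unique l (s≤s z≤n) (trans lam≡ (two l)))
      where
      two : ∀ l → l + l ≡ l * 2 + 0
      two = ℕ-Solver.solve-∀

    lam-half : lam div 2 ≡ l
    lam-half = div-unique l (s≤s z≤n) (trans lam≡ (two l))
      where
      two : ∀ l → l + l ≡ l * 2 + 0
      two = ℕ-Solver.solve-∀

    A-ov : ∀ s → admissible (s , true) ≡ resid s
    A-ov s rewrite lam-even = ∧-identityʳ (resid s)

    A-plain : ∀ s → admissible (s , false) ≡ z s ∧ not (fb s)
    A-plain s = trans (unfold s) (trans
      (cong (λ w → resid s ∧ (z s ∧ not w)) (trans (cong₂ (λ m t → forbidden (η * m) s (η * (r ∸ t))) (modulus K M+lam) lam-half) (forbidden≡fb s)))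
      (absorb (z s) (sel (s mod η)) (not (fb s))))
      where
      unfold : ∀ s → admissible (s , false) ≡ resid s ∧ (z s ∧ not (forbidden (η * (2 * k ∸ lam ∸ 1)) s (η * (r ∸ (lam div 2)))))
      unfold s rewrite lam-even = refl
      absorb : ∀ x y w → (x ∨ y) ∧ (x ∧ w) ≡ x ∧ w
      absorb true  y     w = refl
      absorb false true  w = refl
      absorb false false w = refl

    multiple-of-η : ∀ s w → s mod N₀ ≡ η * w → T (z s)
    multiple-of-η s w e = ℕₚ.≡⇒≡ᵇ (s mod η) 0 (mod-unique (s div N₀ * M + w) 1≤η
      (trans (div-mod s N₀ 1≤N₀) (trans (cong (λ y → s div N₀ * N₀ + y) e) (sort (s div N₀) η M w))))
      where
      sort : ∀ q η M w → q * (η * M) + η * w ≡ (q * M + w) * η + 0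
      sort = ℕ-Solver.solve-∀

    fb⇒z : ∀ s → T (fb s) → T (z s)
    fb⇒z s t with fb⁻ s t
    ... | inj₁ e        = multiple-of-η s 0 (trans e (sym (ℕₚ.*-zeroʳ η)))
    ... | inj₂ (inj₁ e) = multiple-of-η s v e
    ... | inj₂ (inj₂ e) = multiple-of-η s (M ∸ v) (trans e (sym (ℕₚ.*-distribˡ-∸ η M v)))

    theorem : ∀ n → Ā₀ lam η α k r n ≡ B̄₀ lam η α k r n
    theorem n = compare admissible n (λ s → mi (z s) s) (λ s → ord-mi (z s) s) (λ L S _ → ≃-refl) per-size
      where
      per-size : ∀ L N s → L ≤ N → 1 ≤ s → mi (z s) s ⊗ sizeFactor N admissible s ≃[ + L ] pl (resid s) s ⊗ mi (fb s) s
      per-size L N s L≤N 1≤s = subst₂ (λ x y → mi (z s) s ⊗ ((if x then geo (suc N) s else 𝟏) ⊗ pl y s) ≃[ + L ] pl (resid s) s ⊗ mi (fb s) s)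
        (sym (A-plain s)) (sym (A-ov s)) (perSize-even L N s L≤N 1≤s (z s) (fb s) (resid s) (fb⇒z s))

  module Odd (l : ℕ) (lam≡ : lam ≡ suc (l + l)) where

    l<lam : l < lam
    l<lam = subst (l <_) (sym lam≡) (s≤s (ℕₚ.m≤m+n l l))

    l<K : l < K
    l<K = ℕₚ.≤-trans l<lam (ℕₚ.≤-trans (ℕₚ.n≤1+n lam) lam<K)

    -- For odd lam the reflection of the residues fixes the middle index; its residue h is therefore
    -- η / 2.
    middle : Fin lam
    middle = fromℕ< l<lam

    middle-fixed : opposite middle ≡ middle
    middle-fixed = Finₚ.toℕ-injective (trans (Finₚ.opposite-prop middle) (trans (cong (λ y → lam ∸ suc y) (Finₚ.toℕ-fromℕ< l<lam))
      (trans (cong (_∸ suc l) lam≡) (trans (ℕₚ.m+n∸m≡n l l) (sym (Finₚ.toℕ-fromℕ< l<lam))))))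

    h v M₂ M a : ℕ
    h  = α middle
    v  = r ∸ suc l
    M₂ = K ∸ l
    M  = M₂ + M₂
    a  = h * suc (v + v)

    h+h : h + h ≡ η
    h+h = trans (cong (_+ h) (trans (α-sym middle) (cong (λ i → η ∸ α i) middle-fixed))) (ℕₚ.m∸n+n≡m (ℕₚ.<⇒≤ (α<η middle)))

    1≤h : 1 ≤ h
    1≤h = 0<α middle

    v+l : v + suc l ≡ r
    v+l = ℕₚ.m∸n+n≡m (ℕₚ.≤-trans l<lam lam≤)

    M₂+l : M₂ + l ≡ K
    M₂+l = ℕₚ.m∸n+n≡m (ℕₚ.<⇒≤ l<K)

    M+lam : M + lam ≡ K + suc K
    M+lam = trans (cong (λ y → M + y) lam≡) (trans (sort M₂ l) (cong (λ y → y + suc y) M₂+l))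
      where
      sort : ∀ x l → x + x + suc (l + l) ≡ x + l + suc (x + l)
      sort = ℕ-Solver.solve-∀

    σ≡ : σ ≡ lam * h
    σ≡ = double-injective (trans 2σ (trans (cong (lam *_) (sym h+h)) (ℕₚ.*-distribˡ-+ lam h h)))

    a+σ : a + σ ≡ r * η
    a+σ = trans (cong (λ y → a + y) (trans σ≡ (cong (_* h) lam≡))) (trans (sort h v l) (cong₂ _*_ v+l h+h))
      where
      sort : ∀ h v l → h * suc (v + v) + suc (l + l) * h ≡ (v + suc l) * (h + h)
      sort = ℕ-Solver.solve-∀

    1≤a : 1 ≤ a
    1≤a = ℕₚ.*-mono-≤ {1} {h} {1} {suc (v + v)} 1≤h (s≤s z≤n)

    v≤M₂ : v ≤ M₂
    v≤M₂ = ℕₚ.+-cancelʳ-≤ (suc l) v M₂ (subst₂ _≤_ (sym v+l) (trans (cong suc (sym M₂+l)) (sym (ℕₚ.+-suc M₂ l))) (s≤s ρ≤K))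

    a<N : a < η * M
    a<N = subst (a <_) (trans (sort h M₂) (cong (_* M) h+h)) (*-<ˡ h 1≤h (ℕₚ.≤-trans
      (s≤s (s≤s (ℕₚ.+-mono-≤ v≤M₂ v≤M₂))) (ℕₚ.+-monoˡ-≤ (M₂ + M₂) (ℕₚ.+-mono-≤ 1≤M₂ 1≤M₂))))
      where
      1≤M₂ : 1 ≤ M₂
      1≤M₂ = ℕₚ.m<n⇒0<n∸m l<K
      sort : ∀ h m → h * (m + m + (m + m)) ≡ (h + h) * (m + m)
      sort = ℕ-Solver.solve-∀

    -- Here M = 2 M₂ is even, whereas 2 a = η (2 v + 1).
    N≢2a : η * M ≢ a + a
    N≢2a e = contradiction (trans (sym (par-suc-double v)) (trans (cong par (sym M≡)) (par-double M₂))) λ ()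
      where
      M≡ : M ≡ suc (v + v)
      M≡ = *-cancel η 1≤η (trans e (trans (sym (ℕₚ.*-distribʳ-+ (suc (v + v)) h h)) (cong (_* suc (v + v)) h+h)))

    open Compare lam η α 1≤η 0<α α-mono α<η α-sym K′ ρ M a lam<K ρ≤K lam≤ M+lam a+σ 1≤a a<N N≢2a

    lam-odd : (lam mod 2 ≡ᵇ 0) ≡ false
    lam-odd = ≡ᵇ-false λ e → contradiction (trans (sym e) (mod-unique l (s≤s (s≤s z≤n)) (trans lam≡ (two l)))) λ ()
      where
      two : ∀ l → suc (l + l) ≡ l * 2 + 1
      two = ℕ-Solver.solve-∀

    η/2 : η div 2 ≡ h
    η/2 = div-unique h (s≤s z≤n) (trans (sym h+h) (two h))
      where
      two : ∀ h → h + h ≡ h * 2 + 0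
      two = ℕ-Solver.solve-∀

    2r∸lam : 2 * r ∸ lam ≡ suc (v + v)
    2r∸lam = trans (cong₂ _∸_ (trans (cong (2 *_) (sym v+l)) (sort v l)) lam≡) (ℕₚ.m+n∸m≡n (suc (l + l)) (suc (v + v)))
      where
      sort : ∀ v l → 2 * (v + suc l) ≡ suc (l + l) + suc (v + v)
      sort = ℕ-Solver.solve-∀

    threshold : (η * (2 * r ∸ lam)) div 2 ≡ a
    threshold = div-unique a (s≤s z≤n) (trans (cong₂ _*_ (sym h+h) 2r∸lam) (sort h (suc (v + v))))
      where
      sort : ∀ h w → (h + h) * w ≡ h * w * 2 + 0
      sort = ℕ-Solver.solve-∀

    mid q4 q2 hz : ℕ → Bool
    mid s = s mod η ≡ᵇ h
    q4 s  = s mod (2 * η) ≡ᵇ 0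
    q2 s  = s mod (2 * η) ≡ᵇ η
    hz s  = s mod h ≡ᵇ 0

    1≤2η : 1 ≤ 2 * η
    1≤2η = ℕₚ.≤-trans 1≤η (ℕₚ.m≤m+n η (1 * η))

    η<2η : η < 2 * η
    η<2η = ℕₚ.m<m+n η (ℕₚ.≤-trans 1≤η (ℕₚ.≤-reflexive (sym (ℕₚ.*-identityˡ η))))

    h<η : h < η
    h<η = α<η middle

    kind : ∀ s → Kind (z s) (mid s) (q4 s) (q2 s) (hz s)
    kind s = by-residue′ (s mod η) refl
      where
      q u : ℕ
      q = s div η
      u = s mod η
      s≡ : s ≡ q * η + u
      s≡ = div-mod s η 1≤η
      build : ∀ {z m f t y z′ m′ f′ t′ y′} → z ≡ z′ → m ≡ m′ → f ≡ f′ → t ≡ t′ → y ≡ y′ → Kind z′ m′ f′ t′ y′ → Kind z m f t y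
      build refl refl refl refl refl k = k
      0≢h : 0 ≢ h
      0≢h = ℕₚ.<⇒≢ 1≤h
      mod2η : (∃ λ q′ → q ≡ q′ + q′) ⊎ (∃ λ q′ → q ≡ suc (q′ + q′)) → s mod (2 * η) ≡ u ⊎ s mod (2 * η) ≡ η + u
      mod2η (inj₁ (q′ , e)) = inj₁ (mod-unique q′ (ℕₚ.<-trans (mod-< s η 1≤η) η<2η) (trans s≡ (trans (cong (λ y → y * η + u) e) (sort q′ η u))))
        where
        sort : ∀ q η u → (q + q) * η + u ≡ q * (2 * η) + u
        sort = ℕ-Solver.solve-∀
      mod2η (inj₂ (q′ , e)) = inj₂ (mod-unique q′ (subst (η + u <_) (cong (λ y → η + y) (sym (ℕₚ.*-identityˡ η))) (ℕₚ.+-monoʳ-< η (mod-< s η 1≤η)))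
        (trans s≡ (trans (cong (λ y → y * η + u) e) (sort q′ η u))))
        where
        sort : ∀ q η u → suc (q + q) * η + u ≡ q * (2 * η) + (η + u)
        sort = ℕ-Solver.solve-∀
      modh-low : u < h → s mod h ≡ u
      modh-low lt = mod-unique (q + q) lt (trans s≡ (trans (cong (λ y → q * y + u) (sym h+h)) (sort q h u)))
        where
        sort : ∀ q h u → q * (h + h) + u ≡ (q + q) * h + u
        sort = ℕ-Solver.solve-∀
      modh-high : ∀ w → u ≡ h + w → s mod h ≡ w
      modh-high w e = mod-unique (suc (q + q)) (ℕₚ.+-cancelˡ-< h w h (subst₂ _<_ e (sym h+h) (mod-< s η 1≤η)))
        (trans s≡ (trans (cong₂ (λ y y′ → q * y + y′) (sym h+h) e) (sort q h w)))
        where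
        sort : ∀ q h w → q * (h + h) + (h + w) ≡ suc (q + q) * h + w
        sort = ℕ-Solver.solve-∀
      nonzero : u ≢ 0 → q4 s ≡ false × q2 s ≡ false
      nonzero ne with mod2η (halve q)
      ... | inj₁ e = ≡ᵇ-false (λ e′ → ne (trans (sym e) e′)) , ≡ᵇ-false (λ e′ → ℕₚ.<⇒≢ (mod-< s η 1≤η) (trans (sym e) e′))
      ... | inj₂ e = ≡ᵇ-false (λ e′ → ℕₚ.<⇒≢ (ℕₚ.≤-trans 1≤η (ℕₚ.m≤m+n η u)) (sym (trans (sym e) e′)))
                   , ≡ᵇ-false (λ e′ → ne (ℕₚ.+-cancelˡ-≡ η u 0 (trans (trans (sym e) e′) (sym (ℕₚ.+-identityʳ η)))))
      other : ∀ w → s mod h ≡ w → w ≢ 0 → hz s ≡ false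
      other w e ne = ≡ᵇ-false (λ e′ → ne (trans (sym e) e′))
      by-residue′ : ∀ w → u ≡ w → Kind (z s) (mid s) (q4 s) (q2 s) (hz s)
      by-residue′ zero e with mod2η (halve q)
      ... | inj₁ e′ = build (≡ᵇ-true e) (≡ᵇ-false (λ x → 0≢h (trans (sym e) x))) (≡ᵇ-true (trans e′ e))
                        (≡ᵇ-false (λ x → ℕₚ.<⇒≢ 1≤η (trans (sym (trans e′ e)) x))) (≡ᵇ-true (trans (modh-low (subst (_< h) (sym e) 1≤h)) e)) k4
      ... | inj₂ e′ = build (≡ᵇ-true e) (≡ᵇ-false (λ x → 0≢h (trans (sym e) x)))
                        (≡ᵇ-false (λ x → ℕₚ.<⇒≢ (ℕₚ.≤-trans 1≤η (ℕₚ.m≤m+n η u)) (sym (trans (sym e′) x))))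
                        (≡ᵇ-true (trans e′ (trans (cong (λ y → η + y) e) (ℕₚ.+-identityʳ η)))) (≡ᵇ-true (trans (modh-low (subst (_< h) (sym e) 1≤h)) e)) k2
      by-residue′ (suc w) e with ℕₚ.<-cmp u h | nonzero (λ x → contradiction (trans (sym e) x) λ ())
      ... | tri< lt ne _ | f₁ , f₂ = build (≡ᵇ-false (λ x → contradiction (trans (sym e) x) λ ())) (≡ᵇ-false ne) f₁ f₂
              (other u (modh-low lt) (λ x → contradiction (trans (sym e) x) λ ())) k0
      ... | tri≈ _ eq _  | f₁ , f₂ = build (≡ᵇ-false (λ x → contradiction (trans (sym e) x) λ ())) (≡ᵇ-true eq) f₁ f₂
              (≡ᵇ-true (modh-high 0 (trans eq (sym (ℕₚ.+-identityʳ h))))) km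
      ... | tri> _ ne gt | f₁ , f₂ = build (≡ᵇ-false (λ x → contradiction (trans (sym e) x) λ ())) (≡ᵇ-false ne) f₁ f₂
              (other (u ∸ h) (modh-high (u ∸ h) (sym (ℕₚ.m+[n∸m]≡n (ℕₚ.<⇒≤ gt)))) (λ x → ℕₚ.<⇒≢ (ℕₚ.m<n⇒0<n∸m gt) (sym x))) k0

    z⇒resid : ∀ s → T (z s) → T (resid s)
    z⇒resid s t = Equivalence.from (T-∨ {z s}) (inj₁ t)

    mid⇒resid : ∀ s → T (mid s) → T (resid s)
    mid⇒resid s t = Equivalence.from (T-∨ {z s}) (inj₂ (subst (T ∘ sel) (sym (ℕₚ.≡ᵇ⇒≡ (s mod η) h t)) (sel⁺ middle)))

    odd-multiple : ∀ s w → s mod N₀ ≡ w * η + h → T (q4 s ∨ mid s)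
    odd-multiple s w e = Equivalence.from (T-∨ {q4 s}) (inj₂ (ℕₚ.≡⇒≡ᵇ (s mod η) h (mod-unique (s div N₀ * M + w) h<η
      (trans (div-mod s N₀ 1≤N₀) (trans (cong (λ y → s div N₀ * N₀ + y) e) (sort (s div N₀) η M w h))))))
      where
      sort : ∀ q η M w h → q * (η * M) + (w * η + h) ≡ (q * M + w) * η + h
      sort = ℕ-Solver.solve-∀

    a≡ : a ≡ v * η + h
    a≡ = trans (sort h v) (cong (λ y → v * y + h) h+h)
      where
      sort : ∀ h v → h * suc (v + v) ≡ v * (h + h) + h
      sort = ℕ-Solver.solve-∀

    -- N₀ = 2 η M₂ is a multiple of 2 η, while a and N₀ - a are odd multiples of η / 2. Forbidden
    -- sizes are thus never of kind `k2` or `k0`.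
    fb⇒q4∨mid : ∀ s → T (fb s) → T (q4 s ∨ mid s)
    fb⇒q4∨mid s t with fb⁻ s t
    ... | inj₁ e = Equivalence.from (T-∨ {q4 s}) (inj₁ (ℕₚ.≡⇒≡ᵇ (s mod (2 * η)) 0 (mod-unique (s div N₀ * M₂) 1≤2η
      (trans (div-mod s N₀ 1≤N₀) (trans (cong (λ y → s div N₀ * N₀ + y) e) (sort (s div N₀) η M₂))))))
      where
      sort : ∀ q η m → q * (η * (m + m)) + 0 ≡ q * m * (2 * η) + 0
      sort = ℕ-Solver.solve-∀
    ... | inj₂ (inj₁ e) = odd-multiple s v (trans e a≡)
    ... | inj₂ (inj₂ e) = odd-multiple s (M ∸ suc v) (trans e (ℕₚ.+-cancelʳ-≡ a (N₀ ∸ a) ((M ∸ suc v) * η + h)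
      (trans (ℕₚ.m∸n+n≡m (ℕₚ.<⇒≤ a<N)) (sym (trans (cong (λ y → (M ∸ suc v) * η + h + y) a≡)
        (trans (trans (sort (M ∸ suc v) v η h) (cong (λ y → (M ∸ suc v) * η + v * η + y) h+h)) (trans (sort′ (M ∸ suc v) v η) (trans (cong (η *_) (ℕₚ.m∸n+n≡m v<M)) refl))))))))
      where
      v<M : v < M
      v<M = ℕₚ.≤-trans (s≤s v≤M₂) (ℕₚ.+-monoˡ-≤ M₂ (ℕₚ.m<n⇒0<n∸m l<K))
      sort : ∀ m v η h → m * η + h + (v * η + h) ≡ m * η + v * η + (h + h)
      sort = ℕ-Solver.solve-∀
      sort′ : ∀ m v η → m * η + v * η + η ≡ η * (m + suc v)
      sort′ = ℕ-Solver.solve-∀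

    A-ov : ∀ s → admissible (s , true) ≡ resid s ∧ not (mid s)
    A-ov s = trans (unfold s) (cong (λ y → resid s ∧ not (s mod η ≡ᵇ y)) η/2)
      where
      unfold : ∀ s → admissible (s , true) ≡ resid s ∧ not (s mod η ≡ᵇ η div 2)
      unfold s rewrite lam-odd = refl

    A-plain : ∀ s → admissible (s , false) ≡ resid s ∧ ((hz s ∧ not (q2 s) ∧ not (fb s)) ∧ true)
    A-plain s = trans (unfold s) (cong₂ (λ y w → resid s ∧ (((s mod y ≡ᵇ 0) ∧ not (q2 s) ∧ not w) ∧ true)) η/2
      (trans (cong₂ (λ m t → forbidden (η * m) s t) (modulus K M+lam) threshold) (forbidden≡fb s)))
      where
      unfold : ∀ s → admissible (s , false) ≡ resid s ∧ (((s mod (η div 2) ≡ᵇ 0) ∧ not (s mod (2 * η) ≡ᵇ η)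
        ∧ not (forbidden (η * (2 * k ∸ lam ∸ 1)) s ((η * (2 * r ∸ lam)) div 2))) ∧ true)
      unfold s rewrite lam-odd = refl

    E : ℕ → Laurent
    E s = pl (mid s) s ⊗ mi (mid s) s ⊗ mi (q4 s) s

    -- Euler: (1 + q^s)(1 - q^s) over the odd multiples s of h gives the factors 1 - q^{2s} that are missing from the multiples of 2η.
    E-SP : ∀ L S → L ≤ S → SP S (λ s → mi (z s) s) ≃[ + L ] SP S E
    E-SP L S L≤S = ≃-trans (≈⇒≃ (≈-trans (SP-cong S (λ s _ → z-split (kind s) s)) (SP-⊗ S (λ s → mi (q2 s) s) (λ s → mi (q4 s) s))))
      (≃-trans (≃-⊗ (ord-SP S (λ s → ord-mi (q2 s) s)) (ord-SP S (λ s → ord-mi (q4 s) s)) pairs ≃-refl)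
        (≈⇒≃ (≈-sym (SP-⊗ S (λ s → pl (mid s) s ⊗ mi (mid s) s) (λ s → mi (q4 s) s)))))
      where
      z-split : ∀ {z m f t y} → Kind z m f t y → ∀ s → mi z s ≈ mi t s ⊗ mi f s
      z-split k4 s = ≈-sym (⊗-identityˡ _)
      z-split k2 s = ≈-sym (⊗-identityʳ _)
      z-split km s = ≈-refl
      z-split k0 s = ≈-refl
      F : ℕ → Laurent
      F s = one+mon (+ s) ⊗ one-mon (+ s)
      F≈ : ∀ s → F s ≈ one-mon (+ (s + s))
      F≈ s = ≈-trans (sq (mon (+ s))) (⊕-cong ≈-refl (⊖-cong (≈-sym (mon-+ (+ s) (+ s)))))
        where
        sq : ∀ m → (𝟏 ⊕ m) ⊗ (𝟏 ⊕ ⊖ m) ≈ 𝟏 ⊕ ⊖ (m ⊗ m)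
        sq = Solver.solve-∀ laurentRing
      module TF = Truncated L F (λ s → ord-⊗ˡ (ord-one+mon s) (ord-one-mon s))
        (λ s le → ≃-trans (≈⇒≃ (F≈ s)) (one-mon-≃𝟏 (s + s) (ℕₚ.≤-trans le (ℕₚ.m≤m+n s s))))
      split-if : ∀ b s → (if b then F s else 𝟏) ≈ pl b s ⊗ mi b s
      split-if true  s = ≈-refl
      split-if false s = ≈-refl
      pairs : SP S (λ s → mi (q2 s) s) ≃[ + L ] SP S (λ s → pl (mid s) s ⊗ mi (mid s) s)
      pairs = ≃-trans (residue-mi S (2 * η) η L≤S 1≤η η<2η) (≃-trans (≈⇒≃ (∏-cong L (λ m _ →
          ≈-trans (⊕-cong ≈-refl (⊖-cong (mon-≡ (cong +_ (index m))))) (≈-sym (F≈ (m * η + h))))))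
        (≃-trans (≃-sym (TF.residue S η h L≤S 1≤h h<η)) (≈⇒≃ (SP-cong S (λ s _ → split-if (mid s) s)))))
        where
        index : ∀ m → m * (2 * η) + η ≡ m * η + h + (m * η + h)
        index m = trans (cong (λ y → m * (2 * η) + y) (sym h+h)) (sort m η h)
          where
          sort : ∀ m η h → m * (2 * η) + (h + h) ≡ m * η + h + (m * η + h)
          sort = ℕ-Solver.solve-∀

    theorem : ∀ n → Ā₀ lam η α k r n ≡ B̄₀ lam η α k r n
    theorem n = compare admissible n E (λ s → ord-⊗ˡ (ord-⊗ˡ (ord-pl (mid s) s) (ord-mi (mid s) s)) (ord-mi (q4 s) s)) E-SP per-size
      where
      per-size : ∀ L N s → L ≤ N → 1 ≤ s → E s ⊗ sizeFactor N admissible s ≃[ + L ] pl (resid s) s ⊗ mi (fb s) s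
      per-size L N s L≤N 1≤s = subst₂ (λ x y → E s ⊗ ((if x then geo (suc N) s else 𝟏) ⊗ pl y s) ≃[ + L ] pl (resid s) s ⊗ mi (fb s) s)
        (sym (A-plain s)) (sym (A-ov s)) (perSize-odd L N s L≤N 1≤s (kind s) (resid s) (fb s) (z⇒resid s) (mid⇒resid s) (fb⇒q4∨mid s))

theorem1p17 : (lam η : ℕ) (α : Fin lam → ℕ) (k r : ℕ)
    → 1 ≤ η
    → (∀ i → 0 < α i)
    → (∀ i j → i <ᶠ j → α i < α j)
    → (∀ i → α i < η)
    → (∀ i → α i ≡ η ∸ α (opposite i))
    → r ≤ k → lam ≤ r → 1 ≤ r
    → suc lam < k
    → (n : ℕ) → Ā₀ lam η α k r n ≡ B̄₀ lam η α k r n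
theorem1p17 lam η α (suc (suc K′)) (suc ρ) 1≤η 0<α α-mono α<η α-sym (s≤s ρ≤K) lam≤ _ (s≤s lam<K) n with halve lam
... | inj₁ (l , e) = Theorem.Even.theorem lam η α 1≤η 0<α α-mono α<η α-sym K′ ρ lam<K ρ≤K lam≤ l e n
... | inj₂ (l , e) = Theorem.Odd.theorem lam η α 1≤η 0<α α-mono α<η α-sym K′ ρ lam<K ρ≤K lam≤ l e n
theorem1p17 lam η α (suc zero) (suc ρ) _ _ _ _ _ _ _ _ (s≤s ()) n
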